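{- Let $p>3$ be a prime. Suppose $p\equiv1\pmod4$ and write $p=x^2+y^2$ with integers $x,y$ and $4\mid x-1$. If $p\equiv1\pmod{12}$ and $3\mid x$, then $$\sum_{k=0}^{p-1}(24k+1)\binom{ -1/12}k^4\equiv-2^{\frac{p-1}6}p\Big(1-\frac16(2^{p-1}-1)\Big)\Big(2x-\frac p{2x}\Big)\pmod{p^3};$$ if $p\equiv1\pmod{12}$ and $3\nmid x$, then $$\sum_{k=0}^{p-1}(24k+1)\binom{ -1/12}k^4\equiv2^{\frac{p-1}6}p\Big(1-\frac16(2^{p-1}-1)\Big)\Big(2x-\frac p{2x}\Big)\pmod{p^3};$$ if $p\equiv5\pmod{12}$ and (choosing the sign of $y$) $3\mid x-y$, then $$\sum_{k=0}^{p-1}(24k+1)\binom{ -1/12}k^4\equiv5\cdot2^{ -\frac{p-5}6}p\Big(1+\frac16(2^{p-1}-1)\Big)\Big(2y-\frac p{2y}\Big)\pmod{p^3}.$$ If $p\equiv7\pmod{12}$, then $$\sum_{k=0}^{p-1}(24k+1)\binom{ -1/12}k^4\equiv(-1)^{\frac{p-7}{12}}\frac{28\cdot2^{\frac{p-1}3}p^2}{5\binom{(p+5)/6}{(p+5)/12}}\pmod{p^3},$$ and if $p\equiv11\pmod{12}$, then $$\sum_{k=0}^{p-1}(24k+1)\binom{ -1/12}k^4\equiv(-1)^{\frac{p-11}{12}}\frac{11p^2}{2^{\frac{p-11}3}\binom{5(p+1)/6}{5(p+1)/12}}\pmod{p^3}.$$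
   Context: The general binomial coefficient is $\binom a0=1$, $\binom ak=a(a-1)\cdots(a-k+1)/k!$ for $k\ge1$. Congruences are in the ring of rationals with denominators prime to $p$. -}

module Defs where

open import Data.Nat as ℕ using (ℕ; zero; suc)
open import Data.Nat.Properties using (_!≢0)
open import Data.Nat.Divisibility as ℕD using ()
open import Data.Integer as ℤ using (ℤ; +_; -[1+_])
open import Data.Rational as ℚ using (ℚ; _+_; _*_; _-_; -_)
open import Data.List using (List; map; foldr; upTo)
open import Data.Product using (∃; _×_)
open import Relation.Nullary using (¬_)
open import Relation.Binary.PropositionalEquality using (_≡_)

ℕ→ℚ : ℕ → ℚ
ℕ→ℚ n = (+ n) ℚ./ 1

ℤ→ℚ : ℤ → ℚ
ℤ→ℚ z = z ℚ./ 1

_^ℚ_ : ℚ → ℕ → ℚ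
q ^ℚ zero = ℚ.1ℚ
q ^ℚ suc n = q * (q ^ℚ n)

-- total division by an integer / natural (junk value 0 when dividing by 0;
-- in the theorem all divisors are nonzero)
_÷ℤ_ : ℚ → ℤ → ℚ
q ÷ℤ (+ zero) = ℚ.0ℚ
q ÷ℤ (+ suc n) = q * ((+ 1) ℚ./ suc n)
q ÷ℤ -[1+ n ] = q * (-[1+ 0 ] ℚ./ suc n)

_÷ℕ_ : ℚ → ℕ → ℚ
q ÷ℕ n = q ÷ℤ (+ n)

falling : ℚ → ℕ → ℚ
falling a zero = ℚ.1ℚ
falling a (suc k) = falling a k * (a - ℕ→ℚ k)

binomℚ : ℚ → ℕ → ℚ
binomℚ a k = falling a k * (((+ 1) ℚ./ (k ℕ.!)) {{k !≢0}})

sumTo : ℕ → (ℕ → ℚ) → ℚ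
sumTo n f = foldr _+_ ℚ.0ℚ (map f (upTo n))

pIntegral : ℕ → ℚ → Set
pIntegral p r = ¬ (p ℕD.∣ ℚ.denominatorℕ r)

CongMod : ℕ → ℕ → ℚ → ℚ → Set
CongMod p e a b = ∃ λ r → pIntegral p r × (a - b ≡ ℕ→ℚ (p ℕ.^ e) * r)

S : ℕ → ℚ
S p = sumTo p (λ k → ℕ→ℚ (24 ℕ.* k ℕ.+ 1) * (binomℚ (-[1+ 0 ] ℚ./ 12) k ^ℚ 4))

{-# OPTIONS --safe #-}

-- Write A = 1/12, p = 12m + a, n = (ap - 1)/12 and u = -ap/12, so that A = -n - u.
-- Modulo p³ one has u³ = 0, hence the factors ((A+j)/(j+1))⁴ of the summand may be
-- replaced by (A+j)((A+j)³+u³)/((j+1)((j+1)³-u³)). The new sum stops at k = n, is well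
-- poised, and has a closed form by the WZ method. Hence the sum is p X, and X modulo p²
-- is a quotient of shifted factorials Π (k + p c).
--
-- If p = 4f + 1, duplication and triplication of these products reduce X to the shifted
-- (2f)!/f!², powers of 2 and a fourth root of unity congruent to 3^f up to sign. The
-- former is 2x - p/2x by the theorem of Chowla, Dwork and Evans, which follows from an
-- evaluation in ℤ/p² of the Jacobi sum K = J(χ,χ²) of the quartic character χ, lifted by
-- T(x) = x^p, and from K being an associate of x + iy in ℤ[i]. The root of unity is found
-- modulo 3: the sum of χ(abc) over a + b + c = 1 is congruent to χ(3) by symmetry and
-- equals K² up to the factor χ(4).
--
-- If p ≡ 3 (mod 4), X is a multiple of p, and duplication and reflection of ordinary
-- factorials modulo p suffice.
module Submission where

-- The cubes come from the parameters A + u, A + ωu, A + ω²u with ω a primitive cube root of unity: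
-- (A+j)³ + u³ is the product of the three corresponding factors, A + u = -n makes the series
-- terminate, and Dougall's very-well-poised ₅F₄ sum applies. Only the sum and the product of the
-- last two parameters occur, so ω is never adjoined. The sum is evaluated in ℚ rather than in ℤ/p³,
-- because its closed form contains A + n = ap/12, to be divided by p exactly once, and the
-- recurrence in n inverts every A + k, this one included. Modulo p², Π (k + pc) depends on c
-- through c p H only, H a harmonic number. Suitable shifts absorb every H except those up to p/2
-- and p/3, which are Fermat quotients of 2 and 3. The former survives in the result; the latter
-- makes the remaining unit an exact fourth root of unity modulo p², so that its residue modulo p
-- determines it. Finding it would ordinarily call for quartic reciprocity at 3; the value of K²
-- modulo 3 takes its place.

module RingKit where

  open import Algebra.Bundles using (CommutativeRing)
  open import Algebra.Structures using (IsCommutativeRing)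
  import Algebra.Solver.Ring as RingSolver
  import Algebra.Solver.Ring.AlmostCommutativeRing as ACR
  open import Data.Nat as ℕ using (ℕ; zero; suc)
  import Data.Nat.Properties as ℕP
  open import Data.Integer as ℤ using (ℤ; +_; -[1+_])
  import Data.Integer.Properties as ℤP
  open import Data.Nat.Combinatorics using (_C_; nCk+nC[k+1]≡[n+1]C[k+1])
  open import Data.Nat.Combinatorics.Specification using (k>n⇒nCk≡0)
  open import Data.Maybe using (Maybe; just; nothing)
  open import Level using (0ℓ)
  open import Relation.Nullary using (yes; no)
  open import Relation.Binary.PropositionalEquality

  -- Commutative rings over propositional equality, with finite sums and products

  record Ring≡ : Set₁ where
    infix  8 -_
    infixl 7 _*_
    infixl 6 _+_
    field
      Carrier : Set
      _+_ _*_ : Carrier → Carrier → Carrier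
      -_ : Carrier → Carrier
      0# 1# : Carrier
      isCR : IsCommutativeRing _≡_ _+_ _*_ -_ 0# 1#

    infixl 6 _-_
    _-_ : Carrier → Carrier → Carrier
    x - y = x + (- y)

  module Kit (K : Ring≡) where

    open Ring≡ K public

    commutativeRing : CommutativeRing 0ℓ 0ℓ
    commutativeRing = record { isCommutativeRing = isCR }

    open CommutativeRing commutativeRing public
      using (+-assoc; +-comm; *-assoc; *-comm; +-identityˡ; +-identityʳ;
             *-identityˡ; *-identityʳ; distribˡ; distribʳ; zeroˡ; zeroʳ;
             -‿inverseˡ; -‿inverseʳ; semiring; commutativeSemiring;
             +-commutativeMonoid; *-commutativeMonoid)
      renaming (ring to stdRing)
    open import Algebra.Properties.Ring stdRing public
      using (-‿involutive; -‿distribˡ-*; -‿distribʳ-*; -0#≈0#)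
    open import Algebra.Properties.AbelianGroup
      (CommutativeRing.+-abelianGroup commutativeRing) public
      using () renaming (⁻¹-∙-comm to -‿+-comm)
    open import Algebra.Properties.CommutativeSemiring.Exp commutativeSemiring public
      using (_^_; ^-homo-*; ^-assocʳ; ^-distrib-*)

    -- The separate clause at 1 makes `ν 1` reduce to `1#` instead of `1# + 0#`, so that the
    -- solver's homomorphism from ℤ respects 1 definitionally.
    ν : ℕ → Carrier
    ν zero = 0#
    ν (suc zero) = 1#
    ν (suc (suc n)) = 1# + ν (suc n)

    ν-suc : ∀ n → ν (suc n) ≡ 1# + ν n
    ν-suc zero = sym (+-identityʳ _)
    ν-suc (suc n) = refl

    ι : ℤ → Carrier
    ι (+ n) = ν n
    ι -[1+ n ] = - ν (suc n)

    ν-+ : ∀ m n → ν (m ℕ.+ n) ≡ ν m + ν n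
    ν-+ zero n = sym (+-identityˡ _)
    ν-+ (suc m) n = begin
      ν (suc (m ℕ.+ n))   ≡⟨ ν-suc (m ℕ.+ n) ⟩
      1# + ν (m ℕ.+ n)    ≡⟨ cong (λ z → 1# + z) (ν-+ m n) ⟩
      1# + (ν m + ν n)    ≡⟨ sym (+-assoc _ _ _) ⟩
      (1# + ν m) + ν n    ≡⟨ cong (_+ ν n) (sym (ν-suc m)) ⟩
      ν (suc m) + ν n ∎
      where open ≡-Reasoning

    ν-* : ∀ m n → ν (m ℕ.* n) ≡ ν m * ν n
    ν-* zero n = sym (zeroˡ _)
    ν-* (suc m) n = begin
      ν (n ℕ.+ m ℕ.* n)    ≡⟨ ν-+ n (m ℕ.* n) ⟩
      ν n + ν (m ℕ.* n)    ≡⟨ cong₂ _+_ (sym (*-identityˡ _)) (ν-* m n) ⟩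
      1# * ν n + ν m * ν n ≡⟨ sym (distribʳ _ _ _) ⟩
      (1# + ν m) * ν n     ≡⟨ cong (_* ν n) (sym (ν-suc m)) ⟩
      ν (suc m) * ν n ∎
      where open ≡-Reasoning

    ι-neg : ∀ i → ι (ℤ.- i) ≡ - ι i
    ι-neg (+ zero) = sym -0#≈0#
    ι-neg (+ suc n) = refl
    ι-neg -[1+ n ] = sym (-‿involutive _)

    private
      cancel : ∀ a b c → (c + a) + - (c + b) ≡ a + - b
      cancel a b c = begin
        (c + a) + - (c + b)   ≡⟨ cong (λ z → (c + a) + z) (sym (-‿+-comm c b)) ⟩
        (c + a) + (- c + - b) ≡⟨ cong (_+ (- c + - b)) (+-comm c a) ⟩
        (a + c) + (- c + - b) ≡⟨ +-assoc a c _ ⟩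
        a + (c + (- c + - b)) ≡⟨ cong (λ z → a + z) (sym (+-assoc c _ _)) ⟩
        a + ((c + - c) + - b) ≡⟨ cong (λ z → a + (z + - b)) (-‿inverseʳ c) ⟩
        a + (0# + - b)        ≡⟨ cong (λ z → a + z) (+-identityˡ _) ⟩
        a + - b ∎
        where open ≡-Reasoning

    ι-⊖ : ∀ m n → ι (m ℤ.⊖ n) ≡ ν m + - ν n
    ι-⊖ m zero = trans (sym (+-identityʳ _)) (cong (λ z → ν m + z) (sym -0#≈0#))
    ι-⊖ zero (suc n) = sym (+-identityˡ _)
    ι-⊖ (suc m) (suc n) = begin
      ι (suc m ℤ.⊖ suc n)   ≡⟨ cong ι (ℤP.[1+m]⊖[1+n]≡m⊖n m n) ⟩
      ι (m ℤ.⊖ n)           ≡⟨ ι-⊖ m n ⟩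
      ν m + - ν n           ≡⟨ sym (cancel _ _ _) ⟩
      (1# + ν m) + - (1# + ν n) ≡⟨ sym (cong₂ (λ a b → a + - b) (ν-suc m) (ν-suc n)) ⟩
      ν (suc m) + - ν (suc n) ∎
      where open ≡-Reasoning

    ι-+ : ∀ i j → ι (i ℤ.+ j) ≡ ι i + ι j
    ι-+ (+ m) (+ n) = ν-+ m n
    ι-+ (+ m) -[1+ n ] = ι-⊖ m (suc n)
    ι-+ -[1+ m ] (+ n) = trans (ι-⊖ n (suc m)) (+-comm _ _)
    ι-+ -[1+ m ] -[1+ n ] = begin
      - ν (suc (suc (m ℕ.+ n)))     ≡⟨ cong (λ z → - ν (suc z)) (sym (ℕP.+-suc m n)) ⟩
      - ν (suc m ℕ.+ suc n)         ≡⟨ cong -_ (ν-+ (suc m) (suc n)) ⟩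
      - (ν (suc m) + ν (suc n))     ≡⟨ sym (-‿+-comm _ _) ⟩
      - ν (suc m) + - ν (suc n) ∎
      where open ≡-Reasoning

    private
      ι-*ʳ : ∀ m j → ι (+ m ℤ.* j) ≡ ν m * ι j
      ι-*ʳ m (+ n) = trans (cong ι (sym (ℤP.pos-* m n))) (ν-* m n)
      ι-*ʳ m -[1+ n ] = begin
        ι (+ m ℤ.* -[1+ n ])          ≡⟨ cong ι (sym (ℤP.neg-distribʳ-* (+ m) (+ suc n))) ⟩
        ι (ℤ.- (+ m ℤ.* + suc n))     ≡⟨ ι-neg (+ m ℤ.* + suc n) ⟩
        - ι (+ m ℤ.* + suc n)         ≡⟨ cong -_ (ι-*ʳ m (+ suc n)) ⟩
        - (ν m * ν (suc n))           ≡⟨ -‿distribʳ-* _ _ ⟩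
        ν m * - ν (suc n) ∎
        where open ≡-Reasoning

    ι-* : ∀ i j → ι (i ℤ.* j) ≡ ι i * ι j
    ι-* (+ m) j = ι-*ʳ m j
    ι-* -[1+ m ] j = begin
      ι (-[1+ m ] ℤ.* j)            ≡⟨ cong ι (sym (ℤP.neg-distribˡ-* (+ suc m) j)) ⟩
      ι (ℤ.- (+ suc m ℤ.* j))       ≡⟨ ι-neg (+ suc m ℤ.* j) ⟩
      - ι (+ suc m ℤ.* j)           ≡⟨ cong -_ (ι-*ʳ (suc m) j) ⟩
      - (ν (suc m) * ι j)           ≡⟨ -‿distribˡ-* _ _ ⟩
      - ν (suc m) * ι j ∎
      where open ≡-Reasoning

    private
      target : ACR.AlmostCommutativeRing 0ℓ 0ℓ
      target = ACR.fromCommutativeRing commutativeRing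

      morphism : CommutativeRing.rawRing ℤP.+-*-commutativeRing
                 ACR.-Raw-AlmostCommutative⟶ target
      morphism = record
        { ⟦_⟧ = ι ; +-homo = ι-+ ; *-homo = ι-* ; -‿homo = ι-neg
        ; 0-homo = refl ; 1-homo = refl }

      dec : ∀ i j → Maybe (ι i ≡ ι j)
      dec i j with i ℤP.≟ j
      ... | yes e = just (cong ι e)
      ... | no _ = nothing

    module Solver = RingSolver
      (CommutativeRing.rawRing ℤP.+-*-commutativeRing) target morphism dec
    open Solver public using (solve; _:=_; con; _:+_; _:*_; _:-_; :-_; _:^_)

    :c : ∀ {n} → ℕ → Solver.Polynomial n
    :c k = con (+ k)

    ν-^ : ∀ a k → ν (a ℕ.^ k) ≡ ν a ^ k
    ν-^ a zero = refl
    ν-^ a (suc k) = trans (ν-* a (a ℕ.^ k)) (cong (ν a *_) (ν-^ a k))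

    -- How nilpotency enters computations: the solver proves x = y + z q with an explicit cofactor
    -- q, and z is a vanishing power such as p², u² or u³.
    drop0 : ∀ {z} → z ≡ 0# → ∀ {x y} q → x ≡ y + z * q → x ≡ y
    drop0 refl {x} {y} q e = trans e (trans (cong (λ w → y + w) (zeroˡ q)) (+-identityʳ y))

    x-y≡0⇒x≡y : ∀ {x y} → x - y ≡ 0# → x ≡ y
    x-y≡0⇒x≡y {x} {y} e = trans (solve 2 (λ x y → x := (x :- y) :+ y) refl x y)
      (trans (cong (_+ y) e) (+-identityˡ y))

    x≡y⇒x-y≡0 : ∀ {x y} → x ≡ y → x - y ≡ 0#
    x≡y⇒x-y≡0 refl = -‿inverseʳ _

    cancelʳ : ∀ u v → u * v ≡ 1# → ∀ {x y} → x * u ≡ y * u → x ≡ y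
    cancelʳ u v uv {x} {y} e = trans (sym (h x)) (trans (cong (_* v) e) (h y))
      where
      h : ∀ z → z * u * v ≡ z
      h z = trans (*-assoc z u v) (trans (cong (z *_) uv) (*-identityʳ z))

    1^ : ∀ n → 1# ^ n ≡ 1#
    1^ zero = refl
    1^ (suc n) = trans (*-identityˡ _) (1^ n)

    Σ< Π< : ℕ → (ℕ → Carrier) → Carrier
    Σ< zero g = 0#
    Σ< (suc n) g = Σ< n g + g n
    Π< zero g = 1#
    Π< (suc n) g = Π< n g * g n

    Σ-cong : ∀ n {g h : ℕ → Carrier} → (∀ i → i ℕ.< n → g i ≡ h i) → Σ< n g ≡ Σ< n h
    Σ-cong zero e = refl
    Σ-cong (suc n) e = cong₂ _+_ (Σ-cong n (λ i l → e i (ℕP.m<n⇒m<1+n l))) (e n (ℕP.n<1+n n))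

    Π-cong : ∀ n {g h : ℕ → Carrier} → (∀ i → i ℕ.< n → g i ≡ h i) → Π< n g ≡ Π< n h
    Π-cong zero e = refl
    Π-cong (suc n) e = cong₂ _*_ (Π-cong n (λ i l → e i (ℕP.m<n⇒m<1+n l))) (e n (ℕP.n<1+n n))

    Σ-+ : ∀ n g h → Σ< n (λ i → g i + h i) ≡ Σ< n g + Σ< n h
    Σ-+ zero g h = sym (+-identityʳ _)
    Σ-+ (suc n) g h = trans (cong (_+ (g n + h n)) (Σ-+ n g h))
      (solve 4 (λ a b c d → (a :+ b) :+ (c :+ d) := (a :+ c) :+ (b :+ d)) refl _ _ _ _)

    Σ-*ˡ : ∀ n c g → Σ< n (λ i → c * g i) ≡ c * Σ< n g
    Σ-*ˡ zero c g = sym (zeroʳ c)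
    Σ-*ˡ (suc n) c g = trans (cong (_+ c * g n) (Σ-*ˡ n c g)) (sym (distribˡ _ _ _))

    Σ-0 : ∀ n {g : ℕ → Carrier} → (∀ i → i ℕ.< n → g i ≡ 0#) → Σ< n g ≡ 0#
    Σ-0 zero e = refl
    Σ-0 (suc n) e = trans (cong₂ _+_ (Σ-0 n (λ i l → e i (ℕP.m<n⇒m<1+n l))) (e n (ℕP.n<1+n n))) (+-identityʳ _)

    Σ-first : ∀ n g → Σ< (suc n) g ≡ g 0 + Σ< n (λ i → g (suc i))
    Σ-first zero g = +-comm _ _
    Σ-first (suc n) g = trans (cong (_+ g (suc n)) (Σ-first n g)) (+-assoc _ _ _)

    Σ-split : ∀ m n g → Σ< (m ℕ.+ n) g ≡ Σ< m g + Σ< n (λ i → g (m ℕ.+ i))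
    Σ-split m zero g rewrite ℕP.+-identityʳ m = sym (+-identityʳ _)
    Σ-split m (suc n) g rewrite ℕP.+-suc m n =
      trans (cong (_+ g (m ℕ.+ n)) (Σ-split m n g)) (+-assoc _ _ _)

    Π-* : ∀ n g h → Π< n (λ i → g i * h i) ≡ Π< n g * Π< n h
    Π-* zero g h = sym (*-identityʳ _)
    Π-* (suc n) g h = trans (cong (_* (g n * h n)) (Π-* n g h))
      (solve 4 (λ a b c d → (a :* b) :* (c :* d) := (a :* c) :* (b :* d)) refl _ _ _ _)

    Π-const : ∀ n c → Π< n (λ _ → c) ≡ c ^ n
    Π-const zero c = refl
    Π-const (suc n) c = trans (cong (_* c) (Π-const n c)) (*-comm _ _)

    Π-first : ∀ n g → Π< (suc n) g ≡ g 0 * Π< n (λ i → g (suc i))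
    Π-first zero g = *-comm _ _
    Π-first (suc n) g = trans (cong (_* g (suc n)) (Π-first n g)) (*-assoc _ _ _)

    Π-split : ∀ m n g → Π< (m ℕ.+ n) g ≡ Π< m g * Π< n (λ i → g (m ℕ.+ i))
    Π-split m zero g rewrite ℕP.+-identityʳ m = sym (*-identityʳ _)
    Π-split m (suc n) g rewrite ℕP.+-suc m n =
      trans (cong (_* g (m ℕ.+ n)) (Π-split m n g)) (*-assoc _ _ _)

    Π-rev : ∀ n g → Π< n g ≡ Π< n (λ i → g (n ℕ.∸ suc i))
    Π-rev zero g = refl
    Π-rev (suc n) g = trans (cong (_* g n) (Π-rev n g))
      (trans (*-comm _ _) (sym (Π-first n (λ i → g (n ℕ.∸ i)))))

    Σ-rev : ∀ n g → Σ< n g ≡ Σ< n (λ i → g (n ℕ.∸ suc i))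
    Σ-rev zero g = refl
    Σ-rev (suc n) g = trans (cong (_+ g n) (Σ-rev n g))
      (trans (+-comm _ _) (sym (Σ-first n (λ i → g (n ℕ.∸ i)))))

    Σ-single : ∀ n a g → a ℕ.< n → (∀ i → i ℕ.< n → i ≢ a → g i ≡ 0#) → Σ< n g ≡ g a
    Σ-single (suc n) a g l e with n ℕP.≟ a
    ... | yes refl = trans (cong (_+ g n) (Σ-0 n (λ i il → e i (ℕP.m<n⇒m<1+n il) (λ q → ℕP.<-irrefl q il)))) (+-identityˡ _)
    ... | no ne = trans (cong₂ _+_ (Σ-single n a g (ℕP.≤∧≢⇒< (ℕP.≤-pred l) (λ q → ne (sym q))) (λ i il → e i (ℕP.m<n⇒m<1+n il)))
                    (e n (ℕP.n<1+n n) ne)) (+-identityʳ _)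

    binomial : ∀ n x → (1# + x) ^ n ≡ Σ< (suc n) (λ k → ν (n C k) * x ^ k)
    binomial zero x = solve 0 (:c 1 := :c 0 :+ :c 1 :* :c 1) refl
    binomial (suc n) x = begin
      (1# + x) * (1# + x) ^ n
        ≡⟨ cong ((1# + x) *_) (binomial n x) ⟩
      (1# + x) * Σ< (suc n) g
        ≡⟨ solve 2 (λ x s → (:c 1 :+ x) :* s := s :+ x :* s) refl x (Σ< (suc n) g) ⟩
      Σ< (suc n) g + x * Σ< (suc n) g
        ≡⟨ cong₂ _+_ lower (sym (Σ-*ˡ (suc n) x g)) ⟩
      1# + Σ< (suc n) (λ k → ν (n C suc k) * x ^ suc k) + Σ< (suc n) (λ k → x * g k)
        ≡⟨ trans (+-assoc _ _ _) (cong (λ z → 1# + z) (sym (Σ-+ (suc n) _ _))) ⟩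
      1# + Σ< (suc n) (λ k → ν (n C suc k) * x ^ suc k + x * g k)
        ≡⟨ cong (λ z → 1# + z) (Σ-cong (suc n) (λ k _ → trans
             (solve 4 (λ a b x y → a :* (x :* y) :+ x :* (b :* y) := (b :+ a) :* (x :* y)) refl (ν (n C suc k)) (ν (n C k)) x (x ^ k))
             (cong (_* x ^ suc k) (trans (sym (ν-+ (n C k) (n C suc k))) (cong ν (nCk+nC[k+1]≡[n+1]C[k+1] n k)))))) ⟩
      1# + Σ< (suc n) (λ k → h (suc k))
        ≡⟨ cong (_+ Σ< (suc n) (λ k → h (suc k))) (sym (*-identityʳ 1#)) ⟩
      h 0 + Σ< (suc n) (λ k → h (suc k))
        ≡⟨ sym (Σ-first (suc n) h) ⟩
      Σ< (suc (suc n)) h ∎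
      where
      open ≡-Reasoning
      g h : ℕ → Carrier
      g k = ν (n C k) * x ^ k
      h k = ν (suc n C k) * x ^ k
      lower : Σ< (suc n) g ≡ 1# + Σ< (suc n) (λ k → ν (n C suc k) * x ^ suc k)
      lower = trans (Σ-first n g) (cong₂ _+_ (*-identityʳ 1#)
        (sym (trans (cong (λ z → Σ< n (λ k → g (suc k)) + ν z * x ^ suc n) (k>n⇒nCk≡0 (ℕP.n<1+n n)))
          (trans (cong (λ z → Σ< n (λ k → g (suc k)) + z) (zeroˡ _)) (+-identityʳ _)))))

-- Residue rings and sums over all residues

module ZMod where

  open RingKit
  open import Data.Nat as ℕ using (ℕ; zero; suc; NonZero)
  import Data.Nat.Properties as ℕP
  open import Data.Nat.DivMod
  open import Data.Nat.Divisibility using (_∣_; divides; m%n≡0⇒n∣m)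
  open import Data.Nat.Coprimality using (Coprime; coprime-Bézout)
  open import Data.Nat.GCD using (module Bézout)
  open import Data.Integer as ℤ using (ℤ; +_; -[1+_])
  open import Data.Fin as Fin using (Fin; toℕ; fromℕ<)
  import Data.Fin.Properties as FinP
  open import Data.Fin.Permutation using (Permutation; permutation)
  open import Data.Product using (_,_; ∃)
  open import Relation.Nullary using (Dec; yes; no)
  open import Relation.Binary.PropositionalEquality hiding ([_])
  import Algebra.Properties.CommutativeMonoid.Sum as FinSum

  module Residues (M : ℕ) .{{nz : NonZero M}} where

    [_] : ℕ → Fin M
    [ a ] = fromℕ< (m%n<n a M)

    toℕ[] : ∀ a → toℕ [ a ] ≡ a % M
    toℕ[] a = FinP.toℕ-fromℕ< (m%n<n a M)

    []-cong : ∀ {a b} → a % M ≡ b % M → [ a ] ≡ [ b ]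
    []-cong {a} {b} e = FinP.toℕ-injective (trans (toℕ[] a) (trans e (sym (toℕ[] b))))

    [toℕ] : ∀ x → [ toℕ x ] ≡ x
    [toℕ] x = FinP.toℕ-injective (trans (toℕ[] (toℕ x)) (m<n⇒m%n≡m (FinP.toℕ<n x)))

    _⊕_ _⊗_ : Fin M → Fin M → Fin M
    x ⊕ y = [ toℕ x ℕ.+ toℕ y ]
    x ⊗ y = [ toℕ x ℕ.* toℕ y ]

    ⊖_ : Fin M → Fin M
    ⊖ x = [ M ℕ.∸ toℕ x ]

    []-+ : ∀ a b → [ a ] ⊕ [ b ] ≡ [ a ℕ.+ b ]
    []-+ a b = []-cong (trans (cong₂ (λ x y → (x ℕ.+ y) % M) (toℕ[] a) (toℕ[] b))
      (sym (%-distribˡ-+ a b M)))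

    []-* : ∀ a b → [ a ] ⊗ [ b ] ≡ [ a ℕ.* b ]
    []-* a b = []-cong (trans (cong₂ (λ x y → (x ℕ.* y) % M) (toℕ[] a) (toℕ[] b))
      (sym (%-distribˡ-* a b M)))

    private
      +r : ∀ x b → x ⊕ [ b ] ≡ [ toℕ x ℕ.+ b ]
      +r x b = trans (cong (_⊕ [ b ]) (sym ([toℕ] x))) ([]-+ (toℕ x) b)
      +l : ∀ a y → [ a ] ⊕ y ≡ [ a ℕ.+ toℕ y ]
      +l a y = trans (cong ([ a ] ⊕_) (sym ([toℕ] y))) ([]-+ a (toℕ y))
      *r : ∀ x b → x ⊗ [ b ] ≡ [ toℕ x ℕ.* b ]
      *r x b = trans (cong (_⊗ [ b ]) (sym ([toℕ] x))) ([]-* (toℕ x) b)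
      *l : ∀ a y → [ a ] ⊗ y ≡ [ a ℕ.* toℕ y ]
      *l a y = trans (cong ([ a ] ⊗_) (sym ([toℕ] y))) ([]-* a (toℕ y))

    ⊕-comm : ∀ x y → x ⊕ y ≡ y ⊕ x
    ⊕-comm x y = cong [_] (ℕP.+-comm (toℕ x) (toℕ y))

    ⊗-comm : ∀ x y → x ⊗ y ≡ y ⊗ x
    ⊗-comm x y = cong [_] (ℕP.*-comm (toℕ x) (toℕ y))

    ⊕-assoc : ∀ x y z → (x ⊕ y) ⊕ z ≡ x ⊕ (y ⊕ z)
    ⊕-assoc x y z = trans (+l _ z)
      (trans (cong [_] (ℕP.+-assoc (toℕ x) (toℕ y) (toℕ z))) (sym (+r x _)))

    ⊗-assoc : ∀ x y z → (x ⊗ y) ⊗ z ≡ x ⊗ (y ⊗ z)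
    ⊗-assoc x y z = trans (*l _ z)
      (trans (cong [_] (ℕP.*-assoc (toℕ x) (toℕ y) (toℕ z))) (sym (*r x _)))

    ⊕-identityˡ : ∀ x → [ 0 ] ⊕ x ≡ x
    ⊕-identityˡ x = trans (+l 0 x) ([toℕ] x)

    ⊗-identityˡ : ∀ x → [ 1 ] ⊗ x ≡ x
    ⊗-identityˡ x = trans (*l 1 x) (trans (cong [_] (ℕP.*-identityˡ (toℕ x))) ([toℕ] x))

    ⊖-inverseˡ : ∀ x → (⊖ x) ⊕ x ≡ [ 0 ]
    ⊖-inverseˡ x = trans (+l _ x) ([]-cong
      (trans (cong (_% M) (ℕP.m∸n+n≡m (ℕP.<⇒≤ (FinP.toℕ<n x)))) (trans (n%n≡0 M) (sym (0%M M)))))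
      where
      0%M : ∀ k .{{_ : NonZero k}} → 0 % k ≡ 0
      0%M (suc k) = refl

    ⊗-distribˡ : ∀ x y z → x ⊗ (y ⊕ z) ≡ (x ⊗ y) ⊕ (x ⊗ z)
    ⊗-distribˡ x y z = trans (*r x _)
      (trans (cong [_] (ℕP.*-distribˡ-+ (toℕ x) (toℕ y) (toℕ z))) (sym ([]-+ _ _)))

    ring : Ring≡
    ring = record
      { Carrier = Fin M ; _+_ = _⊕_ ; _*_ = _⊗_ ; -_ = ⊖_ ; 0# = [ 0 ] ; 1# = [ 1 ]
      ; isCR = record
        { isRing = record
          { +-isAbelianGroup = record
            { isGroup = record
              { isMonoid = record
                { isSemigroup = record
                  { isMagma = record { isEquivalence = isEquivalence ; ∙-cong = cong₂ _⊕_ }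
                  ; assoc = ⊕-assoc }
                ; identity = ⊕-identityˡ , λ x → trans (⊕-comm x _) (⊕-identityˡ x) }
              ; inverse = ⊖-inverseˡ , λ x → trans (⊕-comm x _) (⊖-inverseˡ x)
              ; ⁻¹-cong = cong ⊖_ }
            ; comm = ⊕-comm }
          ; *-cong = cong₂ _⊗_
          ; *-assoc = ⊗-assoc
          ; *-identity = ⊗-identityˡ , λ x → trans (⊗-comm x _) (⊗-identityˡ x)
          ; distrib = ⊗-distribˡ , λ x y z → trans (⊗-comm (y ⊕ z) x)
              (trans (⊗-distribˡ x y z) (cong₂ _⊕_ (⊗-comm x y) (⊗-comm x z))) }
        ; *-comm = ⊗-comm } }

  -- ℤ/M, up to the facts that characterise it.
  record Quotient (M : ℕ) : Set₁ where
    field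
      ring : Ring≡
    open Kit ring public
    field
      rep : Carrier → ℕ
      rep< : ∀ x → rep x ℕ.< M
      ν-rep : ∀ x → ν (rep x) ≡ x
      rep-ν : ∀ {n} → n ℕ.< M → rep (ν n) ≡ n
      νM : ν M ≡ 0#
      ν-ker : ∀ n → ν n ≡ 0# → M ∣ n

    infix 4 _≟_
    _≟_ : (x y : Carrier) → Dec (x ≡ y)
    x ≟ y with rep x ℕP.≟ rep y
    ... | yes e = yes (trans (sym (ν-rep x)) (trans (cong ν e) (ν-rep y)))
    ... | no ne = no (λ e → ne (cong rep e))

    ι-ker : ∀ z → ι z ≡ 0# → M ∣ ℤ.∣ z ∣
    ι-ker (+ n) e = ν-ker n e
    ι-ker -[1+ n ] e = ν-ker (suc n)
      (trans (sym (-‿involutive _)) (trans (cong -_ e) -0#≈0#))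

    ∣⇒ν≡0 : ∀ {n} → M ∣ n → ν n ≡ 0#
    ∣⇒ν≡0 (divides q refl) = trans (ν-* q M) (trans (cong (ν q *_) νM) (zeroʳ _))

    ∣⇒ι≡0 : ∀ z → M ∣ ℤ.∣ z ∣ → ι z ≡ 0#
    ∣⇒ι≡0 (+ n) d = ∣⇒ν≡0 d
    ∣⇒ι≡0 -[1+ n ] d = trans (cong -_ (∣⇒ν≡0 d)) -0#≈0#

    coprime-inverse : ∀ {k} → Coprime k M → ∃ λ y → ν k * y ≡ 1#
    coprime-inverse {k} c with coprime-Bézout c
    ... | Bézout.+- x y eq = ν x , (begin
      ν k * ν x          ≡⟨ trans (*-comm _ _) (sym (ν-* x k)) ⟩
      ν (x ℕ.* k)        ≡⟨ cong ν (sym eq) ⟩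
      ν (1 ℕ.+ y ℕ.* M)  ≡⟨ ν-+ 1 (y ℕ.* M) ⟩
      1# + ν (y ℕ.* M)   ≡⟨ cong (λ z → 1# + z) (trans (ν-* y M) (trans (cong (ν y *_) νM) (zeroʳ _))) ⟩
      1# + 0#            ≡⟨ +-identityʳ _ ⟩
      1# ∎)
      where open ≡-Reasoning
    ... | Bézout.-+ x y eq = - ν x , (begin
      ν k * - ν x                ≡⟨ solve 2 (λ k x → k :* (:- x) := :c 1 :- (:c 1 :+ x :* k)) refl (ν k) (ν x) ⟩
      1# - (1# + ν x * ν k)      ≡⟨ cong (λ z → 1# - (1# + z)) (sym (ν-* x k)) ⟩
      1# - (1# + ν (x ℕ.* k))    ≡⟨ cong (λ z → 1# - z) (sym (ν-+ 1 (x ℕ.* k))) ⟩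
      1# - ν (1 ℕ.+ x ℕ.* k)     ≡⟨ cong (λ z → 1# - ν z) eq ⟩
      1# - ν (y ℕ.* M)           ≡⟨ cong (λ z → 1# - z) (trans (ν-* y M) (trans (cong (ν y *_) νM) (zeroʳ _))) ⟩
      1# - 0#                    ≡⟨ solve 0 (:c 1 :- :c 0 := :c 1) refl ⟩
      1# ∎)
      where open ≡-Reasoning

  quotient : ∀ M .{{_ : NonZero M}} → Quotient M
  quotient M = record
    { ring = ring
    ; rep = toℕ
    ; rep< = FinP.toℕ<n
    ; ν-rep = λ x → trans (ν≡[] (toℕ x)) ([toℕ] x)
    ; rep-ν = λ {n} l → trans (cong toℕ (ν≡[] n)) (trans (toℕ[] n) (m<n⇒m%n≡m l))
    ; νM = trans (ν≡[] M) ([]-cong (trans (n%n≡0 M) (sym (0%M M))))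
    ; ν-ker = λ n e → m%n≡0⇒n∣m n M
        (trans (sym (toℕ[] n)) (trans (cong toℕ (trans (sym (ν≡[] n)) e)) (trans (toℕ[] 0) (0%M M))))
    }
    where
    open Residues M
    open Kit ring using (ν; ν-suc)
    0%M : ∀ k .{{_ : NonZero k}} → 0 % k ≡ 0
    0%M (suc k) = refl
    ν≡[] : ∀ n → ν n ≡ [ n ]
    ν≡[] zero = refl
    ν≡[] (suc n) = trans (ν-suc n) (trans (cong ([ 1 ] ⊕_) (ν≡[] n)) ([]-+ 1 n))

  module SumOver {M : ℕ} (Q : Quotient M) (S : Ring≡) where
    private
      module Q = Quotient Q
      module S = Kit S
    open S using (_+_; _*_; 0#; Σ<)

    Σ∀ : (Q.Carrier → S.Carrier) → S.Carrier
    Σ∀ g = Σ< M (λ i → g (Q.ν i))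

    Σ∀-cong : ∀ {g h : Q.Carrier → S.Carrier} → (∀ x → g x ≡ h x) → Σ∀ g ≡ Σ∀ h
    Σ∀-cong e = S.Σ-cong M (λ i _ → e (Q.ν i))

    private
      module FS = FinSum S.+-commutativeMonoid

      Σ<≡sum : ∀ n g → Σ< n g ≡ FS.sum {n} (λ i → g (toℕ i))
      Σ<≡sum zero g = refl
      Σ<≡sum (suc n) g = trans (S.Σ-first n g) (cong (λ z → g 0 + z) (Σ<≡sum n (λ i → g (suc i))))


    Σ∀≡sum : ∀ g → Σ∀ g ≡ FS.sum {M} (λ i → g (Q.ν (toℕ i)))
    Σ∀≡sum g = Σ<≡sum M _

    -- Conjugating mutually inverse maps of residues by `rep` and `ν` yields a permutation of
    -- `Fin M`, under which sums are invariant. The character sums are transformed in this way by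
    -- scalings, by 1 - x and by other affine maps.
    Σ∀-reindex : (h k : Q.Carrier → Q.Carrier) → (∀ x → h (k x) ≡ x) → (∀ x → k (h x) ≡ x) →
      ∀ g → Σ∀ (λ x → g (h x)) ≡ Σ∀ g
    Σ∀-reindex h k hk kh g = begin
      Σ∀ (λ x → g (h x))                            ≡⟨ Σ∀≡sum (λ x → g (h x)) ⟩
      FS.sum {M} (λ i → g (h (Q.ν (toℕ i))))        ≡⟨ FS.sum-cong-≗ {M} (λ i → cong g (sym (back h i))) ⟩
      FS.sum {M} (λ i → g (Q.ν (toℕ (fwd h i))))    ≡⟨ sym (FS.sum-permute (λ i → g (Q.ν (toℕ i))) π) ⟩
      FS.sum {M} (λ i → g (Q.ν (toℕ i)))            ≡⟨ sym (Σ∀≡sum g) ⟩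
      Σ∀ g ∎
      where
      open ≡-Reasoning
      fwd : (Q.Carrier → Q.Carrier) → Fin M → Fin M
      fwd f i = fromℕ< (Q.rep< (f (Q.ν (toℕ i))))
      back : ∀ f i → Q.ν (toℕ (fwd f i)) ≡ f (Q.ν (toℕ i))
      back f i = trans (cong Q.ν (FinP.toℕ-fromℕ< (Q.rep< (f (Q.ν (toℕ i)))))) (Q.ν-rep _)
      comp : ∀ f f' → (∀ x → f (f' x) ≡ x) → ∀ i → fwd f (fwd f' i) ≡ i
      comp f f' e i = FinP.toℕ-injective (trans (FinP.toℕ-fromℕ< (Q.rep< (f (Q.ν (toℕ (fwd f' i))))))
        (trans (cong Q.rep (trans (cong f (back f' i)) (e _))) (Q.rep-ν (FinP.toℕ<n i))))
      π : Permutation M M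
      π = permutation (fwd h) (fwd k) (comp h k hk) (comp k h kh)

    Σ∀-+ : ∀ g h → Σ∀ (λ x → g x + h x) ≡ Σ∀ g + Σ∀ h
    Σ∀-+ g h = S.Σ-+ M _ _

    Σ∀-*ˡ : ∀ c g → Σ∀ (λ x → c * g x) ≡ c * Σ∀ g
    Σ∀-*ˡ c g = S.Σ-*ˡ M c _

    Σ∀-0 : ∀ {g} → (∀ x → g x ≡ 0#) → Σ∀ g ≡ 0#
    Σ∀-0 e = S.Σ-0 M (λ i _ → e (Q.ν i))

    Σ-Σ< : ∀ m n (g : ℕ → ℕ → S.Carrier) →
      Σ< m (λ i → Σ< n (λ j → g i j)) ≡ Σ< n (λ j → Σ< m (λ i → g i j))
    Σ-Σ< zero n g = sym (S.Σ-0 n (λ _ _ → refl))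
    Σ-Σ< (suc m) n g = trans (cong (_+ Σ< n (g m)) (Σ-Σ< m n g)) (sym (S.Σ-+ n _ _))

    Σ∀-swap : ∀ (g : Q.Carrier → Q.Carrier → S.Carrier) →
      Σ∀ (λ x → Σ∀ (λ y → g x y)) ≡ Σ∀ (λ y → Σ∀ (λ x → g x y))
    Σ∀-swap g = Σ-Σ< M M (λ i j → g (Q.ν i) (Q.ν j))

    Σ∀-Σ< : ∀ n (g : Q.Carrier → ℕ → S.Carrier) →
      Σ∀ (λ x → Σ< n (λ j → g x j)) ≡ Σ< n (λ j → Σ∀ (λ x → g x j))
    Σ∀-Σ< n g = Σ-Σ< M n (λ i j → g (Q.ν i) j)

    Σ∀-single : ∀ a g → (∀ x → x ≢ a → g x ≡ 0#) → Σ∀ g ≡ g a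
    Σ∀-single a g e = trans (S.Σ-single M (Q.rep a) _ (Q.rep< a)
        (λ i l ne → e (Q.ν i) (λ q → ne (trans (sym (Q.rep-ν l)) (cong Q.rep q)))))
      (cong g (Q.ν-rep a))

-- A very-well-poised hypergeometric sum by the WZ method

module WZ where

  open RingKit
  open import Data.Nat as ℕ using (ℕ; zero; suc)
  import Data.Nat.Properties as ℕP
  open import Relation.Nullary using (yes; no)
  open import Relation.Binary.PropositionalEquality

  module WellPoised (K : Ring≡) where
    open Kit K

    -- Dougall's ₅F₄ sum with parameters A, 1 + A/2, c, d, -n, multiplied by A. Only s = c + d and q
    -- = c d enter: `b x` is (x + c)(x + d) and `d x` is (A + x - c)(A + x - d), so neither c nor d
    -- has to lie in the ring.
    module Summation (A s q : Carrier)
      (i1 iD iE : ℕ → Carrier)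
      (d : Carrier → Carrier)
      (d-def : ∀ x → d x ≡ (A + x) * (A + x) - (A + x) * s + q)
      (i1-inv : ∀ k → i1 k * ν (suc k) ≡ 1#)
      (iD-inv : ∀ k → iD k * d (ν (suc k)) ≡ 1#)
      (iE-inv : ∀ k → iE k * (A + ν (suc k)) ≡ 1#)
      where

      b : Carrier → Carrier
      b x = x * x + x * s + q

      w : ℕ → Carrier
      w k = Π< k (λ j → (A + ν j) * b (ν j) * i1 j * iD j)

      -- The Pochhammer symbols (-n)_k and 1/(A + n + 1)_k, the only factors of the summand that
      -- depend on n.
      V E : ℕ → ℕ → Carrier
      V n k = Π< k (λ j → ν j - ν n)
      E n k = Π< k (λ j → iE (n ℕ.+ j))

      F : ℕ → ℕ → Carrier
      F n k = (A + ν 2 * ν k) * w k * V n k * E n k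

      closed : ℕ → Carrier
      closed n = A * Π< n (λ j → (A + ν (suc j)) * (1# + A - s + ν j) * iD j)

      V-vanish : ∀ n k → n ℕ.< k → V n k ≡ 0#
      V-vanish n (suc k) (ℕ.s≤s l) with n ℕP.≟ k
      ... | yes refl = trans (cong (V n n *_) (-‿inverseʳ (ν n))) (zeroʳ _)
      ... | no ne = trans (cong (_* (ν k - ν n)) (V-vanish n k (ℕP.≤∧≢⇒< l ne))) (zeroˡ _)

      V-shift : ∀ n k → V (suc n) (suc k) ≡ - ν (suc n) * V n k
      V-shift n k = trans (Π-first k (λ j → ν j - ν (suc n)))
        (cong₂ _*_ (+-identityˡ _) (Π-cong k λ i _ →
          trans (cong₂ _-_ (ν-suc i) (ν-suc n))
            (solve 2 (λ i n → (:c 1 :+ i) :- (:c 1 :+ n) := i :- n) refl (ν i) (ν n))))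

      E-first : ∀ n k → E n (suc k) ≡ iE n * E (suc n) k
      E-first n k = trans (Π-first k (λ j → iE (n ℕ.+ j)))
        (cong₂ _*_ (cong iE (ℕP.+-identityʳ n)) (Π-cong k (λ i _ → cong iE (ℕP.+-suc n i))))

      module Step (n : ℕ) where
        -- `G` is the WZ companion of `F`, and `e` the common factor: F (n+1) k, G k, G (k+1) and,
        -- after multiplication by n + 1, also F n k are polynomials in n and k times `e k`.
        e G : ℕ → Carrier
        e k = w k * V (suc n) k * E n (suc k)
        G k = ν k * d (ν k) * (A + (1# + ν n) + ν k) * e k

        E-last : ∀ k → E n k ≡ E n (suc k) * (A + (1# + ν n) + ν k)
        E-last k = sym (begin
          E n k * iE (n ℕ.+ k) * (A + (1# + ν n) + ν k)   ≡⟨ *-assoc _ _ _ ⟩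
          E n k * (iE (n ℕ.+ k) * (A + (1# + ν n) + ν k)) ≡⟨ cong (λ z → E n k * (iE (n ℕ.+ k) * z)) eq ⟩
          E n k * (iE (n ℕ.+ k) * (A + ν (suc (n ℕ.+ k)))) ≡⟨ cong (E n k *_) (iE-inv (n ℕ.+ k)) ⟩
          E n k * 1#                                       ≡⟨ *-identityʳ _ ⟩
          E n k ∎)
          where
          open ≡-Reasoning
          eq : A + (1# + ν n) + ν k ≡ A + ν (suc (n ℕ.+ k))
          eq = trans (solve 3 (λ A n k → A :+ (:c 1 :+ n) :+ k := A :+ (:c 1 :+ (n :+ k))) refl A (ν n) (ν k))
            (cong (λ z → A + z) (trans (cong (λ z → 1# + z) (sym (ν-+ n k))) (sym (ν-suc (n ℕ.+ k)))))

        F-suc : ∀ k → F (suc n) k ≡ (A + ν 2 * ν k) * e k * (A + (1# + ν n))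
        F-suc k = sym (begin
          (A + ν 2 * ν k) * (w k * V (suc n) k * E n (suc k)) * (A + (1# + ν n))
            ≡⟨ cong (λ z → (A + ν 2 * ν k) * (w k * V (suc n) k * z) * (A + (1# + ν n))) (E-first n k) ⟩
          (A + ν 2 * ν k) * (w k * V (suc n) k * (iE n * E (suc n) k)) * (A + (1# + ν n))
            ≡⟨ solve 6 (λ h w v i E x → h :* (w :* v :* (i :* E)) :* x := h :* w :* v :* E :* (i :* x)) refl _ _ _ _ _ _ ⟩
          F (suc n) k * (iE n * (A + (1# + ν n)))
            ≡⟨ cong (λ z → F (suc n) k * (iE n * (A + z))) (sym (ν-suc n)) ⟩
          F (suc n) k * (iE n * (A + ν (suc n)))
            ≡⟨ cong (F (suc n) k *_) (iE-inv n) ⟩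
          F (suc n) k * 1# ≡⟨ *-identityʳ _ ⟩
          F (suc n) k ∎)
          where open ≡-Reasoning

        F-old : ∀ k → (1# + ν n) * F n k ≡
          - ((A + ν 2 * ν k) * e k * (ν k - (1# + ν n)) * (A + (1# + ν n) + ν k))
        F-old k = begin
          (1# + ν n) * ((A + ν 2 * ν k) * w k * V n k * E n k)
            ≡⟨ cong (λ z → (1# + ν n) * ((A + ν 2 * ν k) * w k * V n k * z)) (E-last k) ⟩
          (1# + ν n) * ((A + ν 2 * ν k) * w k * V n k * (E n (suc k) * (A + (1# + ν n) + ν k)))
            ≡⟨ solve 6 (λ n h w v E x → n :* (h :* w :* v :* (E :* x)) := :- (h :* w :* (:- n :* v) :* E :* x)) refl _ _ _ _ _ _ ⟩
          - ((A + ν 2 * ν k) * w k * (- (1# + ν n) * V n k) * E n (suc k) * (A + (1# + ν n) + ν k))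
            ≡⟨ cong (λ z → - ((A + ν 2 * ν k) * w k * z * E n (suc k) * (A + (1# + ν n) + ν k))) veq ⟩
          - ((A + ν 2 * ν k) * w k * (V (suc n) k * (ν k - (1# + ν n))) * E n (suc k) * (A + (1# + ν n) + ν k))
            ≡⟨ solve 6 (λ h w v y E x → :- (h :* w :* (v :* y) :* E :* x) := :- (h :* (w :* v :* E) :* y :* x)) refl _ _ _ _ _ _ ⟩
          - ((A + ν 2 * ν k) * e k * (ν k - (1# + ν n)) * (A + (1# + ν n) + ν k)) ∎
          where
          open ≡-Reasoning
          veq : - (1# + ν n) * V n k ≡ V (suc n) k * (ν k - (1# + ν n))
          veq = trans (cong (λ z → - z * V n k) (sym (ν-suc n)))
            (trans (sym (V-shift n k)) (cong (λ z → V (suc n) k * (ν k - z)) (ν-suc n)))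

        G-suc : ∀ k → G (suc k) ≡ (A + ν k) * b (ν k) * (ν k - (1# + ν n)) * e k
        G-suc k = begin
          ν (suc k) * d (ν (suc k)) * X * (w k * (a * b₀ * i1 k * iD k) * (v * y) * E n (suc (suc k)))
            ≡⟨ solve 11 (λ s d X w a b i j v y E → s :* d :* X :* (w :* (a :* b :* i :* j) :* (v :* y) :* E)
                 := (i :* s) :* (j :* d) :* (E :* X) :* (a :* b :* y :* (w :* v))) refl
                 (ν (suc k)) (d (ν (suc k))) X (w k) a b₀ (i1 k) (iD k) v y (E n (suc (suc k))) ⟩
          (i1 k * ν (suc k)) * (iD k * d (ν (suc k))) * (E n (suc (suc k)) * X) * (a * b₀ * y * (w k * v))
            ≡⟨ cong₂ (λ r t → r * t * (E n (suc (suc k)) * X) * (a * b₀ * y * (w k * v))) (i1-inv k) (iD-inv k) ⟩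
          1# * 1# * (E n (suc (suc k)) * X) * (a * b₀ * y * (w k * v))
            ≡⟨ cong (λ z → 1# * 1# * z * (a * b₀ * y * (w k * v))) (sym (E-last (suc k))) ⟩
          1# * 1# * E n (suc k) * (a * b₀ * y * (w k * v))
            ≡⟨ solve 6 (λ E a b y w v → :c 1 :* :c 1 :* E :* (a :* b :* y :* (w :* v)) := a :* b :* y :* (w :* v :* E)) refl
                 (E n (suc k)) a b₀ y (w k) v ⟩
          a * b₀ * y * e k
            ≡⟨ cong (λ z → a * b₀ * (ν k - z) * e k) (ν-suc n) ⟩
          a * b₀ * (ν k - (1# + ν n)) * e k ∎
          where
          open ≡-Reasoning
          a = A + ν k
          b₀ = b (ν k)
          v = V (suc n) k
          y = ν k - ν (suc n)
          X = A + (1# + ν n) + ν (suc k)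

        D₁ N₁ : Carrier
        D₁ = d (ν (suc n))
        N₁ = (A + (1# + ν n)) * (1# + A - s + ν n)

        -- The WZ equation with denominators cleared. Once every term is a polynomial times `e k`, a
        -- single polynomial identity in A, s, q, n, k remains.
        telescoping : ∀ k → (1# + ν n) * (D₁ * F (suc n) k) - N₁ * ((1# + ν n) * F n k)
          ≡ (A + (1# + ν n)) * (G k - G (suc k))
        telescoping k = begin
          (1# + ν n) * (D₁ * F (suc n) k) - N₁ * ((1# + ν n) * F n k)
            ≡⟨ cong₂ (λ x y → (1# + ν n) * (D₁ * x) - N₁ * y) (F-suc k) (F-old k) ⟩
          (1# + ν n) * (D₁ * ((A + ν 2 * ν k) * e k * (A + (1# + ν n)))) - N₁ * (- ((A + ν 2 * ν k) * e k * (ν k - (1# + ν n)) * (A + (1# + ν n) + ν k)))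
            ≡⟨ cong (λ z → (1# + ν n) * (z * ((A + ν 2 * ν k) * e k * (A + (1# + ν n)))) - N₁ * (- ((A + ν 2 * ν k) * e k * (ν k - (1# + ν n)) * (A + (1# + ν n) + ν k))))
                 (trans (d-def (ν (suc n))) (cong (λ z → (A + z) * (A + z) - (A + z) * s + q) (ν-suc n))) ⟩
          (1# + ν n) * (((A + (1# + ν n)) * (A + (1# + ν n)) - (A + (1# + ν n)) * s + q) * ((A + ν 2 * ν k) * e k * (A + (1# + ν n)))) - N₁ * (- ((A + ν 2 * ν k) * e k * (ν k - (1# + ν n)) * (A + (1# + ν n) + ν k)))
            ≡⟨ solve 6 (λ A s q n k e →
                 let m = :c 1 :+ n; a = A :+ m; h = A :+ :c 2 :* k in
                 m :* ((a :* a :- a :* s :+ q) :* (h :* e :* a)) :- a :* (:c 1 :+ A :- s :+ n) :* (:- (h :* e :* (k :- m) :* (a :+ k)))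
                 := a :* (k :* ((A :+ k) :* (A :+ k) :- (A :+ k) :* s :+ q) :* (a :+ k) :* e
                           :- (A :+ k) :* (k :* k :+ k :* s :+ q) :* (k :- m) :* e)) refl A s q (ν n) (ν k) (e k) ⟩
          (A + (1# + ν n)) * (ν k * ((A + ν k) * (A + ν k) - (A + ν k) * s + q) * (A + (1# + ν n) + ν k) * e k
            - (A + ν k) * b (ν k) * (ν k - (1# + ν n)) * e k)
            ≡⟨ cong₂ (λ x y → (A + (1# + ν n)) * (ν k * x * (A + (1# + ν n) + ν k) * e k - y)) (sym (d-def (ν k))) (sym (G-suc k)) ⟩
          (A + (1# + ν n)) * (G k - G (suc k)) ∎
          where open ≡-Reasoning

        telescoped : ∀ N → (1# + ν n) * (D₁ * Σ< N (F (suc n))) - N₁ * ((1# + ν n) * Σ< N (F n))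
          ≡ (A + (1# + ν n)) * (- G N)
        telescoped zero = trans
          (solve 3 (λ m D N → m :* (D :* :c 0) :- N :* (m :* :c 0) := :c 0) refl (1# + ν n) D₁ N₁)
          (sym (trans (cong (λ z → (A + (1# + ν n)) * (- z)) G0) (trans (cong ((A + (1# + ν n)) *_) -0#≈0#) (zeroʳ _))))
          where
          G0 : G 0 ≡ 0#
          G0 = solve 3 (λ D X e → :c 0 :* D :* X :* e := :c 0) refl (d (ν 0)) (A + (1# + ν n) + ν 0) (e 0)
        telescoped (suc N) = begin
          m * (D₁ * (S₁ + F (suc n) N)) - N₁ * (m * (S₀ + F n N))
            ≡⟨ solve 7 (λ m D S f N T g → m :* (D :* (S :+ f)) :- N :* (m :* (T :+ g))
                 := (m :* (D :* S) :- N :* (m :* T)) :+ (m :* (D :* f) :- N :* (m :* g))) refl m D₁ S₁ (F (suc n) N) N₁ S₀ (F n N) ⟩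
          (m * (D₁ * S₁) - N₁ * (m * S₀)) + (m * (D₁ * F (suc n) N) - N₁ * (m * F n N))
            ≡⟨ cong₂ _+_ (telescoped N) (telescoping N) ⟩
          (A + m) * (- G N) + (A + m) * (G N - G (suc N))
            ≡⟨ solve 3 (λ x g h → x :* (:- g) :+ x :* (g :- h) := x :* (:- h)) refl (A + m) (G N) (G (suc N)) ⟩
          (A + m) * (- G (suc N)) ∎
          where
          open ≡-Reasoning
          m = 1# + ν n
          S₁ = Σ< N (F (suc n))
          S₀ = Σ< N (F n)

        -- Telescoping leaves only - G N, as G 0 has the factor `ν 0`; and G N = 0 because (-n-1)_N
        -- vanishes for N > n + 1. The factors n + 1 and d(n + 1) are then cancelled by their
        -- inverses.
        recurrence : ∀ N → suc n ℕ.< N → Σ< N (F (suc n)) ≡ iD n * (N₁ * Σ< N (F n))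
        recurrence N l = begin
          Σ< N (F (suc n))            ≡⟨ sym (*-identityˡ _) ⟩
          1# * Σ< N (F (suc n))       ≡⟨ cong (_* Σ< N (F (suc n))) (sym (iD-inv n)) ⟩
          iD n * D₁ * Σ< N (F (suc n)) ≡⟨ *-assoc _ _ _ ⟩
          iD n * (D₁ * Σ< N (F (suc n))) ≡⟨ cong (iD n *_) eq ⟩
          iD n * (N₁ * Σ< N (F n)) ∎
          where
          open ≡-Reasoning
          G-N : G N ≡ 0#
          G-N = trans (cong (λ z → ν N * d (ν N) * (A + (1# + ν n) + ν N) * (w N * z * E n (suc N))) (V-vanish (suc n) N l))
            (solve 3 (λ x w E → x :* (w :* :c 0 :* E) := :c 0) refl _ _ _)
          eq : D₁ * Σ< N (F (suc n)) ≡ N₁ * Σ< N (F n)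
          eq = cancelʳ (ν (suc n)) (i1 n) (trans (*-comm _ _) (i1-inv n)) (x-y≡0⇒x≡y (begin
            D₁ * Σ< N (F (suc n)) * ν (suc n) - N₁ * Σ< N (F n) * ν (suc n)
              ≡⟨ cong (λ z → D₁ * Σ< N (F (suc n)) * z - N₁ * Σ< N (F n) * z) (ν-suc n) ⟩
            D₁ * Σ< N (F (suc n)) * (1# + ν n) - N₁ * Σ< N (F n) * (1# + ν n)
              ≡⟨ solve 5 (λ D S m N T → D :* S :* m :- N :* T :* m := m :* (D :* S) :- N :* (m :* T)) refl _ _ _ _ _ ⟩
            (1# + ν n) * (D₁ * Σ< N (F (suc n))) - N₁ * ((1# + ν n) * Σ< N (F n))
              ≡⟨ telescoped N ⟩
            (A + (1# + ν n)) * (- G N)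
              ≡⟨ cong (λ z → (A + (1# + ν n)) * (- z)) G-N ⟩
            (A + (1# + ν n)) * (- 0#)
              ≡⟨ solve 1 (λ x → x :* (:- :c 0) := :c 0) refl _ ⟩
            0# ∎))

      summation : ∀ N n → n ℕ.< N → Σ< N (F n) ≡ closed n
      summation (suc N) zero l = begin
        Σ< (suc N) (F 0)                      ≡⟨ Σ-first N (F 0) ⟩
        F 0 0 + Σ< N (λ i → F 0 (suc i))      ≡⟨ cong (λ z → F 0 0 + z) (Σ-0 N λ i _ →
          trans (cong (λ z → (A + ν 2 * ν (suc i)) * w (suc i) * z * E 0 (suc i)) (V-vanish 0 (suc i) (ℕ.s≤s ℕ.z≤n)))
            (solve 3 (λ x w E → x :* w :* :c 0 :* E := :c 0) refl _ _ _)) ⟩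
        F 0 0 + 0#                            ≡⟨ solve 1 (λ A → (A :+ :c 2 :* :c 0) :* :c 1 :* :c 1 :* :c 1 :+ :c 0 := A :* :c 1) refl A ⟩
        closed 0 ∎
        where open ≡-Reasoning
      summation N (suc n) l = begin
        Σ< N (F (suc n))        ≡⟨ Step.recurrence n N l ⟩
        iD n * ((A + (1# + ν n)) * (1# + A - s + ν n) * Σ< N (F n))
          ≡⟨ cong₂ (λ x y → iD n * ((A + x) * (1# + A - s + ν n) * y)) (sym (ν-suc n)) (summation N n (ℕP.<-trans (ℕP.n<1+n n) l)) ⟩
        iD n * ((A + ν (suc n)) * (1# + A - s + ν n) * closed n)
          ≡⟨ solve 5 (λ i x y A P → i :* (x :* y :* (A :* P)) := A :* (P :* (x :* y :* i))) refl _ _ _ _ _ ⟩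
        closed (suc n) ∎
        where open ≡-Reasoning

-- Rational numbers with denominator prime to p and their residues

module Reduction where

  open import Defs using (ℕ→ℚ; ℤ→ℚ; CongMod; pIntegral)
  open RingKit
  open ZMod
  open import Data.Nat as ℕ using (ℕ; zero; suc; NonZero)
  import Data.Nat.Properties as ℕP
  open import Data.Nat.Divisibility as ℕD using (_∣_; _∤_; divides)
  open import Data.Nat.Primality using (Prime; euclidsLemma; prime⇒nonTrivial; prime⇒nonZero)
  open import Data.Integer as ℤ using (ℤ; +_; -[1+_])
  import Data.Integer.Properties as ℤP
  import Data.Integer.GCD as ℤG
  open import Data.Rational as ℚ using (ℚ)
  import Data.Rational.Properties as ℚP
  open import Data.Rational.Unnormalised as ℚᵘ using (mkℚᵘ; *≡*)
  import Data.Rational.Unnormalised.Properties as ℚᵘP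
  open import Data.Product using (_,_; ∃)
  open import Data.Sum using (inj₁; inj₂)
  open import Data.Empty using (⊥-elim)
  open import Relation.Binary.PropositionalEquality

  ℚring : Ring≡
  ℚring = record { isCR = ℚP.+-*-isCommutativeRing }

  module ℚK = Kit ℚring

  ℚᵘ-from-+ : ∀ x y → ℚ.fromℚᵘ (x ℚᵘ.+ y) ≡ ℚ.fromℚᵘ x ℚ.+ ℚ.fromℚᵘ y
  ℚᵘ-from-+ x y = ℚP.toℚᵘ-injective (ℚᵘP.≃-trans (ℚP.toℚᵘ-fromℚᵘ (x ℚᵘ.+ y))
    (ℚᵘP.≃-sym (ℚᵘP.≃-trans (ℚP.toℚᵘ-homo-+ (ℚ.fromℚᵘ x) (ℚ.fromℚᵘ y))
      (ℚᵘP.+-cong (ℚP.toℚᵘ-fromℚᵘ x) (ℚP.toℚᵘ-fromℚᵘ y)))))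

  ℚᵘ-from-* : ∀ x y → ℚ.fromℚᵘ (x ℚᵘ.* y) ≡ ℚ.fromℚᵘ x ℚ.* ℚ.fromℚᵘ y
  ℚᵘ-from-* x y = ℚP.toℚᵘ-injective (ℚᵘP.≃-trans (ℚP.toℚᵘ-fromℚᵘ (x ℚᵘ.* y))
    (ℚᵘP.≃-sym (ℚᵘP.≃-trans (ℚP.toℚᵘ-homo-* (ℚ.fromℚᵘ x) (ℚ.fromℚᵘ y))
      (ℚᵘP.*-cong (ℚP.toℚᵘ-fromℚᵘ x) (ℚP.toℚᵘ-fromℚᵘ y)))))

  ℕ→ℚ-suc : ∀ n → ℕ→ℚ (suc n) ≡ ℚ.1ℚ ℚ.+ ℕ→ℚ n
  ℕ→ℚ-suc n = trans
    (ℚP.fromℚᵘ-cong {mkℚᵘ (+ suc n) 0} {mkℚᵘ (+ 1) 0 ℚᵘ.+ mkℚᵘ (+ n) 0}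
      (*≡* (cong (λ z → (+ 1 ℤ.+ z) ℤ.* + 1) (sym (ℤP.*-identityʳ (+ n))))))
    (ℚᵘ-from-+ (mkℚᵘ (+ 1) 0) (mkℚᵘ (+ n) 0))

  ℕ→ℚ≡ν : ∀ n → ℕ→ℚ n ≡ ℚK.ν n
  ℕ→ℚ≡ν zero = refl
  ℕ→ℚ≡ν (suc n) = trans (ℕ→ℚ-suc n) (trans (cong (ℚ.1ℚ ℚ.+_) (ℕ→ℚ≡ν n)) (sym (ℚK.ν-suc n)))

  ℤ→ℚ≡ι : ∀ z → ℤ→ℚ z ≡ ℚK.ι z
  ℤ→ℚ≡ι (+ n) = ℕ→ℚ≡ν n
  ℤ→ℚ≡ι -[1+ n ] = cong ℚ.-_ (ℕ→ℚ≡ν (suc n))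

  unitFraction : ∀ k .{{_ : NonZero k}} → ((+ 1) ℚ./ k) ℚ.* ℚK.ν k ≡ ℚ.1ℚ
  unitFraction (suc k) = trans (cong (((+ 1) ℚ./ suc k) ℚ.*_) (sym (ℕ→ℚ≡ν (suc k))))
    (trans (sym (ℚᵘ-from-* (mkℚᵘ (+ 1) k) (mkℚᵘ (+ suc k) 0)))
      (ℚP.fromℚᵘ-cong {mkℚᵘ (+ 1) k ℚᵘ.* mkℚᵘ (+ suc k) 0} {mkℚᵘ (+ 1) 0}
        (*≡* (trans (ℤP.*-identityʳ _) (cong (λ z → + suc z) (trans (ℕP.+-identityʳ k) (sym (trans (ℕP.+-identityʳ _) (ℕP.*-identityʳ k)))))))))

  fraction : ∀ z k .{{_ : NonZero k}} → z ℚ./ k ≡ ℚK.ι z ℚ.* ((+ 1) ℚ./ k)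
  fraction z (suc k) = trans
    (ℚP.fromℚᵘ-cong {mkℚᵘ z k} {mkℚᵘ z 0 ℚᵘ.* mkℚᵘ (+ 1) k}
      (*≡* (trans (cong (λ w → z ℤ.* + suc w) (ℕP.+-identityʳ k)) (cong (ℤ._* + suc k) (sym (ℤP.*-identityʳ z))))))
    (trans (ℚᵘ-from-* (mkℚᵘ z 0) (mkℚᵘ (+ 1) k)) (cong (ℚ._* ((+ 1) ℚ./ suc k)) (ℤ→ℚ≡ι z)))

  -- a ↦ x: the p-integral element a of K₁ reduces to x in K₂, as witnessed by
  -- a fraction z/m with p ∤ m.
  module Reduce (p : ℕ) (pr : Prime p) (K₁ K₂ : Ring≡) where
    private
      module A = Kit K₁
      module B = Kit K₂

    infix 4 _↦_
    record _↦_ (a : A.Carrier) (x : B.Carrier) : Set where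
      constructor red
      field
        den : ℕ
        num : ℤ
        unit : p ∤ den
        eq₁ : A.ν den A.* a ≡ A.ι num
        eq₂ : B.ν den B.* x ≡ B.ι num

    p∤* : ∀ {a b} → p ∤ a → p ∤ b → p ∤ (a ℕ.* b)
    p∤* {a} {b} na nb d with euclidsLemma a b pr d
    ... | inj₁ q = na q
    ... | inj₂ q = nb q

    p∤1 : p ∤ 1
    p∤1 d = ℕP.<⇒≱ (ℕ.nonTrivial⇒n>1 p {{prime⇒nonTrivial pr}}) (ℕD.∣⇒≤ d)

    private
      module Add (K : Ring≡) where
        open Kit K
        add : ∀ m₁ m₂ z₁ z₂ {a b} → ν m₁ * a ≡ ι z₁ → ν m₂ * b ≡ ι z₂ →
          ν (m₁ ℕ.* m₂) * (a + b) ≡ ι (z₁ ℤ.* + m₂ ℤ.+ z₂ ℤ.* + m₁)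
        add m₁ m₂ z₁ z₂ {a} {b} e₁ e₂ = begin
          ν (m₁ ℕ.* m₂) * (a + b)         ≡⟨ cong (_* (a + b)) (ν-* m₁ m₂) ⟩
          ν m₁ * ν m₂ * (a + b)           ≡⟨ solve 4 (λ m n a b → m :* n :* (a :+ b) := (m :* a) :* n :+ (n :* b) :* m) refl _ _ _ _ ⟩
          ν m₁ * a * ν m₂ + ν m₂ * b * ν m₁ ≡⟨ cong₂ (λ x y → x * ν m₂ + y * ν m₁) e₁ e₂ ⟩
          ι z₁ * ν m₂ + ι z₂ * ν m₁       ≡⟨ cong₂ _+_ (sym (ι-* z₁ (+ m₂))) (sym (ι-* z₂ (+ m₁))) ⟩
          ι (z₁ ℤ.* + m₂) + ι (z₂ ℤ.* + m₁) ≡⟨ sym (ι-+ (z₁ ℤ.* + m₂) _) ⟩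
          ι (z₁ ℤ.* + m₂ ℤ.+ z₂ ℤ.* + m₁) ∎
          where open ≡-Reasoning
        mul : ∀ m₁ m₂ z₁ z₂ {a b} → ν m₁ * a ≡ ι z₁ → ν m₂ * b ≡ ι z₂ →
          ν (m₁ ℕ.* m₂) * (a * b) ≡ ι (z₁ ℤ.* z₂)
        mul m₁ m₂ z₁ z₂ {a} {b} e₁ e₂ = trans (cong (_* (a * b)) (ν-* m₁ m₂))
          (trans (solve 4 (λ m n a b → m :* n :* (a :* b) := (m :* a) :* (n :* b)) refl _ _ _ _)
            (trans (cong₂ _*_ e₁ e₂) (sym (ι-* z₁ z₂))))
        neg : ∀ m z {a} → ν m * a ≡ ι z → ν m * (- a) ≡ ι (ℤ.- z)
        neg m z e = trans (sym (-‿distribʳ-* _ _)) (trans (cong -_ e) (sym (ι-neg z)))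

    red-+ : ∀ {a b x y} → a ↦ x → b ↦ y → a A.+ b ↦ x B.+ y
    red-+ (red m₁ z₁ u₁ e₁ f₁) (red m₂ z₂ u₂ e₂ f₂) =
      red (m₁ ℕ.* m₂) (z₁ ℤ.* + m₂ ℤ.+ z₂ ℤ.* + m₁) (p∤* u₁ u₂) (Add.add K₁ m₁ m₂ z₁ z₂ e₁ e₂) (Add.add K₂ m₁ m₂ z₁ z₂ f₁ f₂)

    red-* : ∀ {a b x y} → a ↦ x → b ↦ y → a A.* b ↦ x B.* y
    red-* (red m₁ z₁ u₁ e₁ f₁) (red m₂ z₂ u₂ e₂ f₂) =
      red (m₁ ℕ.* m₂) (z₁ ℤ.* z₂) (p∤* u₁ u₂) (Add.mul K₁ m₁ m₂ z₁ z₂ e₁ e₂) (Add.mul K₂ m₁ m₂ z₁ z₂ f₁ f₂)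

    red-neg : ∀ {a x} → a ↦ x → A.- a ↦ B.- x
    red-neg (red m z u e f) = red m (ℤ.- z) u (Add.neg K₁ m z e) (Add.neg K₂ m z f)

    red-- : ∀ {a b x y} → a ↦ x → b ↦ y → a A.- b ↦ x B.- y
    red-- r s = red-+ r (red-neg s)

    red-ι : ∀ z → A.ι z ↦ B.ι z
    red-ι z = red 1 z p∤1 (A.*-identityˡ _) (B.*-identityˡ _)

    red-ν : ∀ n → A.ν n ↦ B.ν n
    red-ν n = red-ι (+ n)

    red-unit : ∀ {a x} k → p ∤ k → a A.* A.ν k ≡ A.1# → x B.* B.ν k ≡ B.1# → a ↦ x
    red-unit k u e f = red k (+ 1) u (trans (A.*-comm _ _) e) (trans (B.*-comm _ _) f)

    red-^ : ∀ {a x} n → a ↦ x → a A.^ n ↦ x B.^ n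
    red-^ zero r = red-ν 1
    red-^ (suc n) r = red-* r (red-^ n r)

    red-Σ : ∀ n {g h} → (∀ i → i ℕ.< n → g i ↦ h i) → A.Σ< n g ↦ B.Σ< n h
    red-Σ zero r = red-ν 0
    red-Σ (suc n) r = red-+ (red-Σ n (λ i l → r i (ℕP.m<n⇒m<1+n l))) (r n (ℕP.n<1+n n))

    red-Π : ∀ n {g h} → (∀ i → i ℕ.< n → g i ↦ h i) → A.Π< n g ↦ B.Π< n h
    red-Π zero r = red-ν 1
    red-Π (suc n) r = red-* (red-Π n (λ i l → r i (ℕP.m<n⇒m<1+n l))) (r n (ℕP.n<1+n n))

    module Inverse (nonunit : ∀ {n y} → p ∣ n → B.ν n B.* y ≢ B.1#)
      (unit-ν : ∀ {n} → p ∤ n → ∃ λ y → B.ν n B.* y ≡ B.1#) where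

      -- If num/den represents a, then den/num represents its inverse. The numerator is prime to p
      -- because its residue times x' is the unit den. Its sign has to move to the new numerator,
      -- since denominators are natural numbers.
      red-inverse : ∀ {a a' x x'} → a ↦ x → a A.* a' ≡ A.1# → x B.* x' ≡ B.1# → a' ↦ x'
      red-inverse {a} {a'} {x} {x'} (red m z u e f) aa xx with unit-ν u
      ... | v , mv = go z e f
        where
        open ≡-Reasoning
        invert : ∀ (K : Ring≡) (let open Kit K) w {a a'} → ν m * a ≡ w → a * a' ≡ 1# → w * a' ≡ ν m
        invert K w {a} {a'} eq aa = trans (cong (_* a') (sym eq)) (trans (*-assoc _ _ _) (trans (cong (ν m *_) aa) (*-identityʳ _)))
          where open Kit K
        go : ∀ z → A.ν m A.* a ≡ A.ι z → B.ν m B.* x ≡ B.ι z → a' ↦ x'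
        go (+ n) e f = red n (+ m) n-unit (invert K₁ (A.ν n) e aa) (invert K₂ (B.ν n) f xx)
          where
          n-unit : p ∤ n
          n-unit d = nonunit {n} {x' B.* v} d (trans (sym (B.*-assoc _ _ _))
            (trans (cong (B._* v) (invert K₂ (B.ν n) f xx)) mv))
        go -[1+ n ] e f = red (suc n) (ℤ.- + m) n-unit
            (trans (move K₁ (invert K₁ (A.- A.ν (suc n)) e aa)) (sym (A.ι-neg (+ m))))
            (trans (move K₂ (invert K₂ (B.- B.ν (suc n)) f xx)) (sym (B.ι-neg (+ m))))
          where
          move : ∀ (K : Ring≡) (let open Kit K) {c y k} → (- c) * y ≡ k → c * y ≡ - k
          move K {c} {y} eq = trans (solve 2 (λ c y → c :* y := :- ((:- c) :* y)) refl c y) (cong -_ eq)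
            where open Kit K
          n-unit : p ∤ suc n
          n-unit d = nonunit {suc n} {B.- (x' B.* v)} d (begin
            B.ν (suc n) B.* (B.- (x' B.* v)) ≡⟨ B.solve 3 (λ n x v → n B.:* (B.:- (x B.:* v)) B.:= (B.:- n) B.:* x B.:* v) refl _ _ _ ⟩
            (B.- B.ν (suc n)) B.* x' B.* v   ≡⟨ cong (B._* v) (invert K₂ _ f xx) ⟩
            B.ν m B.* v                      ≡⟨ mv ⟩
            B.1# ∎)

  private
    module Clear (K : Ring≡) where
      open Kit K
      clear : ∀ {m n w c} (μ : Carrier) → μ * ν m ≡ 1# → ν m * c ≡ ι (+ n ℤ.* w) → c ≡ ν n * (ι w * μ)
      clear {m} {n} {w} {c} μ inv eq = begin
        c                      ≡⟨ sym (*-identityˡ _) ⟩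
        1# * c                 ≡⟨ cong (_* c) (sym inv) ⟩
        μ * ν m * c            ≡⟨ *-assoc μ (ν m) _ ⟩
        μ * (ν m * c)          ≡⟨ cong (μ *_) eq ⟩
        μ * ι (+ n ℤ.* w)      ≡⟨ cong (μ *_) (ι-* (+ n) w) ⟩
        μ * (ν n * ι w)        ≡⟨ solve 3 (λ m n w → m :* (n :* w) := n :* (w :* m)) refl μ (ν n) (ι w) ⟩
        ν n * (ι w * μ) ∎
        where open ≡-Reasoning

    clear-denominator : ∀ {m n w c μ} → μ ℚ.* ℚK.ν m ≡ ℚ.1ℚ → ℚK.ν m ℚ.* c ≡ ℚK.ι (+ n ℤ.* w) →
      c ≡ ℚK.ν n ℚ.* (ℚK.ι w ℚ.* μ)
    clear-denominator {m} {n} {w} {c} {μ} = Clear.clear ℚring {m} {n} {w} {c} μ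

  module ToCongMod (p : ℕ) (pr : Prime p) (e : ℕ) (Q : Quotient (p ℕ.^ e)) where
    private
      module B = Quotient Q
      instance
        p≢0 : NonZero p
        p≢0 = prime⇒nonZero pr
    open Reduce p pr ℚring B.ring

    -- Passing to lowest terms divides m by a gcd, so the reduced denominator divides m and stays
    -- prime to p.
    pIntegral-/ : ∀ w m .{{_ : NonZero m}} → p ∤ m → pIntegral p (w ℚ./ m)
    pIntegral-/ w m u d = u (ℕD.∣-trans d (divides ℤ.∣ ℤG.gcd w (+ m) ∣
      (trans (cong ℤ.∣_∣ (sym (ℚP.↧-/ w m))) (trans (ℤP.abs-* (ℚ.↧ (w ℚ./ m)) (ℤG.gcd w (+ m))) (ℕP.*-comm (ℚ.denominatorℕ (w ℚ./ m)) ℤ.∣ ℤG.gcd w (+ m) ∣)))))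

    private
      ∣∣-quotient : ∀ {n} z → n ∣ ℤ.∣ z ∣ → ∃ λ w → z ≡ + n ℤ.* w
      ∣∣-quotient {n} (+ k) (divides q eq) = + q , trans (cong +_ (trans eq (ℕP.*-comm q n))) (ℤP.pos-* n q)
      ∣∣-quotient {n} -[1+ k ] (divides q eq) = ℤ.- + q ,
        trans (cong (λ t → ℤ.- + t) (trans eq (ℕP.*-comm q n))) (trans (cong ℤ.-_ (ℤP.pos-* n q)) (ℤP.neg-distribʳ-* (+ n) (+ q)))

    private
      quotient-form : ∀ {c} m z w .{{_ : NonZero m}} → ℚK.ν m ℚ.* c ≡ ℚK.ι z → z ≡ + (p ℕ.^ e) ℤ.* w →
        c ≡ ℕ→ℚ (p ℕ.^ e) ℚ.* (w ℚ./ m)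
      quotient-form m z w eq zw =
        trans (clear-denominator {m} {p ℕ.^ e} {w} (unitFraction m) (trans eq (cong ℚK.ι zw)))
          (cong₂ ℚ._*_ (sym (ℕ→ℚ≡ν (p ℕ.^ e))) (sym (fraction w m)))

      nonZero : ∀ {m} → p ∤ m → NonZero m
      nonZero {zero} u = ⊥-elim (u (divides 0 refl))
      nonZero {suc m} u = _

    -- A witness m (a - b) = z with residue 0 has p^e dividing z; writing z = p^e w, the required
    -- p-integral factor is w/m.
    congMod-0 : ∀ {a b} → (a ℚ.- b) ↦ B.0# → CongMod p e a b
    congMod-0 {a} {b} (red m z u e₁ e₂) = go (∣∣-quotient z (B.ι-ker z (trans (sym e₂) (B.zeroʳ _))))
      where
      instance
        m≢0 : NonZero m
        m≢0 = nonZero u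
      go : (∃ λ w → z ≡ + (p ℕ.^ e) ℤ.* w) → CongMod p e a b
      go (w , zw) = (w ℚ./ m) , pIntegral-/ w m u , quotient-form m z w e₁ zw

-- Units in ℤ/p^(e+1)

module Local where

  open RingKit
  open ZMod
  open import Data.Nat as ℕ using (ℕ; zero; suc; _<_)
  import Data.Nat.Properties as ℕP
  open import Data.Nat.Divisibility as ℕD using (_∣_; _∤_; divides; _∣?_)
  open import Data.Nat.Primality using (Prime; prime⇒irreducible; prime⇒nonTrivial)
  open import Data.Nat.Coprimality using (Coprime; coprime-divisor)
  open import Data.Product using (_,_; ∃; proj₁; proj₂)
  open import Data.Sum using (inj₁; inj₂)
  open import Data.Empty using (⊥-elim)
  open import Relation.Nullary using (yes; no)
  open import Relation.Binary.PropositionalEquality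

  ∤-coprime-^ : ∀ {p k} → Prime p → p ∤ k → ∀ e → Coprime k (p ℕ.^ e)
  ∤-coprime-^ pr u zero (d∣k , d∣1) = ℕD.∣1⇒≡1 d∣1
  ∤-coprime-^ {p} {k} pr u (suc e) {d} (d∣k , d∣q) = ∤-coprime-^ pr u e (d∣k , coprime-divisor d⊥p d∣q)
    where
    d⊥p : Coprime d p
    d⊥p {c} (c∣d , c∣p) with prime⇒irreducible pr c∣p
    ... | inj₁ c≡1 = c≡1
    ... | inj₂ refl = ⊥-elim (u (ℕD.∣-trans c∣d d∣k))

  module LocalRing (p : ℕ) (pr : Prime p) (e : ℕ) (Q : Quotient (p ℕ.^ suc e)) where
    open Quotient Q

    P : Carrier
    P = ν p

    P^ : P ^ suc e ≡ 0#
    P^ = trans (sym (ν-^ p (suc e))) νM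

    unit-ν : ∀ {k} → p ∤ k → ∃ λ y → ν k * y ≡ 1#
    unit-ν u = coprime-inverse (∤-coprime-^ pr u (suc e))

    -- 0 at multiples of p
    inv : ℕ → Carrier
    inv k with p ∣? k
    ... | yes _ = 0#
    ... | no u = proj₁ (unit-ν u)

    ν-inv : ∀ {k} → p ∤ k → ν k * inv k ≡ 1#
    ν-inv {k} u with p ∣? k
    ... | yes d = ⊥-elim (u d)
    ... | no u′ = proj₂ (unit-ν u′)

    1≢0 : 1# ≢ 0#
    1≢0 eq = ℕP.<⇒≱ 1<p (ℕD.∣⇒≤ (ℕD.∣-trans (ℕD.m∣m*n (p ℕ.^ e)) (ν-ker 1 eq)))
      where
      1<p : 1 < p
      1<p = ℕ.nonTrivial⇒n>1 p {{prime⇒nonTrivial pr}}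

    -- p is nilpotent, so the (e+1)-st power of `ν n * y` is 0, whereas that of 1 is not.
    nonunit : ∀ {n y} → p ∣ n → ν n * y ≢ 1#
    nonunit {n} {y} (divides q refl) eq = 1≢0 (begin
      1#                           ≡⟨ sym (1^ (suc e)) ⟩
      1# ^ suc e                   ≡⟨ cong (_^ suc e) (sym eq) ⟩
      (ν (q ℕ.* p) * y) ^ suc e    ≡⟨ cong (λ z → (z * y) ^ suc e) (ν-* q p) ⟩
      (ν q * P * y) ^ suc e        ≡⟨ cong (_^ suc e) (solve 3 (λ q p y → q :* p :* y := p :* (q :* y)) refl _ _ _) ⟩
      (P * (ν q * y)) ^ suc e      ≡⟨ ^-distrib-* P (ν q * y) (suc e) ⟩
      P ^ suc e * (ν q * y) ^ suc e ≡⟨ cong (_* (ν q * y) ^ suc e) P^ ⟩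
      0# * (ν q * y) ^ suc e       ≡⟨ zeroˡ _ ⟩
      0# ∎)
      where open ≡-Reasoning

  suc<⇒∤ : ∀ {p k} → suc k < p → p ∤ suc k
  suc<⇒∤ l d = ℕP.<⇒≱ l (ℕD.∣⇒≤ d)

-- The truncated sum, exactly and modulo powers of p

module Truncated where

  open RingKit
  open ZMod
  open Local
  open Reduction
  open WZ
  open import Data.Nat as ℕ using (ℕ; zero; suc; NonZero; _<_; _!)
  import Data.Nat.Properties as ℕP
  open import Data.Nat.Divisibility as ℕD using (_∣_; _∤_)
  open import Data.Nat.Primality using (Prime; euclidsLemma)
  open import Data.Sum using (inj₁; inj₂)
  open import Relation.Binary.PropositionalEquality

  module ∤Facts {p} (pr : Prime p) (3<p : 3 < p) where

    p∤2 : p ∤ 2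
    p∤2 d = ℕP.<⇒≱ (ℕP.<-trans (ℕP.n<1+n 2) 3<p) (ℕD.∣⇒≤ d)

    p∤3 : p ∤ 3
    p∤3 d = ℕP.<⇒≱ 3<p (ℕD.∣⇒≤ d)

    ∤* : ∀ {a b} → p ∤ a → p ∤ b → p ∤ (a ℕ.* b)
    ∤* {a} {b} na nb d with euclidsLemma a b pr d
    ... | inj₁ q = na q
    ... | inj₂ q = nb q

    p∤6 : p ∤ 6
    p∤6 = ∤* p∤2 p∤3

    p∤12 : p ∤ 12
    p∤12 = ∤* p∤2 p∤6

    p∤! : ∀ {k} → k < p → p ∤ (k !)
    p∤! {zero} l d = ℕP.<⇒≱ (ℕP.≤-trans (ℕ.s≤s (ℕ.s≤s ℕ.z≤n)) 3<p) (ℕD.∣⇒≤ d)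
    p∤! {suc k} l = ∤* (suc<⇒∤ l) (p∤! (ℕP.<-trans (ℕP.n<1+n k) l))

  module Shift (p a n : ℕ) (an : a ℕ.* p ≡ suc (12 ℕ.* n))
    (K : Ring≡) (A : Ring≡.Carrier K) (A12 : Ring≡._*_ K A (Kit.ν K 12) ≡ Ring≡.1# K) where
    open Kit K

    u′ : Carrier
    u′ = - (ν a * ν p * A)

    apA : ν a * ν p * A ≡ A + ν n
    apA = begin
      ν a * ν p * A             ≡⟨ cong (_* A) (sym (ν-* a p)) ⟩
      ν (a ℕ.* p) * A           ≡⟨ cong (λ z → ν z * A) an ⟩
      ν (suc (12 ℕ.* n)) * A    ≡⟨ cong (_* A) (trans (ν-suc (12 ℕ.* n)) (cong (λ z → 1# + z) (ν-* 12 n))) ⟩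
      (1# + ν 12 * ν n) * A     ≡⟨ solve 3 (λ t n A → (:c 1 :+ t :* n) :* A := A :+ n :* (A :* t)) refl (ν 12) (ν n) A ⟩
      A + ν n * (A * ν 12)      ≡⟨ cong (λ z → A + ν n * z) A12 ⟩
      A + ν n * 1#              ≡⟨ cong (λ z → A + z) (*-identityʳ _) ⟩
      A + ν n ∎
      where open ≡-Reasoning

    ν-n : ν n ≡ - (A + u′)
    ν-n = trans (solve 2 (λ A n → n := :- (A :+ (:- (A :+ n)))) refl A (ν n)) (cong (λ z → - (A + - z)) (sym apA))

  -- The summation needs inverses of k + 1, d(k + 1) and A + k + 1 for all k, multiples of p
  -- included; hence a ring in which every positive integer is invertible.
  module ClosedForm (p : ℕ) (pr : Prime p) (3<p : 3 < p)
    (K : Ring≡)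
    (recip : ∀ k .{{_ : NonZero k}} → Ring≡.Carrier K)
    (recip-inv : ∀ k .{{_ : NonZero k}} → Ring≡._*_ K (recip k) (Kit.ν K k) ≡ Ring≡.1# K)
    (a n : ℕ) {{a≢0 : NonZero a}} (an : a ℕ.* p ≡ suc (12 ℕ.* n))
    where
    open Kit K
    open ∤Facts pr 3<p

    A u : Carrier
    A = recip 12
    u = - (ν a * ν p * A)

    -- Sum and product of A + ωu and A + ω²u, ω a primitive cube root of unity. Hence (x + A + u)
    -- b(x) = (x + A)³ + u³ and (x - u) d(x) = x³ - u³.
    s q : Carrier
    s = ν 2 * A - u
    q = A * A - u * A + u * u

    A12 : A * ν 12 ≡ 1#
    A12 = recip-inv 12

    open Shift p a n an K A A12 using (ν-n)

    d : Carrier → Carrier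
    d x = (A + x) * (A + x) - (A + x) * s + q

    d-quadratic : ∀ x → d x ≡ x * x + u * x + u * u
    d-quadratic x = solve 3 (λ A x u → (A :+ x) :* (A :+ x) :- (A :+ x) :* (:c 2 :* A :- u) :+ (A :* A :- u :* A :+ u :* u)
      := x :* x :+ u :* x :+ u :* u) refl A x u

    -- 144 d(k+1) = x² - x y + y² with x = 12(k+1) and y = a p
    d144 : ℕ → ℕ
    d144 k = ℕ.∣ x - y ∣ ℕ.* ℕ.∣ x - y ∣ ℕ.+ x ℕ.* y
      where
      x = 12 ℕ.* suc k
      y = a ℕ.* p

    private
      d144≢0 : ∀ k → NonZero (d144 k)
      d144≢0 k = ℕ.>-nonZero (ℕP.≤-trans (ℕ.>-nonZero⁻¹ (12 ℕ.* suc k ℕ.* (a ℕ.* p))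
        {{ℕP.m*n≢0 (12 ℕ.* suc k) (a ℕ.* p) {{_}} {{subst NonZero (sym an) _}}}})
        (ℕP.m≤n+m (12 ℕ.* suc k ℕ.* (a ℕ.* p)) (ℕ.∣ 12 ℕ.* suc k - a ℕ.* p ∣ ℕ.* ℕ.∣ 12 ℕ.* suc k - a ℕ.* p ∣)))

      ν-∸ : ∀ {m n} → m ℕ.≤ n → ν (n ℕ.∸ m) ≡ ν n - ν m
      ν-∸ {m} {n} l = trans (solve 2 (λ x m → x := (x :+ m) :- m) refl (ν (n ℕ.∸ m)) (ν m))
        (cong (_- ν m) (trans (sym (ν-+ (n ℕ.∸ m) m)) (cong ν (ℕP.m∸n+n≡m l))))

      ν-dist² : ∀ x y → ν ℕ.∣ x - y ∣ * ν ℕ.∣ x - y ∣ ≡ (ν x - ν y) * (ν x - ν y)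
      ν-dist² x y with ℕP.≤-total x y
      ... | inj₁ l = trans (cong (λ z → z * z) (trans (cong ν (ℕP.m≤n⇒∣m-n∣≡n∸m l)) (ν-∸ l)))
        (solve 2 (λ x y → (y :- x) :* (y :- x) := (x :- y) :* (x :- y)) refl (ν x) (ν y))
      ... | inj₂ l = cong (λ z → z * z) (trans (cong ν (ℕP.m≤n⇒∣n-m∣≡n∸m l)) (ν-∸ l))

      d144-eq : ∀ k → ν 144 * d (ν (suc k)) ≡ ν (d144 k)
      d144-eq k = sym (begin
        ν (d144 k)
          ≡⟨ ν-+ (ℕ.∣ x - y ∣ ℕ.* ℕ.∣ x - y ∣) (x ℕ.* y) ⟩
        ν (ℕ.∣ x - y ∣ ℕ.* ℕ.∣ x - y ∣) + ν (x ℕ.* y)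
          ≡⟨ cong₂ _+_ (trans (ν-* ℕ.∣ x - y ∣ ℕ.∣ x - y ∣) (ν-dist² x y)) (ν-* x y) ⟩
        (ν x - ν y) * (ν x - ν y) + ν x * ν y
          ≡⟨ cong₂ (λ z w → (z - w) * (z - w) + z * w) (ν-* 12 (suc k)) (ν-* a p) ⟩
        (ν 12 * X - Y) * (ν 12 * X - Y) + ν 12 * X * Y
          ≡⟨ solve 3 (λ t X Y → (t :* X :- Y) :* (t :* X :- Y) :+ t :* X :* Y
               := t :* t :* (X :* X) :- t :* X :* Y :* :c 1 :+ :c 1 :* :c 1 :* (Y :* Y)) refl (ν 12) X Y ⟩
        ν 12 * ν 12 * (X * X) - ν 12 * X * Y * 1# + 1# * 1# * (Y * Y)
          ≡⟨ cong (λ z → ν 12 * ν 12 * (X * X) - ν 12 * X * Y * z + z * z * (Y * Y)) (sym A12) ⟩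
        ν 12 * ν 12 * (X * X) - ν 12 * X * Y * (A * ν 12) + A * ν 12 * (A * ν 12) * (Y * Y)
          ≡⟨ solve 4 (λ t X Y A → t :* t :* (X :* X) :- t :* X :* Y :* (A :* t) :+ A :* t :* (A :* t) :* (Y :* Y)
               := t :* t :* (X :* X :+ (:- (Y :* A)) :* X :+ (:- (Y :* A)) :* (:- (Y :* A)))) refl (ν 12) X Y A ⟩
        ν 12 * ν 12 * (X * X + u * X + u * u)
          ≡⟨ cong₂ _*_ (sym (ν-* 12 12)) (sym (d-quadratic X)) ⟩
        ν 144 * d X ∎)
        where
        open ≡-Reasoning
        x = 12 ℕ.* suc k
        y = a ℕ.* p
        X = ν (suc k)
        Y = ν a * ν p

    recip144 : ℕ → Carrier
    recip144 k = recip (d144 k) {{d144≢0 k}}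

    recip! : ℕ → Carrier
    recip! k = recip (k !) {{k ℕP.!≢0}}

    i1 iD iE : ℕ → Carrier
    i1 k = recip (suc k)
    iD k = ν 144 * recip144 k
    iE k = ν 12 * recip (suc (12 ℕ.* suc k))

    i1-inv : ∀ k → i1 k * ν (suc k) ≡ 1#
    i1-inv k = recip-inv (suc k)

    iD-inv : ∀ k → iD k * d (ν (suc k)) ≡ 1#
    iD-inv k = trans (solve 3 (λ c r d → c :* r :* d := r :* (c :* d)) refl (ν 144) (recip144 k) (d (ν (suc k))))
      (trans (cong (recip144 k *_) (d144-eq k)) (recip-inv (d144 k) {{d144≢0 k}}))

    iE-inv : ∀ k → iE k * (A + ν (suc k)) ≡ 1#
    iE-inv k = begin
      ν 12 * r * (A + ν (suc k))             ≡⟨ solve 4 (λ t r A k → t :* r :* (A :+ k) := r :* (A :* t :+ t :* k)) refl (ν 12) r A (ν (suc k)) ⟩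
      r * (A * ν 12 + ν 12 * ν (suc k))      ≡⟨ cong₂ (λ z w → r * (z + w)) A12 (sym (ν-* 12 (suc k))) ⟩
      r * (1# + ν (12 ℕ.* suc k))            ≡⟨ cong (r *_) (sym (ν-suc (12 ℕ.* suc k))) ⟩
      r * ν (suc (12 ℕ.* suc k))             ≡⟨ recip-inv (suc (12 ℕ.* suc k)) ⟩
      1# ∎
      where
      open ≡-Reasoning
      r = recip (suc (12 ℕ.* suc k))

    module WP = WellPoised.Summation K A s q i1 iD iE d (λ _ → refl) i1-inv iD-inv iE-inv

    n<p⇒Σ : n < p → Σ< p (λ k → ν 12 * WP.F n k) ≡ ν 12 * WP.closed n
    n<p⇒Σ l = trans (Σ-*ˡ p (ν 12) (WP.F n)) (cong (ν 12 *_) (WP.summation p n l))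

    ratio : ℕ → Carrier
    ratio j = (A + ν j) * WP.b (ν j) * i1 j * iD j * (ν j - ν n) * iE (n ℕ.+ j)

    F-ratio : ∀ k → ν 12 * WP.F n k ≡ ν 12 * (A + ν 2 * ν k) * Π< k ratio
    F-ratio k = trans (solve 5 (λ t h w v e → t :* (h :* w :* v :* e) := t :* h :* (w :* v :* e)) refl _ _ _ _ _)
      (cong (ν 12 * (A + ν 2 * ν k) *_)
        (trans (cong (_* WP.E n k) (sym (Π-* k _ _))) (sym (Π-* k _ _))))

    binomTerm : ℕ → Carrier
    binomTerm k = ν (24 ℕ.* k ℕ.+ 1) * (Π< k (λ j → - A - ν j) * recip! k) ^ 4

    -- The sum divided by p. The first product of `closed n` ends with A + n = a p A; taking p out
    -- of it leaves `pred n` factors and the front factor `ν a * A`, while the 12 cancels the A in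
    -- front of `closed n`.
    T : Carrier
    T = ν a * A * Π< (ℕ.pred n) (λ j → A + ν (suc j)) * Π< n (λ j → 1# + A - s + ν j) * Π< n iD

    module _ (1≤n : 0 < n) where

      12closed≡pT : ν 12 * WP.closed n ≡ ν p * T
      12closed≡pT = begin
        ν 12 * (A * Π< n (λ j → (A + ν (suc j)) * (1# + A - s + ν j) * iD j))
          ≡⟨ solve 3 (λ t A x → t :* (A :* x) := (A :* t) :* x) refl (ν 12) A _ ⟩
        A * ν 12 * Π< n (λ j → (A + ν (suc j)) * (1# + A - s + ν j) * iD j)
          ≡⟨ cong₂ _*_ A12 (trans (Π-* n _ iD) (cong (_* Π< n iD) (Π-* n _ _))) ⟩
        1# * (Π< n (λ j → A + ν (suc j)) * Y * Z)
          ≡⟨ cong (λ z → 1# * (z * Y * Z)) (last-factor n 1≤n refl) ⟩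
        1# * (X * (ν a * ν p * A) * Y * Z)
          ≡⟨ solve 6 (λ X a p A Y Z → :c 1 :* (X :* (a :* p :* A) :* Y :* Z) := p :* (a :* A :* X :* Y :* Z)) refl X (ν a) (ν p) A Y Z ⟩
        ν p * T ∎
        where
        open ≡-Reasoning
        X = Π< (ℕ.pred n) (λ j → A + ν (suc j))
        Y = Π< n (λ j → 1# + A - s + ν j)
        Z = Π< n iD
        last-factor : ∀ m → 0 < m → m ≡ n → Π< m (λ j → A + ν (suc j)) ≡ Π< (ℕ.pred m) (λ j → A + ν (suc j)) * (ν a * ν p * A)
        last-factor (suc m) _ refl = cong (Π< m (λ j → A + ν (suc j)) *_) (sym (Shift.apA p a n an K A A12))

    -- The denominators A + n + j + 1 occurring in `E` are j + 1 - u, units modulo p whenever j + 1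
    -- < p, although A + n itself is not a unit.
    shift-n : ∀ j → ν (suc j) - u ≡ A + ν (suc (n ℕ.+ j))
    shift-n j = sym (begin
      A + ν (suc (n ℕ.+ j))   ≡⟨ cong (λ z → A + z) (trans (cong ν (sym (ℕP.+-suc n j))) (ν-+ n (suc j))) ⟩
      A + (ν n + ν (suc j))   ≡⟨ cong (λ z → A + (z + ν (suc j))) ν-n ⟩
      A + (- (A + u) + ν (suc j)) ≡⟨ solve 3 (λ A u x → A :+ ((:- (A :+ u)) :+ x) := x :- u) refl A u (ν (suc j)) ⟩
      ν (suc j) - u ∎)
      where open ≡-Reasoning

  module Image (p : ℕ) (pr : Prime p) (3<p : 3 < p)
    (K : Ring≡)
    (recip : ∀ k .{{_ : NonZero k}} → Ring≡.Carrier K)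
    (recip-inv : ∀ k .{{_ : NonZero k}} → Ring≡._*_ K (recip k) (Kit.ν K k) ≡ Ring≡.1# K)
    (a n : ℕ) {{a≢0 : NonZero a}} (an : a ℕ.* p ≡ suc (12 ℕ.* n))
    (e : ℕ) (Q : Quotient (p ℕ.^ suc e))
    where
    open Kit K hiding (solve; _:=_; con; _:+_; _:*_; _:-_; :-_; _:^_; :c)
    open ∤Facts pr 3<p
    open ClosedForm p pr 3<p K recip recip-inv a n an
    module B = Quotient Q
    open LocalRing p pr e Q using (inv; ν-inv; nonunit; unit-ν; P)
    open Reduce p pr K B.ring
    open Inverse nonunit unit-ν

    A₂ u₂ : B.Carrier
    A₂ = inv 12
    u₂ = B.- (B.ν a B.* B.ν p B.* A₂)

    A₂12 : A₂ B.* B.ν 12 ≡ B.1#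
    A₂12 = trans (B.*-comm _ _) (ν-inv p∤12)

    A↦ : A ↦ A₂
    A↦ = red-unit 12 p∤12 A12 A₂12

    u↦ : u ↦ u₂
    u↦ = red-neg (red-* (red-* (red-ν a) (red-ν p)) A↦)

    j1 : ℕ → B.Carrier
    j1 k = inv (suc k)

    j1-inv : ∀ {k} → suc k < p → B.ν (suc k) B.* j1 k ≡ B.1#
    j1-inv l = ν-inv (suc<⇒∤ l)

    i1↦ : ∀ {k} → suc k < p → i1 k ↦ j1 k
    i1↦ {k} l = red-unit (suc k) (suc<⇒∤ l) (i1-inv k) (trans (B.*-comm _ _) (j1-inv l))

    open Shift p a n an B.ring A₂ A₂12 renaming (ν-n to ν-n₂) using ()

    module Nilpotent (u³ : u₂ B.* u₂ B.* u₂ ≡ B.0#) where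

      -- From (x - u)(x² + ux + u²) = x³ - u³ = x³ at x = k + 1: each factor divided by x³ inverts
      -- the other one. `jD` inverts d(x), and `jE` inverts x - u.
      jD jE : ℕ → B.Carrier
      jD k = (B.ν (suc k) B.- u₂) B.* (j1 k B.* j1 k B.* j1 k)
      jE k = (B.ν (suc k) B.* B.ν (suc k) B.+ u₂ B.* B.ν (suc k) B.+ u₂ B.* u₂) B.* (j1 k B.* j1 k B.* j1 k)

      private
        cube : ∀ {k} → suc k < p →
          (B.ν (suc k) B.- u₂) B.* jE k ≡ B.1#
        cube {k} l = begin
          (x B.- u₂) B.* ((x B.* x B.+ u₂ B.* x B.+ u₂ B.* u₂) B.* (y B.* y B.* y))
            ≡⟨ B.drop0 u³ (B.- (y B.* y B.* y)) (B.solve 3 (λ x u y → (x B.:- u) B.:* ((x B.:* x B.:+ u B.:* x B.:+ u B.:* u) B.:* (y B.:* y B.:* y))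
                 B.:= (x B.:* y) B.:* (x B.:* y) B.:* (x B.:* y) B.:+ u B.:* u B.:* u B.:* (B.:- (y B.:* y B.:* y))) refl x u₂ y) ⟩
          (x B.* y) B.* (x B.* y) B.* (x B.* y)
            ≡⟨ cong (λ z → z B.* z B.* z) (j1-inv l) ⟩
          B.1# B.* B.1# B.* B.1#
            ≡⟨ B.solve 0 (B.:c 1 B.:* B.:c 1 B.:* B.:c 1 B.:= B.:c 1) refl ⟩
          B.1# ∎
          where
          open ≡-Reasoning
          x = B.ν (suc k)
          y = j1 k

      d↦ : ∀ x y → x ↦ y → d x ↦ y B.* y B.+ u₂ B.* y B.+ u₂ B.* u₂
      d↦ x y r = subst (_↦ (y B.* y B.+ u₂ B.* y B.+ u₂ B.* u₂)) (sym (d-quadratic x))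
        (red-+ (red-+ (red-* r r) (red-* u↦ r)) (red-* u↦ u↦))

      iD↦ : ∀ {k} → suc k < p → iD k ↦ jD k
      iD↦ {k} l = red-inverse (d↦ _ _ (red-ν (suc k))) (trans (*-comm _ _) (iD-inv k))
        (trans (B.solve 3 (λ d x y → d B.:* (x B.:* y) B.:= x B.:* (d B.:* y)) refl _ _ _) (cube l))

      iE↦ : ∀ {j} → suc j < p → iE (n ℕ.+ j) ↦ jE j
      iE↦ {j} l = red-inverse
        (subst (_↦ (B.ν (suc j) B.- u₂)) (shift-n j) (red-- (red-ν (suc j)) u↦))
        (trans (*-comm _ _) (iE-inv (n ℕ.+ j))) (cube l)

      ratio₂ : ℕ → B.Carrier
      ratio₂ j = ((A₂ B.+ B.ν j) B.* j1 j) B.^ 4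

      -- As x - n = x + A + u, the numerator (A + x) b(x) (x - n) is (A + x)((A + x)³ + u³), and u³
      -- = 0 leaves a fourth power. The denominators collapse likewise to (j + 1)⁴.
      ratio↦ : ∀ {j} → suc j < p → ratio j ↦ ratio₂ j
      ratio↦ {j} l = subst (ratio j ↦_) eq
        (red-* (red-* (red-* (red-* (red-* (red-+ A↦ (red-ν j)) b↦) (i1↦ l)) (iD↦ l)) (red-- (red-ν j) (red-ν n))) (iE↦ l))
        where
        s₂ q₂ : B.Carrier
        s₂ = B.ν 2 B.* A₂ B.- u₂
        q₂ = A₂ B.* A₂ B.- u₂ B.* A₂ B.+ u₂ B.* u₂
        b↦ : WP.b (ν j) ↦ B.ν j B.* B.ν j B.+ B.ν j B.* s₂ B.+ q₂
        b↦ = red-+ (red-+ (red-* (red-ν j) (red-ν j)) (red-* (red-ν j) (red-- (red-* (red-ν 2) A↦) u↦)))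
          (red-+ (red-- (red-* A↦ A↦) (red-* u↦ A↦)) (red-* u↦ u↦))
        open ≡-Reasoning
        open B using (_:*_; _:+_; _:-_; :-_; _:=_; :c; _:^_)
        x = B.ν j
        y = j1 j
        z = B.ν (suc j)
        eq : (A₂ B.+ x) B.* (x B.* x B.+ x B.* s₂ B.+ q₂) B.* y B.* jD j B.* (x B.- B.ν n) B.* jE j
          ≡ ((A₂ B.+ x) B.* y) B.^ 4
        eq = begin
          (A₂ B.+ x) B.* (x B.* x B.+ x B.* s₂ B.+ q₂) B.* y B.* jD j B.* (x B.- B.ν n) B.* jE j
            ≡⟨ cong (λ w → (A₂ B.+ x) B.* (x B.* x B.+ x B.* s₂ B.+ q₂) B.* y B.* jD j B.* (x B.- w) B.* jE j) ν-n₂ ⟩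
          (A₂ B.+ x) B.* (x B.* x B.+ x B.* s₂ B.+ q₂) B.* y B.* ((z B.- u₂) B.* (y B.* y B.* y)) B.* (x B.- (B.- (A₂ B.+ u₂))) B.* jE j
            ≡⟨ B.solve 6 (λ A x u y z E → (A :+ x) :* (x :* x :+ x :* (:c 2 :* A :- u) :+ (A :* A :- u :* A :+ u :* u)) :* y :* ((z :- u) :* (y :* y :* y)) :* (x :- (:- (A :+ u))) :* E
                 := (A :+ x) :* ((A :+ x) :* (A :+ x) :* (A :+ x) :+ u :* u :* u) :* (y :* y :* y :* y) :* ((z :- u) :* E)) refl A₂ x u₂ y z (jE j) ⟩
          (A₂ B.+ x) B.* ((A₂ B.+ x) B.* (A₂ B.+ x) B.* (A₂ B.+ x) B.+ u₂ B.* u₂ B.* u₂) B.* (y B.* y B.* y B.* y) B.* ((z B.- u₂) B.* jE j)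
            ≡⟨ cong₂ (λ w v → (A₂ B.+ x) B.* ((A₂ B.+ x) B.* (A₂ B.+ x) B.* (A₂ B.+ x) B.+ w) B.* (y B.* y B.* y B.* y) B.* v) u³ (cube l) ⟩
          (A₂ B.+ x) B.* ((A₂ B.+ x) B.* (A₂ B.+ x) B.* (A₂ B.+ x) B.+ B.0#) B.* (y B.* y B.* y B.* y) B.* B.1#
            ≡⟨ B.solve 2 (λ t y → t :* (t :* t :* t :+ :c 0) :* (y :* y :* y :* y) :* :c 1 := (t :* y) :^ 4) refl (A₂ B.+ x) y ⟩
          ((A₂ B.+ x) B.* y) B.^ 4 ∎

      -- The common residue through which the exactly summed series and the original binomial sum
      -- are compared; the two need not agree as rational numbers.
      S₂ : B.Carrier
      S₂ = B.Σ< p (λ k → B.ν (24 ℕ.* k ℕ.+ 1) B.* B.Π< k ratio₂)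

      below : ∀ {i k} → i < k → k < p → suc i < p
      below i<k k<p = ℕP.≤-<-trans i<k k<p

      closed↦ : n < p → ν 12 * WP.closed n ↦ S₂
      closed↦ l = subst (_↦ S₂) (n<p⇒Σ l) (red-Σ p λ k k<p →
        subst₂ _↦_ (sym (F-ratio k)) (cong (B._* B.Π< k ratio₂) (coef k))
          (red-* (red-* (red-ν 12) (red-+ A↦ (red-* (red-ν 2) (red-ν k)))) (red-Π k (λ i i<k → ratio↦ (below i<k k<p)))))
        where
        open B using (_:*_; _:+_; _:-_; :-_; _:=_; :c; _:^_)
        coef : ∀ k → B.ν 12 B.* (A₂ B.+ B.ν 2 B.* B.ν k) ≡ B.ν (24 ℕ.* k ℕ.+ 1)
        coef k = begin
          B.ν 12 B.* (A₂ B.+ B.ν 2 B.* B.ν k) ≡⟨ B.solve 3 (λ t A k → t :* (A :+ :c 2 :* k) := (:c 2 :* t) :* k :+ A :* t) refl (B.ν 12) A₂ (B.ν k) ⟩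
          (B.ν 2 B.* B.ν 12) B.* B.ν k B.+ A₂ B.* B.ν 12 ≡⟨ cong₂ (λ v w → v B.* B.ν k B.+ w) (sym (B.ν-* 2 12)) A₂12 ⟩
          B.ν 24 B.* B.ν k B.+ B.1# ≡⟨ cong (B._+ B.1#) (sym (B.ν-* 24 k)) ⟩
          B.ν (24 ℕ.* k) B.+ B.1# ≡⟨ sym (B.ν-+ (24 ℕ.* k) 1) ⟩
          B.ν (24 ℕ.* k ℕ.+ 1) ∎
          where open ≡-Reasoning

      binomTerm↦ : ∀ {k} → k < p → binomTerm k ↦ B.ν (24 ℕ.* k ℕ.+ 1) B.* B.Π< k ratio₂
      binomTerm↦ {k} l = red-* (red-ν (24 ℕ.* k ℕ.+ 1)) (subst ((Π< k (λ j → - A - ν j) * recip! k) ^ 4 ↦_) eq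
        (red-^ 4 (red-* (red-Π k (λ j _ → red-- (red-neg A↦) (red-ν j)))
          (red-unit (k !) (p∤! l) (recip-inv (k !) {{k ℕP.!≢0}}) (fact-inv k l)))))
        where
        open B using (_:*_; _:+_; _:-_; :-_; _:=_; :c; _:^_)
        open ≡-Reasoning
        fact-inv : ∀ k → k < p → B.Π< k j1 B.* B.ν (k !) ≡ B.1#
        fact-inv zero l = B.*-identityˡ _
        fact-inv (suc k) l = begin
          B.Π< k j1 B.* j1 k B.* B.ν (suc k ℕ.* k !) ≡⟨ cong (B.Π< k j1 B.* j1 k B.*_) (B.ν-* (suc k) (k !)) ⟩
          B.Π< k j1 B.* j1 k B.* (B.ν (suc k) B.* B.ν (k !)) ≡⟨ B.solve 4 (λ a b c d → a :* b :* (c :* d) := (a :* d) :* (c :* b)) refl _ _ _ _ ⟩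
          (B.Π< k j1 B.* B.ν (k !)) B.* (B.ν (suc k) B.* j1 k) ≡⟨ cong₂ B._*_ (fact-inv k (ℕP.<-trans (ℕP.n<1+n k) l)) (j1-inv l) ⟩
          B.1# B.* B.1# ≡⟨ B.*-identityˡ _ ⟩
          B.1# ∎
        Π4 : ∀ k g → B.Π< k (λ j → g j B.^ 4) ≡ B.Π< k g B.^ 4
        Π4 zero g = sym (B.1^ 4)
        Π4 (suc k) g = trans (cong (B._* g k B.^ 4) (Π4 k g)) (sym (B.^-distrib-* (B.Π< k g) (g k) 4))
        eq : (B.Π< k (λ j → B.- A₂ B.- B.ν j) B.* B.Π< k j1) B.^ 4 ≡ B.Π< k ratio₂
        eq = begin
          (B.Π< k (λ j → B.- A₂ B.- B.ν j) B.* B.Π< k j1) B.^ 4 ≡⟨ cong (B._^ 4) (sym (B.Π-* k _ j1)) ⟩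
          B.Π< k (λ j → (B.- A₂ B.- B.ν j) B.* j1 j) B.^ 4     ≡⟨ sym (Π4 k _) ⟩
          B.Π< k (λ j → ((B.- A₂ B.- B.ν j) B.* j1 j) B.^ 4)   ≡⟨ B.Π-cong k (λ j _ → B.solve 3 (λ A x y → ((:- A :- x) :* y) :^ 4 := ((A :+ x) :* y) :^ 4) refl A₂ (B.ν j) (j1 j)) ⟩
          B.Π< k ratio₂ ∎

      binomSum↦ : Σ< p binomTerm ↦ S₂
      binomSum↦ = red-Σ p (λ k l → binomTerm↦ l)

    fac : ℕ → B.Carrier → B.Carrier
    fac N c = B.Π< N (λ j → B.ν (suc j) B.+ P B.* c)

    module Square (u² : u₂ B.* u₂ ≡ B.0#) (l : n < p) (1≤n : 0 < n) where
      open Nilpotent (trans (cong (B._* u₂) u²) (B.zeroˡ _))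
      open B using (_:*_; _:+_; _:-_; :-_; _:=_; :c; _:^_)
      open ≡-Reasoning

      private
        m : ℕ
        m = ℕ.pred n
        sm : suc m ≡ n
        sm = ℕP.suc-pred n {{ℕ.>-nonZero 1≤n}}
        s₂ c : B.Carrier
        s₂ = B.ν 2 B.* A₂ B.- u₂
        c = B.- (B.ν 2 B.* B.ν a B.* A₂)

      T₂ : B.Carrier
      T₂ = B.ν a B.* A₂ B.* B.Π< m (λ j → A₂ B.+ B.ν (suc j)) B.* B.Π< n (λ j → B.1# B.+ A₂ B.- s₂ B.+ B.ν j) B.* B.Π< n jD

      T↦ : T ↦ T₂
      T↦ = red-* (red-* (red-* (red-* (red-ν a) A↦) (red-Π m (λ j _ → red-+ A↦ (red-ν (suc j)))))
        (red-Π n (λ j _ → red-+ (red-- (red-+ (red-ν 1) A↦) (red-- (red-* (red-ν 2) A↦) u↦)) (red-ν j))))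
        (red-Π n (λ j j<n → iD↦ (below j<n l)))

      private
        -- Since A = -n - u, reading the product backwards turns A + n - (j + 1) into -(j + 1 + u).
        -- The separate factor `A₂` is the term j = 0 of the full product.
        reflected : A₂ B.* B.Π< m (λ j → A₂ B.+ B.ν (suc j)) ≡ (B.- B.1#) B.^ n B.* B.Π< n (λ j → B.ν (suc j) B.+ u₂)
        reflected = begin
          A₂ B.* B.Π< m (λ j → A₂ B.+ B.ν (suc j))
            ≡⟨ cong (B._* B.Π< m (λ j → A₂ B.+ B.ν (suc j))) (sym (B.+-identityʳ A₂)) ⟩
          (A₂ B.+ B.ν 0) B.* B.Π< m (λ j → A₂ B.+ B.ν (suc j))
            ≡⟨ sym (B.Π-first m (λ j → A₂ B.+ B.ν j)) ⟩
          B.Π< (suc m) (λ j → A₂ B.+ B.ν j)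
            ≡⟨ cong (λ k → B.Π< k (λ j → A₂ B.+ B.ν j)) sm ⟩
          B.Π< n (λ j → A₂ B.+ B.ν j)
            ≡⟨ B.Π-rev n _ ⟩
          B.Π< n (λ j → A₂ B.+ B.ν (n ℕ.∸ suc j))
            ≡⟨ B.Π-cong n (λ j j<n → flip j j<n) ⟩
          B.Π< n (λ j → (B.- B.1#) B.* (B.ν (suc j) B.+ u₂))
            ≡⟨ trans (B.Π-* n _ _) (cong (B._* B.Π< n (λ j → B.ν (suc j) B.+ u₂)) (B.Π-const n (B.- B.1#))) ⟩
          (B.- B.1#) B.^ n B.* B.Π< n (λ j → B.ν (suc j) B.+ u₂) ∎
          where
          flip : ∀ j → j < n → A₂ B.+ B.ν (n ℕ.∸ suc j) ≡ (B.- B.1#) B.* (B.ν (suc j) B.+ u₂)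
          flip j j<n = begin
            A₂ B.+ B.ν (n ℕ.∸ suc j)
              ≡⟨ B.solve 3 (λ A x y → A :+ x := A :+ ((x :+ y) :- y)) refl A₂ (B.ν (n ℕ.∸ suc j)) (B.ν (suc j)) ⟩
            A₂ B.+ (B.ν (n ℕ.∸ suc j) B.+ B.ν (suc j) B.- B.ν (suc j))
              ≡⟨ cong (λ z → A₂ B.+ (z B.- B.ν (suc j))) (trans (sym (B.ν-+ (n ℕ.∸ suc j) (suc j))) (trans (cong B.ν (ℕP.m∸n+n≡m j<n)) ν-n₂)) ⟩
            A₂ B.+ (B.- (A₂ B.+ u₂) B.- B.ν (suc j))
              ≡⟨ B.solve 3 (λ A u y → A :+ (:- (A :+ u) :- y) := :- :c 1 :* (y :+ u)) refl A₂ u₂ (B.ν (suc j)) ⟩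
            (B.- B.1#) B.* (B.ν (suc j) B.+ u₂) ∎

        -- Factorwise (x + u) · (x - u)/x³ · x = (x² - u²)/x² = 1, because u² = 0.
        cancelled : B.Π< n (λ j → B.ν (suc j) B.+ u₂) B.* B.Π< n jD B.* fac n B.0# ≡ B.1#
        cancelled = begin
          B.Π< n (λ j → B.ν (suc j) B.+ u₂) B.* B.Π< n jD B.* fac n B.0#
            ≡⟨ trans (cong (B._* fac n B.0#) (sym (B.Π-* n _ jD))) (sym (B.Π-* n _ _)) ⟩
          B.Π< n (λ j → (B.ν (suc j) B.+ u₂) B.* jD j B.* (B.ν (suc j) B.+ P B.* B.0#))
            ≡⟨ B.Π-cong n (λ j j<n → one j (below j<n l)) ⟩
          B.Π< n (λ _ → B.1#) ≡⟨ B.Π-const n B.1# ⟩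
          B.1# B.^ n ≡⟨ B.1^ n ⟩
          B.1# ∎
          where
          one : ∀ j → suc j < p → (B.ν (suc j) B.+ u₂) B.* jD j B.* (B.ν (suc j) B.+ P B.* B.0#) ≡ B.1#
          one j sj = trans (B.drop0 u² (B.- (x B.* y B.* y B.* y)) (B.solve 4 (λ x u y P → (x :+ u) :* ((x :- u) :* (y :* y :* y)) :* (x :+ P :* :c 0)
              := (x :* y) :* (x :* y) :* (x :* y) :+ u :* u :* (:- (x :* y :* y :* y))) refl x u₂ y P))
            (trans (cong (λ z → z B.* z B.* z) (j1-inv sj)) (B.solve 0 (:c 1 :* :c 1 :* :c 1 := :c 1) refl))
            where
            x = B.ν (suc j)
            y = j1 j

      -- Here 1 + A - s = n + 1 + 2u and 2u = pc, so this product is the second half of the shifted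
      -- (2n)!.
      fac-2n : B.Π< n (λ j → B.1# B.+ A₂ B.- s₂ B.+ B.ν j) B.* fac n c ≡ fac (n ℕ.+ n) c
      fac-2n = sym (trans (B.Π-split n n _) (trans (B.*-comm _ _) (cong (B._* fac n c) (B.Π-cong n (λ j _ → begin
        B.ν (suc (n ℕ.+ j)) B.+ P B.* c
          ≡⟨ cong (B._+ P B.* c) (trans (B.ν-suc (n ℕ.+ j)) (cong (λ z → B.1# B.+ z) (B.ν-+ n j))) ⟩
        B.1# B.+ (B.ν n B.+ B.ν j) B.+ P B.* c
          ≡⟨ cong (λ z → B.1# B.+ (z B.+ B.ν j) B.+ P B.* c) ν-n₂ ⟩
        B.1# B.+ (B.- (A₂ B.+ u₂) B.+ B.ν j) B.+ P B.* c
          ≡⟨ B.solve 4 (λ A a P j → :c 1 :+ (:- (A :+ (:- (a :* P :* A))) :+ j) :+ P :* (:- (:c 2 :* a :* A))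
               := :c 1 :+ A :- (:c 2 :* A :- (:- (a :* P :* A))) :+ j) refl A₂ (B.ν a) P (B.ν j) ⟩
        B.1# B.+ A₂ B.- s₂ B.+ B.ν j ∎)))))

      -- A shifted central binomial coefficient with denominators cleared: c = -a/6 shifts (2n)! and
      -- one of the n!. When 2n ≥ p, as for a = 7 and a = 11, a factor p hides in (2n)!.
      T₂-fac : T₂ B.* fac n c B.* fac n B.0# ≡ B.ν a B.* (B.- B.1#) B.^ n B.* fac (n ℕ.+ n) c
      T₂-fac = begin
        B.ν a B.* A₂ B.* X B.* Y B.* Z B.* fac n c B.* fac n B.0#
          ≡⟨ B.solve 7 (λ a A X Y Z f g → a :* A :* X :* Y :* Z :* f :* g := a :* (A :* X) :* (Z :* g) :* (Y :* f)) refl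
               (B.ν a) A₂ X Y Z (fac n c) (fac n B.0#) ⟩
        B.ν a B.* (A₂ B.* X) B.* (Z B.* fac n B.0#) B.* (Y B.* fac n c)
          ≡⟨ cong₂ (λ v w → B.ν a B.* v B.* (Z B.* fac n B.0#) B.* w) reflected fac-2n ⟩
        B.ν a B.* ((B.- B.1#) B.^ n B.* U) B.* (Z B.* fac n B.0#) B.* fac (n ℕ.+ n) c
          ≡⟨ B.solve 6 (λ a e U Z g f → a :* (e :* U) :* (Z :* g) :* f := a :* e :* (U :* Z :* g) :* f) refl
               (B.ν a) ((B.- B.1#) B.^ n) U Z (fac n B.0#) (fac (n ℕ.+ n) c) ⟩
        B.ν a B.* (B.- B.1#) B.^ n B.* (U B.* Z B.* fac n B.0#) B.* fac (n ℕ.+ n) c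
          ≡⟨ cong (λ z → B.ν a B.* (B.- B.1#) B.^ n B.* z B.* fac (n ℕ.+ n) c) cancelled ⟩
        B.ν a B.* (B.- B.1#) B.^ n B.* B.1# B.* fac (n ℕ.+ n) c
          ≡⟨ cong (B._* fac (n ℕ.+ n) c) (B.*-identityʳ _) ⟩
        B.ν a B.* (B.- B.1#) B.^ n B.* fac (n ℕ.+ n) c ∎
        where
        X = B.Π< m (λ j → A₂ B.+ B.ν (suc j))
        Y = B.Π< n (λ j → B.1# B.+ A₂ B.- s₂ B.+ B.ν j)
        Z = B.Π< n jD
        U = B.Π< n (λ j → B.ν (suc j) B.+ u₂)

-- Shifted factorials modulo p²

module Factorials where

  open RingKit
  open ZMod
  open Local
  open import Data.Nat as ℕ using (ℕ; zero; suc; _<_)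
  import Data.Nat.Properties as ℕP
  import Data.Nat.Solver as ℕS
  open import Data.Nat.Primality using (Prime)
  open import Data.Product using (_,_; ∃; _×_)
  open import Relation.Binary.PropositionalEquality

  module ShiftedFactorials (p : ℕ) (pr : Prime p) (Q : Quotient (p ℕ.^ 2)) where
    open Quotient Q
    open LocalRing p pr 1 Q

    P² : P * P ≡ 0#
    P² = trans (cong (P *_) (sym (*-identityʳ P))) P^

    fac : ℕ → Carrier → Carrier
    fac N c = Π< N (λ j → ν (suc j) + P * c)

    range : ℕ → ℕ → Carrier → Carrier
    range b N c = Π< N (λ j → ν (suc (b ℕ.+ j)) + P * c)

    fac-range : ∀ b N c → fac (b ℕ.+ N) c ≡ fac b c * range b N c
    fac-range b N c = Π-split b N _

    H : ℕ → Carrier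
    H N = Σ< N (λ j → inv (suc j))

    -- Since p² = 0, a change c′ of the shift acts to first order only, through the logarithmic
    -- derivative p H N taken at c = 0; the dependence of that derivative on c is itself killed by
    -- p².
    fac-shift : ∀ N c c′ → N < p → fac N (c + c′) ≡ fac N c * (1# + P * c′ * H N)
    fac-shift zero c c′ _ = solve 1 (λ x → :c 1 := :c 1 :* (:c 1 :+ x :* :c 0)) refl (P * c′)
    fac-shift (suc N) c c′ l = begin
      fac N (c + c′) * (x + P * (c + c′))
        ≡⟨ cong (_* (x + P * (c + c′))) (fac-shift N c c′ (ℕP.<-trans (ℕP.n<1+n N) l)) ⟩
      fac N c * (1# + P * c′ * h) * (x + P * (c + c′))
        ≡⟨ solve 6 (λ F P c d h x → F :* (:c 1 :+ P :* d :* h) :* (x :+ P :* (c :+ d))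
             := F :* (:c 1 :+ P :* d :* h) :* (x :+ P :* c :+ P :* d :* :c 1)) refl (fac N c) P c c′ h x ⟩
      fac N c * (1# + P * c′ * h) * (x + P * c + P * c′ * 1#)
        ≡⟨ cong (λ z → fac N c * (1# + P * c′ * h) * (x + P * c + P * c′ * z)) (sym (ν-inv (suc<⇒∤ l))) ⟩
      fac N c * (1# + P * c′ * h) * (x + P * c + P * c′ * (x * y))
        ≡⟨ drop0 P² (fac N c * (c′ * h * c′ * (x * y) - c * (c′ * y)))
           (solve 7 (λ F P c d h x y → F :* (:c 1 :+ P :* d :* h) :* (x :+ P :* c :+ P :* d :* (x :* y))
             := F :* (x :+ P :* c) :* (:c 1 :+ P :* d :* (h :+ y)) :+ P :* P :* (F :* (d :* h :* d :* (x :* y) :- c :* (d :* y)))) refl (fac N c) P c c′ h x y) ⟩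
      fac N c * (x + P * c) * (1# + P * c′ * (h + y)) ∎
      where
      open ≡-Reasoning
      x = ν (suc N)
      y = inv (suc N)
      h = H N

    P-fac : ∀ N c → P * fac N c ≡ P * fac N 0#
    P-fac zero c = refl
    P-fac (suc N) c = begin
      P * (fac N c * (x + P * c))  ≡⟨ drop0 P² (fac N c * c) (solve 4 (λ P F x c → P :* (F :* (x :+ P :* c)) := P :* F :* x :+ P :* P :* (F :* c)) refl P (fac N c) x c) ⟩
      P * fac N c * x              ≡⟨ cong (_* x) (P-fac N c) ⟩
      P * fac N 0# * x             ≡⟨ solve 3 (λ P F x → P :* F :* x := P :* (F :* (x :+ P :* :c 0))) refl P (fac N 0#) x ⟩
      P * (fac N 0# * (x + P * 0#)) ∎
      where
      open ≡-Reasoning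
      x = ν (suc N)

    fac-unit : ∀ N c → N < p → ∃ λ y → fac N c * y ≡ 1#
    fac-unit zero c _ = 1# , *-identityˡ _
    fac-unit (suc N) c l with fac-unit N c (ℕP.<-trans (ℕP.n<1+n N) l)
    ... | y , eq = y * (i * (1# - P * c * i)) , (begin
      fac N c * (x + P * c) * (y * (i * (1# - P * c * i)))
        ≡⟨ drop0 P² (- (fac N c * y * c * c * i * i)) (solve 6 (λ F x P c y i → F :* (x :+ P :* c) :* (y :* (i :* (:c 1 :- P :* c :* i)))
             := (F :* y) :* (x :* i :+ P :* c :* i :* (:c 1 :- x :* i)) :+ P :* P :* (:- (F :* y :* c :* c :* i :* i))) refl (fac N c) x P c y i) ⟩
      fac N c * y * (x * i + P * c * i * (1# - x * i))
        ≡⟨ cong₂ (λ z w → z * (w + P * c * i * (1# - w))) eq (ν-inv (suc<⇒∤ l)) ⟩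
      1# * (1# + P * c * i * (1# - 1#))
        ≡⟨ solve 3 (λ P c i → :c 1 :* (:c 1 :+ P :* c :* i :* (:c 1 :- :c 1)) := :c 1) refl P c i ⟩
      1# ∎)
      where
      open ≡-Reasoning
      x = ν (suc N)
      i = inv (suc N)

    private
      Π2 : ∀ N g → Π< (2 ℕ.* N) g ≡ Π< N (λ i → g (suc (2 ℕ.* i))) * Π< N (λ i → g (2 ℕ.* i))
      Π2 zero g = sym (*-identityˡ _)
      Π2 (suc N) g = trans (cong (λ k → Π< k g) (ℕP.*-suc 2 N)) (trans (cong (λ z → z * g (2 ℕ.* N) * g (suc (2 ℕ.* N))) (Π2 N g))
        (solve 4 (λ a b c d → a :* b :* c :* d := (a :* d) :* (b :* c)) refl _ _ _ _))

      Π3 : ∀ N g → Π< (3 ℕ.* N) g ≡ Π< N (λ i → g (suc (suc (3 ℕ.* i)))) * Π< N (λ i → g (3 ℕ.* i)) * Π< N (λ i → g (suc (3 ℕ.* i)))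
      Π3 zero g = solve 0 (:c 1 := :c 1 :* :c 1 :* :c 1) refl
      Π3 (suc N) g = trans (cong (λ k → Π< k g) (ℕP.*-suc 3 N)) (trans (cong (λ z → z * g (3 ℕ.* N) * g (suc (3 ℕ.* N)) * g (suc (suc (3 ℕ.* N)))) (Π3 N g))
        (solve 6 (λ a b c d e f → a :* b :* c :* d :* e :* f := (a :* f) :* (b :* d) :* (c :* e)) refl _ _ _ _ _ _))

      scaled : ∀ N e (g h : ℕ → Carrier) → (∀ i → i < N → g i ≡ e * h i) → Π< N g ≡ e ^ N * Π< N h
      scaled N e g h eq = trans (Π-cong N eq) (trans (Π-* N (λ _ → e) h) (cong (_* Π< N h) (Π-const N e)))

      ν-diff : ∀ i k → i ℕ.+ k ≡ p → ν i ≡ P - ν k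
      ν-diff i k eq = trans (solve 2 (λ i k → i := (i :+ k) :- k) refl (ν i) (ν k))
        (cong (_- ν k) (trans (sym (ν-+ i k)) (cong ν eq)))

    module Halves (h : Carrier) (2h : ν 2 * h ≡ 1#) where

      -- Legendre duplication. An even factor 2i with shift 2c is 2(i + pc). An odd one is p minus
      -- an even number 2k; with p = 2hp it becomes -2(k - p(h + c)), and these k fill the range
      -- from b + 1 to b + N = (p - 1)/2.
      doubling : ∀ N b c → p ≡ suc (2 ℕ.* (b ℕ.+ N)) →
        fac (2 ℕ.* N) (ν 2 * c) * fac b (- (h + c)) ≡ ν 2 ^ N * (- ν 2) ^ N * (fac N c * fac (b ℕ.+ N) (- (h + c)))
      doubling N b c p≡ = begin
        fac (2 ℕ.* N) (ν 2 * c) * fac b c″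
          ≡⟨ cong (_* fac b c″) (trans (Π2 N _) (cong₂ _*_ evens odds)) ⟩
        ν 2 ^ N * fac N c * ((- ν 2) ^ N * range b N c″) * fac b c″
          ≡⟨ solve 5 (λ a F b r g → a :* F :* (b :* r) :* g := a :* b :* (F :* (g :* r))) refl _ _ _ _ _ ⟩
        ν 2 ^ N * (- ν 2) ^ N * (fac N c * (fac b c″ * range b N c″))
          ≡⟨ cong (λ z → ν 2 ^ N * (- ν 2) ^ N * (fac N c * z)) (sym (fac-range b N c″)) ⟩
        ν 2 ^ N * (- ν 2) ^ N * (fac N c * fac (b ℕ.+ N) c″) ∎
        where
        open ≡-Reasoning
        c″ = - (h + c)
        evens : Π< N (λ i → ν (suc (suc (2 ℕ.* i))) + P * (ν 2 * c)) ≡ ν 2 ^ N * fac N c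
        evens = scaled N (ν 2) _ _ (λ i _ → trans
          (cong (_+ P * (ν 2 * c)) (trans (cong ν (sym (ℕP.*-suc 2 i))) (ν-* 2 (suc i))))
          (solve 3 (λ x P c → :c 2 :* x :+ P :* (:c 2 :* c) := :c 2 :* (x :+ P :* c)) refl (ν (suc i)) P c))
        odds : Π< N (λ i → ν (suc (2 ℕ.* i)) + P * (ν 2 * c)) ≡ (- ν 2) ^ N * range b N c″
        odds = trans (Π-rev N _) (scaled N (- ν 2) _ _ (λ i l → begin
          ν (suc (2 ℕ.* (N ℕ.∸ suc i))) + P * (ν 2 * c)
            ≡⟨ cong (_+ P * (ν 2 * c)) (ν-diff (suc (2 ℕ.* (N ℕ.∸ suc i))) (2 ℕ.* suc (b ℕ.+ i)) (index i l)) ⟩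
          P - ν (2 ℕ.* suc (b ℕ.+ i)) + P * (ν 2 * c)
            ≡⟨ cong (λ z → P - z + P * (ν 2 * c)) (ν-* 2 (suc (b ℕ.+ i))) ⟩
          P - ν 2 * ν (suc (b ℕ.+ i)) + P * (ν 2 * c)
            ≡⟨ solve 4 (λ P t x c → P :- t :* x :+ P :* (t :* c) := P :* :c 1 :- t :* x :+ P :* (t :* c)) refl P (ν 2) _ c ⟩
          P * 1# - ν 2 * ν (suc (b ℕ.+ i)) + P * (ν 2 * c)
            ≡⟨ cong (λ z → P * z - ν 2 * ν (suc (b ℕ.+ i)) + P * (ν 2 * c)) (sym 2h) ⟩
          P * (ν 2 * h) - ν 2 * ν (suc (b ℕ.+ i)) + P * (ν 2 * c)
            ≡⟨ solve 5 (λ P t h x c → P :* (t :* h) :- t :* x :+ P :* (t :* c) := :- t :* (x :+ P :* (:- (h :+ c)))) refl P (ν 2) h _ c ⟩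
          - ν 2 * (ν (suc (b ℕ.+ i)) + P * c″) ∎))
          where
          index : ∀ i → i < N → suc (2 ℕ.* (N ℕ.∸ suc i)) ℕ.+ 2 ℕ.* suc (b ℕ.+ i) ≡ p
          index i l = trans (solveℕ 3 (λ k b i → (conℕ 1 :+ℕ conℕ 2 :*ℕ k) :+ℕ conℕ 2 :*ℕ (conℕ 1 :+ℕ (b :+ℕ i))
              :=ℕ conℕ 1 :+ℕ conℕ 2 :*ℕ (b :+ℕ (k :+ℕ (conℕ 1 :+ℕ i)))) refl (N ℕ.∸ suc i) b i)
            (trans (cong (λ z → suc (2 ℕ.* (b ℕ.+ z))) (ℕP.m∸n+n≡m l)) (sym p≡))
            where open ℕS.+-*-Solver renaming (solve to solveℕ; _:+_ to _:+ℕ_; _:*_ to _:*ℕ_; con to conℕ; _:=_ to _:=ℕ_)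

    module Thirds (h : Carrier) (3h : ν 3 * h ≡ 1#) where

      private
        c₁ c₂ : Carrier → Carrier
        c₁ c = - (h + c)
        c₂ c = c - h

        multiples : ∀ N c → Π< N (λ i → ν (suc (suc (suc (3 ℕ.* i)))) + P * (ν 3 * c)) ≡ ν 3 ^ N * fac N c
        multiples N c = scaled N (ν 3) _ _ (λ i _ → trans
          (cong (_+ P * (ν 3 * c)) (trans (cong ν (sym (ℕP.*-suc 3 i))) (ν-* 3 (suc i))))
          (solve 3 (λ x P c → :c 3 :* x :+ P :* (:c 3 :* c) := :c 3 :* (x :+ P :* c)) refl (ν (suc i)) P c))

        below : ∀ i k c → i ℕ.+ 3 ℕ.* k ≡ p → ν i + P * (ν 3 * c) ≡ - ν 3 * (ν k + P * c₁ c)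
        below i k c eq = begin
          ν i + P * (ν 3 * c)                    ≡⟨ cong (_+ P * (ν 3 * c)) (ν-diff i (3 ℕ.* k) eq) ⟩
          P - ν (3 ℕ.* k) + P * (ν 3 * c)        ≡⟨ cong (λ z → P - z + P * (ν 3 * c)) (ν-* 3 k) ⟩
          P - ν 3 * ν k + P * (ν 3 * c)          ≡⟨ cong (λ z → z - ν 3 * ν k + P * (ν 3 * c)) (trans (sym (*-identityʳ P)) (cong (P *_) (sym 3h))) ⟩
          P * (ν 3 * h) - ν 3 * ν k + P * (ν 3 * c) ≡⟨ solve 5 (λ P t h x c → P :* (t :* h) :- t :* x :+ P :* (t :* c) := :- t :* (x :+ P :* (:- (h :+ c)))) refl P (ν 3) h (ν k) c ⟩
          - ν 3 * (ν k + P * c₁ c) ∎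
          where open ≡-Reasoning

        above : ∀ i k c → i ℕ.+ p ≡ 3 ℕ.* k → ν i + P * (ν 3 * c) ≡ ν 3 * (ν k + P * c₂ c)
        above i k c eq = begin
          ν i + P * (ν 3 * c)                    ≡⟨ solve 3 (λ i P c → i :+ P :* c := (i :+ P) :- P :* :c 1 :+ P :* c) refl (ν i) P (ν 3 * c) ⟩
          ν i + P - P * 1# + P * (ν 3 * c)       ≡⟨ cong₂ (λ z w → z - P * w + P * (ν 3 * c)) (trans (sym (ν-+ i p)) (trans (cong ν eq) (ν-* 3 k))) (sym 3h) ⟩
          ν 3 * ν k - P * (ν 3 * h) + P * (ν 3 * c) ≡⟨ solve 5 (λ P t h x c → t :* x :- P :* (t :* h) :+ P :* (t :* c) := t :* (x :+ P :* (c :- h))) refl P (ν 3) h (ν k) c ⟩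
          ν 3 * (ν k + P * c₂ c) ∎
          where open ≡-Reasoning

        reindex : ∀ t b N {i} → t ≡ b ℕ.+ N → i < N → 3 ℕ.* (N ℕ.∸ suc i) ℕ.+ 3 ℕ.* suc (b ℕ.+ i) ≡ 3 ℕ.* t
        reindex t b N {i} t≡ l = trans (sym (ℕP.*-distribˡ-+ 3 (N ℕ.∸ suc i) (suc (b ℕ.+ i)))) (cong (3 ℕ.*_)
          (trans (solveℕ 3 (λ k b i → k :+ℕ (conℕ 1 :+ℕ (b :+ℕ i)) :=ℕ b :+ℕ (k :+ℕ (conℕ 1 :+ℕ i))) refl (N ℕ.∸ suc i) b i)
            (trans (cong (b ℕ.+_) (ℕP.m∸n+n≡m l)) (sym t≡))))
          where open ℕS.+-*-Solver renaming (solve to solveℕ; _:+_ to _:+ℕ_; _:*_ to _:*ℕ_; con to conℕ; _:=_ to _:=ℕ_)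

      -- Gauss triplication. A factor i prime to 3 has either p - i or p + i of the form 3k. The
      -- former gives -3 times k with shift -(h + c), the latter 3 times k with shift c - h; the
      -- values of k fill the N places up to t and the N places after t.
      tripling₁ : ∀ N b t c → p ≡ suc (3 ℕ.* t) → t ≡ b ℕ.+ N →
        fac (3 ℕ.* N) (ν 3 * c) * (fac b (c₁ c) * fac t (c₂ c))
        ≡ ν 3 ^ N * (- ν 3) ^ N * ν 3 ^ N * (fac N c * fac t (c₁ c) * fac (t ℕ.+ N) (c₂ c))
      tripling₁ N b t c p≡ t≡ = begin
        fac (3 ℕ.* N) (ν 3 * c) * (fac b (c₁ c) * fac t (c₂ c))
          ≡⟨ cong (_* (fac b (c₁ c) * fac t (c₂ c))) (trans (Π3 N _) (cong₂ _*_ (cong₂ _*_ (multiples N c) ones) twos)) ⟩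
        ν 3 ^ N * fac N c * ((- ν 3) ^ N * range b N (c₁ c)) * (ν 3 ^ N * range t N (c₂ c)) * (fac b (c₁ c) * fac t (c₂ c))
          ≡⟨ solve 8 (λ x F y r z s g k → x :* F :* (y :* r) :* (z :* s) :* (g :* k) := x :* y :* z :* (F :* (g :* r) :* (k :* s))) refl _ _ _ _ _ _ _ _ ⟩
        ν 3 ^ N * (- ν 3) ^ N * ν 3 ^ N * (fac N c * (fac b (c₁ c) * range b N (c₁ c)) * (fac t (c₂ c) * range t N (c₂ c)))
          ≡⟨ cong₂ (λ z w → ν 3 ^ N * (- ν 3) ^ N * ν 3 ^ N * (fac N c * z * w))
               (trans (sym (fac-range b N (c₁ c))) (cong (λ k → fac k (c₁ c)) (sym t≡))) (sym (fac-range t N (c₂ c))) ⟩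
        ν 3 ^ N * (- ν 3) ^ N * ν 3 ^ N * (fac N c * fac t (c₁ c) * fac (t ℕ.+ N) (c₂ c)) ∎
        where
        open ≡-Reasoning
        ones : Π< N (λ i → ν (suc (3 ℕ.* i)) + P * (ν 3 * c)) ≡ (- ν 3) ^ N * range b N (c₁ c)
        ones = trans (Π-rev N _) (scaled N (- ν 3) _ _ (λ i l → below (suc (3 ℕ.* (N ℕ.∸ suc i))) (suc (b ℕ.+ i)) c
          (trans (cong suc (reindex t b N t≡ l)) (sym p≡))))
        twos : Π< N (λ i → ν (suc (suc (3 ℕ.* i))) + P * (ν 3 * c)) ≡ ν 3 ^ N * range t N (c₂ c)
        twos = scaled N (ν 3) _ _ (λ i l → above (suc (suc (3 ℕ.* i))) (suc (t ℕ.+ i)) c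
          (trans (cong (suc (suc (3 ℕ.* i)) ℕ.+_) p≡)
            (solveℕ 2 (λ i t → (conℕ 2 :+ℕ conℕ 3 :*ℕ i) :+ℕ (conℕ 1 :+ℕ conℕ 3 :*ℕ t) :=ℕ conℕ 3 :*ℕ (conℕ 1 :+ℕ (t :+ℕ i))) refl i t)))
          where open ℕS.+-*-Solver renaming (solve to solveℕ; _:+_ to _:+ℕ_; _:*_ to _:*ℕ_; con to conℕ; _:=_ to _:=ℕ_)

      -- For p ≡ 2 (mod 3) the two classes exchange roles. The product stops at 3N + 1, one factor
      -- into the next block; that factor belongs to the class with p + i divisible by 3, which
      -- therefore has N + 1 members.
      tripling₂ : ∀ N b t c → p ≡ suc (suc (3 ℕ.* t)) → t ≡ b ℕ.+ N →
        fac (suc (3 ℕ.* N)) (ν 3 * c) * (fac b (c₁ c) * fac t (c₂ c))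
        ≡ ν 3 ^ N * (- ν 3) ^ N * ν 3 ^ suc N * (fac N c * fac t (c₁ c) * fac (t ℕ.+ suc N) (c₂ c))
      tripling₂ N b t c p≡ t≡ = begin
        fac (3 ℕ.* N) (ν 3 * c) * (ν (suc (3 ℕ.* N)) + P * (ν 3 * c)) * (fac b (c₁ c) * fac t (c₂ c))
          ≡⟨ cong (λ z → z * (ν (suc (3 ℕ.* N)) + P * (ν 3 * c)) * (fac b (c₁ c) * fac t (c₂ c)))
               (trans (Π3 N _) (cong₂ (λ x y → x * Π< N o * y) (multiples N c) twos)) ⟩
        ν 3 ^ N * fac N c * Π< N o * ((- ν 3) ^ N * range b N (c₁ c)) * o N * (fac b (c₁ c) * fac t (c₂ c))
          ≡⟨ solve 8 (λ x F O y r z g k → x :* F :* O :* (y :* r) :* z :* (g :* k) := x :* F :* (O :* z) :* (y :* r) :* (g :* k)) refl _ _ _ _ _ _ _ _ ⟩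
        ν 3 ^ N * fac N c * Π< (suc N) o * ((- ν 3) ^ N * range b N (c₁ c)) * (fac b (c₁ c) * fac t (c₂ c))
          ≡⟨ cong (λ z → ν 3 ^ N * fac N c * z * ((- ν 3) ^ N * range b N (c₁ c)) * (fac b (c₁ c) * fac t (c₂ c))) ones ⟩
        ν 3 ^ N * fac N c * (ν 3 ^ suc N * range t (suc N) (c₂ c)) * ((- ν 3) ^ N * range b N (c₁ c)) * (fac b (c₁ c) * fac t (c₂ c))
          ≡⟨ solve 8 (λ x F z s y r g k → x :* F :* (z :* s) :* (y :* r) :* (g :* k) := x :* y :* z :* (F :* (g :* r) :* (k :* s))) refl _ _ _ _ _ _ _ _ ⟩
        ν 3 ^ N * (- ν 3) ^ N * ν 3 ^ suc N * (fac N c * (fac b (c₁ c) * range b N (c₁ c)) * (fac t (c₂ c) * range t (suc N) (c₂ c)))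
          ≡⟨ cong₂ (λ z w → ν 3 ^ N * (- ν 3) ^ N * ν 3 ^ suc N * (fac N c * z * w))
               (trans (sym (fac-range b N (c₁ c))) (cong (λ k → fac k (c₁ c)) (sym t≡))) (sym (fac-range t (suc N) (c₂ c))) ⟩
        ν 3 ^ N * (- ν 3) ^ N * ν 3 ^ suc N * (fac N c * fac t (c₁ c) * fac (t ℕ.+ suc N) (c₂ c)) ∎
        where
        open ≡-Reasoning
        o : ℕ → Carrier
        o i = ν (suc (3 ℕ.* i)) + P * (ν 3 * c)
        twos : Π< N (λ i → ν (suc (suc (3 ℕ.* i))) + P * (ν 3 * c)) ≡ (- ν 3) ^ N * range b N (c₁ c)
        twos = trans (Π-rev N _) (scaled N (- ν 3) _ _ (λ i l → below (suc (suc (3 ℕ.* (N ℕ.∸ suc i)))) (suc (b ℕ.+ i)) c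
          (trans (cong (λ z → suc (suc z)) (reindex t b N t≡ l)) (sym p≡))))
        ones : Π< (suc N) o ≡ ν 3 ^ suc N * range t (suc N) (c₂ c)
        ones = scaled (suc N) (ν 3) _ _ (λ i l → above (suc (3 ℕ.* i)) (suc (t ℕ.+ i)) c
          (trans (cong (suc (3 ℕ.* i) ℕ.+_) p≡)
            (solveℕ 2 (λ i t → (conℕ 1 :+ℕ conℕ 3 :*ℕ i) :+ℕ (conℕ 2 :+ℕ conℕ 3 :*ℕ t) :=ℕ conℕ 3 :*ℕ (conℕ 1 :+ℕ (t :+ℕ i))) refl i t)))
          where open ℕS.+-*-Solver renaming (solve to solveℕ; _:+_ to _:+ℕ_; _:*_ to _:*ℕ_; con to conℕ; _:=_ to _:=ℕ_)

    -- The factor p - x + pc equals -(x - p(1 + c)): counting down from p turns the upper end of the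
    -- factorial into a lower one with shift -(1 + c).
    reflection : ∀ b N c → p ≡ suc (b ℕ.+ N) →
      fac (b ℕ.+ N) c ≡ fac b c * ((- 1#) ^ N * fac N (- (1# + c)))
    reflection b N c p≡ = trans (fac-range b N c) (cong (fac b c *_) (trans (Π-rev N _)
      (scaled N (- 1#) _ _ (λ i l → trans (cong (_+ P * c) (ν-diff (suc (b ℕ.+ (N ℕ.∸ suc i))) (suc i) (index i l)))
        (solve 3 (λ P x c → P :- x :+ P :* c := :- :c 1 :* (x :+ P :* (:- (:c 1 :+ c)))) refl P (ν (suc i)) c)))))
      where
      index : ∀ i → i < N → suc (b ℕ.+ (N ℕ.∸ suc i)) ℕ.+ suc i ≡ p
      index i l = trans (cong suc (trans (ℕP.+-assoc b (N ℕ.∸ suc i) (suc i)) (cong (b ℕ.+_) (ℕP.m∸n+n≡m l)))) (sym p≡)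

    -- From the reflection k ↦ p - k the harmonic number H (p-1) vanishes mod p.
    fac-p-1 : ∀ N c → p ≡ suc N → 2 ℕ.* ℕ.⌊ N /2⌋ ≡ N → fac N c ≡ fac N 0#
    fac-p-1 N c p≡ even = begin
      fac N c                                     ≡⟨ cong (fac N) (sym (+-identityˡ c)) ⟩
      fac N (0# + c)                              ≡⟨ fac-shift N 0# c N<p ⟩
      fac N 0# * (1# + P * c * H N)               ≡⟨ cong (λ z → fac N 0# * (1# + z)) (solve 3 (λ P c H → P :* c :* H := c :* (P :* H)) refl P c (H N)) ⟩
      fac N 0# * (1# + c * (P * H N))             ≡⟨ cong (λ z → fac N 0# * (1# + c * z)) PH ⟩
      fac N 0# * (1# + c * 0#)                    ≡⟨ solve 2 (λ F c → F :* (:c 1 :+ c :* :c 0) := F) refl (fac N 0#) c ⟩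
      fac N 0# ∎
      where
      open ≡-Reasoning
      N<p : N < p
      N<p = subst (N <_) (sym p≡) (ℕP.n<1+n N)
      sign : (- 1#) ^ N ≡ 1#
      sign = trans (cong ((- 1#) ^_) (sym even)) (trans (sym (^-assocʳ (- 1#) 2 ℕ.⌊ N /2⌋))
        (trans (cong (_^ ℕ.⌊ N /2⌋) (solve 0 ((:- :c 1) :^ 2 := :c 1) refl)) (1^ ℕ.⌊ N /2⌋)))
      PH : P * H N ≡ 0#
      PH with fac-unit N 0# N<p
      ... | y , Fy = trans (solve 1 (λ x → x := :c 1 :- :c 1 :* (:c 1 :+ (:- x))) refl (P * H N)) (trans
        (cong (λ z → 1# - z * (1# + - (P * H N))) (sym Fy)) (trans
        (solve 3 (λ F y x → :c 1 :- (F :* y) :* (:c 1 :+ (:- x)) := :c 1 :- (F :* (:c 1 :+ (:- x))) :* y) refl (fac N 0#) y (P * H N)) (trans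
        (cong (λ z → 1# - z * y) (begin
          fac N 0# * (1# + - (P * H N))
            ≡⟨ solve 3 (λ F P H → F :* (:c 1 :+ (:- (P :* H))) := F :* (:c 1 :+ P :* (:- :c 1) :* H)) refl (fac N 0#) P (H N) ⟩
          fac N 0# * (1# + P * (- 1#) * H N)
            ≡⟨ sym (fac-shift N 0# (- 1#) N<p) ⟩
          fac N (0# + - 1#)
            ≡⟨ cong (fac N) (solve 0 (:c 0 :+ (:- :c 1) := :- (:c 1 :+ :c 0)) refl) ⟩
          fac N (- (1# + 0#))
            ≡⟨ solve 1 (λ F → F := :c 1 :* (:c 1 :* F)) refl (fac N (- (1# + 0#))) ⟩
          1# * (1# * fac N (- (1# + 0#)))
            ≡⟨ cong (λ z → 1# * (z * fac N (- (1# + 0#)))) (sym sign) ⟩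
          1# * ((- 1#) ^ N * fac N (- (1# + 0#)))
            ≡⟨ sym (reflection 0 N 0# p≡) ⟩
          fac N 0# ∎))
        (trans (cong (λ z → 1# - z) Fy) (-‿inverseʳ 1#)))))

    cancel-unit : ∀ {u x y} → (∃ λ v → u * v ≡ 1#) → x * u ≡ y * u → x ≡ y
    cancel-unit {u} (v , e) = cancelʳ u v e

    -- H_{(p-1)/2} in terms of the Fermat quotient of 2
    fermat2 : ∀ h → ν 2 * h ≡ 1# → ∀ N → p ≡ suc (2 ℕ.* N) → fac N (- h) ≡ ν 2 ^ (2 ℕ.* N) * fac N 0#
    fermat2 h 2h N p≡ = cancel-unit {x = fac N (- h)} (unit (fac-unit N (- h) N<p)) (begin
      fac N (- h) * ((- 1#) ^ N * fac N (- h))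
        ≡⟨ cong (λ z → fac N (- h) * ((- 1#) ^ N * fac N z)) half ⟩
      fac N (- h) * ((- 1#) ^ N * fac N (- (1# + - h)))
        ≡⟨ sym (reflection N N (- h) (trans p≡ (cong suc (cong (N ℕ.+_) (ℕP.+-identityʳ N))))) ⟩
      fac (N ℕ.+ N) (- h)
        ≡⟨ cong (λ k → fac k (- h)) (cong (N ℕ.+_) (sym (ℕP.+-identityʳ N))) ⟩
      fac (2 ℕ.* N) (- h)
        -- The full (p-1)! does not feel its shift, so one and the same product is split above by
        -- reflection and below by duplication; comparison produces 2^(p-1).
        ≡⟨ trans (fac-p-1 (2 ℕ.* N) (- h) p≡ (even N)) (cong (fac (2 ℕ.* N)) (sym (zeroʳ (ν 2)))) ⟩
      fac (2 ℕ.* N) (ν 2 * 0#)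
        ≡⟨ trans (sym (*-identityʳ _)) (doubling N 0 0# p≡) ⟩
      ν 2 ^ N * (- ν 2) ^ N * (fac N 0# * fac N (- (h + 0#)))
        ≡⟨ cong₂ (λ z w → ν 2 ^ N * z * (fac N 0# * fac N (- w))) neg (+-identityʳ h) ⟩
      ν 2 ^ N * ((- 1#) ^ N * ν 2 ^ N) * (fac N 0# * fac N (- h))
        ≡⟨ solve 4 (λ t s F G → t :* (s :* t) :* (F :* G) := (t :* t) :* F :* (s :* G)) refl _ _ _ _ ⟩
      ν 2 ^ N * ν 2 ^ N * fac N 0# * ((- 1#) ^ N * fac N (- h))
        ≡⟨ cong (λ z → z * fac N 0# * ((- 1#) ^ N * fac N (- h))) (trans (sym (^-homo-* (ν 2) N N)) (cong (ν 2 ^_) (cong (N ℕ.+_) (sym (ℕP.+-identityʳ N))))) ⟩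
      ν 2 ^ (2 ℕ.* N) * fac N 0# * ((- 1#) ^ N * fac N (- h)) ∎)
      where
      open ≡-Reasoning
      open Halves h 2h
      N<p : N < p
      N<p = subst (N <_) (sym p≡) (ℕ.s≤s (ℕP.m≤m+n N _))
      even : ∀ N → 2 ℕ.* ℕ.⌊ 2 ℕ.* N /2⌋ ≡ 2 ℕ.* N
      even N = cong (2 ℕ.*_) (trans (cong ℕ.⌊_/2⌋ (cong (N ℕ.+_) (ℕP.+-identityʳ N))) (sym (ℕP.n≡⌊n+n/2⌋ N)))
      half : - h ≡ - (1# + - h)
      half = trans (solve 1 (λ h → :- h := :- (:c 2 :* h :+ (:- h))) refl h) (cong (λ z → - (z + - h)) 2h)
      neg : (- ν 2) ^ N ≡ (- 1#) ^ N * ν 2 ^ N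
      neg = trans (cong (_^ N) (solve 0 (:- :c 2 := :- :c 1 :* :c 2) refl)) (^-distrib-* (- 1#) (ν 2) N)
      unit : ∀ {z} → (∃ λ v → z * v ≡ 1#) → ∃ λ v → (- 1#) ^ N * z * v ≡ 1#
      unit {z} (v , e) = (- 1#) ^ N * v , trans (solve 3 (λ s z v → s :* z :* (s :* v) := (s :* s) :* (z :* v)) refl _ _ _)
        (trans (cong₂ _*_ (trans (sym (^-distrib-* (- 1#) (- 1#) N)) (trans (cong (_^ N) (solve 0 (:- :c 1 :* :- :c 1 := :c 1) refl)) (1^ N))) e) (*-identityˡ _))

    -- H_{⌊p/3⌋} in terms of the Fermat quotient of 3
    private
      fermat3 : ∀ h L B t → p ≡ suc L → L ≡ B ℕ.+ t → 2 ℕ.* ℕ.⌊ L /2⌋ ≡ L →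
        fac L 0# * fac t (- h) ≡ (- 1#) ^ t * ν 3 ^ L * (fac t 0# * fac t (- h) * fac B (- h)) →
        fac t (- (1# + - h)) ≡ ν 3 ^ L * fac t 0#
      fermat3 h L B t p≡ L≡ even eq = cancel-unit {x = fac t (- (1# + - h))} (fac-unit t (- h) t<p)
        (cancel-unit {x = _ * fac t (- h)} (fac-unit B (- h) B<p) (cancel-unit {x = _ * fac t (- h) * fac B (- h)} sign-unit (begin
        g * f * b * s            ≡⟨ solve 4 (λ g f b s → g :* f :* b :* s := b :* (s :* g) :* f) refl g f b s ⟩
        b * (s * g) * f          ≡⟨ cong (_* f) (trans (sym (reflection B t (- h) (trans p≡ (cong suc L≡)))) (trans (cong (λ k → fac k (- h)) (sym L≡)) (fac-p-1 L (- h) p≡ even))) ⟩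
        fac L 0# * f             ≡⟨ eq ⟩
        s * r * (f₀ * f * b)     ≡⟨ solve 5 (λ s r g f b → s :* r :* (g :* f :* b) := r :* g :* f :* b :* s) refl s r f₀ f b ⟩
        r * f₀ * f * b * s ∎)))
        where
        open ≡-Reasoning
        g = fac t (- (1# + - h))
        f = fac t (- h)
        f₀ = fac t 0#
        b = fac B (- h)
        s = (- 1#) ^ t
        r = ν 3 ^ L
        L<p : L < p
        L<p = subst (L <_) (sym p≡) (ℕP.n<1+n L)
        t<p : t < p
        t<p = ℕP.≤-<-trans (subst (t ℕ.≤_) (sym L≡) (ℕP.m≤n+m t B)) L<p
        B<p : B < p
        B<p = ℕP.≤-<-trans (subst (B ℕ.≤_) (sym L≡) (ℕP.m≤m+n B t)) L<p
        sign-unit : ∃ λ v → s * v ≡ 1#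
        sign-unit = s , trans (sym (^-distrib-* (- 1#) (- 1#) t)) (trans (cong (_^ t) (solve 0 (:- :c 1 :* :- :c 1 := :c 1) refl)) (1^ t))

    power3 : ∀ i j k → ν 3 ^ i * (- ν 3) ^ j * ν 3 ^ k ≡ (- 1#) ^ j * ν 3 ^ (i ℕ.+ j ℕ.+ k)
    power3 i j k = begin
      ν 3 ^ i * (- ν 3) ^ j * ν 3 ^ k ≡⟨ cong (λ z → ν 3 ^ i * z ^ j * ν 3 ^ k) (solve 0 (:- :c 3 := :- :c 1 :* :c 3) refl) ⟩
      ν 3 ^ i * ((- 1#) * ν 3) ^ j * ν 3 ^ k ≡⟨ cong (λ z → ν 3 ^ i * z * ν 3 ^ k) (^-distrib-* (- 1#) (ν 3) j) ⟩
      ν 3 ^ i * ((- 1#) ^ j * ν 3 ^ j) * ν 3 ^ k ≡⟨ solve 4 (λ a s b c → a :* (s :* b) :* c := s :* (a :* b :* c)) refl _ _ _ _ ⟩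
      (- 1#) ^ j * (ν 3 ^ i * ν 3 ^ j * ν 3 ^ k) ≡⟨ cong ((- 1#) ^ j *_) (sym (trans (^-homo-* (ν 3) (i ℕ.+ j) k) (cong (_* ν 3 ^ k) (^-homo-* (ν 3) i j)))) ⟩
      (- 1#) ^ j * ν 3 ^ (i ℕ.+ j ℕ.+ k) ∎
      where open ≡-Reasoning

    module Fermat3 (h : Carrier) (3h : ν 3 * h ≡ 1#) where
      open Thirds h 3h
      open ≡-Reasoning
      private
        constants : ∀ L B t e → fac L (ν 3 * 0#) * (fac 0 (- (h + 0#)) * fac t (0# - h)) ≡ e * (fac t 0# * fac t (- (h + 0#)) * fac B (0# - h)) →
          fac L 0# * fac t (- h) ≡ e * (fac t 0# * fac t (- h) * fac B (- h))
        constants L B t e eq = begin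
          fac L 0# * fac t (- h)                        ≡⟨ cong₂ (λ x y → fac L x * y) (sym (zeroʳ (ν 3))) (trans (sym (*-identityˡ _)) (cong (λ z → 1# * fac t z) (sym (+-identityˡ _)))) ⟩
          fac L (ν 3 * 0#) * (1# * fac t (0# - h))      ≡⟨ eq ⟩
          e * (fac t 0# * fac t (- (h + 0#)) * fac B (0# - h)) ≡⟨ cong₂ (λ x y → e * (fac t 0# * fac t (- x) * fac B y)) (+-identityʳ h) (+-identityˡ _) ⟩
          e * (fac t 0# * fac t (- h) * fac B (- h)) ∎

      fermat3₁ : ∀ t → p ≡ suc (3 ℕ.* t) → 2 ℕ.* ℕ.⌊ 3 ℕ.* t /2⌋ ≡ 3 ℕ.* t →
        fac t (- (1# + - h)) ≡ ν 3 ^ (3 ℕ.* t) * fac t 0#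
      fermat3₁ t p≡ even = fermat3 h (3 ℕ.* t) (t ℕ.+ t) t p≡ sum even
        (trans (constants (3 ℕ.* t) (t ℕ.+ t) t _ (tripling₁ t 0 t 0# p≡ refl)) (cong (_* (fac t 0# * fac t (- h) * fac (t ℕ.+ t) (- h))) (trans (power3 t t t) (cong (λ k → (- 1#) ^ t * ν 3 ^ k) (sym sum)))))
        where
        sum : 3 ℕ.* t ≡ t ℕ.+ t ℕ.+ t
        sum = trans (cong (λ z → t ℕ.+ (t ℕ.+ z)) (ℕP.+-identityʳ t)) (sym (ℕP.+-assoc t t t))

      fermat3₂ : ∀ t → p ≡ suc (suc (3 ℕ.* t)) → 2 ℕ.* ℕ.⌊ suc (3 ℕ.* t) /2⌋ ≡ suc (3 ℕ.* t) →
        fac t (- (1# + - h)) ≡ ν 3 ^ suc (3 ℕ.* t) * fac t 0#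
      fermat3₂ t p≡ even = fermat3 h (suc (3 ℕ.* t)) (t ℕ.+ suc t) t p≡ sum even
        (trans (constants (suc (3 ℕ.* t)) (t ℕ.+ suc t) t _ (tripling₂ t 0 t 0# p≡ refl)) (cong (_* (fac t 0# * fac t (- h) * fac (t ℕ.+ suc t) (- h))) (trans (power3 t t (suc t)) (cong (λ k → (- 1#) ^ t * ν 3 ^ k) (sym sum′)))))
        where
        open ℕS.+-*-Solver renaming (solve to solveℕ; _:+_ to _:+ℕ_; _:*_ to _:*ℕ_; con to conℕ; _:=_ to _:=ℕ_)
        sum : suc (3 ℕ.* t) ≡ t ℕ.+ suc t ℕ.+ t
        sum = solveℕ 1 (λ t → conℕ 1 :+ℕ conℕ 3 :*ℕ t :=ℕ t :+ℕ (conℕ 1 :+ℕ t) :+ℕ t) refl t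
        sum′ : suc (3 ℕ.* t) ≡ t ℕ.+ t ℕ.+ suc t
        sum′ = solveℕ 1 (λ t → conℕ 1 :+ℕ conℕ 3 :*ℕ t :=ℕ t :+ℕ t :+ℕ (conℕ 1 :+ℕ t)) refl t

    -- In the supersingular case everything is a multiple of p, and only products mod p matter.
    module _ (n N k : ℕ) (c : Carrier) (p≡ : p ≡ suc (n ℕ.+ N)) (2n : n ℕ.+ n ≡ p ℕ.+ k) where
      open ≡-Reasoning
      private
        n<p : n < p
        n<p = subst (n <_) (sym p≡) (ℕ.s≤s (ℕP.m≤m+n n N))

        F : ℕ → Carrier
        F j = fac j 0#

        -- The product passes p, where the factor is p + pc = p(1 + c). With this p in front, the p
        -- - 1 factors below it are taken modulo p and reflected, and the k factors above it reduce
        -- to k!.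
        wrap : fac (n ℕ.+ n) c ≡ P * ((1# + c) * F n * (- 1#) ^ N * F N * F k)
        wrap = begin
          fac (n ℕ.+ n) c ≡⟨ cong (λ j → fac j c) 2n ⟩
          fac (p ℕ.+ k) c ≡⟨ fac-range p k c ⟩
          fac p c * range p k c ≡⟨ cong (λ j → fac j c * range p k c) p≡ ⟩
          fac (n ℕ.+ N) c * (ν (suc (n ℕ.+ N)) + P * c) * range p k c
            ≡⟨ cong (λ j → fac (n ℕ.+ N) c * (ν j + P * c) * range p k c) (sym p≡) ⟩
          fac (n ℕ.+ N) c * (P + P * c) * range p k c
            ≡⟨ solve 4 (λ G P c r → G :* (P :+ P :* c) :* r := (:c 1 :+ c) :* (P :* G) :* r) refl _ P c _ ⟩
          (1# + c) * (P * fac (n ℕ.+ N) c) * range p k c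
            ≡⟨ cong (λ z → (1# + c) * z * range p k c) (trans (P-fac (n ℕ.+ N) c) (cong (P *_) (trans (reflection n N 0# p≡) refl))) ⟩
          (1# + c) * (P * (F n * ((- 1#) ^ N * fac N (- (1# + 0#))))) * range p k c
            ≡⟨ solve 6 (λ d P f s g r → d :* (P :* (f :* (s :* g))) :* r := d :* f :* s :* (P :* g) :* r) refl _ _ _ _ _ _ ⟩
          (1# + c) * F n * (- 1#) ^ N * (P * fac N (- (1# + 0#))) * range p k c
            ≡⟨ cong (λ z → (1# + c) * F n * (- 1#) ^ N * z * range p k c) (P-fac N _) ⟩
          (1# + c) * F n * (- 1#) ^ N * (P * F N) * range p k c
            ≡⟨ solve 6 (λ d P f s g r → d :* f :* s :* (P :* g) :* r := d :* f :* s :* g :* (P :* r)) refl _ _ _ _ _ _ ⟩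
          (1# + c) * F n * (- 1#) ^ N * F N * (P * range p k c)
            ≡⟨ cong ((1# + c) * F n * (- 1#) ^ N * F N *_) (P-range k) ⟩
          (1# + c) * F n * (- 1#) ^ N * F N * (P * F k)
            ≡⟨ solve 6 (λ d P f s g r → d :* f :* s :* g :* (P :* r) := P :* (d :* f :* s :* g :* r)) refl _ _ _ _ _ _ ⟩
          P * ((1# + c) * F n * (- 1#) ^ N * F N * F k) ∎
          where
          P-range : ∀ k → P * range p k c ≡ P * F k
          P-range zero = refl
          P-range (suc k) = begin
            P * (range p k c * (ν (suc (p ℕ.+ k)) + P * c))
              ≡⟨ cong (λ z → P * (range p k c * (z + P * c))) (trans (cong ν (sym (ℕP.+-suc p k))) (ν-+ p (suc k))) ⟩
            P * (range p k c * (P + ν (suc k) + P * c))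
              ≡⟨ drop0 P² (range p k c * (1# + c)) (solve 4 (λ P r x c → P :* (r :* (P :+ x :+ P :* c)) := P :* r :* x :+ P :* P :* (r :* (:c 1 :+ c))) refl P _ (ν (suc k)) c) ⟩
            P * range p k c * ν (suc k)   ≡⟨ cong (_* ν (suc k)) (P-range k) ⟩
            P * F k * ν (suc k)           ≡⟨ solve 3 (λ P r x → P :* r :* x := P :* (r :* (x :+ P :* :c 0))) refl P (F k) (ν (suc k)) ⟩
            P * (F k * (ν (suc k) + P * 0#)) ∎

      -- Y matters only modulo p, so its equation is stated after multiplication by p; all shifts
      -- then disappear and ordinary factorials remain.
      supersingular : ∀ {X e} → X * fac n c * fac n 0# ≡ e * fac (n ℕ.+ n) c →
        ∃ λ Y → X ≡ P * Y × P * (Y * F n) ≡ P * (e * (1# + c) * (- 1#) ^ N * F N * F k)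
      supersingular {X} {e} eq = go (fac-unit n c n<p) (fac-unit n 0# n<p)
        where
        Z = e * (1# + c) * (- 1#) ^ N * F N * F k
        rhs : X * fac n c * F n ≡ P * (Z * F n)
        rhs = trans eq (trans (cong (e *_) wrap) (solve 7 (λ e P d f s g r → e :* (P :* (d :* f :* s :* g :* r)) := P :* (e :* d :* s :* g :* r :* f)) refl _ _ _ _ _ _ _))
        go : (∃ λ v → fac n c * v ≡ 1#) → (∃ λ v → F n * v ≡ 1#) → ∃ λ Y → X ≡ P * Y × P * (Y * F n) ≡ P * Z
        go (v , cv) u@(w , cw) = Z * v , X≡ , (begin
          P * (Z * v * F n)      ≡⟨ solve 4 (λ P Z v f → P :* (Z :* v :* f) := (Z :* v) :* (P :* f)) refl P Z v (F n) ⟩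
          Z * v * (P * F n)      ≡⟨ cong (Z * v *_) (sym (P-fac n c)) ⟩
          Z * v * (P * fac n c)  ≡⟨ solve 4 (λ P Z v f → (Z :* v) :* (P :* f) := P :* Z :* (f :* v)) refl P Z v (fac n c) ⟩
          P * Z * (fac n c * v)  ≡⟨ trans (cong (P * Z *_) cv) (*-identityʳ _) ⟩
          P * Z ∎)
          where
          X≡ : X ≡ P * (Z * v)
          X≡ = cancel-unit {x = X} (v , cv) (cancel-unit {x = X * fac n c} u (trans rhs
            (trans (solve 3 (λ P Z f → P :* (Z :* f) := P :* Z :* :c 1 :* f) refl P Z (F n))
              (trans (cong (λ z → P * Z * z * F n) (sym cv)) (solve 5 (λ P Z g v f → P :* Z :* (g :* v) :* f := P :* (Z :* v) :* g :* f) refl P Z (fac n c) v (F n))))))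

-- Teichmüller representatives modulo p² and power sums

module Teichmuller where

  open RingKit
  open ZMod
  open Local
  open import Data.Nat as ℕ using (ℕ; zero; suc; NonZero; _<_)
  import Data.Nat.Properties as ℕP
  import Data.Nat.Solver as ℕS
  open import Data.Nat.Induction using (<-rec)
  open import Data.Nat.DivMod using (_%_; _/_; m≡m%n+[m/n]*n; m%n<n)
  open import Data.Nat.Combinatorics using (_C_; nCk+nC[k+1]≡[n+1]C[k+1]; nCn≡1)
  open import Data.Nat.Combinatorics.Specification using (k>n⇒nCk≡0)
  open import Data.Nat.Divisibility as ℕD using (_∣_; _∤_; divides)
  open import Data.Nat.Primality using (Prime; euclidsLemma; prime⇒nonZero)
  open import Data.Integer as ℤ using (ℤ; +_)
  import Data.Integer.Properties as ℤP
  import Data.Integer.Divisibility.Signed as ℤS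
  open import Data.Product using (_,_; ∃; _×_; proj₁; proj₂)
  open import Data.Sum using (inj₁; inj₂)
  open import Data.Empty using (⊥-elim)
  open import Relation.Nullary using (yes; no; ¬?)
  open import Relation.Nullary.Decidable using (_×-dec_; decidable-stable)
  open import Relation.Binary.PropositionalEquality

  private
    suc-*-C-base : ∀ k → suc k ℕ.* (1 C suc k) ≡ 1 ℕ.* (0 C k)
    suc-*-C-base zero = refl
    suc-*-C-base (suc k) = trans (cong (suc (suc k) ℕ.*_) (k>n⇒nCk≡0 {1} {suc (suc k)} (ℕ.s≤s (ℕ.s≤s ℕ.z≤n))))
      (trans (ℕP.*-zeroʳ (suc (suc k))) (sym (cong (1 ℕ.*_) (k>n⇒nCk≡0 {0} {suc k} (ℕ.s≤s ℕ.z≤n)))))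

  suc-*-C : ∀ n k → suc k ℕ.* (suc n C suc k) ≡ suc n ℕ.* (n C k)
  suc-*-C zero k = suc-*-C-base k
  suc-*-C (suc n) zero = begin
    1 ℕ.* (suc (suc n) C 1)                    ≡⟨ cong (1 ℕ.*_) (sym (nCk+nC[k+1]≡[n+1]C[k+1] (suc n) 0)) ⟩
    1 ℕ.* ((suc n C 0) ℕ.+ (suc n C 1))        ≡⟨ ℕP.*-distribˡ-+ 1 (suc n C 0) (suc n C 1) ⟩
    1 ℕ.* (suc n C 0) ℕ.+ 1 ℕ.* (suc n C 1)    ≡⟨ cong (1 ℕ.* (suc n C 0) ℕ.+_) (suc-*-C n 0) ⟩
    1 ℕ.* 1 ℕ.+ suc n ℕ.* 1                    ≡⟨ sym (ℕP.*-distribʳ-+ 1 1 (suc n)) ⟩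
    suc (suc n) ℕ.* 1 ∎
    where open ≡-Reasoning
  suc-*-C (suc n) (suc k) = begin
    (2 ℕ.+ k) ℕ.* (suc (suc n) C suc (suc k))
      ≡⟨ cong ((2 ℕ.+ k) ℕ.*_) (sym (nCk+nC[k+1]≡[n+1]C[k+1] (suc n) (suc k))) ⟩
    (2 ℕ.+ k) ℕ.* ((suc n C suc k) ℕ.+ (suc n C suc (suc k)))
      ≡⟨ solveℕ 3 (λ k a b → (con 2 :+ k) :* (a :+ b) := a :+ (con 1 :+ k) :* a :+ (con 2 :+ k) :* b) refl k (suc n C suc k) _ ⟩
    (suc n C suc k) ℕ.+ suc k ℕ.* (suc n C suc k) ℕ.+ (2 ℕ.+ k) ℕ.* (suc n C suc (suc k))
      ≡⟨ cong₂ (λ x y → (suc n C suc k) ℕ.+ x ℕ.+ y) (suc-*-C n k) (suc-*-C n (suc k)) ⟩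
    (suc n C suc k) ℕ.+ suc n ℕ.* (n C k) ℕ.+ suc n ℕ.* (n C suc k)
      ≡⟨ solveℕ 4 (λ a n b c → a :+ (con 1 :+ n) :* b :+ (con 1 :+ n) :* c := a :+ (con 1 :+ n) :* (b :+ c)) refl (suc n C suc k) n (n C k) (n C suc k) ⟩
    (suc n C suc k) ℕ.+ suc n ℕ.* ((n C k) ℕ.+ (n C suc k))
      ≡⟨ cong (λ x → (suc n C suc k) ℕ.+ suc n ℕ.* x) (nCk+nC[k+1]≡[n+1]C[k+1] n k) ⟩
    suc (suc n) ℕ.* (suc n C suc k) ∎
    where
    open ≡-Reasoning
    open ℕS.+-*-Solver renaming (solve to solveℕ)

  module TeichmullerSums (p : ℕ) (pr : Prime p) (f : ℕ) (p≡ : p ≡ suc (4 ℕ.* f)) (0<f : 0 < f)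
    (F : Quotient p) (R : Quotient (p ℕ.^ 2)) where
    private module F = Quotient F
    open Quotient R
    open LocalRing p pr 1 R public
    open SumOver F ring public

    instance
      p≢0 : NonZero p
      p≢0 = prime⇒nonZero pr

    4f<p : 4 ℕ.* f < p
    4f<p = subst (4 ℕ.* f <_) (sym p≡) (ℕP.n<1+n _)

    0<4f : 0 < 4 ℕ.* f
    0<4f = ℕP.≤-trans 0<f (ℕP.m≤m+n f _)

    PP : P * P ≡ 0#
    PP = trans (cong (P *_) (sym (*-identityʳ P))) P^

    p∣C : ∀ {k} → suc k < p → p ∣ (p C suc k)
    p∣C {k} l with euclidsLemma (suc k) (p C suc k) pr
      (subst (λ q → q ∣ suc k ℕ.* (q C suc k)) (sym p≡) (divides ((4 ℕ.* f) C k) (trans (suc-*-C (4 ℕ.* f) k) (ℕP.*-comm (suc (4 ℕ.* f)) _))))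
    ... | inj₁ d = ⊥-elim (suc<⇒∤ l d)
    ... | inj₂ d = d

    evenPower : ∀ m → (- 1#) ^ (4 ℕ.* m) ≡ 1#
    evenPower m = trans (sym (^-assocʳ (- 1#) 4 m)) (trans (cong (_^ m) (solve 0 ((:- :c 1) :^ 4 := :c 1) refl)) (1^ m))


    ^p : ∀ x → x F.^ p ≡ x F.* x F.^ (4 ℕ.* f)
    ^p x = cong (x F.^_) p≡

    frobenius : ∀ x → (F.1# F.+ x) F.^ p ≡ F.1# F.+ x F.^ p
    frobenius x = begin
      (F.1# F.+ x) F.^ p ≡⟨ F.binomial p x ⟩
      F.Σ< p g F.+ g p   ≡⟨ cong₂ F._+_ lower top ⟩
      F.1# F.+ x F.^ p ∎
      where
      open ≡-Reasoning
      g : ℕ → F.Carrier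
      g k = F.ν (p C k) F.* x F.^ k
      lower : F.Σ< p g ≡ F.1#
      lower = trans (F.Σ-single p 0 g (ℕP.<-trans 0<4f 4f<p) vanish) (F.*-identityˡ F.1#)
        where
        vanish : ∀ i → i < p → i ≢ 0 → g i ≡ F.0#
        vanish zero _ ne = ⊥-elim (ne refl)
        vanish (suc i) l _ = trans (cong (F._* x F.^ suc i) (F.∣⇒ν≡0 (p∣C l))) (F.zeroˡ _)
      top : g p ≡ x F.^ p
      top = trans (cong (λ z → F.ν z F.* x F.^ p) (nCn≡1 p)) (F.*-identityˡ _)

    fermat : ∀ x → x F.^ p ≡ x
    fermat x = trans (cong (F._^ p) (sym (F.ν-rep x))) (trans (onν (F.rep x)) (F.ν-rep x))
      where
      onν : ∀ n → F.ν n F.^ p ≡ F.ν n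
      onν zero = trans (^p F.0#) (F.zeroˡ _)
      onν (suc n) = trans (cong (F._^ p) (F.ν-suc n))
        (trans (frobenius (F.ν n)) (trans (cong (λ z → F.1# F.+ z) (onν n)) (sym (F.ν-suc n))))

    p∤rep : ∀ {x} → x ≢ F.0# → p ∤ F.rep x
    p∤rep {x} ne d = ne (trans (sym (F.ν-rep x)) (F.∣⇒ν≡0 d))

    F-inverse : ∀ {x} → x ≢ F.0# → ∃ λ y → x F.* y ≡ F.1#
    F-inverse {x} ne with F.coprime-inverse {F.rep x} (λ {d} q → ∤-coprime-^ pr (p∤rep ne) 1 (proj₁ q , subst (d ∣_) (sym (ℕP.*-identityʳ p)) (proj₂ q)))
    ... | y , e = y , trans (cong (F._* y) (sym (F.ν-rep x))) e

    F-cancel : ∀ {x y z} → z ≢ F.0# → x F.* z ≡ y F.* z → x ≡ y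
    F-cancel {z = z} ne = F.cancelʳ z (proj₁ (F-inverse ne)) (proj₂ (F-inverse ne))

    F-1≢0 : F.1# ≢ F.0#
    F-1≢0 e = ℕP.<⇒≱ (ℕP.≤-trans (ℕ.s≤s 0<4f) (ℕP.≤-reflexive (sym p≡))) (ℕD.∣⇒≤ (F.ν-ker 1 e))

    fermat-1 : ∀ {x} → x ≢ F.0# → x F.^ (4 ℕ.* f) ≡ F.1#
    fermat-1 {x} ne = F-cancel ne (trans (F.*-comm _ _) (trans (sym (^p x)) (trans (fermat x) (sym (F.*-identityˡ x)))))

    module FF = SumOver F F.ring

    powerSum : ℕ → F.Carrier
    powerSum k = FF.Σ∀ (λ x → x F.^ k)

    -- The translation x ↦ 1 + x leaves the sum of the (k+1)-st powers unchanged. In its binomial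
    -- expansion the top terms cancel and those below k vanish by induction; what remains is k + 1,
    -- a unit, times the k-th power sum.
    powerSum-zero : ∀ k → k < 4 ℕ.* f → powerSum k ≡ F.0#
    powerSum-zero = <-rec _ step
      where
      open ≡-Reasoning
      step : ∀ k → (∀ {j} → j < k → j < 4 ℕ.* f → powerSum j ≡ F.0#) → k < 4 ℕ.* f → powerSum k ≡ F.0#
      step k ih l = F-cancel unit (trans (F.*-comm _ _) (trans eq (sym (F.zeroˡ _))))
        where
        shifted : FF.Σ∀ (λ x → (F.1# F.+ x) F.^ suc k) ≡ powerSum (suc k)
        shifted = FF.Σ∀-reindex (λ x → F.1# F.+ x) (λ x → x F.- F.1#)
          (λ x → F.solve 1 (λ x → F.:c 1 F.:+ (x F.:- F.:c 1) F.:= x) refl x)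
          (λ x → F.solve 1 (λ x → (F.:c 1 F.:+ x) F.:- F.:c 1 F.:= x) refl x) (λ x → x F.^ suc k)
        expanded : FF.Σ∀ (λ x → (F.1# F.+ x) F.^ suc k) ≡ F.Σ< (suc (suc k)) (λ j → F.ν (suc k C j) F.* powerSum j)
        expanded = trans (FF.Σ∀-cong (F.binomial (suc k)))
          (trans (FF.Σ∀-Σ< (suc (suc k)) (λ x j → F.ν (suc k C j) F.* x F.^ j))
            (F.Σ-cong (suc (suc k)) (λ j _ → FF.Σ∀-*ˡ (F.ν (suc k C j)) (λ x → x F.^ j))))
        lowVanish : F.Σ< k (λ j → F.ν (suc k C j) F.* powerSum j) ≡ F.0#
        lowVanish = F.Σ-0 k (λ j jk → trans (cong (F.ν (suc k C j) F.*_) (ih jk (ℕP.<-trans jk l))) (F.zeroʳ _))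
        s = powerSum k
        s′ = powerSum (suc k)
        eq : F.ν (suc k C k) F.* s ≡ F.0#
        eq = trans (F.solve 2 (λ a b → a F.:= (F.:c 0 F.:+ a F.:+ b) F.:- b) refl (F.ν (suc k C k) F.* s) s′)
          (F.x≡y⇒x-y≡0 (trans (sym (cong₂ (λ x y → x F.+ F.ν (suc k C k) F.* s F.+ y) lowVanish
              (trans (cong (λ z → F.ν z F.* s′) (nCn≡1 (suc k))) (F.*-identityˡ s′))))
            (trans (sym expanded) shifted)))
        unit : F.ν (suc k C k) ≢ F.0#
        unit e = suc<⇒∤ {p} {k} (ℕP.≤-<-trans l 4f<p) (F.ν-ker (suc k) (trans (cong F.ν (sym C≡)) e))
          where
          C≡ : suc k C k ≡ suc k
          C≡ = ℕP.*-cancelˡ-≡ _ _ (suc k) (begin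
            suc k ℕ.* (suc k C k)  ≡⟨ cong (suc k ℕ.*_) (choose k) ⟩
            suc k ℕ.* suc k ∎)
            where
            choose : ∀ k → suc k C k ≡ suc k
            choose zero = refl
            choose (suc k) = trans (sym (nCk+nC[k+1]≡[n+1]C[k+1] (suc k) k))
              (trans (cong₂ ℕ._+_ (choose k) (nCn≡1 (suc k))) (ℕP.+-comm (suc k) 1))


    mod-p : ∀ {a b} → F.ν a ≡ F.ν b → ∃ λ z → ν a ≡ ν b + P * z
    mod-p {a} {b} e with ℤS.∣ᵤ⇒∣ {+ p} {+ a ℤ.- + b} (F.ι-ker (+ a ℤ.- + b) (trans (F.ι-+ (+ a) (ℤ.- + b)) (trans (cong (λ z → F.ν a F.+ z) (F.ι-neg (+ b))) (F.x≡y⇒x-y≡0 e))))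
    ... | ℤS.divides q eq = ι q , (begin
      ν a                            ≡⟨ cong ι (sym (ab (+ a) (+ b))) ⟩
      ι (+ b ℤ.+ (+ a ℤ.- + b))      ≡⟨ ι-+ (+ b) (+ a ℤ.- + b) ⟩
      ν b + ι (+ a ℤ.- + b)          ≡⟨ cong (λ z → ν b + ι z) eq ⟩
      ν b + ι (q ℤ.* + p)            ≡⟨ cong (λ z → ν b + z) (trans (ι-* q (+ p)) (*-comm _ _)) ⟩
      ν b + P * ι q ∎)
      where
      open ≡-Reasoning
      ab : ∀ x y → y ℤ.+ (x ℤ.- y) ≡ x
      ab x y = trans (ℤP.+-comm y (x ℤ.- y)) (trans (ℤP.+-assoc x (ℤ.- y) y) (trans (cong (λ z → x ℤ.+ z) (ℤP.+-inverseˡ y)) (ℤP.+-identityʳ x)))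

    from-mod-p : ∀ {a b} z → ν a ≡ ν b + P * z → F.ν a ≡ F.ν b
    from-mod-p {a} {b} z e = trans (F.x-y≡0⇒x≡y (trans (cong (λ w → F.ν a F.+ w) (sym (F.ι-neg (+ (b ℕ.+ p ℕ.* c))))) (trans (sym (F.ι-+ (+ a) (ℤ.- + (b ℕ.+ p ℕ.* c))))
        (F.∣⇒ι≡0 (+ a ℤ.- + (b ℕ.+ p ℕ.* c)) (ℕD.∣-trans (ℕD.m∣m*n (p ℕ.* 1)) (ι-ker (+ a ℤ.- + (b ℕ.+ p ℕ.* c))
          (trans (ι-+ (+ a) (ℤ.- + (b ℕ.+ p ℕ.* c))) (trans (cong (λ w → ν a + w) (ι-neg (+ (b ℕ.+ p ℕ.* c)))) (x≡y⇒x-y≡0 (trans e eq))))))))))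
      (trans (F.ν-+ b (p ℕ.* c)) (trans (cong (λ w → F.ν b F.+ w) (F.∣⇒ν≡0 (ℕD.m∣m*n c))) (F.+-identityʳ _)))
      where
      c = rep z
      eq : ν b + P * z ≡ ν (b ℕ.+ p ℕ.* c)
      eq = sym (trans (ν-+ b (p ℕ.* c)) (cong (λ w → ν b + w) (trans (ν-* p c) (cong (P *_) (ν-rep z)))))

    power-+P : ∀ u v n → (u + P * v) ^ suc n ≡ u ^ suc n + P * (ν (suc n) * u ^ n * v)
    power-+P u v zero = solve 3 (λ u P v → (u :+ P :* v) :* :c 1 := u :* :c 1 :+ P :* (:c 1 :* :c 1 :* v)) refl u P v
    power-+P u v (suc n) = trans (cong ((u + P * v) *_) (power-+P u v n))
      (trans (drop0 PP (ν (suc n) * u ^ n * v * v) (solve 5 (λ u P v m w → (u :+ P :* v) :* (u :* w :+ P :* (m :* w :* v))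
          := u :* (u :* w) :+ P :* ((:c 1 :+ m) :* (u :* w) :* v) :+ P :* P :* (m :* w :* v :* v)) refl u P v (ν (suc n)) (u ^ n)))
        (cong (λ z → u ^ suc (suc n) + P * (z * u ^ suc n * v)) (sym (ν-suc (suc n)))))

    -- The first-order term of a p-th power carries the factor p · p. Hence x^p modulo p² depends
    -- only on x modulo p, which makes `T` independent of representatives.
    power-mod-p : ∀ {u v} → (∃ λ z → u ≡ v + P * z) → u ^ p ≡ v ^ p
    power-mod-p {u} {v} (z , refl) = trans (cong ((v + P * z) ^_) p≡) (trans (power-+P v z (4 ℕ.* f))
      (trans (drop0 PP (v ^ (4 ℕ.* f) * z) (trans (cong (λ q → v ^ suc (4 ℕ.* f) + P * (ν q * v ^ (4 ℕ.* f) * z)) (sym p≡))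
          (solve 4 (λ V P v z → V :+ P :* (P :* v :* z) := V :+ P :* P :* (v :* z)) refl (v ^ suc (4 ℕ.* f)) P _ z)))
        (cong (v ^_) (sym p≡))))

    -- To precision p², the Teichmüller representative is simply the p-th power of any lift.
    ℓ T : F.Carrier → Carrier
    ℓ x = ν (F.rep x)
    T x = ℓ x ^ p

    T-ν : ∀ n {x} → x ≡ F.ν n → T x ≡ ν n ^ p
    T-ν n {x} e = power-mod-p (mod-p {F.rep x} {n} (trans (F.ν-rep x) e))

    T-* : ∀ x y → T (x F.* y) ≡ T x * T y
    T-* x y = trans (T-ν (F.rep x ℕ.* F.rep y) (sym (trans (F.ν-* (F.rep x) (F.rep y)) (cong₂ F._*_ (F.ν-rep x) (F.ν-rep y)))))
      (trans (cong (_^ p) (ν-* (F.rep x) (F.rep y))) (^-distrib-* (ℓ x) (ℓ y) p))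

    T-0 : T F.0# ≡ 0#
    T-0 = trans (T-ν 0 refl) (trans (cong (0# ^_) p≡) (zeroˡ _))

    T-1 : T F.1# ≡ 1#
    T-1 = trans (T-ν 1 refl) (1^ p)

    T-mod-p : ∀ x → ∃ λ z → T x ≡ ℓ x + P * z
    T-mod-p x with mod-p {F.rep x ℕ.^ p} {F.rep x} (trans (F.ν-^ (F.rep x) p) (fermat (F.ν (F.rep x))))
    ... | z , e = z , trans (sym (ν-^ (F.rep x) p)) e

    T-rep : ∀ x → F.ν (rep (T x)) ≡ x
    T-rep x with T-mod-p x
    ... | z , e = trans (from-mod-p {rep (T x)} {F.rep x} z (trans (ν-rep (T x)) e)) (F.ν-rep x)

    PT : ∀ x → P * T x ≡ P * ℓ x
    PT x with T-mod-p x
    ... | z , e = trans (cong (P *_) e) (drop0 PP z (solve 3 (λ P l z → P :* (l :+ P :* z) := P :* l :+ P :* P :* z) refl P (ℓ x) z))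

    T-4f : ∀ {x} → x ≢ F.0# → T x ^ (4 ℕ.* f) ≡ 1#
    T-4f {x} ne = begin
      T x ^ (4 ℕ.* f)         ≡⟨ ^-assocʳ (ℓ x) p (4 ℕ.* f) ⟩
      ℓ x ^ (p ℕ.* (4 ℕ.* f)) ≡⟨ cong (ℓ x ^_) (ℕP.*-comm p (4 ℕ.* f)) ⟩
      ℓ x ^ (4 ℕ.* f ℕ.* p)   ≡⟨ sym (^-assocʳ (ℓ x) (4 ℕ.* f) p) ⟩
      (ℓ x ^ (4 ℕ.* f)) ^ p   ≡⟨ cong (_^ p) (sym (ν-^ (F.rep x) (4 ℕ.* f))) ⟩
      ν (F.rep x ℕ.^ (4 ℕ.* f)) ^ p ≡⟨ power-mod-p (mod-p {F.rep x ℕ.^ (4 ℕ.* f)} {1} (trans (F.ν-^ (F.rep x) (4 ℕ.* f)) (trans (cong (F._^ (4 ℕ.* f)) (F.ν-rep x)) (fermat-1 ne)))) ⟩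
      1# ^ p                  ≡⟨ 1^ p ⟩
      1# ∎
      where open ≡-Reasoning

    T-period : ∀ x n → 0 < n → T x ^ (n ℕ.+ 4 ℕ.* f) ≡ T x ^ n
    T-period x (suc n) _ with x F.≟ F.0#
    ... | yes refl = trans (cong (_* T F.0# ^ (n ℕ.+ 4 ℕ.* f)) T-0) (trans (zeroˡ _) (sym (trans (cong (_* T F.0# ^ n) T-0) (zeroˡ _))))
    ... | no ne = trans (^-homo-* (T x) (suc n) (4 ℕ.* f)) (trans (cong (T x ^ suc n *_) (T-4f ne)) (*-identityʳ _))

    unit-rep : ∀ x → p ∤ rep x → ∃ λ y → x * y ≡ 1#
    unit-rep x u with unit-ν u
    ... | y , e = y , trans (cong (_* y) (sym (ν-rep x))) e

    p∣rep : ∀ x → p ∣ rep x → ∃ λ z → x ≡ P * z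
    p∣rep x (divides q e) = ν q , trans (sym (ν-rep x)) (trans (cong ν (trans e (ℕP.*-comm q p))) (ν-* p q))

    τ : ℕ → Carrier
    τ N = Σ∀ (λ x → T x ^ N)

    -- If x^r = 1 held for all x ≠ 0, the sum of 1 - x^r over the field would be its single term 1
    -- at x = 0, yet both power sums vanish. This stands in for a primitive root.
    non-root : ∀ r → 0 < r → r < 4 ℕ.* f → ∃ λ x → x ≢ F.0# × x F.^ r ≢ F.1#
    non-root r 0<r r<4f with ℕP.anyUpTo? (λ i → ¬? (F.ν i F.≟ F.0#) ×-dec ¬? (F.ν i F.^ r F.≟ F.1#)) p
    ... | yes (i , _ , q) = F.ν i , q
    ... | no none = ⊥-elim (F-1≢0 (begin
        F.1#                                       ≡⟨ sym (trans (cong (λ z → F.1# F.- z) (0^ 0<r)) (F.solve 0 (F.:c 1 F.:- F.:c 0 F.:= F.:c 1) refl)) ⟩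
        F.1# F.- F.0# F.^ r                        ≡⟨ sym (FF.Σ∀-single F.0# (λ x → F.1# F.- x F.^ r) (λ x ne → trans (cong (λ z → F.1# F.- z) (root x ne)) (F.-‿inverseʳ _))) ⟩
        FF.Σ∀ (λ x → F.1# F.- x F.^ r)             ≡⟨ FF.Σ∀-+ (λ _ → F.1#) (λ x → F.- x F.^ r) ⟩
        FF.Σ∀ (λ _ → F.1#) F.+ FF.Σ∀ (λ x → F.- x F.^ r) ≡⟨ cong₂ F._+_ (FF.Σ∀-cong (λ _ → refl)) (trans (FF.Σ∀-cong (λ x → F.solve 1 (λ y → F.:- y F.:= F.:- F.:c 1 F.:* y) refl (x F.^ r))) (FF.Σ∀-*ˡ (F.- F.1#) (λ x → x F.^ r))) ⟩
        powerSum 0 F.+ (F.- F.1#) F.* powerSum r   ≡⟨ cong₂ (λ a b → a F.+ (F.- F.1#) F.* b) (powerSum-zero 0 0<4f) (powerSum-zero r r<4f) ⟩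
        F.0# F.+ (F.- F.1#) F.* F.0#               ≡⟨ F.solve 0 (F.:c 0 F.:+ (F.:- F.:c 1) F.:* F.:c 0 F.:= F.:c 0) refl ⟩
        F.0# ∎))
      where
      open ≡-Reasoning
      0^ : ∀ {r} → 0 < r → F.0# F.^ r ≡ F.0#
      0^ {suc r} _ = F.zeroˡ _
      root : ∀ x → x ≢ F.0# → x F.^ r ≡ F.1#
      root x ne = decidable-stable (x F.^ r F.≟ F.1#) (λ bad → none (F.rep x , F.rep< x ,
        subst (λ y → y ≢ F.0# × y F.^ r ≢ F.1#) (sym (F.ν-rep x)) (ne , bad)))

    -- Multiplying the argument by x₀ gives (T x₀^r - 1) τ r = 0, and with x₀^r ≠ 1 modulo p the
    -- first factor is a unit.
    τ-zero< : ∀ r → 0 < r → r < 4 ℕ.* f → τ r ≡ 0#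
    τ-zero< r 0<r r<4f with non-root r 0<r r<4f
    ... | x₀ , ne , nr = cancelʳ u v uv (trans (*-comm (τ r) u) (trans
        (trans (solve 2 (λ t s → (t :- :c 1) :* s := t :* s :- s) refl (T x₀ ^ r) (τ r))
          (x≡y⇒x-y≡0 (trans (sym (Σ∀-*ˡ (T x₀ ^ r) (λ x → T x ^ r)))
            (trans (Σ∀-cong (λ x → trans (sym (^-distrib-* (T x₀) (T x) r)) (cong (_^ r) (sym (T-* x₀ x)))))
              (Σ∀-reindex (x₀ F.*_) (y F.*_) (λ x → inverse x y x₀y) (λ x → inverse′ x) (λ x → T x ^ r))))))
        (sym (zeroˡ u))))
      where
      y = proj₁ (F-inverse ne)
      x₀y = proj₂ (F-inverse ne)
      inverse : ∀ x y → x₀ F.* y ≡ F.1# → x₀ F.* (y F.* x) ≡ x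
      inverse x y e = trans (sym (F.*-assoc x₀ y x)) (trans (cong (F._* x) e) (F.*-identityˡ x))
      inverse′ : ∀ x → y F.* (x₀ F.* x) ≡ x
      inverse′ x = trans (sym (F.*-assoc y x₀ x)) (trans (cong (F._* x) (trans (F.*-comm y x₀) x₀y)) (F.*-identityˡ x))
      u = T x₀ ^ r - 1#
      nonzero : p ∤ rep u
      nonzero d with p∣rep u d
      ... | z , e = nr (trans (cong (F._^ r) (sym (T-rep x₀))) (trans (sym (F.ν-^ (rep (T x₀)) r))
        (from-mod-p {rep (T x₀) ℕ.^ r} {1} z (trans (ν-^ (rep (T x₀)) r) (trans (cong (_^ r) (ν-rep (T x₀)))
          (trans (solve 1 (λ t → t := :c 1 :+ (t :- :c 1)) refl (T x₀ ^ r)) (cong (λ w → 1# + w) e)))))))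
      v = proj₁ (unit-rep u nonzero)
      uv = proj₂ (unit-rep u nonzero)

    τ-period : ∀ n q → 0 < n → τ (n ℕ.+ q ℕ.* (4 ℕ.* f)) ≡ τ n
    τ-period n zero _ = cong τ (ℕP.+-identityʳ n)
    τ-period n (suc q) l = trans (cong τ (trans (cong (n ℕ.+_) (ℕP.+-comm (4 ℕ.* f) (q ℕ.* (4 ℕ.* f)))) (sym (ℕP.+-assoc n _ _))))
      (trans (Σ∀-cong (λ x → T-period x (n ℕ.+ q ℕ.* (4 ℕ.* f)) (ℕP.≤-trans l (ℕP.m≤m+n n _)))) (τ-period n q l))

    τ-zero : ∀ N → (4 ℕ.* f) ∤ N → τ N ≡ 0#
    τ-zero N nd = trans (cong τ (m≡m%n+[m/n]*n N (4 ℕ.* f))) (trans (τ-period (N % (4 ℕ.* f)) (N / (4 ℕ.* f)) pos) (τ-zero< _ pos (m%n<n N (4 ℕ.* f))))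
      where
      instance
        4f≢0 : NonZero (4 ℕ.* f)
        4f≢0 = ℕ.>-nonZero 0<4f
      pos : 0 < N % (4 ℕ.* f)
      pos = ℕP.n≢0⇒n>0 (λ e → nd (ℕD.m%n≡0⇒n∣m N (4 ℕ.* f) e))

    -- Each nonzero residue contributes 1 and the zero residue contributes 0, whence p - 1 and not
    -- p.
    τ-full : ∀ q → τ (4 ℕ.* f ℕ.+ q ℕ.* (4 ℕ.* f)) ≡ P - 1#
    τ-full q = begin
      τ (4 ℕ.* f ℕ.+ q ℕ.* (4 ℕ.* f)) ≡⟨ τ-period (4 ℕ.* f) q 0<4f ⟩
      τ (4 ℕ.* f)                     ≡⟨ solve 2 (λ t o → t := o :- (o :+ (:- :c 1) :* t)) refl (τ (4 ℕ.* f)) (Σ∀ (λ _ → 1#)) ⟩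
      Σ∀ (λ _ → 1#) - (Σ∀ (λ _ → 1#) + (- 1#) * τ (4 ℕ.* f))
        ≡⟨ cong₂ _-_ (Σ1 p) (trans (cong (λ z → Σ∀ (λ _ → 1#) + z) (sym (Σ∀-*ˡ (- 1#) (λ x → T x ^ (4 ℕ.* f))))) (sym (Σ∀-+ (λ _ → 1#) (λ x → (- 1#) * T x ^ (4 ℕ.* f))))) ⟩
      P - Σ∀ (λ x → 1# + (- 1#) * T x ^ (4 ℕ.* f))
        ≡⟨ cong (λ z → P - z) (Σ∀-single F.0# _ (λ x ne → trans (cong (λ z → 1# + (- 1#) * z) (T-4f ne)) (solve 0 (:c 1 :+ (:- :c 1) :* :c 1 := :c 0) refl))) ⟩
      P - (1# + (- 1#) * T F.0# ^ (4 ℕ.* f))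
        ≡⟨ cong (λ z → P - (1# + (- 1#) * z)) (zero-power 0<4f) ⟩
      P - (1# + (- 1#) * 0#)
        ≡⟨ solve 1 (λ P → P :- (:c 1 :+ (:- :c 1) :* :c 0) := P :- :c 1) refl P ⟩
      P - 1# ∎
      where
      open ≡-Reasoning
      Σ1 : ∀ n → Σ< n (λ _ → 1#) ≡ ν n
      Σ1 zero = refl
      Σ1 (suc n) = trans (cong (_+ 1#) (Σ1 n)) (trans (+-comm _ _) (sym (ν-suc n)))
      zero-power : ∀ {n} → 0 < n → T F.0# ^ n ≡ 0#
      zero-power {suc n} _ = trans (cong (_* T F.0# ^ n) T-0) (zeroˡ _)

    -- (1 - x)^p = 1 - x^p - p Σ x^κ/κ modulo p²
    L : F.Carrier → Carrier
    L x = Σ< (4 ℕ.* f) (λ k → inv (suc k) * T x ^ suc k)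

    T-1- : ∀ x → T (F.1# F.- x) ≡ 1# - T x - P * L x
    T-1- x = begin
      T (F.1# F.- x)
        ≡⟨ cong (λ z → T (F.1# F.+ z)) (F.solve 1 (λ x → F.:- x F.:= (F.:- F.:c 1) F.:* x) refl x) ⟩
      T (F.1# F.+ (F.- F.1#) F.* x)
        -- As 4f = p - 1 is -1 modulo p, this natural number represents 1 - x without subtraction.
        ≡⟨ T-ν (1 ℕ.+ 4 ℕ.* f ℕ.* F.rep x) lift ⟩
      ν (1 ℕ.+ 4 ℕ.* f ℕ.* F.rep x) ^ p
        ≡⟨ power-mod-p {v = 1# + y} (ℓ x , (trans (ν-+ 1 (4 ℕ.* f ℕ.* F.rep x)) (trans (cong (λ z → 1# + z) (trans (ν-* (4 ℕ.* f) (F.rep x)) (cong (_* ℓ x) 4f≡)))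
             (solve 2 (λ P l → :c 1 :+ (P :- :c 1) :* l := :c 1 :+ (:- :c 1) :* l :+ P :* l) refl P (ℓ x))))) ⟩
      (1# + y) ^ p
        ≡⟨ binomial p y ⟩
      Σ< p g + g p
        ≡⟨ cong₂ (λ a b → a + b) (trans (cong (λ q → Σ< q g) p≡) (Σ-first (4 ℕ.* f) g)) top ⟩
      g 0 + Σ< (4 ℕ.* f) (λ k → g (suc k)) + - T x
        ≡⟨ cong (λ z → g 0 + z + - T x) (trans (Σ-cong (4 ℕ.* f) middle) (Σ-*ˡ (4 ℕ.* f) (- P) (λ k → inv (suc k) * T x ^ suc k))) ⟩
      1# * 1# + (- P) * L x + - T x
        ≡⟨ solve 3 (λ P L t → :c 1 :* :c 1 :+ (:- P) :* L :+ :- t := :c 1 :- t :- P :* L) refl P (L x) (T x) ⟩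
      1# - T x - P * L x ∎
      where
      open ≡-Reasoning
      y = (- 1#) * ℓ x
      g : ℕ → Carrier
      g k = ν (p C k) * y ^ k
      4f≡ : ν (4 ℕ.* f) ≡ P - 1#
      4f≡ = trans (solve 1 (λ z → z := :c 1 :+ z :- :c 1) refl (ν (4 ℕ.* f))) (cong (_- 1#) (trans (sym (ν-suc (4 ℕ.* f))) (cong ν (sym p≡))))
      lift : F.1# F.+ (F.- F.1#) F.* x ≡ F.ν (1 ℕ.+ 4 ℕ.* f ℕ.* F.rep x)
      lift = sym (trans (F.ν-+ 1 (4 ℕ.* f ℕ.* F.rep x)) (cong (λ z → F.1# F.+ z) (trans (F.ν-* (4 ℕ.* f) (F.rep x)) (cong₂ F._*_ F4f (F.ν-rep x)))))
        where
        F4f : F.ν (4 ℕ.* f) ≡ F.- F.1#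
        F4f = trans (F.solve 1 (λ z → z F.:= (F.:c 1 F.:+ z) F.:- F.:c 1) refl (F.ν (4 ℕ.* f)))
          (trans (cong (F._- F.1#) (trans (sym (F.ν-suc (4 ℕ.* f))) (trans (cong F.ν (sym p≡)) F.νM))) (F.+-identityˡ _))
      -1^p : (- 1#) ^ p ≡ - 1#
      -1^p = trans (cong ((- 1#) ^_) p≡) (trans (cong ((- 1#) *_) (evenPower f)) (*-identityʳ _))
      top : g p ≡ - T x
      top = trans (cong (λ z → ν z * y ^ p) (nCn≡1 p)) (trans (*-identityˡ _) (trans (^-distrib-* (- 1#) (ℓ x) p)
        (trans (cong (_* T x) -1^p) (solve 1 (λ t → (:- :c 1) :* t := :- t) refl (T x)))))
      alternating : ∀ k → suc k < p → P * ν ((4 ℕ.* f) C k) ≡ P * (- 1#) ^ k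
      alternating zero _ = refl
      alternating (suc k) l = begin
        P * ν ((4 ℕ.* f) C suc k)
          ≡⟨ solve 3 (λ P a b → P :* b := P :* (a :+ b) :- P :* a) refl P (ν ((4 ℕ.* f) C k)) _ ⟩
        P * (ν ((4 ℕ.* f) C k) + ν ((4 ℕ.* f) C suc k)) - P * ν ((4 ℕ.* f) C k)
          ≡⟨ cong₂ (λ a b → P * a - b) (trans (sym (ν-+ ((4 ℕ.* f) C k) _)) (cong ν (trans (nCk+nC[k+1]≡[n+1]C[k+1] (4 ℕ.* f) k) (cong (_C suc k) (sym p≡))))) (alternating k l′) ⟩
        P * ν (p C suc k) - P * (- 1#) ^ k
          ≡⟨ cong (_- P * (- 1#) ^ k) (P∣ (p∣C l′)) ⟩
        0# - P * (- 1#) ^ k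
          ≡⟨ solve 2 (λ P s → :c 0 :- P :* s := P :* ((:- :c 1) :* s)) refl P ((- 1#) ^ k) ⟩
        P * (- 1#) ^ suc k ∎
        where
        l′ = ℕP.<-trans (ℕP.n<1+n (suc k)) l
        P∣ : ∀ {m} → p ∣ m → P * ν m ≡ 0#
        P∣ (divides q refl) = trans (cong (P *_) (ν-* q p)) (trans (solve 2 (λ P q → P :* (q :* P) := P :* P :* q) refl P (ν q)) (trans (cong (_* ν q) PP) (zeroˡ _)))
      -- From C(p, k+1) = p/(k+1) · C(p-1, k) and C(p-1, k) ≡ (-1)^k modulo p. The factor p also
      -- permits replacing the lift `ℓ x` by `T x`.
      middle : ∀ k → k < 4 ℕ.* f → g (suc k) ≡ (- P) * (inv (suc k) * T x ^ suc k)
      middle k l = begin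
        ν (p C suc k) * y ^ suc k
          ≡⟨ cong (_* y ^ suc k) coefficient ⟩
        inv (suc k) * (P * (- 1#) ^ k) * y ^ suc k
          ≡⟨ cong (inv (suc k) * (P * (- 1#) ^ k) *_) (^-distrib-* (- 1#) (ℓ x) (suc k)) ⟩
        inv (suc k) * (P * (- 1#) ^ k) * ((- 1#) * (- 1#) ^ k * ℓ x ^ suc k)
          ≡⟨ solve 4 (λ i P s l → i :* (P :* s) :* ((:- :c 1) :* s :* l) := (:- P) :* (i :* l) :* (s :* s)) refl (inv (suc k)) P ((- 1#) ^ k) (ℓ x ^ suc k) ⟩
        (- P) * (inv (suc k) * ℓ x ^ suc k) * ((- 1#) ^ k * (- 1#) ^ k)
          ≡⟨ cong ((- P) * (inv (suc k) * ℓ x ^ suc k) *_) (trans (sym (^-distrib-* (- 1#) (- 1#) k)) (trans (cong (_^ k) (solve 0 ((:- :c 1) :* (:- :c 1) := :c 1) refl)) (1^ k))) ⟩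
        (- P) * (inv (suc k) * ℓ x ^ suc k) * 1#
          ≡⟨ solve 3 (λ P i l → (:- P) :* (i :* l) :* :c 1 := (:- i) :* (P :* l)) refl P (inv (suc k)) (ℓ x ^ suc k) ⟩
        (- inv (suc k)) * (P * ℓ x ^ suc k)
          ≡⟨ cong ((- inv (suc k)) *_) (sym (PT^ (suc k))) ⟩
        (- inv (suc k)) * (P * T x ^ suc k)
          ≡⟨ solve 3 (λ P i l → (:- i) :* (P :* l) := (:- P) :* (i :* l)) refl P (inv (suc k)) (T x ^ suc k) ⟩
        (- P) * (inv (suc k) * T x ^ suc k) ∎
        where
        sk<p : suc k < p
        sk<p = ℕP.≤-<-trans l 4f<p
        PT^ : ∀ n → P * T x ^ n ≡ P * ℓ x ^ n
        PT^ zero = refl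
        PT^ (suc n) = begin
          P * (T x * T x ^ n)  ≡⟨ solve 3 (λ P t u → P :* (t :* u) := t :* (P :* u)) refl P (T x) (T x ^ n) ⟩
          T x * (P * T x ^ n)  ≡⟨ cong (T x *_) (PT^ n) ⟩
          T x * (P * ℓ x ^ n)  ≡⟨ solve 3 (λ P t u → t :* (P :* u) := P :* t :* u) refl P (T x) (ℓ x ^ n) ⟩
          P * T x * ℓ x ^ n    ≡⟨ cong (_* ℓ x ^ n) (PT x) ⟩
          P * ℓ x * ℓ x ^ n    ≡⟨ *-assoc _ _ _ ⟩
          P * (ℓ x * ℓ x ^ n) ∎
        coefficient : ν (p C suc k) ≡ inv (suc k) * (P * (- 1#) ^ k)
        coefficient = begin
          ν (p C suc k)                                 ≡⟨ trans (sym (*-identityˡ _)) (cong (_* ν (p C suc k)) (sym (ν-inv (suc<⇒∤ sk<p)))) ⟩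
          ν (suc k) * inv (suc k) * ν (p C suc k)       ≡⟨ solve 3 (λ k i c → k :* i :* c := i :* (k :* c)) refl (ν (suc k)) (inv (suc k)) _ ⟩
          inv (suc k) * (ν (suc k) * ν (p C suc k))     ≡⟨ cong (inv (suc k) *_) (trans (sym (ν-* (suc k) (p C suc k))) (trans (cong ν (trans (cong (λ q → suc k ℕ.* (q C suc k)) p≡) (trans (suc-*-C (4 ℕ.* f) k) (cong (ℕ._* ((4 ℕ.* f) C k)) (sym p≡))))) (ν-* p ((4 ℕ.* f) C k)))) ⟩
          inv (suc k) * (P * ν ((4 ℕ.* f) C k))         ≡⟨ cong (inv (suc k) *_) (alternating k sk<p) ⟩
          inv (suc k) * (P * (- 1#) ^ k) ∎

-- Quartic Jacobi sums modulo p²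

module JacobiSum where

  open RingKit
  open ZMod
  open Local
  open Factorials
  open Teichmuller
  open import Data.Nat as ℕ using (ℕ; zero; suc; _<_; _!)
  import Data.Nat.Properties as ℕP
  import Data.Nat.Solver as ℕS
  open import Data.Nat.Combinatorics using (_C_; nCk+nC[k+1]≡[n+1]C[k+1]; nCn≡1; nCk≡nC[n∸k])
  open import Data.Nat.Divisibility as ℕD using (_∣_; _∤_; divides)
  open import Data.Nat.Primality using (Prime)
  open import Data.Empty using (⊥-elim)
  open import Relation.Binary.PropositionalEquality
  open import Relation.Binary.Definitions using (tri<; tri≈; tri>)

  C-factorials : ∀ a b → ((a ℕ.+ b) C a) ℕ.* (a ! ℕ.* b !) ≡ (a ℕ.+ b) !
  C-factorials zero b = trans (ℕP.*-identityˡ _) (ℕP.*-identityˡ _)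
  C-factorials (suc a) b = begin
    c ℕ.* (suc a ℕ.* a ! ℕ.* b !)           ≡⟨ solveℕ 4 (λ c a x y → c :* (a :* x :* y) := (a :* c) :* (x :* y)) refl c (suc a) (a !) (b !) ⟩
    suc a ℕ.* c ℕ.* (a ! ℕ.* b !)           ≡⟨ cong (ℕ._* (a ! ℕ.* b !)) (suc-*-C (a ℕ.+ b) a) ⟩
    suc (a ℕ.+ b) ℕ.* ((a ℕ.+ b) C a) ℕ.* (a ! ℕ.* b !) ≡⟨ ℕP.*-assoc (suc (a ℕ.+ b)) ((a ℕ.+ b) C a) (a ! ℕ.* b !) ⟩
    suc (a ℕ.+ b) ℕ.* (((a ℕ.+ b) C a) ℕ.* (a ! ℕ.* b !)) ≡⟨ cong (suc (a ℕ.+ b) ℕ.*_) (C-factorials a b) ⟩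
    suc (a ℕ.+ b) ! ∎
    where
    open ≡-Reasoning
    open ℕS.+-*-Solver renaming (solve to solveℕ)
    c = suc (a ℕ.+ b) C suc a

  C-upper : ∀ r m → suc r ℕ.* ((m ℕ.+ suc r) C m) ≡ (m ℕ.+ suc r) ℕ.* ((m ℕ.+ r) C m)
  C-upper r m = begin
    suc r ℕ.* ((m ℕ.+ suc r) C m)              ≡⟨ cong (suc r ℕ.*_) (symmetric m (suc r)) ⟩
    suc r ℕ.* ((m ℕ.+ suc r) C suc r)          ≡⟨ cong (λ n → suc r ℕ.* (n C suc r)) (ℕP.+-suc m r) ⟩
    suc r ℕ.* (suc (m ℕ.+ r) C suc r)          ≡⟨ suc-*-C (m ℕ.+ r) r ⟩
    suc (m ℕ.+ r) ℕ.* ((m ℕ.+ r) C r)          ≡⟨ cong₂ ℕ._*_ (sym (ℕP.+-suc m r)) (sym (symmetric m r)) ⟩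
    (m ℕ.+ suc r) ℕ.* ((m ℕ.+ r) C m) ∎
    where
    open ≡-Reasoning
    symmetric : ∀ m r → ((m ℕ.+ r) C m) ≡ ((m ℕ.+ r) C r)
    symmetric m r = trans (nCk≡nC[n∸k] (ℕP.m≤m+n m r)) (cong ((m ℕ.+ r) C_) (ℕP.m+n∸m≡n m r))

  module JacobiSums (p : ℕ) (pr : Prime p) (g : ℕ) (p≡ : p ≡ suc (4 ℕ.* suc g))
    (F : Quotient p) (R : Quotient (p ℕ.^ 2)) where
    private
      module F = Quotient F
      f : ℕ
      f = suc g
    open Quotient R
    open TeichmullerSums p pr f p≡ (ℕ.s≤s ℕ.z≤n) F R
    open ShiftedFactorials p pr R hiding (P²)

    private
      b : ℕ
      b = f ℕ.+ g

      2f≡ : 2 ℕ.* f ≡ suc b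
      2f≡ = trans (cong (f ℕ.+_) (ℕP.+-identityʳ f)) (ℕP.+-suc f g)

      sgn : ℕ → Carrier
      sgn k = (- 1#) ^ k

      sgn² : ∀ k → sgn k * sgn k ≡ 1#
      sgn² k = trans (sym (^-distrib-* (- 1#) (- 1#) k)) (trans (cong (_^ k) (solve 0 ((:- :c 1) :* (:- :c 1) := :c 1) refl)) (1^ k))

      b<p : ∀ {k} → k ℕ.≤ 4 ℕ.* f → k < p
      b<p l = ℕP.≤-<-trans l 4f<p

    -- [t^k] (1-t)^n
    co : ℕ → ℕ → Carrier
    co n k = ν (n C k) * sgn k

    1-T^ : ∀ n x → (1# - T x) ^ n ≡ Σ< (suc n) (λ k → co n k * T x ^ k)
    1-T^ n x = trans (cong (_^ n) (solve 1 (λ t → :c 1 :- t := :c 1 :+ (:- :c 1) :* t) refl (T x)))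
      (trans (binomial n ((- 1#) * T x)) (Σ-cong (suc n) (λ k _ →
        trans (cong (ν (n C k) *_) (^-distrib-* (- 1#) (T x) k)) (sym (*-assoc _ _ _)))))

    -- A window of 4f consecutive exponents contains just one multiple of 4f; this isolates the
    -- single power sum that survives in an expansion.
    4f∣-unique : ∀ N {i j} → i < 4 ℕ.* f → j < 4 ℕ.* f → 4 ℕ.* f ∣ (N ℕ.+ suc i) → 4 ℕ.* f ∣ (N ℕ.+ suc j) → i ≡ j
    4f∣-unique N {i} {j} li lj di dj with ℕP.<-cmp i j
    ... | tri≈ _ e _ = e
    ... | tri< i<j _ _ = ⊥-elim (impossible i<j lj di dj)
      where
      impossible : ∀ {i j} → i < j → j < 4 ℕ.* f → 4 ℕ.* f ∣ (N ℕ.+ suc i) → 4 ℕ.* f ∣ (N ℕ.+ suc j) → Data.Empty.⊥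
      impossible {i} {j} i<j lj di dj = ℕP.<⇒≱ (ℕP.≤-<-trans (ℕP.m∸n≤m j i) lj) (ℕD.∣⇒≤ {{ℕ.>-nonZero (ℕP.m<n⇒0<n∸m i<j)}}
        (ℕD.∣m+n∣m⇒∣n (subst (4 ℕ.* f ∣_) (trans (cong (λ z → N ℕ.+ suc z) (sym (ℕP.m+[n∸m]≡n (ℕP.<⇒≤ i<j)))) (sym (ℕP.+-assoc N (suc i) (j ℕ.∸ i)))) dj) di))
    ... | tri> _ _ j<i = sym (4f∣-unique′ j<i)
      where
      4f∣-unique′ : j < i → j ≡ i
      4f∣-unique′ j<i = ⊥-elim (ℕP.<⇒≱ (ℕP.≤-<-trans (ℕP.m∸n≤m i j) li) (ℕD.∣⇒≤ {{ℕ.>-nonZero (ℕP.m<n⇒0<n∸m j<i)}}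
        (ℕD.∣m+n∣m⇒∣n (subst (4 ℕ.* f ∣_) (trans (cong (λ z → N ℕ.+ suc z) (sym (ℕP.m+[n∸m]≡n (ℕP.<⇒≤ j<i)))) (sym (ℕP.+-assoc N (suc j) (i ℕ.∸ j)))) di) dj)))

    ΣTL : ℕ → Carrier
    ΣTL N = Σ∀ (λ x → T x ^ N * L x)

    ΣTL-value : ∀ N κ q → κ < 4 ℕ.* f → N ℕ.+ suc κ ≡ suc q ℕ.* (4 ℕ.* f) → ΣTL N ≡ inv (suc κ) * (P - 1#)
    ΣTL-value N κ q l e = begin
      Σ∀ (λ x → T x ^ N * L x)
        ≡⟨ Σ∀-cong (λ x → trans (sym (Σ-*ˡ (4 ℕ.* f) (T x ^ N) _)) (Σ-cong (4 ℕ.* f) (λ k _ → trans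
             (solve 3 (λ t i u → t :* (i :* u) := i :* (t :* u)) refl (T x ^ N) (inv (suc k)) (T x ^ suc k))
             (cong (inv (suc k) *_) (sym (^-homo-* (T x) N (suc k))))))) ⟩
      Σ∀ (λ x → Σ< (4 ℕ.* f) (λ k → inv (suc k) * T x ^ (N ℕ.+ suc k)))
        ≡⟨ trans (Σ∀-Σ< (4 ℕ.* f) (λ x k → inv (suc k) * T x ^ (N ℕ.+ suc k))) (Σ-cong (4 ℕ.* f) (λ k _ → Σ∀-*ˡ (inv (suc k)) (λ x → T x ^ (N ℕ.+ suc k)))) ⟩
      Σ< (4 ℕ.* f) (λ k → inv (suc k) * τ (N ℕ.+ suc k))
        ≡⟨ Σ-single (4 ℕ.* f) κ _ l (λ i il ne → trans (cong (inv (suc i) *_) (τ-zero (N ℕ.+ suc i)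
             (λ d → ne (4f∣-unique N il l d (divides (suc q) e))))) (zeroʳ _)) ⟩
      inv (suc κ) * τ (N ℕ.+ suc κ)
        ≡⟨ cong (inv (suc κ) *_) (trans (cong τ e) (τ-full q)) ⟩
      inv (suc κ) * (P - 1#) ∎
      where open ≡-Reasoning

    -- For a = f and a = 3f these are the residues of the Jacobi sum J(χ, χ²) and of its complex
    -- conjugate, where χ(x) corresponds to T(x)^f.
    W : ℕ → Carrier
    W a = Σ∀ (λ x → T x ^ a * T (F.1# F.- x) ^ (2 ℕ.* f))

    -- T(1 - x) = 1 - T x - p L x raised to the power 2f: the first sum is the part of order zero in
    -- p, the second the derivative term with (1 - T x)^(2f-1) L x, where b = 2f - 1.
    W-expand : ∀ a → W a ≡ Σ< (suc (2 ℕ.* f)) (λ k → co (2 ℕ.* f) k * τ (a ℕ.+ k))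
      - P * ν (2 ℕ.* f) * Σ< (suc b) (λ k → co b k * ΣTL (a ℕ.+ k))
    W-expand a = begin
      W a
        ≡⟨ Σ∀-cong (λ x → trans (cong (T x ^ a *_) (second x))
             (solve 5 (λ t u P v w → t :* (u :+ (:- P) :* (v :* w)) := t :* u :+ (:- (P :* v)) :* (t :* w)) refl (T x ^ a) ((1# - T x) ^ (2 ℕ.* f)) P (ν (2 ℕ.* f)) _)) ⟩
      Σ∀ (λ x → T x ^ a * (1# - T x) ^ (2 ℕ.* f) + - (P * ν (2 ℕ.* f)) * (T x ^ a * ((1# - T x) ^ b * L x)))
        ≡⟨ trans (Σ∀-+ (λ x → T x ^ a * (1# - T x) ^ (2 ℕ.* f)) (λ x → - (P * ν (2 ℕ.* f)) * (T x ^ a * ((1# - T x) ^ b * L x))))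
               (cong (λ z → Σ∀ (λ x → T x ^ a * (1# - T x) ^ (2 ℕ.* f)) + z) (Σ∀-*ˡ (- (P * ν (2 ℕ.* f))) (λ x → T x ^ a * ((1# - T x) ^ b * L x)))) ⟩
      Σ∀ (λ x → T x ^ a * (1# - T x) ^ (2 ℕ.* f)) + - (P * ν (2 ℕ.* f)) * Σ∀ (λ x → T x ^ a * ((1# - T x) ^ b * L x))
        ≡⟨ cong₂ (λ u v → u + - (P * ν (2 ℕ.* f)) * v) first third ⟩
      A + - (P * ν (2 ℕ.* f)) * B
        ≡⟨ cong (λ z → A + z) (sym (-‿distribˡ-* (P * ν (2 ℕ.* f)) B)) ⟩
      A - P * ν (2 ℕ.* f) * B ∎
      where
      open ≡-Reasoning
      A = Σ< (suc (2 ℕ.* f)) (λ k → co (2 ℕ.* f) k * τ (a ℕ.+ k))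
      B = Σ< (suc b) (λ k → co b k * ΣTL (a ℕ.+ k))
      second : ∀ x → T (F.1# F.- x) ^ (2 ℕ.* f) ≡ (1# - T x) ^ (2 ℕ.* f) + (- P) * (ν (2 ℕ.* f) * ((1# - T x) ^ b * L x))
      second x = begin
        T (F.1# F.- x) ^ (2 ℕ.* f)  ≡⟨ cong₂ _^_ (T-1- x) 2f≡ ⟩
        (1# - T x - P * L x) ^ suc b ≡⟨ cong (_^ suc b) (solve 3 (λ u P l → u :- P :* l := u :+ P :* (:- l)) refl (1# - T x) P (L x)) ⟩
        (1# - T x + P * (- L x)) ^ suc b ≡⟨ power-+P (1# - T x) (- L x) b ⟩
        (1# - T x) ^ suc b + P * (ν (suc b) * (1# - T x) ^ b * (- L x))
          ≡⟨ solve 5 (λ w P n u l → w :+ P :* (n :* u :* (:- l)) := w :+ (:- P) :* (n :* (u :* l))) refl ((1# - T x) ^ suc b) P (ν (suc b)) ((1# - T x) ^ b) (L x) ⟩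
        (1# - T x) ^ suc b + (- P) * (ν (suc b) * ((1# - T x) ^ b * L x))
          ≡⟨ cong (λ k → (1# - T x) ^ k + (- P) * (ν k * ((1# - T x) ^ b * L x))) (sym 2f≡) ⟩
        (1# - T x) ^ (2 ℕ.* f) + (- P) * (ν (2 ℕ.* f) * ((1# - T x) ^ b * L x)) ∎
      first : Σ∀ (λ x → T x ^ a * (1# - T x) ^ (2 ℕ.* f)) ≡ A
      first = trans (Σ∀-cong (λ x → trans (cong (T x ^ a *_) (1-T^ (2 ℕ.* f) x)) (trans (sym (Σ-*ˡ (suc (2 ℕ.* f)) (T x ^ a) _))
          (Σ-cong (suc (2 ℕ.* f)) (λ k _ → trans (solve 3 (λ t c u → t :* (c :* u) := c :* (t :* u)) refl (T x ^ a) (co (2 ℕ.* f) k) (T x ^ k))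
            (cong (co (2 ℕ.* f) k *_) (sym (^-homo-* (T x) a k))))))))
        (trans (Σ∀-Σ< (suc (2 ℕ.* f)) (λ x k → co (2 ℕ.* f) k * T x ^ (a ℕ.+ k))) (Σ-cong (suc (2 ℕ.* f)) (λ k _ → Σ∀-*ˡ (co (2 ℕ.* f) k) (λ x → T x ^ (a ℕ.+ k)))))
      third : Σ∀ (λ x → T x ^ a * ((1# - T x) ^ b * L x)) ≡ B
      third = trans (Σ∀-cong (λ x → trans (solve 3 (λ t u l → t :* (u :* l) := (t :* l) :* u) refl (T x ^ a) _ (L x))
          (trans (cong (T x ^ a * L x *_) (1-T^ b x)) (trans (sym (Σ-*ˡ (suc b) (T x ^ a * L x) _))
          (Σ-cong (suc b) (λ k _ → trans (solve 4 (λ t l c u → t :* l :* (c :* u) := c :* (t :* u :* l)) refl (T x ^ a) (L x) (co b k) (T x ^ k))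
            (cong (λ z → co b k * (z * L x)) (sym (^-homo-* (T x) a k)))))))))
        (trans (Σ∀-Σ< (suc b) (λ x k → co b k * (T x ^ (a ℕ.+ k) * L x))) (Σ-cong (suc b) (λ k _ → Σ∀-*ˡ (co b k) (λ x → T x ^ (a ℕ.+ k) * L x))))


    -- The Beta integral of t^y (1 - t)^m: expanding the power gives the sum, and the value is
    -- m!/((y+1)...(y+m+1)). The induction is B(y, m+1) = B(y, m) - B(y+1, m).
    beta : ∀ m y → m ℕ.+ suc y < p →
      Σ< (suc m) (λ j → co m j * inv (suc (y ℕ.+ j))) * Π< (suc m) (λ i → ν (suc (y ℕ.+ i))) ≡ ν (m !)
    beta zero y l = trans (solve 2 (λ i n → (:c 0 :+ :c 1 :* :c 1 :* i) :* (:c 1 :* n) := n :* i) refl (inv (suc (y ℕ.+ 0))) (ν (suc (y ℕ.+ 0))))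
      (ν-inv (subst (λ z → p ∤ suc z) (sym (ℕP.+-identityʳ y)) (suc<⇒∤ l)))
    beta (suc m) y l = begin
      S (suc m) y * (Π m y * ν (suc (y ℕ.+ suc m)))
        ≡⟨ cong (_* (Π m y * ν (suc (y ℕ.+ suc m)))) pascal ⟩
      (S m y - S m (suc y)) * (Π m y * t)
        ≡⟨ solve 4 (λ a b c d → (a :- b) :* (c :* d) := a :* c :* d :- b :* (c :* d)) refl (S m y) (S m (suc y)) (Π m y) t ⟩
      S m y * Π m y * t - S m (suc y) * (Π m y * t)
        ≡⟨ cong₂ (λ u v → u * t - S m (suc y) * v) (beta m y (ℕP.<-trans (ℕP.n<1+n _) l)) Πshift ⟩
      ν (m !) * t - S m (suc y) * (Π m (suc y) * ν (suc y))
        ≡⟨ cong (λ z → ν (m !) * t - z) (trans (sym (*-assoc _ _ _)) (cong (_* ν (suc y)) (beta m (suc y) (subst (_< p) (sym (ℕP.+-suc m (suc y))) l)))) ⟩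
      ν (m !) * t - ν (m !) * ν (suc y)
        ≡⟨ cong (λ z → ν (m !) * z - ν (m !) * ν (suc y)) (ν-+ (suc y) (suc m)) ⟩
      ν (m !) * (ν (suc y) + ν (suc m)) - ν (m !) * ν (suc y)
        ≡⟨ solve 3 (λ a y m → a :* (y :+ m) :- a :* y := m :* a) refl (ν (m !)) (ν (suc y)) (ν (suc m)) ⟩
      ν (suc m) * ν (m !)
        ≡⟨ sym (ν-* (suc m) (m !)) ⟩
      ν (suc m !) ∎
      where
      open ≡-Reasoning
      t = ν (suc (y ℕ.+ suc m))
      S Π : ℕ → ℕ → Carrier
      S m y = Σ< (suc m) (λ j → co m j * inv (suc (y ℕ.+ j)))
      Π m y = Π< (suc m) (λ i → ν (suc (y ℕ.+ i)))
      Πshift : Π m y * t ≡ Π m (suc y) * ν (suc y)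
      Πshift = trans (Π-first (suc m) (λ i → ν (suc (y ℕ.+ i)))) (trans (*-comm _ _) (cong₂ _*_
        (Π-cong (suc m) (λ i _ → cong (λ z → ν (suc z)) (ℕP.+-suc y i))) (cong (λ z → ν (suc z)) (ℕP.+-identityʳ y))))
      pascal : S (suc m) y ≡ S m y - S m (suc y)
      pascal = begin
        Σ< (suc (suc m)) (λ j → co (suc m) j * i j)
          ≡⟨ Σ-first (suc m) _ ⟩
        co (suc m) 0 * i 0 + Σ< (suc m) (λ j → co (suc m) (suc j) * i (suc j))
          ≡⟨ cong (λ z → co (suc m) 0 * i 0 + z) (trans (Σ-cong (suc m) (λ j _ → trans
               (cong (λ z → z * sgn (suc j) * i (suc j)) (trans (cong ν (sym (nCk+nC[k+1]≡[n+1]C[k+1] m j))) (ν-+ (m C j) _)))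
               (solve 4 (λ a b s i → (a :+ b) :* ((:- :c 1) :* s) :* i := b :* ((:- :c 1) :* s) :* i :+ (:- :c 1) :* (a :* s :* i)) refl (ν (m C j)) (ν (m C suc j)) (sgn j) (i (suc j)))))
               (trans (Σ-+ (suc m) _ _) (cong (λ z → Σ< (suc m) (λ j → co m (suc j) * i (suc j)) + z) (Σ-*ˡ (suc m) (- 1#) _)))) ⟩
        co (suc m) 0 * i 0 + (Σ< (suc m) (λ j → co m (suc j) * i (suc j)) + (- 1#) * Σ< (suc m) (λ j → co m j * i (suc j)))
          ≡⟨ solve 3 (λ a b c → a :+ (b :+ (:- :c 1) :* c) := (a :+ b) :- c) refl (co (suc m) 0 * i 0) _ _ ⟩
        (co m 0 * i 0 + Σ< (suc m) (λ j → co m (suc j) * i (suc j))) - Σ< (suc m) (λ j → co m j * i (suc j))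
          ≡⟨ cong₂ _-_ (trans (sym (Σ-first (suc m) (λ j → co m j * i j))) (trans (cong (λ z → Σ< (suc m) (λ j → co m j * i j) + z)
               (trans (cong (λ z → ν z * sgn (suc m) * i (suc m)) (k>n⇒nCk≡0 (ℕP.n<1+n m))) (solve 2 (λ s i → :c 0 :* s :* i := :c 0) refl (sgn (suc m)) (i (suc m))))) (+-identityʳ _)))
               (Σ-cong (suc m) (λ j _ → cong (λ z → co m j * inv (suc z)) (ℕP.+-suc y j))) ⟩
        S m y - S m (suc y) ∎
        where
        open import Data.Nat.Combinatorics.Specification using (k>n⇒nCk≡0)
        i : ℕ → Carrier
        i j = inv (suc (y ℕ.+ j))

    fac-0 : ∀ N → fac N 0# ≡ ν (N !)
    fac-0 zero = refl
    fac-0 (suc N) = trans (cong₂ _*_ (fac-0 N) (solve 2 (λ x P → x :+ P :* :c 0 := x) refl (ν (suc N)) P))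
      (trans (*-comm _ _) (sym (ν-* (suc N) (N !))))

    private
      open ℕS.+-*-Solver using () renaming (solve to solveℕ; _:+_ to _:+ℕ_; _:*_ to _:*ℕ_; con to conℕ; _:=_ to _:=ℕ_)

      odd-sgn : ∀ {j k} → j ℕ.+ k ≡ b → sgn k ≡ - sgn j
      odd-sgn {j} {k} e = begin
        sgn k                     ≡⟨ sym (*-identityˡ _) ⟩
        1# * sgn k                ≡⟨ cong (_* sgn k) (sym (sgn² j)) ⟩
        sgn j * sgn j * sgn k     ≡⟨ *-assoc _ _ _ ⟩
        sgn j * (sgn j * sgn k)   ≡⟨ cong (sgn j *_) (trans (sym (^-homo-* (- 1#) j k)) (trans (cong sgn e) sgn-b)) ⟩
        sgn j * (- 1#)            ≡⟨ solve 1 (λ s → s :* (:- :c 1) := :- s) refl (sgn j) ⟩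
        - sgn j ∎
        where
        open ≡-Reasoning
        sgn-b : sgn b ≡ - 1#
        sgn-b = trans (cong sgn (solveℕ 1 (λ g → conℕ 1 :+ℕ g :+ℕ g :=ℕ conℕ 1 :+ℕ conℕ 2 :*ℕ g) refl g))
          (trans (cong ((- 1#) *_) (trans (sym (^-assocʳ (- 1#) 2 g)) (trans (cong (_^ g) (solve 0 ((:- :c 1) :^ 2 := :c 1) refl)) (1^ g)))) (*-identityʳ _))

      C-sym : ∀ {j k} → j ℕ.+ k ≡ b → (b C k) ≡ (b C j)
      C-sym {j} {k} eq = trans (nCk≡nC[n∸k] (subst (k ℕ.≤_) eq (ℕP.m≤n+m k j)))
        (cong (b C_) (trans (cong (ℕ._∸ k) (sym eq)) (ℕP.m+n∸n≡m j k)))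

      co-reflect : ∀ {j k} → j ℕ.+ k ≡ b → co b k ≡ - co b j
      co-reflect {j} {k} e = trans (cong₂ (λ c s → ν c * s) (C-sym {j} {k} e) (odd-sgn {j} {k} e)) (sym (-‿distribʳ-* _ _))

    -- The exponents f + k with k ≤ 2f lie strictly between 0 and 4f, so the part of order zero
    -- vanishes and `W f` is a multiple of p; the logarithmic part is a Beta sum.
    W-f : W f * fac (3 ℕ.* f) 0# ≡ - (P * fac (2 ℕ.* f) 0# * fac f 0#)
    W-f = begin
      W f * fac (3 ℕ.* f) 0#
        ≡⟨ cong (_* fac (3 ℕ.* f) 0#) (trans (W-expand f) (cong₂ (λ u v → u - P * ν (2 ℕ.* f) * v) low high)) ⟩
      (0# - P * ν (2 ℕ.* f) * ((- (P - 1#)) * B)) * fac (3 ℕ.* f) 0#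
        ≡⟨ drop0 PP (ν (2 ℕ.* f) * B * fac (3 ℕ.* f) 0#) (solve 4 (λ P n B F → (:c 0 :- P :* n :* ((:- (P :- :c 1)) :* B)) :* F := :- (P :* n :* (B :* F)) :+ P :* P :* (n :* B :* F)) refl P (ν (2 ℕ.* f)) B (fac (3 ℕ.* f) 0#)) ⟩
      - (P * ν (2 ℕ.* f) * (B * fac (3 ℕ.* f) 0#))
        ≡⟨ cong (λ z → - (P * ν (2 ℕ.* f) * z)) product ⟩
      - (P * ν (2 ℕ.* f) * (ν (b !) * fac f 0#))
        ≡⟨ solve 4 (λ P n z F → :- (P :* n :* (z :* F)) := :- (P :* (n :* z) :* F)) refl P (ν (2 ℕ.* f)) (ν (b !)) (fac f 0#) ⟩
      - (P * (ν (2 ℕ.* f) * ν (b !)) * fac f 0#)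
        ≡⟨ cong (λ z → - (P * z * fac f 0#)) (trans (cong (λ k → ν k * ν (b !)) 2f≡) (trans (sym (ν-* (suc b) (b !))) (trans (sym (fac-0 (suc b))) (cong (λ k → fac k 0#) (sym 2f≡))))) ⟩
      - (P * fac (2 ℕ.* f) 0# * fac f 0#) ∎
      where
      open ≡-Reasoning
      B = Σ< (suc b) (λ j → co b j * inv (suc (f ℕ.+ j)))
      low : Σ< (suc (2 ℕ.* f)) (λ k → co (2 ℕ.* f) k * τ (f ℕ.+ k)) ≡ 0#
      low = Σ-0 (suc (2 ℕ.* f)) (λ k l → trans (cong (co (2 ℕ.* f) k *_) (τ-zero< (f ℕ.+ k) (ℕ.s≤s ℕ.z≤n)
        (ℕP.<-≤-trans (ℕP.+-monoʳ-< f l) (subst (f ℕ.+ suc (2 ℕ.* f) ℕ.≤_) (solveℕ 1 (λ f → f :+ℕ (f :+ℕ conℕ 2 :*ℕ f) :=ℕ conℕ 4 :*ℕ f) refl f)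
          (ℕP.+-monoʳ-≤ f (ℕP.+-monoˡ-≤ (2 ℕ.* f) (ℕ.s≤s ℕ.z≤n))))))) (zeroʳ _))
      high : Σ< (suc b) (λ k → co b k * ΣTL (f ℕ.+ k)) ≡ (- (P - 1#)) * B
      high = trans (Σ-rev (suc b) _) (trans (Σ-cong (suc b) (λ j l → begin
          co b (b ℕ.∸ j) * ΣTL (f ℕ.+ (b ℕ.∸ j))
            ≡⟨ cong₂ _*_ (co-reflect {j} {b ℕ.∸ j} (ℕP.m+[n∸m]≡n (ℕP.≤-pred l)))
                 (ΣTL-value (f ℕ.+ (b ℕ.∸ j)) (f ℕ.+ j) 0 (small j (ℕP.≤-pred l)) (index j (ℕP.≤-pred l))) ⟩
          (- co b j) * (inv (suc (f ℕ.+ j)) * (P - 1#))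
            ≡⟨ solve 3 (λ c i q → (:- c) :* (i :* q) := (:- q) :* (c :* i)) refl (co b j) (inv (suc (f ℕ.+ j))) (P - 1#) ⟩
          (- (P - 1#)) * (co b j * inv (suc (f ℕ.+ j))) ∎)) (Σ-*ˡ (suc b) (- (P - 1#)) _))
        where
        index : ∀ j → j ℕ.≤ b → f ℕ.+ (b ℕ.∸ j) ℕ.+ suc (f ℕ.+ j) ≡ 1 ℕ.* (4 ℕ.* f)
        index j l = trans (solveℕ 3 (λ f k j → f :+ℕ k :+ℕ (conℕ 1 :+ℕ (f :+ℕ j)) :=ℕ f :+ℕ f :+ℕ conℕ 1 :+ℕ (k :+ℕ j)) refl f (b ℕ.∸ j) j)
          (trans (cong (f ℕ.+ f ℕ.+ 1 ℕ.+_) (ℕP.m∸n+n≡m l)) (solveℕ 1 (λ g → let f = conℕ 1 :+ℕ g in f :+ℕ f :+ℕ conℕ 1 :+ℕ (f :+ℕ g) :=ℕ conℕ 1 :*ℕ (conℕ 4 :*ℕ f)) refl g))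
        small : ∀ j → j ℕ.≤ b → f ℕ.+ j < 4 ℕ.* f
        small j l = ℕP.≤-<-trans (ℕP.+-monoʳ-≤ f l) (ℕP.≤-trans (ℕP.m≤m+n (suc (f ℕ.+ b)) f)
          (ℕP.≤-reflexive (solveℕ 1 (λ g → let f = conℕ 1 :+ℕ g in conℕ 1 :+ℕ (f :+ℕ (f :+ℕ g)) :+ℕ f :=ℕ conℕ 4 :*ℕ f) refl g)))
      product : B * fac (3 ℕ.* f) 0# ≡ ν (b !) * fac f 0#
      product = begin
        B * fac (3 ℕ.* f) 0#
          ≡⟨ cong (λ k → B * fac k 0#) (trans (cong (f ℕ.+_) 2f≡) refl) ⟩
        B * fac (f ℕ.+ suc b) 0#
          ≡⟨ cong (B *_) (trans (fac-range f (suc b) 0#) (*-comm _ _)) ⟩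
        B * (range f (suc b) 0# * fac f 0#)
          ≡⟨ sym (*-assoc _ _ _) ⟩
        B * range f (suc b) 0# * fac f 0#
          ≡⟨ cong (λ z → B * z * fac f 0#) (Π-cong (suc b) (λ i _ → solve 2 (λ x P → x :+ P :* :c 0 := x) refl (ν (suc (f ℕ.+ i))) P)) ⟩
        B * Π< (suc b) (λ i → ν (suc (f ℕ.+ i))) * fac f 0#
          ≡⟨ cong (_* fac f 0#) (beta b f (b<p bound)) ⟩
        ν (b !) * fac f 0# ∎
        where
        bound : b ℕ.+ suc f ℕ.≤ 4 ℕ.* f
        bound = ℕP.≤-trans (ℕP.m≤m+n (b ℕ.+ suc f) f) (ℕP.≤-reflexive (solveℕ 1 (λ g → let f = conℕ 1 :+ℕ g in (f :+ℕ g) :+ℕ (conℕ 1 :+ℕ f) :+ℕ f :=ℕ conℕ 4 :*ℕ f) refl g))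


    -- The coefficient of t^m in -(1 - t)^N log(1 - t).
    e : ℕ → ℕ → Carrier
    e N m = Σ< m (λ k → co N k * inv (m ℕ.∸ k))
    pascal : ∀ N m → e (suc N) (suc m) ≡ e N (suc m) - e N m
    pascal N m = begin
      Σ< (suc m) (λ k → co (suc N) k * inv (suc m ℕ.∸ k)) ≡⟨ Σ-first m _ ⟩
      co N 0 * inv (suc m) + Σ< m (λ k → co (suc N) (suc k) * inv (m ℕ.∸ k))
        ≡⟨ cong (λ z → co N 0 * inv (suc m) + z) (trans (Σ-cong m (λ k _ → trans
             (cong (λ z → z * sgn (suc k) * inv (m ℕ.∸ k)) (trans (cong ν (sym (nCk+nC[k+1]≡[n+1]C[k+1] N k))) (ν-+ (N C k) _)))
             (solve 4 (λ a b s i → (a :+ b) :* ((:- :c 1) :* s) :* i := b :* ((:- :c 1) :* s) :* i :+ (:- :c 1) :* (a :* s :* i)) refl (ν (N C k)) (ν (N C suc k)) (sgn k) (inv (m ℕ.∸ k)))))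
             (trans (Σ-+ m _ _) (cong (λ z → Σ< m (λ k → co N (suc k) * inv (m ℕ.∸ k)) + z) (Σ-*ˡ m (- 1#) _)))) ⟩
      co N 0 * inv (suc m) + (Σ< m (λ k → co N (suc k) * inv (m ℕ.∸ k)) + (- 1#) * e N m)
        ≡⟨ solve 3 (λ a b c → a :+ (b :+ (:- :c 1) :* c) := (a :+ b) :- c) refl (co N 0 * inv (suc m)) _ _ ⟩
      (co N 0 * inv (suc m) + Σ< m (λ k → co N (suc k) * inv (m ℕ.∸ k))) - e N m
        ≡⟨ cong (_- e N m) (sym (Σ-first m (λ k → co N k * inv (suc m ℕ.∸ k)))) ⟩
      e N (suc m) - e N m ∎
      where open ≡-Reasoning

    -- Differentiating (1 - t)^N with respect to N multiplies it by log(1 - t), while C(N, m) has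
    -- the derivative C(N, m)(H_N - H_(N-m)). The formal proof is Pascal's rule in N = m + r.
    harmonic : ∀ m r → m ℕ.+ r < p →
      Σ< m (λ k → co (m ℕ.+ r) k * inv (m ℕ.∸ k)) ≡ - (sgn m * ν ((m ℕ.+ r) C m) * (H (m ℕ.+ r) - H r))
    harmonic zero r _ = solve 1 (λ h → :c 0 := :- (:c 1 :* :c 1 :* (h :- h))) refl (H r)
    harmonic (suc m) zero l = begin
      e (suc (m ℕ.+ 0)) (suc m)             ≡⟨ pascal (m ℕ.+ 0) m ⟩
      e (m ℕ.+ 0) (suc m) - e (m ℕ.+ 0) m   ≡⟨ cong₂ _-_ boundary (harmonic m 0 (ℕP.<-trans (ℕP.n<1+n _) l)) ⟩
      - (inv (suc (m ℕ.+ 0)) * sgn (suc m)) - - (sgn m * ν ((m ℕ.+ 0) C m) * (H (m ℕ.+ 0) - 0#))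
        ≡⟨ cong (λ z → - (inv (suc (m ℕ.+ 0)) * sgn (suc m)) - - (sgn m * ν z * (H (m ℕ.+ 0) - 0#))) (C1 m) ⟩
      - (inv (suc (m ℕ.+ 0)) * sgn (suc m)) - - (sgn m * 1# * (H (m ℕ.+ 0) - 0#))
        ≡⟨ solve 3 (λ i s h → :- (i :* ((:- :c 1) :* s)) :- (:- (s :* :c 1 :* (h :- :c 0))) := :- ((:- :c 1) :* s :* :c 1 :* (h :+ i :- :c 0))) refl (inv (suc (m ℕ.+ 0))) (sgn m) (H (m ℕ.+ 0)) ⟩
      - (sgn (suc m) * 1# * (H (suc (m ℕ.+ 0)) - 0#))
        ≡⟨ cong (λ z → - (sgn (suc m) * ν z * (H (suc (m ℕ.+ 0)) - 0#))) (sym (C1 (suc m))) ⟩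
      - (sgn (suc m) * ν ((suc m ℕ.+ 0) C suc m) * (H (suc m ℕ.+ 0) - H 0)) ∎
      where
      open ≡-Reasoning
      C1 : ∀ m → (m ℕ.+ 0) C m ≡ 1
      C1 m = trans (cong (_C m) (ℕP.+-identityʳ m)) (nCn≡1 m)
      -- By C(m, k)/(m + 1 - k) = C(m + 1, k)/(m + 1) this is a full alternating sum of binomial
      -- coefficients lacking its last term.
      boundary : e (m ℕ.+ 0) (suc m) ≡ - (inv (suc (m ℕ.+ 0)) * sgn (suc m))
      boundary = begin
        e (m ℕ.+ 0) (suc m)
          ≡⟨ cong (λ z → e z (suc m)) (ℕP.+-identityʳ m) ⟩
        Σ< (suc m) (λ k → co m k * inv (suc m ℕ.∸ k))
          ≡⟨ trans (Σ-cong (suc m) (λ k l → absorb k (ℕP.≤-pred l))) (Σ-*ˡ (suc m) (inv (suc m)) (co (suc m))) ⟩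
        inv (suc m) * Σ< (suc m) (co (suc m))
          ≡⟨ cong (inv (suc m) *_) (solve 2 (λ a b → a := a :+ b :- b) refl (Σ< (suc m) (co (suc m))) (co (suc m) (suc m))) ⟩
        inv (suc m) * (Σ< (suc (suc m)) (co (suc m)) - co (suc m) (suc m))
          ≡⟨ cong₂ (λ u v → inv (suc m) * (u - v)) alternatingSum (trans (cong (λ z → ν z * sgn (suc m)) (nCn≡1 (suc m))) (*-identityˡ _)) ⟩
        inv (suc m) * (0# - sgn (suc m))
          ≡⟨ solve 2 (λ i s → i :* (:c 0 :- s) := :- (i :* s)) refl (inv (suc m)) (sgn (suc m)) ⟩
        - (inv (suc m) * sgn (suc m))
          ≡⟨ cong (λ z → - (inv (suc z) * sgn (suc m))) (sym (ℕP.+-identityʳ m)) ⟩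
        - (inv (suc (m ℕ.+ 0)) * sgn (suc m)) ∎
        where
        alternatingSum : Σ< (suc (suc m)) (co (suc m)) ≡ 0#
        alternatingSum = trans (sym (trans (binomial (suc m) (- 1#)) refl)) (trans (cong (_^ suc m) (-‿inverseʳ 1#)) (zeroˡ _))
        absorb : ∀ k → k ℕ.≤ m → co m k * inv (suc m ℕ.∸ k) ≡ inv (suc m) * co (suc m) k
        absorb k k≤m = cancelʳ (ν (suc m) * ν s) (inv (suc m) * inv s)
          (trans (solve 4 (λ a b c d → (a :* b) :* (c :* d) := (a :* c) :* (b :* d)) refl (ν (suc m)) (ν s) (inv (suc m)) (inv s)) (trans (cong₂ _*_ u₁ u₂) (*-identityˡ _)))
          (begin
            ν (m C k) * sgn k * inv s * (ν (suc m) * ν s)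
              ≡⟨ solve 5 (λ c t i n s → c :* t :* i :* (n :* s) := (n :* c) :* t :* (s :* i)) refl (ν (m C k)) (sgn k) (inv s) (ν (suc m)) (ν s) ⟩
            ν (suc m) * ν (m C k) * sgn k * (ν s * inv s)
              ≡⟨ cong₂ (λ u v → u * sgn k * v) (trans (sym (ν-* (suc m) (m C k))) (trans (cong ν (sym C-eq)) (ν-* s (suc m C k)))) u₂ ⟩
            ν s * ν (suc m C k) * sgn k * 1#
              ≡⟨ cong (ν s * ν (suc m C k) * sgn k *_) (sym u₁) ⟩
            ν s * ν (suc m C k) * sgn k * (ν (suc m) * inv (suc m))
              ≡⟨ solve 5 (λ s c t n i → s :* c :* t :* (n :* i) := i :* (c :* t) :* (n :* s)) refl (ν s) (ν (suc m C k)) (sgn k) (ν (suc m)) (inv (suc m)) ⟩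
            inv (suc m) * (ν (suc m C k) * sgn k) * (ν (suc m) * ν s) ∎)
          where
          s = suc m ℕ.∸ k
          m<p : suc m < p
          m<p = subst (λ z → suc z < p) (ℕP.+-identityʳ m) l
          s≡ : s ≡ suc (m ℕ.∸ k)
          s≡ = ℕP.+-∸-assoc 1 k≤m
          u₁ : ν (suc m) * inv (suc m) ≡ 1#
          u₁ = ν-inv (suc<⇒∤ m<p)
          u₂ : ν s * inv s ≡ 1#
          u₂ = trans (cong (λ z → ν z * inv z) s≡) (ν-inv (suc<⇒∤ (ℕP.≤-<-trans (ℕ.s≤s (ℕP.m∸n≤m m k)) m<p)))
          C-eq : s ℕ.* (suc m C k) ≡ suc m ℕ.* (m C k)
          C-eq = trans (cong₂ (λ x y → x ℕ.* (y C k)) s≡ (sym (trans (ℕP.+-suc k (m ℕ.∸ k)) (cong suc (ℕP.m+[n∸m]≡n k≤m)))))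
            (trans (C-upper (m ℕ.∸ k) k) (cong₂ (λ x y → x ℕ.* (y C k)) (trans (ℕP.+-suc k (m ℕ.∸ k)) (cong suc (ℕP.m+[n∸m]≡n k≤m))) (ℕP.m+[n∸m]≡n k≤m)))
    harmonic (suc m) (suc r) l = begin
      e (suc N) (suc m)   ≡⟨ pascal N m ⟩
      e N (suc m) - e N m ≡⟨ cong₂ _-_ (trans (cong (λ z → e z (suc m)) N≡) (trans (harmonic (suc m) r l′) (cong (λ z → - (sgn (suc m) * ν (z C suc m) * (H z - H r))) (sym N≡)))) (harmonic m (suc r) (ℕP.<-trans (ℕP.n<1+n _) l)) ⟩
      - (sgn (suc m) * c₁ * (h - H r)) - - (sgn m * c₀ * (h - (H r + inv (suc r))))
        ≡⟨ solve 6 (λ s a b h k i → :- ((:- :c 1) :* s :* a :* (h :- k)) :- (:- (s :* b :* (h :- (k :+ i))))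
              := :- ((:- :c 1) :* s :* ((b :+ a) :* (h :- (k :+ i)) :+ a :* i))) refl (sgn m) c₁ c₀ h (H r) (inv (suc r)) ⟩
      - (sgn (suc m) * ((c₀ + c₁) * (h - (H r + inv (suc r))) + c₁ * inv (suc r)))
        ≡⟨ cong₂ (λ u v → - (sgn (suc m) * (u * (h - (H r + inv (suc r))) + v))) (trans (sym (ν-+ (N C m) (N C suc m))) (cong ν (nCk+nC[k+1]≡[n+1]C[k+1] N m))) absorb ⟩
      - (sgn (suc m) * (c * (h - (H r + inv (suc r))) + c * inv (suc N)))
        ≡⟨ solve 5 (λ s c h k i → :- (s :* (c :* (h :- k) :+ c :* i)) := :- (s :* c :* (h :+ i :- k))) refl (sgn (suc m)) c h (H r + inv (suc r)) (inv (suc N)) ⟩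
      - (sgn (suc m) * c * (H (suc N) - H (suc r))) ∎
      where
      open ≡-Reasoning
      N = m ℕ.+ suc r
      N≡ : N ≡ suc (m ℕ.+ r)
      N≡ = ℕP.+-suc m r
      l′ : suc m ℕ.+ r < p
      l′ = subst (_< p) N≡ (ℕP.<-trans (ℕP.n<1+n _) l)
      h = H N
      c₀ = ν (N C m)
      c₁ = ν (N C suc m)
      c = ν (suc N C suc m)
      absorb : c₁ * inv (suc r) ≡ c * inv (suc N)
      absorb = cancelʳ (ν (suc r) * ν (suc N)) (inv (suc r) * inv (suc N))
        (trans (solve 4 (λ a b c d → (a :* b) :* (c :* d) := (a :* c) :* (b :* d)) refl _ _ _ _) (trans (cong₂ _*_ u₁ u₂) (*-identityˡ _)))
        (begin
          c₁ * inv (suc r) * (ν (suc r) * ν (suc N)) ≡⟨ solve 4 (λ c i r n → c :* i :* (r :* n) := (n :* c) :* (r :* i)) refl c₁ (inv (suc r)) (ν (suc r)) (ν (suc N)) ⟩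
          ν (suc N) * c₁ * (ν (suc r) * inv (suc r)) ≡⟨ cong₂ _*_ (trans (sym (ν-* (suc N) (N C suc m))) (trans (cong ν (sym C-eq)) (ν-* (suc r) (suc N C suc m)))) (trans u₁ (sym u₂)) ⟩
          ν (suc r) * c * (ν (suc N) * inv (suc N)) ≡⟨ solve 4 (λ c i r n → (r :* c) :* (n :* i) := c :* i :* (r :* n)) refl c (inv (suc N)) (ν (suc r)) (ν (suc N)) ⟩
          c * inv (suc N) * (ν (suc r) * ν (suc N)) ∎)
        where
        u₁ : ν (suc r) * inv (suc r) ≡ 1#
        u₁ = ν-inv (suc<⇒∤ (ℕP.≤-<-trans (ℕP.m≤n+m (suc r) (suc m)) l))
        u₂ : ν (suc N) * inv (suc N) ≡ 1#
        u₂ = ν-inv (suc<⇒∤ l)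
        C-eq : suc r ℕ.* (suc N C suc m) ≡ suc N ℕ.* (N C suc m)
        C-eq = trans (C-upper r (suc m)) (cong (λ z → suc N ℕ.* (z C suc m)) (sym N≡))

    private
      ff : f ℕ.+ f ≡ 2 ℕ.* f
      ff = cong (f ℕ.+_) (sym (ℕP.+-identityʳ f))

      inv-reflect : ∀ {i j} → i ℕ.+ j ≡ p → p ∤ i → p ∤ j → P * inv i ≡ - (P * inv j)
      inv-reflect {i} {j} e ni nj = begin
        P * inv i                         ≡⟨ trans (sym (*-identityʳ _)) (cong (P * inv i *_) (sym (ν-inv nj))) ⟩
        P * inv i * (ν j * inv j)         ≡⟨ solve 5 (λ P a n b m → P :* a :* (n :* b) := P :* a :* ((m :+ n) :- m) :* b) refl P (inv i) (ν j) (inv j) (ν i) ⟩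
        P * inv i * (ν i + ν j - ν i) * inv j ≡⟨ cong (λ z → P * inv i * (z - ν i) * inv j) (trans (sym (ν-+ i j)) (cong ν e)) ⟩
        P * inv i * (P - ν i) * inv j     ≡⟨ drop0 PP (inv i * inv j) (solve 4 (λ P a m b → P :* a :* (P :- m) :* b := :- (P :* (m :* a) :* b) :+ P :* P :* (a :* b)) refl P (inv i) (ν i) (inv j)) ⟩
        - (P * (ν i * inv i) * inv j)     ≡⟨ cong (λ z → - (P * z * inv j)) (ν-inv ni) ⟩
        - (P * 1# * inv j)                ≡⟨ cong (λ z → - (z * inv j)) (*-identityʳ P) ⟩
        - (P * inv j) ∎
        where open ≡-Reasoning

      D : Carrier
      D = Σ< f (λ k → co b k * inv (f ℕ.∸ k))

      -- Only k = f makes the exponent 3f + k a multiple of 4f.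
      rational-part : Σ< (suc (2 ℕ.* f)) (λ k → co (2 ℕ.* f) k * τ (3 ℕ.* f ℕ.+ k)) ≡ co (2 ℕ.* f) f * (P - 1#)
      rational-part = trans (Σ-single (suc (2 ℕ.* f)) f _ (ℕ.s≤s (ℕP.m≤m+n f _))
        (λ k l ne → trans (cong (co (2 ℕ.* f) k *_) (τ-zero (3 ℕ.* f ℕ.+ k) (λ d → ne (4f∣-unique (g ℕ.+ 2 ℕ.* f)
            (ℕP.<-≤-trans l 2f<4f) (ℕP.<-≤-trans (ℕ.s≤s (ℕP.m≤m+n f _)) 2f<4f)
            (subst (4 ℕ.* f ∣_) (sym (ℕP.+-suc (g ℕ.+ 2 ℕ.* f) k)) d) (divides 1 full))))) (zeroʳ _)))
        (cong (co (2 ℕ.* f) f *_) (trans (cong τ (solveℕ 1 (λ f → conℕ 3 :*ℕ f :+ℕ f :=ℕ conℕ 4 :*ℕ f :+ℕ conℕ 0) refl f)) (τ-full 0)))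
        where
        2f<4f : suc (2 ℕ.* f) ℕ.≤ 4 ℕ.* f
        2f<4f = ℕP.≤-trans (ℕP.m≤m+n (suc (2 ℕ.* f)) (suc (g ℕ.+ g))) (ℕP.≤-reflexive
          (solveℕ 1 (λ g → let f = conℕ 1 :+ℕ g in (conℕ 1 :+ℕ conℕ 2 :*ℕ f) :+ℕ (conℕ 1 :+ℕ (g :+ℕ g)) :=ℕ conℕ 4 :*ℕ f) refl g))
        full : g ℕ.+ 2 ℕ.* f ℕ.+ suc f ≡ 1 ℕ.* (4 ℕ.* f)
        full = solveℕ 1 (λ g → let f = conℕ 1 :+ℕ g in g :+ℕ conℕ 2 :*ℕ f :+ℕ (conℕ 1 :+ℕ f) :=ℕ conℕ 1 :*ℕ (conℕ 4 :*ℕ f)) refl g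

      P[P-1] : ∀ x → P * (x * (P - 1#)) ≡ - (P * x)
      P[P-1] x = drop0 PP x (solve 2 (λ P x → P :* (x :* (P :- :c 1)) := :- (P :* x) :+ P :* P :* x) refl P x)

      -- The surviving index is f - k for k < f; for k = f + i it is 4f - i = p - (i + 1), whose
      -- inverse is -1/(i + 1) modulo p. The coefficients are antisymmetric because b is odd, so
      -- both halves contribute D, with the factor p - 1 acting as -1 next to p.
      log-part : P * Σ< (suc b) (λ k → co b k * ΣTL (3 ℕ.* f ℕ.+ k)) ≡ - (P * (ν 2 * D))
      log-part = begin
        P * Σ< (suc b) t
          ≡⟨ cong (λ n → P * Σ< n t) (sym (ℕP.+-suc f g)) ⟩
        P * Σ< (f ℕ.+ f) t
          ≡⟨ trans (cong (P *_) (Σ-split f f t)) (distribˡ _ _ _) ⟩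
        P * Σ< f t + P * Σ< f (λ i → t (f ℕ.+ i))
          ≡⟨ cong₂ _+_ (scale t (λ k → co b k * inv (f ℕ.∸ k)) (λ k l → first k (ℕP.≤-pred l)))
               (trans (scale (λ i → t (f ℕ.+ i)) (λ i → co b (g ℕ.∸ i) * inv (suc i)) (λ i l → second i (ℕP.≤-pred l))) (cong (λ z → - (P * z)) (sym reversed))) ⟩
        - (P * D) + - (P * D)
          ≡⟨ solve 2 (λ P D → :- (P :* D) :+ :- (P :* D) := :- (P :* (:c 2 :* D))) refl P D ⟩
        - (P * (ν 2 * D)) ∎
        where
        open ≡-Reasoning
        t : ℕ → Carrier
        t k = co b k * ΣTL (3 ℕ.* f ℕ.+ k)
        scale : ∀ u v → (∀ i → i < f → P * u i ≡ - (P * v i)) → P * Σ< f u ≡ - (P * Σ< f v)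
        scale u v eq = trans (sym (Σ-*ˡ f P u)) (trans (Σ-cong f (λ i l → trans (eq i l) (-‿distribˡ-* P (v i)))) (trans (Σ-*ˡ f (- P) v) (sym (-‿distribˡ-* P _))))
        first : ∀ k → k ℕ.≤ g → P * t k ≡ - (P * (co b k * inv (f ℕ.∸ k)))
        first k l = trans (cong (λ z → P * (co b k * z)) (trans (ΣTL-value (3 ℕ.* f ℕ.+ k) (g ℕ.∸ k) 0
            (ℕP.≤-<-trans (ℕP.m∸n≤m g k) (ℕP.m≤m+n f _))
            (trans (solveℕ 3 (λ f k x → conℕ 3 :*ℕ f :+ℕ k :+ℕ (conℕ 1 :+ℕ x) :=ℕ conℕ 3 :*ℕ f :+ℕ (conℕ 1 :+ℕ (k :+ℕ x))) refl f k (g ℕ.∸ k))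
              (trans (cong (λ z → 3 ℕ.* f ℕ.+ suc z) (ℕP.m+[n∸m]≡n l)) (solveℕ 1 (λ f → conℕ 3 :*ℕ f :+ℕ f :=ℕ conℕ 1 :*ℕ (conℕ 4 :*ℕ f)) refl f))))
            (cong (λ z → inv z * (P - 1#)) (sym (ℕP.+-∸-assoc 1 l)))))
          (trans (cong (P *_) (sym (*-assoc _ _ _))) (P[P-1] (co b k * inv (f ℕ.∸ k))))
        second : ∀ i → i ℕ.≤ g → P * t (f ℕ.+ i) ≡ - (P * (co b (g ℕ.∸ i) * inv (suc i)))
        second i l = begin
          P * (co b (f ℕ.+ i) * ΣTL (3 ℕ.* f ℕ.+ (f ℕ.+ i)))
            ≡⟨ cong₂ (λ u v → P * (u * v)) (co-reflect {g ℕ.∸ i} {f ℕ.+ i} opposite)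
                 (ΣTL-value (3 ℕ.* f ℕ.+ (f ℕ.+ i)) κ 1 (ℕP.∸-monoʳ-< {4 ℕ.* f} {suc i} {0} (ℕ.s≤s ℕ.z≤n) i<4f) index) ⟩
          P * ((- co b (g ℕ.∸ i)) * (inv (suc κ) * (P - 1#)))
            ≡⟨ trans (cong (P *_) (sym (*-assoc _ _ _))) (P[P-1] _) ⟩
          - (P * ((- co b (g ℕ.∸ i)) * inv (suc κ)))
            ≡⟨ solve 3 (λ P c j → :- (P :* ((:- c) :* j)) := c :* (P :* j)) refl P (co b (g ℕ.∸ i)) (inv (suc κ)) ⟩
          co b (g ℕ.∸ i) * (P * inv (suc κ))
            ≡⟨ cong (co b (g ℕ.∸ i) *_) (inv-reflect {suc κ} {suc i} sum≡p (suc<⇒∤ sκ<p) (suc<⇒∤ (b<p i<4f))) ⟩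
          co b (g ℕ.∸ i) * (- (P * inv (suc i)))
            ≡⟨ solve 3 (λ P c j → c :* (:- (P :* j)) := :- (P :* (c :* j))) refl P (co b (g ℕ.∸ i)) (inv (suc i)) ⟩
          - (P * (co b (g ℕ.∸ i) * inv (suc i))) ∎
          where
          κ = 4 ℕ.* f ℕ.∸ suc i
          i<4f : suc i ℕ.≤ 4 ℕ.* f
          i<4f = ℕP.≤-trans (ℕ.s≤s l) (ℕP.m≤m+n f _)
          sum≡p : suc κ ℕ.+ suc i ≡ p
          sum≡p = trans (cong suc (ℕP.m∸n+n≡m i<4f)) (sym p≡)
          sκ<p : suc κ < p
          sκ<p = subst (suc κ <_) sum≡p (ℕP.m<m+n (suc κ) (ℕ.s≤s ℕ.z≤n))
          opposite : g ℕ.∸ i ℕ.+ (f ℕ.+ i) ≡ b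
          opposite = trans (solveℕ 3 (λ x f i → x :+ℕ (f :+ℕ i) :=ℕ f :+ℕ (x :+ℕ i)) refl (g ℕ.∸ i) f i) (cong (f ℕ.+_) (ℕP.m∸n+n≡m l))
          index : 3 ℕ.* f ℕ.+ (f ℕ.+ i) ℕ.+ suc κ ≡ 2 ℕ.* (4 ℕ.* f)
          index = trans (solveℕ 3 (λ f i x → conℕ 3 :*ℕ f :+ℕ (f :+ℕ i) :+ℕ (conℕ 1 :+ℕ x) :=ℕ conℕ 4 :*ℕ f :+ℕ (x :+ℕ (conℕ 1 :+ℕ i))) refl f i κ)
            (trans (cong (4 ℕ.* f ℕ.+_) (ℕP.m∸n+n≡m i<4f)) (solveℕ 1 (λ f → conℕ 4 :*ℕ f :+ℕ conℕ 4 :*ℕ f :=ℕ conℕ 2 :*ℕ (conℕ 4 :*ℕ f)) refl f))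
        reversed : D ≡ Σ< f (λ i → co b (g ℕ.∸ i) * inv (suc i))
        reversed = trans (Σ-rev f _) (Σ-cong f (λ i l → cong (λ z → co b (g ℕ.∸ i) * inv z) (ℕP.m∸[m∸n]≡n l)))

    2C : ν 2 * ν (b C f) ≡ ν (2 ℕ.* f C f)
    2C = begin
      ν 2 * ν (b C f)             ≡⟨ solve 1 (λ x → :c 2 :* x := x :+ x) refl (ν (b C f)) ⟩
      ν (b C f) + ν (b C f)       ≡⟨ cong (λ z → ν z + ν (b C f)) (C-sym {g} {f} (ℕP.+-comm g f)) ⟩
      ν (b C g) + ν (b C f)       ≡⟨ sym (ν-+ (b C g) (b C f)) ⟩
      ν ((b C g) ℕ.+ (b C suc g)) ≡⟨ cong ν (nCk+nC[k+1]≡[n+1]C[k+1] b g) ⟩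
      ν (suc b C f)               ≡⟨ cong (λ n → ν (n C f)) (sym 2f≡) ⟩
      ν (2 ℕ.* f C f) ∎
      where open ≡-Reasoning

    module UnitSum (h κ : Carrier) (2h : ν 2 * h ≡ 1#) (2κ : ν 2 * κ ≡ h) where

      private
        c Ff F2f Δ : Carrier
        c = ν (2 ℕ.* f C f)
        Ff = fac f 0#
        F2f = fac (2 ℕ.* f) 0#
        Δ = H (2 ℕ.* f) - H f

        f<p : f < p
        f<p = b<p (ℕP.m≤m+n f _)

        2f<p : 2 ℕ.* f < p
        2f<p = b<p (ℕP.*-monoˡ-≤ f {2} {4} (ℕ.s≤s (ℕ.s≤s ℕ.z≤n)))

      -- Passing from H_(2f-1) - H_(f-1) to H_(2f) - H_f changes 2f times the difference by exactly
      -- 1, which cancels the p in p - 1; and 2fp = -p/2 because 4f = p - 1.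
      W-3f : W (3 ℕ.* f) ≡ - (sgn f * c * (1# - P * h * Δ))
      W-3f = begin
        W (3 ℕ.* f)
          ≡⟨ trans (W-expand (3 ℕ.* f)) (cong (_- P * ν (2 ℕ.* f) * B) rational-part) ⟩
        co (2 ℕ.* f) f * (P - 1#) - P * ν (2 ℕ.* f) * B
          ≡⟨ cong (λ z → co (2 ℕ.* f) f * (P - 1#) - z) (trans (solve 3 (λ P n B → P :* n :* B := n :* (P :* B)) refl P (ν (2 ℕ.* f)) B) (cong (ν (2 ℕ.* f) *_) log-part)) ⟩
        c * sgn f * (P - 1#) - ν (2 ℕ.* f) * (- (P * (ν 2 * D)))
          ≡⟨ cong (λ z → c * sgn f * (P - 1#) - ν (2 ℕ.* f) * (- (P * (ν 2 * z)))) (harmonic f g (b<p b≤4f)) ⟩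
        c * sgn f * (P - 1#) - ν (2 ℕ.* f) * (- (P * (ν 2 * (- (sgn f * ν (b C f) * (H b - H g))))))
          ≡⟨ solve 7 (λ c s P n t x d → c :* s :* (P :- :c 1) :- n :* (:- (P :* (t :* (:- (s :* x :* d)))))
               := c :* s :* (P :- :c 1) :- s :* (t :* x) :* (P :* (n :* d))) refl c (sgn f) P (ν (2 ℕ.* f)) (ν 2) (ν (b C f)) (H b - H g) ⟩
        c * sgn f * (P - 1#) - sgn f * (ν 2 * ν (b C f)) * (P * (ν (2 ℕ.* f) * (H b - H g)))
          ≡⟨ cong₂ (λ x y → c * sgn f * (P - 1#) - sgn f * x * (P * y)) 2C harmonicDifference ⟩
        c * sgn f * (P - 1#) - sgn f * c * (P * (ν (2 ℕ.* f) * Δ + 1#))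
          ≡⟨ solve 5 (λ c s P n d → c :* s :* (P :- :c 1) :- s :* c :* (P :* (n :* d :+ :c 1)) := :- (s :* c :* (:c 1 :+ P :* n :* d))) refl c (sgn f) P (ν (2 ℕ.* f)) Δ ⟩
        - (sgn f * c * (1# + P * ν (2 ℕ.* f) * Δ))
          ≡⟨ cong (λ z → - (sgn f * c * (1# + z * Δ))) P2f ⟩
        - (sgn f * c * (1# + (- (P * h)) * Δ))
          ≡⟨ cong (λ z → - (sgn f * c * (1# + z))) (sym (-‿distribˡ-* (P * h) Δ)) ⟩
        - (sgn f * c * (1# - P * h * Δ)) ∎
        where
        open ≡-Reasoning
        B = Σ< (suc b) (λ k → co b k * ΣTL (3 ℕ.* f ℕ.+ k))
        b≤4f : b ℕ.≤ 4 ℕ.* f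
        b≤4f = ℕP.≤-trans (ℕP.n≤1+n b) (subst (ℕ._≤ 4 ℕ.* f) 2f≡ (ℕP.*-monoˡ-≤ f {2} {4} (ℕ.s≤s (ℕ.s≤s ℕ.z≤n))))
        harmonicDifference : ν (2 ℕ.* f) * (H b - H g) ≡ ν (2 ℕ.* f) * Δ + 1#
        harmonicDifference = sym (begin
          ν (2 ℕ.* f) * (H (2 ℕ.* f) - H f) + 1#
            ≡⟨ cong (λ n → ν (2 ℕ.* f) * (H n - H f) + 1#) 2f≡ ⟩
          ν (2 ℕ.* f) * (H b + inv (suc b) - (H g + inv f)) + 1#
            ≡⟨ solve 5 (λ n x y i j → n :* (x :+ i :- (y :+ j)) :+ :c 1 := n :* (x :- y) :+ n :* i :- n :* j :+ :c 1) refl (ν (2 ℕ.* f)) (H b) (H g) (inv (suc b)) (inv f) ⟩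
          ν (2 ℕ.* f) * (H b - H g) + ν (2 ℕ.* f) * inv (suc b) - ν (2 ℕ.* f) * inv f + 1#
            ≡⟨ cong₂ (λ x y → ν (2 ℕ.* f) * (H b - H g) + x - y + 1#)
                 (trans (cong (λ n → ν n * inv (suc b)) 2f≡) (ν-inv (suc<⇒∤ (subst (_< p) 2f≡ 2f<p))))
                 (trans (cong (_* inv f) (ν-* 2 f)) (trans (*-assoc _ _ _) (trans (cong (ν 2 *_) (ν-inv (suc<⇒∤ f<p))) (*-identityʳ _)))) ⟩
          ν (2 ℕ.* f) * (H b - H g) + 1# - ν 2 + 1#
            ≡⟨ solve 1 (λ x → x :+ :c 1 :- :c 2 :+ :c 1 := x) refl (ν (2 ℕ.* f) * (H b - H g)) ⟩
          ν (2 ℕ.* f) * (H b - H g) ∎)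
        P2f : P * ν (2 ℕ.* f) ≡ - (P * h)
        P2f = begin
          P * ν (2 ℕ.* f)            ≡⟨ trans (sym (*-identityʳ _)) (cong (P * ν (2 ℕ.* f) *_) (sym 2h)) ⟩
          P * ν (2 ℕ.* f) * (ν 2 * h) ≡⟨ solve 4 (λ P n t h → P :* n :* (t :* h) := P :* h :* (t :* n)) refl P (ν (2 ℕ.* f)) (ν 2) h ⟩
          P * h * (ν 2 * ν (2 ℕ.* f)) ≡⟨ cong (P * h *_) (trans (sym (ν-* 2 (2 ℕ.* f))) (trans (cong ν (sym (ℕP.*-assoc 2 2 f)))
              (trans (solve 1 (λ z → z := (:c 1 :+ z) :- :c 1) refl (ν (4 ℕ.* f))) (cong (_- 1#) (trans (sym (ν-suc (4 ℕ.* f))) (cong ν (sym p≡))))))) ⟩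
          P * h * (P - 1#)           ≡⟨ trans (*-assoc _ _ _) (P[P-1] h) ⟩
          - (P * h) ∎

      central : c * (Ff * Ff) ≡ F2f
      central = begin
        ν (2 ℕ.* f C f) * (Ff * Ff)            ≡⟨ cong₂ (λ n z → ν (n C f) * (z * z)) (sym ff) (fac-0 f) ⟩
        ν ((f ℕ.+ f) C f) * (ν (f !) * ν (f !)) ≡⟨ trans (cong (ν ((f ℕ.+ f) C f) *_) (sym (ν-* (f !) (f !)))) (sym (ν-* ((f ℕ.+ f) C f) (f ! ℕ.* f !))) ⟩
        ν (((f ℕ.+ f) C f) ℕ.* (f ! ℕ.* f !))  ≡⟨ cong ν (C-factorials f f) ⟩
        ν ((f ℕ.+ f) !)                        ≡⟨ trans (sym (fac-0 (f ℕ.+ f))) (cong (λ n → fac n 0#) ff) ⟩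
        F2f ∎
        where open ≡-Reasoning

      -- The shifts are chosen to swallow the harmonic numbers: with h = 1/2 and κ = 1/4 the squared
      -- factorial contributes -p H_f/2 and the other one -p H_(2f)/2, which together is the
      -- correction in `W-3f`.
      unitSum : W (3 ℕ.* f) * (fac f (- κ) * fac f (- κ)) ≡ - (sgn f * fac (2 ℕ.* f) (- h))
      unitSum = begin
        W (3 ℕ.* f) * (fac f (- κ) * fac f (- κ))
          ≡⟨ cong₂ (λ u v → u * (v * v)) W-3f (shifted f κ f<p) ⟩
        - (sgn f * c * (1# - P * h * (H₂ - H₁))) * (Ff * (1# + P * (- κ) * H₁) * (Ff * (1# + P * (- κ) * H₁)))
          ≡⟨ drop0 PP (- (sgn f * c * (Ff * Ff) * (κ * κ * H₁ * H₁ + ν 2 * κ * h * H₁ * (H₂ - H₁) - h * P * κ * κ * H₁ * H₁ * (H₂ - H₁))))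
             (solve 8 (λ s c P h x y F k → :- (s :* c :* (:c 1 :- P :* h :* (x :- y))) :* (F :* (:c 1 :+ P :* (:- k) :* y) :* (F :* (:c 1 :+ P :* (:- k) :* y)))
                := :- (s :* (c :* (F :* F)) :* (:c 1 :- P :* h :* (x :- y) :- P :* (:c 2 :* k) :* y)) :+ P :* P :* (:- (s :* c :* (F :* F) :* (k :* k :* y :* y :+ :c 2 :* k :* h :* y :* (x :- y) :- h :* P :* k :* k :* y :* y :* (x :- y)))))
                refl (sgn f) c P h H₂ H₁ Ff κ) ⟩
        - (sgn f * (c * (Ff * Ff)) * (1# - P * h * (H₂ - H₁) - P * (ν 2 * κ) * H₁))
          ≡⟨ cong₂ (λ u v → - (sgn f * u * (1# - P * h * (H₂ - H₁) - P * v * H₁))) central 2κ ⟩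
        - (sgn f * F2f * (1# - P * h * (H₂ - H₁) - P * h * H₁))
          ≡⟨ solve 6 (λ s F P h x y → :- (s :* F :* (:c 1 :- P :* h :* (x :- y) :- P :* h :* y)) := :- (s :* (F :* (:c 1 :+ P :* (:- h) :* x)))) refl (sgn f) F2f P h H₂ H₁ ⟩
        - (sgn f * (F2f * (1# + P * (- h) * H₂)))
          ≡⟨ cong (λ z → - (sgn f * z)) (sym (shifted (2 ℕ.* f) h 2f<p)) ⟩
        - (sgn f * fac (2 ℕ.* f) (- h)) ∎
        where
        open ≡-Reasoning
        H₁ = H f
        H₂ = H (2 ℕ.* f)
        shifted : ∀ N z → N < p → fac N (- z) ≡ fac N 0# * (1# + P * (- z) * H N)
        shifted N z l = trans (cong (fac N) (sym (+-identityˡ (- z)))) (fac-shift N 0# (- z) l)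

      -- `W f` carries a factor p, so `W (3f)` matters only modulo p. What remains is (2f)!² ≡
      -- (-1)^f (3f)! f!, and by reflection both sides are (4f)! modulo p.
      norm : W f * W (3 ℕ.* f) ≡ P
      norm = cancel-unit {x = W f * W (3 ℕ.* f)} (fac-unit (3 ℕ.* f) 0# (b<p (ℕP.*-monoˡ-≤ f {3} {4} (ℕ.s≤s (ℕ.s≤s (ℕ.s≤s ℕ.z≤n))))))
        (cancel-unit {x = W f * W (3 ℕ.* f) * F3f} (fac-unit f 0# f<p) (begin
        W f * W (3 ℕ.* f) * F3f * Ff
          ≡⟨ solve 4 (λ w v F G → w :* v :* F :* G := w :* F :* v :* G) refl (W f) (W (3 ℕ.* f)) F3f Ff ⟩
        W f * F3f * W (3 ℕ.* f) * Ff
          ≡⟨ cong₂ (λ u v → u * v * Ff) W-f W-3f ⟩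
        (- (P * F2f * Ff)) * (- (sgn f * c * (1# - P * h * Δ))) * Ff
          ≡⟨ drop0 PP (- (F2f * Ff * Ff * sgn f * c * h * Δ)) (solve 7 (λ P F G s c h d → (:- (P :* F :* G)) :* (:- (s :* c :* (:c 1 :- P :* h :* d))) :* G
               := s :* (P :* (F :* (c :* (G :* G)))) :+ P :* P :* (:- (F :* G :* G :* s :* c :* h :* d))) refl P F2f Ff (sgn f) c h Δ) ⟩
        sgn f * (P * (F2f * (c * (Ff * Ff))))
          ≡⟨ cong (λ z → sgn f * (P * (F2f * z))) central ⟩
        sgn f * (P * (F2f * F2f))
          ≡⟨ cong (sgn f *_) squares ⟩
        sgn f * (P * (F3f * (sgn f * Ff)))
          ≡⟨ solve 4 (λ s P F G → s :* (P :* (F :* (s :* G))) := (s :* s) :* (P :* F :* G)) refl (sgn f) P F3f Ff ⟩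
        sgn f * sgn f * (P * F3f * Ff)
          ≡⟨ trans (cong (_* (P * F3f * Ff)) (sgn² f)) (*-identityˡ _) ⟩
        P * F3f * Ff ∎))
        where
        open ≡-Reasoning
        F3f = fac (3 ℕ.* f) 0#
        Preflect : ∀ B N → B ℕ.+ N ≡ 4 ℕ.* f → P * fac (4 ℕ.* f) 0# ≡ P * (fac B 0# * (sgn N * fac N 0#))
        Preflect B N e = begin
          P * fac (4 ℕ.* f) 0#  ≡⟨ cong (λ n → P * fac n 0#) (sym e) ⟩
          P * fac (B ℕ.+ N) 0#  ≡⟨ cong (P *_) (reflection B N 0# (trans p≡ (cong suc (sym e)))) ⟩
          P * (fac B 0# * (sgn N * fac N (- (1# + 0#)))) ≡⟨ solve 4 (λ P a s z → P :* (a :* (s :* z)) := a :* s :* (P :* z)) refl P (fac B 0#) (sgn N) _ ⟩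
          fac B 0# * sgn N * (P * fac N (- (1# + 0#)))   ≡⟨ cong (fac B 0# * sgn N *_) (P-fac N _) ⟩
          fac B 0# * sgn N * (P * fac N 0#)              ≡⟨ solve 4 (λ P a s z → a :* s :* (P :* z) := P :* (a :* (s :* z))) refl P (fac B 0#) (sgn N) _ ⟩
          P * (fac B 0# * (sgn N * fac N 0#)) ∎
        sgn-2f : sgn (2 ℕ.* f) ≡ 1#
        sgn-2f = trans (sym (^-assocʳ (- 1#) 2 f)) (trans (cong (_^ f) (solve 0 ((:- :c 1) :^ 2 := :c 1) refl)) (1^ f))
        squares : P * (F2f * F2f) ≡ P * (F3f * (sgn f * Ff))
        squares = trans (cong (λ z → P * (F2f * z)) (trans (sym (*-identityˡ F2f)) (cong (_* F2f) (sym sgn-2f))))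
          (trans (sym (Preflect (2 ℕ.* f) (2 ℕ.* f) (solveℕ 1 (λ f → conℕ 2 :*ℕ f :+ℕ conℕ 2 :*ℕ f :=ℕ conℕ 4 :*ℕ f) refl f)))
            (Preflect (3 ℕ.* f) f (solveℕ 1 (λ f → conℕ 3 :*ℕ f :+ℕ f :=ℕ conℕ 4 :*ℕ f) refl f)))

-- Gaussian integers and the values of a quartic character

module Gaussian where

  open RingKit
  open import Data.Nat as ℕ using (ℕ; zero; suc)
  import Data.Nat.Properties as ℕP
  open import Data.Integer as ℤ using (ℤ; +_; -[1+_])
  import Data.Integer.Properties as ℤP
  open import Data.Integer.Solver using (module +-*-Solver)
  open import Data.Fin as Fin using (Fin)
  open import Data.Fin.Patterns
  import Data.Fin.Properties as FinP
  open import Data.Product using (_,_; ∃)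
  open import Data.Empty using (⊥-elim)
  open import Relation.Nullary using (Dec)
  open import Relation.Nullary.Decidable using (map′; _×-dec_; from-yes; _→-dec_)
  open import Relation.Binary.PropositionalEquality
  open +-*-Solver using (solve; _:=_; con; _:+_; _:*_; _:-_; :-_)

  infix 5 _+i_
  record ℤ[i] : Set where
    no-eta-equality
    pattern
    constructor _+i_
    field
      re im : ℤ
  open ℤ[i] public

  ℤ[i]-ring : Ring≡
  ℤ[i]-ring = record
    { Carrier = ℤ[i]
    ; _+_ = λ { (a +i b) (c +i d) → (a ℤ.+ c) +i (b ℤ.+ d) }
    ; _*_ = λ { (a +i b) (c +i d) → (a ℤ.* c ℤ.- b ℤ.* d) +i (a ℤ.* d ℤ.+ b ℤ.* c) }
    ; -_ = λ { (a +i b) → (ℤ.- a) +i (ℤ.- b) }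
    ; 0# = + 0 +i + 0 ; 1# = + 1 +i + 0
    ; isCR = record
      { isRing = record
        { +-isAbelianGroup = record
          { isGroup = record
            { isMonoid = record
              { isSemigroup = record
                { isMagma = record { isEquivalence = isEquivalence ; ∙-cong = λ { refl refl → refl } }
                ; assoc = λ { (a +i b) (c +i d) (e +i f) → cong₂ _+i_ (ℤP.+-assoc a c e) (ℤP.+-assoc b d f) } }
              ; identity = (λ { (a +i b) → cong₂ _+i_ (ℤP.+-identityˡ a) (ℤP.+-identityˡ b) })
                         , (λ { (a +i b) → cong₂ _+i_ (ℤP.+-identityʳ a) (ℤP.+-identityʳ b) }) }
            ; inverse = (λ { (a +i b) → cong₂ _+i_ (ℤP.+-inverseˡ a) (ℤP.+-inverseˡ b) })
                      , (λ { (a +i b) → cong₂ _+i_ (ℤP.+-inverseʳ a) (ℤP.+-inverseʳ b) })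
            ; ⁻¹-cong = λ { refl → refl } }
          ; comm = λ { (a +i b) (c +i d) → cong₂ _+i_ (ℤP.+-comm a c) (ℤP.+-comm b d) } }
        ; *-cong = λ { refl refl → refl }
        ; *-assoc = λ { (a +i b) (c +i d) (e +i f) → cong₂ _+i_
            (solve 6 (λ a b c d e f → (a :* c :- b :* d) :* e :- (a :* d :+ b :* c) :* f := a :* (c :* e :- d :* f) :- b :* (c :* f :+ d :* e)) refl a b c d e f)
            (solve 6 (λ a b c d e f → (a :* c :- b :* d) :* f :+ (a :* d :+ b :* c) :* e := a :* (c :* f :+ d :* e) :+ b :* (c :* e :- d :* f)) refl a b c d e f) }
        ; *-identity = (λ { (a +i b) → cong₂ _+i_
              (solve 2 (λ a b → con (+ 1) :* a :- con (+ 0) :* b := a) refl a b)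
              (solve 2 (λ a b → con (+ 1) :* b :+ con (+ 0) :* a := b) refl a b) })
            , (λ { (a +i b) → cong₂ _+i_
              (solve 2 (λ a b → a :* con (+ 1) :- b :* con (+ 0) := a) refl a b)
              (solve 2 (λ a b → a :* con (+ 0) :+ b :* con (+ 1) := b) refl a b) })
        ; distrib = (λ { (a +i b) (c +i d) (e +i f) → cong₂ _+i_
              (solve 6 (λ a b c d e f → a :* (c :+ e) :- b :* (d :+ f) := (a :* c :- b :* d) :+ (a :* e :- b :* f)) refl a b c d e f)
              (solve 6 (λ a b c d e f → a :* (d :+ f) :+ b :* (c :+ e) := (a :* d :+ b :* c) :+ (a :* f :+ b :* e)) refl a b c d e f) })
            , (λ { (a +i b) (c +i d) (e +i f) → cong₂ _+i_
              (solve 6 (λ a b c d e f → (c :+ e) :* a :- (d :+ f) :* b := (c :* a :- d :* b) :+ (e :* a :- f :* b)) refl a b c d e f)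
              (solve 6 (λ a b c d e f → (c :+ e) :* b :+ (d :+ f) :* a := (c :* b :+ d :* a) :+ (e :* b :+ f :* a)) refl a b c d e f) }) }
      ; *-comm = λ { (a +i b) (c +i d) → cong₂ _+i_
            (solve 4 (λ a b c d → a :* c :- b :* d := c :* a :- d :* b) refl a b c d)
            (solve 4 (λ a b c d → a :* d :+ b :* c := c :* b :+ d :* a) refl a b c d) } } }

  module Z = Kit ℤ[i]-ring

  infix 4 _≟ᵢ_
  _≟ᵢ_ : (x y : ℤ[i]) → Dec (x ≡ y)
  (a +i b) ≟ᵢ (c +i d) = map′ (λ { (e , f) → cong₂ _+i_ e f }) (λ e → cong re e , cong im e) ((a ℤP.≟ c) ×-dec (b ℤP.≟ d))

  conj : ℤ[i] → ℤ[i]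
  conj (a +i b) = a +i (ℤ.- b)

  conj-+ : ∀ x y → conj (x Z.+ y) ≡ conj x Z.+ conj y
  conj-+ (a +i b) (c +i d) = cong ((a ℤ.+ c) +i_) (ℤP.neg-distrib-+ b d)

  conj-* : ∀ x y → conj (x Z.* y) ≡ conj x Z.* conj y
  conj-* (a +i b) (c +i d) = cong₂ _+i_
    (solve 4 (λ a b c d → a :* c :- b :* d := a :* c :- (:- b) :* (:- d)) refl a b c d)
    (solve 4 (λ a b c d → :- (a :* d :+ b :* c) := a :* (:- d) :+ (:- b) :* c) refl a b c d)

  norm : ℤ[i] → ℤ
  norm (a +i b) = a ℤ.* a ℤ.+ b ℤ.* b

  *-conj : ∀ z → z Z.* conj z ≡ norm z +i + 0
  *-conj (a +i b) = cong₂ _+i_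
    (solve 2 (λ a b → a :* a :- b :* (:- b) := a :* a :+ b :* b) refl a b)
    (solve 2 (λ a b → a :* (:- b) :+ b :* a := con (+ 0)) refl a b)

  -- The ℓ¹ norm: subadditive without square roots, at most 1 on character values, and with a square
  -- that bounds `norm`.
  size : ℤ[i] → ℕ
  size (a +i b) = ℤ.∣ a ∣ ℕ.+ ℤ.∣ b ∣

  size-+ : ∀ x y → size (x Z.+ y) ℕ.≤ size x ℕ.+ size y
  size-+ (a +i b) (c +i d) = ℕP.≤-trans (ℕP.+-mono-≤ (ℤP.∣i+j∣≤∣i∣+∣j∣ a c) (ℤP.∣i+j∣≤∣i∣+∣j∣ b d))
    (ℕP.≤-reflexive (interchange ℤ.∣ a ∣ ℤ.∣ c ∣ ℤ.∣ b ∣ ℤ.∣ d ∣))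
    where
    import Data.Nat.Solver as ℕS
    interchange : ∀ a c b d → a ℕ.+ c ℕ.+ (b ℕ.+ d) ≡ a ℕ.+ b ℕ.+ (c ℕ.+ d)
    interchange = N.solve 4 (λ a c b d → a N.:+ c N.:+ (b N.:+ d) N.:= a N.:+ b N.:+ (c N.:+ d)) refl
      where module N = ℕS.+-*-Solver

  -- Zero and the four units, indexed by a finite type so that identities between character values
  -- are settled by enumeration.
  ⟦_⟧ : Fin 5 → ℤ[i]
  ⟦ 0F ⟧ = + 0 +i + 0
  ⟦ 1F ⟧ = + 1 +i + 0
  ⟦ 2F ⟧ = -[1+ 0 ] +i + 0
  ⟦ 3F ⟧ = + 0 +i + 1
  ⟦ 4F ⟧ = + 0 +i -[1+ 0 ]

  ⟦⟧-closed : ∀ s t → ∃ λ r → ⟦ s ⟧ Z.* ⟦ t ⟧ ≡ ⟦ r ⟧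
  ⟦⟧-closed = from-yes (FinP.all? λ s → FinP.all? λ t → FinP.any? λ r → ⟦ s ⟧ Z.* ⟦ t ⟧ ≟ᵢ ⟦ r ⟧)

  -- With this bound, a prime above 4 that divides the norm of a difference of two values forces the
  -- values to coincide.
  ⟦⟧-norm≤4 : ∀ s t → ℤ.∣ norm (⟦ s ⟧ Z.- ⟦ t ⟧) ∣ ℕ.≤ 4
  ⟦⟧-norm≤4 = from-yes (FinP.all? λ s → FinP.all? λ t → ℤ.∣ norm (⟦ s ⟧ Z.- ⟦ t ⟧) ∣ ℕP.≤? 4)

  ⟦⟧-norm0 : ∀ s t → ℤ.∣ norm (⟦ s ⟧ Z.- ⟦ t ⟧) ∣ ≡ 0 → ⟦ s ⟧ ≡ ⟦ t ⟧
  ⟦⟧-norm0 = from-yes (FinP.all? λ s → FinP.all? λ t → (ℤ.∣ norm (⟦ s ⟧ Z.- ⟦ t ⟧) ∣ ℕP.≟ 0) →-dec (⟦ s ⟧ ≟ᵢ ⟦ t ⟧))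

  ⟦⟧-size≤1 : ∀ s → size ⟦ s ⟧ ℕ.≤ 1
  ⟦⟧-size≤1 = from-yes (FinP.all? λ s → size ⟦ s ⟧ ℕP.≤? 1)

  ⟦⟧-conj : ∀ s → conj ⟦ s ⟧ ≡ ⟦ s ⟧ Z.^ 3
  ⟦⟧-conj = from-yes (FinP.all? λ s → conj ⟦ s ⟧ ≟ᵢ ⟦ s ⟧ Z.^ 3)

  ⟦⟧²-conj : ∀ s → conj (⟦ s ⟧ Z.^ 2) ≡ ⟦ s ⟧ Z.^ 2
  ⟦⟧²-conj = from-yes (FinP.all? λ s → conj (⟦ s ⟧ Z.^ 2) ≟ᵢ ⟦ s ⟧ Z.^ 2)

  ⟦⟧²²≡1 : ∀ s → ⟦ s ⟧ ≢ ⟦ 0F ⟧ → (⟦ s ⟧ Z.^ 2) Z.* (⟦ s ⟧ Z.^ 2) ≡ Z.1#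
  ⟦⟧²²≡1 0F ne = ⊥-elim (ne refl)
  ⟦⟧²²≡1 1F _ = refl
  ⟦⟧²²≡1 2F _ = refl
  ⟦⟧²²≡1 3F _ = refl
  ⟦⟧²²≡1 4F _ = refl

  -- What counts is that 1 + φ(t), the expected number of square roots of t, is a natural number:
  -- nonnegativity stands in for knowing φ at the nonsquares.
  1+⟦⟧² : ∀ s → ∃ λ k → Z.1# Z.+ ⟦ s ⟧ Z.^ 2 ≡ Z.ν k
  1+⟦⟧² 0F = 1 , refl
  1+⟦⟧² 1F = 2 , refl
  1+⟦⟧² 2F = 2 , refl
  1+⟦⟧² 3F = 0 , refl
  1+⟦⟧² 4F = 0 , refl

  ⟦⟧³-inverse : ∀ s t → ⟦ s ⟧ Z.* ⟦ t ⟧ ≡ Z.1# → ⟦ s ⟧ Z.^ 3 ≡ ⟦ t ⟧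
  ⟦⟧³-inverse = from-yes (FinP.all? λ s → FinP.all? λ t → (⟦ s ⟧ Z.* ⟦ t ⟧ ≟ᵢ Z.1#) →-dec (⟦ s ⟧ Z.^ 3 ≟ᵢ ⟦ t ⟧))

  re-+ : ∀ x y → re (x Z.+ y) ≡ re x ℤ.+ re y
  re-+ (a +i b) (c +i d) = refl

  im-+ : ∀ x y → im (x Z.+ y) ≡ im x ℤ.+ im y
  im-+ (a +i b) (c +i d) = refl

  re-ν : ∀ n → re (Z.ν n) ≡ + n
  re-ν zero = refl
  re-ν (suc n) = trans (cong re (Z.ν-suc n)) (trans (re-+ Z.1# (Z.ν n)) (cong (λ z → + 1 ℤ.+ z) (re-ν n)))

  im-ν : ∀ n → im (Z.ν n) ≡ + 0
  im-ν zero = refl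
  im-ν (suc n) = trans (cong im (Z.ν-suc n)) (trans (im-+ Z.1# (Z.ν n)) (trans (ℤP.+-identityˡ (im (Z.ν n))) (im-ν n)))

-- Uniqueness of p = x² + y² up to a normalised unit

module TwoSquares where

  open import Data.Nat as ℕ using (ℕ; zero; suc; NonZero)
  import Data.Nat.Properties as ℕP
  open import Data.Nat.Divisibility as ℕD using (divides)
  open import Data.Integer as ℤ using (ℤ; +_; -[1+_])
  import Data.Integer.Properties as ℤP
  open import Data.Integer.Divisibility.Signed as ℤS using (_∣_; divides)
  open RingKit
  open import Data.Product using (_,_; ∃; _×_; proj₁; proj₂)
  open import Data.Sum using (_⊎_; inj₁; inj₂)
  open import Data.Empty using (⊥-elim)
  open import Relation.Binary.PropositionalEquality

  ℤ-ring : Ring≡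
  ℤ-ring = record { isCR = ℤP.+-*-isCommutativeRing }

  private
    module Id (K : Ring≡) where
      open Kit K
      id1 : ∀ c d x y → (c * x + d * y) * (c * x + d * y) + (c * y - d * x) * (c * y - d * x) ≡ (x * x + y * y) * (c * c + d * d)
      id1 = solve 4 (λ c d x y → (c :* x :+ d :* y) :* (c :* x :+ d :* y) :+ (c :* y :- d :* x) :* (c :* y :- d :* x) := (x :* x :+ y :* y) :* (c :* c :+ d :* d)) refl
      id2 : ∀ c d x y i → c * y - d * x ≡ (c + d * i) * y - d * (x + y * i)
      id2 = solve 5 (λ c d x y i → c :* y :- d :* x := (c :+ d :* i) :* y :- d :* (x :+ y :* i)) refl
      id3 : ∀ b p y d a → b * p * y - d * (a * p) ≡ (b * y - d * a) * p
      id3 = solve 5 (λ b p y d a → b :* p :* y :- d :* (a :* p) := (b :* y :- d :* a) :* p) refl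
      id4 : ∀ n m x′ f → ν 1 ≡ (ν 1 + ν 2 * n) * (ν 1 + ν 2 * n) - ν 4 * (n + n * n)
      id4 = solve 4 (λ n m x′ f → :c 1 := (:c 1 :+ :c 2 :* n) :* (:c 1 :+ :c 2 :* n) :- :c 4 :* (n :+ n :* n)) refl
      id5 : ∀ a b → b ≡ a + b - a
      id5 = solve 2 (λ a b → b := a :+ b :- a) refl
      id6 : ∀ f x n → ν 1 + ν 4 * f - (ν 1 + x * ν 4) * (ν 1 + x * ν 4) - ν 4 * (n + n * n) ≡ ν 2 * (ν 2 * f - ν 4 * x - ν 8 * x * x - ν 2 * n * n - ν 2 * n)
      id6 = solve 3 (λ f x n → :c 1 :+ :c 4 :* f :- (:c 1 :+ x :* :c 4) :* (:c 1 :+ x :* :c 4) :- :c 4 :* (n :+ n :* n) := :c 2 :* (:c 2 :* f :- :c 4 :* x :- :c 8 :* x :* x :- :c 2 :* n :* n :- :c 2 :* n)) refl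
      id7 : ∀ f → ν 4 * f ≡ ν 1 + ν 4 * f - ν 1
      id7 = solve 1 (λ f → :c 4 :* f := :c 1 :+ :c 4 :* f :- :c 1) refl
      id8 : ∀ x y → (ν 1 + x * ν 4) * (ν 1 + x * ν 4) + ν 2 * y * (ν 2 * y) - ν 1 ≡ ν 4 * (ν 2 * x + ν 4 * x * x + y * y)
      id8 = solve 2 (λ x y → (:c 1 :+ x :* :c 4) :* (:c 1 :+ x :* :c 4) :+ :c 2 :* y :* (:c 2 :* y) :- :c 1 := :c 4 :* (:c 2 :* x :+ :c 4 :* x :* x :+ y :* y)) refl
      id9 : ∀ q f → q ≡ q * (ν 1 + ν 4 * f) - ν 4 * f * q
      id9 = solve 2 (λ q f → q := q :* (:c 1 :+ :c 4 :* f) :- :c 4 :* f :* q) refl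
      id10 : ∀ c y d x f q → c * (ν 2 * y) - ν 2 * d * x - ν 4 * f * q ≡ ν 2 * (c * y - d * x - ν 2 * f * q)
      id10 = solve 6 (λ c y d x f q → c :* (:c 2 :* y) :- :c 2 :* d :* x :- :c 4 :* f :* q := :c 2 :* (c :* y :- d :* x :- :c 2 :* f :* q)) refl
      id11 : ∀ q p → ν 2 * q * p ≡ q * (ν 2 * p)
      id11 = solve 2 (λ q p → :c 2 :* q :* p := q :* (:c 2 :* p)) refl
      id12 : ∀ c x y → c * (x * x + y * y) ≡ x * (c * x) + (c * y) * y
      id12 = solve 3 (λ c x y → c :* (x :* x :+ y :* y) := x :* (c :* x) :+ (c :* y) :* y) refl
      id13 : ∀ c d x y → x * (c * x) + d * x * y ≡ x * (c * x + d * y)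
      id13 = solve 4 (λ c d x y → x :* (c :* x) :+ d :* x :* y := x :* (c :* x :+ d :* y)) refl
      id14 : ∀ x e p → x * (e * p) ≡ e * x * p
      id14 = solve 3 (λ x e p → x :* (e :* p) := e :* x :* p) refl
      id15 : ∀ d x y → d * (x * x + y * y) ≡ x * (d * x) + d * y * y
      id15 = solve 3 (λ d x y → d :* (x :* x :+ y :* y) := x :* (d :* x) :+ d :* y :* y) refl
      id16 : ∀ c d x y → x * (c * y) + d * y * y ≡ y * (c * x + d * y)
      id16 = solve 4 (λ c d x y → x :* (c :* y) :+ d :* y :* y := y :* (c :* x :+ d :* y)) refl
      id17 : ∀ x e p → x * (e * p) ≡ e * x * p
      id17 = solve 3 (λ x e p → x :* (e :* p) := e :* x :* p) refl
      id18 : ∀ a p → (a - p) * (a + p) ≡ a * a + ν 0 * ν 0 - p * p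
      id18 = solve 2 (λ a p → (a :- p) :* (a :+ p) := a :* a :+ :c 0 :* :c 0 :- p :* p) refl
      id19 : ∀ f y → ν 1 ≡ f + ν 1 - f
      id19 = solve 2 (λ f y → :c 1 := f :+ :c 1 :- f) refl
      id20 : ∀ n x s → ν 2 * n + ν 1 - (ν 2 * x + ν 4 * x * x + (ν 2 * s - ν 1) * (ν 2 * s - ν 1)) ≡ ν 2 * (n - x - ν 2 * x * x - ν 2 * s * s + ν 2 * s)
      id20 = solve 3 (λ n x s → :c 2 :* n :+ :c 1 :- (:c 2 :* x :+ :c 4 :* x :* x :+ (:c 2 :* s :- :c 1) :* (:c 2 :* s :- :c 1)) := :c 2 :* (n :- x :- :c 2 :* x :* x :- :c 2 :* s :* s :+ :c 2 :* s)) refl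
      id21 : ∀ y x f → ν 2 * y ≡ ν 1 * (ν 1 + x * ν 4) + ν 1 * (ν 2 * y) + (ν 1 + ν 4 * f) - ν 2 - ν 4 * x - ν 4 * f
      id21 = solve 3 (λ y x f → :c 2 :* y := :c 1 :* (:c 1 :+ x :* :c 4) :+ :c 1 :* (:c 2 :* y) :+ (:c 1 :+ :c 4 :* f) :- :c 2 :- :c 4 :* x :- :c 4 :* f) refl
      id22 : ∀ k x f → ν 4 * k - ν 2 - ν 4 * x - ν 4 * f ≡ ν 2 * (ν 2 * (k - x - f) - ν 1)
      id22 = solve 3 (λ k x f → :c 4 :* k :- :c 2 :- :c 4 :* x :- :c 4 :* f := :c 2 :* (:c 2 :* (k :- x :- f) :- :c 1)) refl
      id23 : ∀ f n → ν 1 ≡ (ν 1 + ν 2 * n) - ν 2 * n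
      id23 = solve 2 (λ f n → :c 1 := (:c 1 :+ :c 2 :* n) :- :c 2 :* n) refl
      id24 : ∀ n x s → ν 2 * x + ν 4 * x * x + (ν 2 * s) * (ν 2 * s) - ν 2 * n ≡ ν 2 * (x + ν 2 * x * x + ν 2 * s * s - n)
      id24 = solve 3 (λ n x s → :c 2 :* x :+ :c 4 :* x :* x :+ (:c 2 :* s) :* (:c 2 :* s) :- :c 2 :* n := :c 2 :* (x :+ :c 2 :* x :* x :+ :c 2 :* s :* s :- n)) refl
      id25 : ∀ y x f → ν 2 * y ≡ ν 4 * f - ν 4 * x - ((- ν 1) * (ν 1 + x * ν 4) + (- ν 1) * (ν 2 * y) + (ν 1 + ν 4 * f))
      id25 = solve 3 (λ y x f → :c 2 :* y := :c 4 :* f :- :c 4 :* x :- ((:- :c 1) :* (:c 1 :+ x :* :c 4) :+ (:- :c 1) :* (:c 2 :* y) :+ (:c 1 :+ :c 4 :* f))) refl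
      id26 : ∀ k x f → ν 4 * f - ν 4 * x - ν 4 * k ≡ ν 2 * (ν 2 * (f - k - x))
      id26 = solve 3 (λ k x f → :c 4 :* f :- :c 4 :* x :- :c 4 :* k := :c 2 :* (:c 2 :* (f :- k :- x))) refl

  open import Data.Integer using (_+_; _*_; _-_; -_)

  parity : ∀ n → (∃ λ k → n ≡ 2 ℕ.* k) ⊎ (∃ λ k → n ≡ suc (2 ℕ.* k))
  parity zero = inj₁ (0 , refl)
  parity (suc n) with parity n
  ... | inj₁ (k , e) = inj₂ (k , cong suc e)
  ... | inj₂ (k , e) = inj₁ (suc k , trans (cong suc e) (sym (ℕP.*-suc 2 k)))

  1≢2q : ∀ q → + 1 ≢ + 2 * q
  1≢2q q e with ℤ.∣ q ∣ | trans (cong ℤ.∣_∣ e) (ℤP.abs-* (+ 2) q)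
  ... | zero | ()
  ... | suc n | e′ = ℕP.1+n≢0 (sym (trans (ℕP.suc-injective e′) (ℕP.+-suc n (n ℕ.+ 0))))

  -- Both x + yi and c + di are divisible by p for the same integer i, which makes the Gaussian
  -- integers x + iy and c + id associates. The evenness of d restricts the unit to ±1, and c + d +
  -- p ≡ 0 (mod 4) fixes the sign.
  module SumOfTwoSquares (p f : ℕ) .{{_ : NonZero p}} (p≡ : + p ≡ + 1 + + 4 * + f)
    (x y c d i x′ d′ k : ℤ)
    (xy : + p ≡ x * x + y * y) (cd : + p ≡ c * c + d * d)
    (p∣xyi : + p ∣ x + y * i) (p∣cdi : + p ∣ c + d * i)
    (x≡ : x ≡ + 1 + x′ * + 4) (d≡ : d ≡ + 2 * d′) (k≡ : c + d + + p ≡ + 4 * k)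
    where

    open ≡-Reasoning

    private
      -- (c + id)(x - iy) = A - iB; the aim is B = 0 and A = ±p.
      A B : ℤ
      A = c * x + d * y
      B = c * y - d * x

      brahmagupta : A * A + B * B ≡ + p * + p
      brahmagupta = trans (Id.id1 ℤ-ring c d x y) (sym (cong₂ _*_ xy cd))

      p∣B : ∃ λ q → B ≡ q * + p
      p∣B = b * y - d * a , (begin
        c * y - d * x                               ≡⟨ Id.id2 ℤ-ring c d x y i ⟩
        (c + d * i) * y - d * (x + y * i)           ≡⟨ cong₂ (λ u v → u * y - d * v) e′ e ⟩
        b * + p * y - d * (a * + p)                 ≡⟨ Id.id3 ℤ-ring b (+ p) y d a ⟩
        (b * y - d * a) * + p ∎)
        where
        open ℤS._∣_ p∣xyi using () renaming (quotient to a; equality to e)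
        open ℤS._∣_ p∣cdi using () renaming (quotient to b; equality to e′)

      -- y is even since p ≡ x² ≡ 1 (mod 4)
      y-even : ∃ λ y′ → y ≡ + 2 * y′
      y-even with parity ℤ.∣ y ∣
      ... | inj₁ (n , e) = sgn y n e
        where
        sgn : ∀ y n → ℤ.∣ y ∣ ≡ 2 ℕ.* n → ∃ λ y′ → y ≡ + 2 * y′
        sgn (+ m) n e = + n , trans (cong +_ e) (ℤP.pos-* 2 n)
        sgn -[1+ m ] n e = - + n , trans (cong (λ z → - + z) e) (trans (cong -_ (ℤP.pos-* 2 n)) (ℤP.neg-distribʳ-* (+ 2) (+ n)))
      ... | inj₂ (n , e) = ⊥-elim (1≢2q (+ 2 * + f - + 4 * x′ - + 8 * x′ * x′ - + 2 * N * N - + 2 * N) (begin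
          + 1 ≡⟨ Id.id4 ℤ-ring N N x′ (+ f) ⟩
          (+ 1 + + 2 * N) * (+ 1 + + 2 * N) - + 4 * (N + N * N) ≡⟨ cong (λ z → z - + 4 * (N + N * N)) (sym yy) ⟩
          y * y - + 4 * (N + N * N) ≡⟨ cong (λ z → z - + 4 * (N + N * N)) (trans (Id.id5 ℤ-ring (x * x) (y * y)) (cong₂ (λ u v → u - v * v) (trans (sym xy) p≡) x≡)) ⟩
          + 1 + + 4 * + f - (+ 1 + x′ * + 4) * (+ 1 + x′ * + 4) - + 4 * (N + N * N)
            ≡⟨ Id.id6 ℤ-ring (+ f) x′ N ⟩
          + 2 * (+ 2 * + f - + 4 * x′ - + 8 * x′ * x′ - + 2 * N * N - + 2 * N) ∎))
        where
        N = + n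
        sq : ∀ y → ℤ.∣ y ∣ ≡ suc (2 ℕ.* n) → y * y ≡ + suc (2 ℕ.* n) * + suc (2 ℕ.* n)
        sq (+ m) e = cong (λ z → + z * + z) e
        sq -[1+ m ] e = cong (λ z → + z * + z) e
        yy : y * y ≡ (+ 1 + + 2 * N) * (+ 1 + + 2 * N)
        yy = trans (sq y e) (cong (λ z → (+ 1 + z) * (+ 1 + z)) (ℤP.pos-* 2 n))

      y′ : ℤ
      y′ = proj₁ y-even

      f≡ : + f ≡ + 2 * x′ + + 4 * x′ * x′ + y′ * y′
      f≡ = ℤP.*-cancelˡ-≡ (+ 4) (+ f) _ (begin
        + 4 * + f ≡⟨ Id.id7 ℤ-ring (+ f) ⟩
        + 1 + + 4 * + f - + 1 ≡⟨ cong (λ z → z - + 1) (trans (sym p≡) (trans xy (cong₂ (λ u v → u * u + v * v) x≡ (proj₂ y-even)))) ⟩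
        (+ 1 + x′ * + 4) * (+ 1 + x′ * + 4) + + 2 * y′ * (+ 2 * y′) - + 1
          ≡⟨ Id.id8 ℤ-ring x′ y′ ⟩
        + 4 * (+ 2 * x′ + + 4 * x′ * x′ + y′ * y′) ∎)

      -- B is a multiple of 2p of absolute value at most p
      B≡0 : B ≡ + 0
      B≡0 = vanish B small (ℤS.∣⇒∣ᵤ (divides q′ multiple))
        where
        q : ℤ
        q = proj₁ p∣B
        e : B ≡ q * + p
        e = proj₂ p∣B
        q′ : ℤ
        q′ = c * y′ - d′ * x - + 2 * + f * q
        q≡ : q ≡ + 2 * q′
        q≡ = begin
          q ≡⟨ Id.id9 ℤ-ring q (+ f) ⟩
          q * (+ 1 + + 4 * + f) - + 4 * + f * q ≡⟨ cong (λ z → z - + 4 * + f * q) (trans (cong (q *_) (sym p≡)) (sym e)) ⟩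
          c * y - d * x - + 4 * + f * q ≡⟨ cong₂ (λ u v → c * u - v * x - + 4 * + f * q) (proj₂ y-even) d≡ ⟩
          c * (+ 2 * y′) - + 2 * d′ * x - + 4 * + f * q
            ≡⟨ Id.id10 ℤ-ring c y′ d′ x (+ f) q ⟩
          + 2 * q′ ∎
        multiple : B ≡ q′ * + (2 ℕ.* p)
        multiple = trans e (trans (cong (_* + p) q≡) (trans (Id.id11 ℤ-ring q′ (+ p)) (cong (q′ *_) (sym (ℤP.pos-* 2 p)))))
        abs² : ∀ z → z * z ≡ + (ℤ.∣ z ∣ ℕ.* ℤ.∣ z ∣)
        abs² (+ n) = sym (ℤP.pos-* n n)
        abs² -[1+ n ] = refl
        squares : ℤ.∣ A ∣ ℕ.* ℤ.∣ A ∣ ℕ.+ ℤ.∣ B ∣ ℕ.* ℤ.∣ B ∣ ≡ p ℕ.* p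
        squares = ℤP.+-injective (trans (sym (cong₂ _+_ (abs² A) (abs² B))) (trans brahmagupta (sym (ℤP.pos-* p p))))
        small : ℤ.∣ B ∣ ℕ.< 2 ℕ.* p
        small = ℕP.≰⇒> (λ 2p≤B → ℕP.<⇒≱ (ℕP.*-mono-< (p<2p) (p<2p))
          (ℕP.≤-trans (ℕP.*-mono-≤ 2p≤B 2p≤B) (ℕP.≤-trans (ℕP.m≤n+m _ (ℤ.∣ A ∣ ℕ.* ℤ.∣ A ∣)) (ℕP.≤-reflexive squares))))
          where
          p<2p : p ℕ.< 2 ℕ.* p
          p<2p = ℕP.m<m+n p (ℕ.>-nonZero⁻¹ (p ℕ.+ 0) {{subst NonZero (sym (ℕP.+-identityʳ p)) (ℕ.≢-nonZero (ℕ.≢-nonZero⁻¹ p))}})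
        vanish : ∀ z → ℤ.∣ z ∣ ℕ.< 2 ℕ.* p → (2 ℕ.* p) ℕD.∣ ℤ.∣ z ∣ → z ≡ + 0
        vanish (+ zero) _ _ = refl
        vanish (+ suc n) l d = ⊥-elim (ℕP.<⇒≱ l (ℕD.∣⇒≤ d))
        vanish -[1+ n ] l d = ⊥-elim (ℕP.<⇒≱ l (ℕD.∣⇒≤ d))

      cy≡dx : c * y ≡ d * x
      cy≡dx = ℤP.i-j≡0⇒i≡j (c * y) (d * x) B≡0

      A≡±p : ∀ ε → A ≡ ε * + p → c ≡ ε * x × d ≡ ε * y
      A≡±p ε e = ℤP.*-cancelʳ-≡ c (ε * x) (+ p) {{pos}} (begin
          c * + p               ≡⟨ cong (c *_) xy ⟩
          c * (x * x + y * y)   ≡⟨ Id.id12 ℤ-ring c x y ⟩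
          x * (c * x) + c * y * y ≡⟨ cong (λ z → x * (c * x) + z * y) cy≡dx ⟩
          x * (c * x) + d * x * y ≡⟨ Id.id13 ℤ-ring c d x y ⟩
          x * A                 ≡⟨ cong (x *_) e ⟩
          x * (ε * + p)         ≡⟨ Id.id14 ℤ-ring x ε (+ p) ⟩
          ε * x * + p ∎)
        , ℤP.*-cancelʳ-≡ d (ε * y) (+ p) {{pos}} (begin
          d * + p               ≡⟨ cong (d *_) xy ⟩
          d * (x * x + y * y)   ≡⟨ Id.id15 ℤ-ring d x y ⟩
          x * (d * x) + d * y * y ≡⟨ cong (λ z → x * z + d * y * y) (sym cy≡dx) ⟩
          x * (c * y) + d * y * y ≡⟨ Id.id16 ℤ-ring c d x y ⟩
          y * A                 ≡⟨ cong (y *_) e ⟩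
          y * (ε * + p)         ≡⟨ Id.id17 ℤ-ring y ε (+ p) ⟩
          ε * y * + p ∎)
        where
        pos : ℤ.NonZero (+ p)
        pos = ℕ.≢-nonZero (ℕ.≢-nonZero⁻¹ p)

      sign : ∃ λ ε → (ε ≡ + 1 ⊎ ε ≡ - + 1) × A ≡ ε * + p
      sign = go (ℤP.i*j≡0⇒i≡0∨j≡0 (A - + p) {A + + p} (begin
          (A - + p) * (A + + p)        ≡⟨ Id.id18 ℤ-ring A (+ p) ⟩
          A * A + + 0 * + 0 - + p * + p ≡⟨ cong (λ z → A * A + z * z - + p * + p) (sym B≡0) ⟩
          A * A + B * B - + p * + p    ≡⟨ ℤP.i≡j⇒i-j≡0 brahmagupta ⟩
          + 0 ∎))
        where
        go : A - + p ≡ + 0 ⊎ A + + p ≡ + 0 → ∃ λ ε → (ε ≡ + 1 ⊎ ε ≡ - + 1) × A ≡ ε * + p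
        go (inj₁ e) = + 1 , inj₁ refl , trans (ℤP.i-j≡0⇒i≡j A (+ p) e) (sym (ℤP.*-identityˡ (+ p)))
        go (inj₂ e) = - + 1 , inj₂ refl , trans (ℤP.i-j≡0⇒i≡j A (- + p) (trans (cong (λ z → A + z) (ℤP.neg-involutive (+ p))) e)) (sym (ℤP.-1*i≡-i (+ p)))

      halve : ∀ u v → + 2 * u ≡ + 2 * v → u ≡ v
      halve u v = ℤP.*-cancelˡ-≡ (+ 2) u v

      expand : ∀ ε → c ≡ ε * x → d ≡ ε * y → ε * (+ 1 + x′ * + 4) + ε * (+ 2 * y′) + (+ 1 + + 4 * + f) ≡ + 4 * k
      expand ε ec ed = trans (cong₂ _+_ (cong₂ _+_ (trans (cong (ε *_) (sym x≡)) (sym ec)) (trans (cong (ε *_) (sym (proj₂ y-even))) (sym ed))) (sym p≡)) k≡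

    -- With x ≡ 1 (mod 4) and y = 2y′ one has f ≡ y′ (mod 2). The sign +1 would give 2 + 2y′ ≡ 0
    -- (mod 4), making y′ and f odd.
    sign-even : ∀ n → f ≡ 2 ℕ.* n → c ≡ - + 1 * x × d ≡ - + 1 * y
    sign-even n f2n = go sign
      where
      go : (∃ λ ε → (ε ≡ + 1 ⊎ ε ≡ - + 1) × A ≡ ε * + p) → c ≡ - + 1 * x × d ≡ - + 1 * y
      go (_ , inj₂ refl , e) = A≡±p (- + 1) e
      go (_ , inj₁ refl , e) = ⊥-elim (1≢2q (+ n - x′ - + 2 * x′ * x′ - + 2 * s * s + + 2 * s) (begin
          + 1 ≡⟨ Id.id19 ℤ-ring (+ f) y′ ⟩
          + f + + 1 - + f ≡⟨ cong₂ (λ u v → u + + 1 - v) (trans (cong +_ f2n) (ℤP.pos-* 2 n)) f≡ ⟩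
          + 2 * + n + + 1 - (+ 2 * x′ + + 4 * x′ * x′ + y′ * y′)
            ≡⟨ cong (λ z → + 2 * + n + + 1 - (+ 2 * x′ + + 4 * x′ * x′ + z * z)) y′≡ ⟩
          + 2 * + n + + 1 - (+ 2 * x′ + + 4 * x′ * x′ + (+ 2 * s - + 1) * (+ 2 * s - + 1))
            ≡⟨ Id.id20 ℤ-ring (+ n) x′ s ⟩
          + 2 * (+ n - x′ - + 2 * x′ * x′ - + 2 * s * s + + 2 * s) ∎))
        where
        s : ℤ
        s = k - x′ - + f
        ed = A≡±p (+ 1) e
        y′≡ : y′ ≡ + 2 * s - + 1
        y′≡ = halve y′ (+ 2 * s - + 1) (begin
          + 2 * y′ ≡⟨ Id.id21 ℤ-ring y′ x′ (+ f) ⟩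
          + 1 * (+ 1 + x′ * + 4) + + 1 * (+ 2 * y′) + (+ 1 + + 4 * + f) - + 2 - + 4 * x′ - + 4 * + f ≡⟨ cong (λ z → z - + 2 - + 4 * x′ - + 4 * + f) (expand (+ 1) (proj₁ ed) (proj₂ ed)) ⟩
          + 4 * k - + 2 - + 4 * x′ - + 4 * + f ≡⟨ Id.id22 ℤ-ring k x′ (+ f) ⟩
          + 2 * (+ 2 * s - + 1) ∎)

    -- With the sign -1 the condition modulo 4 would read 2y′ ≡ 0, making y′ and f even.
    sign-odd : ∀ n → f ≡ suc (2 ℕ.* n) → c ≡ + 1 * x × d ≡ + 1 * y
    sign-odd n f2n = go sign
      where
      go : (∃ λ ε → (ε ≡ + 1 ⊎ ε ≡ - + 1) × A ≡ ε * + p) → c ≡ + 1 * x × d ≡ + 1 * y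
      go (_ , inj₁ refl , e) = A≡±p (+ 1) e
      go (_ , inj₂ refl , e) = ⊥-elim (1≢2q (x′ + + 2 * x′ * x′ + + 2 * s * s - + n) (begin
          + 1 ≡⟨ Id.id23 ℤ-ring (+ f) (+ n) ⟩
          (+ 1 + + 2 * + n) - + 2 * + n ≡⟨ cong (λ z → z - + 2 * + n) (trans (sym (trans (cong +_ f2n) (cong (λ z → + 1 + z) (ℤP.pos-* 2 n)))) f≡) ⟩
          + 2 * x′ + + 4 * x′ * x′ + y′ * y′ - + 2 * + n ≡⟨ cong (λ z → + 2 * x′ + + 4 * x′ * x′ + z * z - + 2 * + n) y′≡ ⟩
          + 2 * x′ + + 4 * x′ * x′ + (+ 2 * s) * (+ 2 * s) - + 2 * + n
            ≡⟨ Id.id24 ℤ-ring (+ n) x′ s ⟩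
          + 2 * (x′ + + 2 * x′ * x′ + + 2 * s * s - + n) ∎))
        where
        s : ℤ
        s = + f - k - x′
        ed = A≡±p (- + 1) e
        y′≡ : y′ ≡ + 2 * s
        y′≡ = halve y′ (+ 2 * s) (begin
          + 2 * y′ ≡⟨ Id.id25 ℤ-ring y′ x′ (+ f) ⟩
          + 4 * + f - + 4 * x′ - (- + 1 * (+ 1 + x′ * + 4) + - + 1 * (+ 2 * y′) + (+ 1 + + 4 * + f)) ≡⟨ cong (λ z → + 4 * + f - + 4 * x′ - z) (expand (- + 1) (proj₁ ed) (proj₂ ed)) ⟩
          + 4 * + f - + 4 * x′ - + 4 * k ≡⟨ Id.id26 ℤ-ring k x′ (+ f) ⟩
          + 2 * (+ 2 * s) ∎)

-- The square of the Jacobi sum modulo 3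

module CubicSum where

  open RingKit
  open ZMod
  open import Data.Nat as ℕ using (ℕ; zero; suc; _<_)
  import Data.Nat.Properties as ℕP
  open import Data.Product using (_,_; ∃; proj₁; proj₂)
  open import Data.Empty using (⊥-elim)
  open import Relation.Nullary using (¬_; Dec; yes; no)
  open import Relation.Binary.PropositionalEquality hiding (J)

  -- Frobenius for a symmetric trilinear form: modulo 3 only the diagonal survives.
  module SymmetricTriple (S : Ring≡) (m : ℕ → ℕ → ℕ → Ring≡.Carrier S)
    (sym₁₂ : ∀ a b c → m a b c ≡ m b a c) (sym₂₃ : ∀ a b c → m a b c ≡ m a c b) where
    open Kit S

    total : ℕ → Carrier
    total n = Σ< n (λ a → Σ< n (λ b → Σ< n (λ c → m a b c)))

    mod-3 : ∀ n → ∃ λ w → total n ≡ Σ< n (λ a → m a a a) + ν 3 * w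
    mod-3 zero = 0# , solve 0 (:c 0 := :c 0 :+ :c 3 :* :c 0) refl
    mod-3 (suc n) with mod-3 n
    -- `X` collects the new triples in which n occurs once, `U` those in which it occurs twice; by
    -- symmetry each appears in three positions.
    ... | w , eq = w + X + U , (begin
      Σ< n (λ a → Σ< n (λ b → A a b + m a b n) + (A a n + m a n n)) + (Σ< n (λ b → A n b + m n b n) + (A n n + m n n n))
        ≡⟨ cong₂ (λ u v → u + (v + (A n n + m n n n)))
             (trans (Σ-+ n _ _) (cong₂ _+_ (trans (Σ-cong n (λ a _ → Σ-+ n _ _)) (Σ-+ n _ _)) (Σ-+ n _ _))) (Σ-+ n _ _) ⟩
      total n + X + (Σ< n (λ a → A a n) + U) + (Σ< n (A n) + Σ< n (λ b → m n b n) + (A n n + m n n n))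
        ≡⟨ cong₂ (λ u v → total n + X + (u + U) + (v + Σ< n (λ b → m n b n) + (A n n + m n n n)))
             (Σ-cong n (λ a _ → Σ-cong n (λ c _ → sym₂₃ a n c)))
             (Σ-cong n (λ b _ → Σ-cong n (λ c _ → trans (sym₁₂ n b c) (sym₂₃ b n c)))) ⟩
      total n + X + (X + U) + (X + Σ< n (λ b → m n b n) + (A n n + m n n n))
        ≡⟨ cong₂ (λ u v → total n + X + (X + U) + (X + u + (v + m n n n)))
             (Σ-cong n (λ b _ → sym₁₂ n b n)) (Σ-cong n (λ c _ → trans (sym₂₃ n n c) (sym₁₂ n c n))) ⟩
      total n + X + (X + U) + (X + U + (U + m n n n))
        ≡⟨ cong (λ z → z + X + (X + U) + (X + U + (U + m n n n))) eq ⟩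
      Σ< n (λ a → m a a a) + ν 3 * w + X + (X + U) + (X + U + (U + m n n n))
        ≡⟨ solve 5 (λ d w X U e → d :+ :c 3 :* w :+ X :+ (X :+ U) :+ (X :+ U :+ (U :+ e)) := d :+ e :+ :c 3 :* (w :+ X :+ U)) refl (Σ< n (λ a → m a a a)) w X U (m n n n) ⟩
      Σ< n (λ a → m a a a) + m n n n + ν 3 * (w + X + U) ∎)
      where
      open ≡-Reasoning
      A : ℕ → ℕ → Carrier
      A a b = Σ< n (λ c → m a b c)
      X U : Carrier
      X = Σ< n (λ a → Σ< n (λ b → m a b n))
      U = Σ< n (λ a → m a n n)

  module CubicSums {p : ℕ} (Q : Quotient p) (S : Ring≡) where
    open Kit S
    open SumOver Q S
    private module F = Quotient Q

    module Congruence
      (F-inverse : ∀ {x} → x ≢ F.0# → ∃ λ y → x F.* y ≡ F.1#)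
      (half : F.Carrier) (F-2half : F.ν 2 F.* half ≡ F.1#)
      (third : F.Carrier) (F-3third : F.ν 3 F.* third ≡ F.1#)
      (char0 : ∀ n → ν n ≡ 0# → n ≡ 0)
      (χ φ : F.Carrier → Carrier)
      (χ-* : ∀ x y → χ (x F.* y) ≡ χ x * χ y)
      (φ≡χ² : ∀ x → φ x ≡ χ x * χ x)
      (φ-0 : φ F.0# ≡ 0#)
      (φ² : ∀ x → x ≢ F.0# → φ x * φ x ≡ 1#)
      (1+φ : ∀ x → ∃ λ k → 1# + φ x ≡ ν k)
      (Σχ : Σ∀ χ ≡ 0#) (Σφ : Σ∀ φ ≡ 0#)
      where

      open ≡-Reasoning

      private
        if : ∀ {A : Set} → Dec A → Carrier
        if (yes _) = 1#
        if (no _) = 0#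

        if-yes : ∀ {A : Set} (d : Dec A) → A → if d ≡ 1#
        if-yes (yes _) _ = refl
        if-yes (no n) a = ⊥-elim (n a)

        if-no : ∀ {A : Set} (d : Dec A) → ¬ A → if d ≡ 0#
        if-no (yes a) n = ⊥-elim (n a)
        if-no (no _) _ = refl

        if-cong : ∀ {A B : Set} (d : Dec A) (d′ : Dec B) → (A → B) → (B → A) → if d ≡ if d′
        if-cong (yes a) d′ f g = sym (if-yes d′ (f a))
        if-cong (no n) d′ f g = sym (if-no d′ (λ b → n (g b)))

      δ : F.Carrier → F.Carrier → Carrier
      δ x y = if (x F.≟ y)

      Σδ : ∀ y (G : F.Carrier → Carrier) → Σ∀ (λ x → δ x y * G x) ≡ G y
      Σδ y G = trans (Σ∀-single y _ (λ x ne → trans (cong (_* G x) (if-no (x F.≟ y) ne)) (zeroˡ _)))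
        (trans (cong (_* G y) (if-yes (y F.≟ y) refl)) (*-identityˡ _))

      Σδ1 : ∀ y → Σ∀ (λ x → δ x y) ≡ 1#
      Σδ1 y = trans (Σ∀-cong {λ x → δ x y} (λ x → sym (*-identityʳ (δ x y)))) (Σδ y (λ _ → 1#))

      F-cancel : ∀ {x y} → x F.* y ≡ F.0# → x ≢ F.0# → y ≡ F.0#
      F-cancel {x} {y} e ne = trans (sym (F.*-identityˡ y)) (trans (cong (F._* y) (trans (sym (proj₂ i)) (F.*-comm x _)))
        (trans (F.*-assoc _ x y) (trans (cong (proj₁ i F.*_) e) (F.zeroʳ _))))
        where i = F-inverse ne


      roots : F.Carrier → Carrier
      roots t = Σ∀ (λ w → δ (w F.* w) t)

      private
        squareRoot? : ∀ t → Dec (∃ λ w → w F.* w ≡ t)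
        squareRoot? t with ℕP.anyUpTo? (λ i → F.ν i F.* F.ν i F.≟ t) p
        ... | yes (i , _ , e) = yes (F.ν i , e)
        ... | no none = no (λ { (w , e) → none (F.rep w , F.rep< w , trans (cong₂ F._*_ (F.ν-rep w) (F.ν-rep w)) e) })

        two-roots : ∀ w₀ → w₀ ≢ F.0# → roots (w₀ F.* w₀) ≡ 1# + 1#
        two-roots w₀ ne = trans (Σ∀-cong pointwise) (trans (Σ∀-+ (λ w → δ w w₀) (λ w → δ w (F.- w₀))) (cong₂ _+_ (Σδ1 w₀) (Σδ1 (F.- w₀))))
          where
          distinct : w₀ ≢ F.- w₀
          distinct e = ne (trans (trans (sym (F.*-identityˡ w₀)) (cong (F._* w₀) (sym F-2half)))
            (trans (F.solve 2 (λ h w → F.:c 2 F.:* h F.:* w F.:= h F.:* (w F.:- (F.:- w))) refl half w₀)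
              (trans (cong (half F.*_) (F.x≡y⇒x-y≡0 e)) (F.zeroʳ half))))
          by : ∀ w → Dec (w ≡ w₀) → Dec (w ≡ F.- w₀) → δ (w F.* w) (w₀ F.* w₀) ≡ δ w w₀ + δ w (F.- w₀)
          by w (yes refl) _ = trans (if-yes (w F.* w F.≟ w F.* w) refl)
            (sym (trans (cong₂ _+_ (if-yes (w F.≟ w) refl) (if-no (w F.≟ F.- w) distinct)) (+-identityʳ 1#)))
          by w (no n₁) (yes e) = trans (if-yes (w F.* w F.≟ w₀ F.* w₀) (trans (cong (λ z → z F.* z) e) (F.solve 1 (λ w → (F.:- w) F.:* (F.:- w) F.:= w F.:* w) refl w₀)))
            (sym (trans (cong₂ _+_ (if-no (w F.≟ w₀) n₁) (if-yes (w F.≟ F.- w₀) e)) (+-identityˡ 1#)))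
          by w (no n₁) (no n₂) = trans (if-no (w F.* w F.≟ w₀ F.* w₀) (λ e → n₂ (F.x-y≡0⇒x≡y (F-cancel
              (trans (F.solve 2 (λ w v → (w F.:- v) F.:* (w F.:- (F.:- v)) F.:= w F.:* w F.:- v F.:* v) refl w w₀) (F.x≡y⇒x-y≡0 e))
              (λ d → n₁ (F.x-y≡0⇒x≡y d))))))
            (sym (trans (cong₂ _+_ (if-no (w F.≟ w₀) n₁) (if-no (w F.≟ F.- w₀) n₂)) (+-identityˡ 0#)))
          pointwise : ∀ w → δ (w F.* w) (w₀ F.* w₀) ≡ δ w w₀ + δ w (F.- w₀)
          pointwise w = by w (w F.≟ w₀) (w F.≟ F.- w₀)

        -- A nonzero square has φ = 1 and two roots, and 0 has one, so squares have no deficit. For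
        -- t without roots it is 1 + φ t itself, known only to be a natural number.
        deficit : ∀ t → ∃ λ k → roots t + ν k ≡ 1# + φ t
        deficit t = go (squareRoot? t)
          where
          go : Dec (∃ λ w → w F.* w ≡ t) → ∃ λ k → roots t + ν k ≡ 1# + φ t
          go (no none) = proj₁ (1+φ t) , trans (cong (_+ ν (proj₁ (1+φ t))) (Σ∀-0 (λ w → if-no (w F.* w F.≟ t) (λ e → none (w , e)))))
            (trans (+-identityˡ _) (sym (proj₂ (1+φ t))))
          go (yes (w , refl)) = by (w F.≟ F.0#)
            where
            by : Dec (w ≡ F.0#) → ∃ λ k → roots (w F.* w) + ν k ≡ 1# + φ (w F.* w)
            by (yes refl) = 0 , (begin
              roots (F.0# F.* F.0#) + 0#    ≡⟨ +-identityʳ _ ⟩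
              roots (F.0# F.* F.0#)         ≡⟨ Σ∀-cong (λ v → if-cong (v F.* v F.≟ F.0# F.* F.0#) (v F.≟ F.0#) (λ e → only v (v F.≟ F.0#) (trans e (F.zeroˡ _))) (λ e → cong (λ z → z F.* z) e)) ⟩
              Σ∀ (λ v → δ v F.0#)           ≡⟨ Σδ1 F.0# ⟩
              1#                            ≡⟨ sym (+-identityʳ 1#) ⟩
              1# + 0#                       ≡⟨ cong (λ z → 1# + z) (sym (trans (cong φ (F.zeroˡ F.0#)) φ-0)) ⟩
              1# + φ (F.0# F.* F.0#) ∎)
              where
              only : ∀ v → Dec (v ≡ F.0#) → v F.* v ≡ F.0# → v ≡ F.0#
              only v (yes e) _ = e
              only v (no ne) e = F-cancel e ne
            by (no ne) = 0 , (begin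
              roots (w F.* w) + 0#   ≡⟨ trans (+-identityʳ _) (two-roots w ne) ⟩
              1# + 1#                ≡⟨ cong (λ z → 1# + z) (sym (φ² w ne)) ⟩
              1# + φ w * φ w         ≡⟨ cong (λ z → 1# + z) (trans (cong₂ _*_ (φ≡χ² w) (φ≡χ² w)) (sym (trans (φ≡χ² (w F.* w)) (cong₂ _*_ (χ-* w w) (χ-* w w))))) ⟩
              1# + φ (w F.* w) ∎)

        sumℕ : ℕ → (ℕ → ℕ) → ℕ
        sumℕ zero k = 0
        sumℕ (suc n) k = sumℕ n k ℕ.+ k n

        ν-sumℕ : ∀ n k → Σ< n (λ i → ν (k i)) ≡ ν (sumℕ n k)
        ν-sumℕ zero k = refl
        ν-sumℕ (suc n) k = trans (cong (_+ ν (k n)) (ν-sumℕ n k)) (sym (ν-+ (sumℕ n k) (k n)))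

        sumℕ≡0 : ∀ n k → sumℕ n k ≡ 0 → ∀ i → i < n → k i ≡ 0
        sumℕ≡0 (suc n) k e i l with i ℕP.≟ n
        ... | yes refl = ℕP.m+n≡0⇒n≡0 (sumℕ n k) e
        ... | no ne = sumℕ≡0 n k (ℕP.m+n≡0⇒m≡0 (sumℕ n k) e) i (ℕP.≤∧≢⇒< (ℕP.≤-pred l) ne)

        Σroots : Σ∀ roots ≡ Σ∀ (λ _ → 1#)
        Σroots = trans (Σ∀-swap (λ t w → δ (w F.* w) t)) (Σ∀-cong (λ w →
          trans (Σ∀-cong (λ t → if-cong (w F.* w F.≟ t) (t F.≟ w F.* w) sym sym)) (Σδ1 (w F.* w))))

        -- Summed over t, the numbers of roots and the values 1 + φ t both give the number of
        -- residues, as Σφ = 0. A vanishing sum of natural numbers in characteristic 0 has vanishing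
        -- terms.
        no-deficit : ∀ t → proj₁ (deficit t) ≡ 0
        no-deficit t = trans (cong (λ z → proj₁ (deficit z)) (sym (F.ν-rep t)))
          (sumℕ≡0 p (λ i → proj₁ (deficit (F.ν i))) (char0 _ (trans (sym (ν-sumℕ p _)) total)) (F.rep t) (F.rep< t))
          where
          D = Σ∀ (λ t → ν (proj₁ (deficit t)))
          o = Σ∀ (λ _ → 1#)
          total : D ≡ 0#
          total = begin
            D                    ≡⟨ solve 2 (λ D o → D := (o :+ D) :- o) refl D o ⟩
            (o + D) - o          ≡⟨ cong (λ z → (z + D) - o) (sym Σroots) ⟩
            (Σ∀ roots + D) - o   ≡⟨ cong (_- o) (sym (Σ∀-+ roots (λ t → ν (proj₁ (deficit t))))) ⟩
            Σ∀ (λ t → roots t + ν (proj₁ (deficit t))) - o ≡⟨ cong (_- o) (Σ∀-cong (λ t → proj₂ (deficit t))) ⟩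
            Σ∀ (λ t → 1# + φ t) - o ≡⟨ cong (_- o) (Σ∀-+ (λ _ → 1#) φ) ⟩
            (o + Σ∀ φ) - o       ≡⟨ cong (λ z → (o + z) - o) Σφ ⟩
            (o + 0#) - o         ≡⟨ solve 1 (λ o → (o :+ :c 0) :- o := :c 0) refl o ⟩
            0# ∎

      roots≡1+φ : ∀ t → roots t ≡ 1# + φ t
      roots≡1+φ t = trans (sym (+-identityʳ _)) (trans (cong (λ k → roots t + ν k) (sym (no-deficit t))) (proj₂ (deficit t)))

      Σ-squares : ∀ G → Σ∀ (λ w → G (w F.* w)) ≡ Σ∀ (λ t → (1# + φ t) * G t)
      Σ-squares G = begin
        Σ∀ (λ w → G (w F.* w))                      ≡⟨ Σ∀-cong (λ w → sym (trans (Σ∀-cong (λ t → cong (_* G t) (if-cong (w F.* w F.≟ t) (t F.≟ w F.* w) sym sym))) (Σδ (w F.* w) G))) ⟩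
        Σ∀ (λ w → Σ∀ (λ t → δ (w F.* w) t * G t))   ≡⟨ Σ∀-swap (λ w t → δ (w F.* w) t * G t) ⟩
        Σ∀ (λ t → Σ∀ (λ w → δ (w F.* w) t * G t))   ≡⟨ Σ∀-cong (λ t → trans (Σ∀-cong (λ w → *-comm (δ (w F.* w) t) (G t))) (trans (Σ∀-*ˡ (G t) (λ w → δ (w F.* w) t)) (*-comm _ _))) ⟩
        Σ∀ (λ t → roots t * G t)                    ≡⟨ Σ∀-cong (λ t → cong (_* G t) (roots≡1+φ t)) ⟩
        Σ∀ (λ t → (1# + φ t) * G t) ∎


      flip : ∀ (ψ : F.Carrier → Carrier) → Σ∀ (λ x → ψ (F.1# F.- x)) ≡ Σ∀ ψ
      flip ψ = Σ∀-reindex (λ x → F.1# F.- x) (λ x → F.1# F.- x) invol invol ψ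
        where
        invol : ∀ x → F.1# F.- (F.1# F.- x) ≡ x
        invol = F.solve 1 (λ x → F.:c 1 F.:- (F.:c 1 F.:- x) F.:= x) refl

      J K : Carrier
      J = Σ∀ (λ x → χ x * χ (F.1# F.- x))
      K = Σ∀ (λ x → χ x * φ (F.1# F.- x))

      -- 4x(1 - x) = 1 - (2x - 1)², and a sum over squares is a sum weighted by 1 + φ; the part of
      -- weight 1 is Σχ = 0.
      χ4*J : χ (F.ν 4) * J ≡ K
      χ4*J = begin
        χ (F.ν 4) * J
          ≡⟨ sym (Σ∀-*ˡ (χ (F.ν 4)) (λ x → χ x * χ (F.1# F.- x))) ⟩
        Σ∀ (λ x → χ (F.ν 4) * (χ x * χ (F.1# F.- x)))
          ≡⟨ Σ∀-cong (λ x → trans (cong (χ (F.ν 4) *_) (sym (χ-* x (F.1# F.- x)))) (trans (sym (χ-* (F.ν 4) _))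
               (cong χ (F.solve 1 (λ x → F.:c 4 F.:* (x F.:* (F.:c 1 F.:- x)) F.:= F.:c 1 F.:- (F.:c 2 F.:* x F.:- F.:c 1) F.:* (F.:c 2 F.:* x F.:- F.:c 1)) refl x)))) ⟩
        Σ∀ (λ x → χ (F.1# F.- (F.ν 2 F.* x F.- F.1#) F.* (F.ν 2 F.* x F.- F.1#)))
          ≡⟨ Σ∀-reindex (λ x → F.ν 2 F.* x F.- F.1#) (λ w → (w F.+ F.1#) F.* half) fwd bwd (λ w → χ (F.1# F.- w F.* w)) ⟩
        Σ∀ (λ w → χ (F.1# F.- w F.* w))
          ≡⟨ Σ-squares (λ t → χ (F.1# F.- t)) ⟩
        Σ∀ (λ t → (1# + φ t) * χ (F.1# F.- t))
          ≡⟨ trans (Σ∀-cong (λ t → solve 2 (λ a b → (:c 1 :+ a) :* b := b :+ b :* a) refl (φ t) (χ (F.1# F.- t)))) (Σ∀-+ (λ t → χ (F.1# F.- t)) (λ t → χ (F.1# F.- t) * φ t)) ⟩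
        Σ∀ (λ t → χ (F.1# F.- t)) + Σ∀ (λ t → χ (F.1# F.- t) * φ t)
          ≡⟨ cong₂ _+_ (trans (flip χ) Σχ) (trans (Σ∀-cong (λ t → cong (λ z → χ (F.1# F.- t) * φ z) (F.solve 1 (λ t → t F.:= F.:c 1 F.:- (F.:c 1 F.:- t)) refl t)))
               (flip (λ x → χ x * φ (F.1# F.- x)))) ⟩
        0# + K ≡⟨ +-identityˡ K ⟩
        K ∎
        where
        fwd : ∀ w → F.ν 2 F.* ((w F.+ F.1#) F.* half) F.- F.1# ≡ w
        fwd w = trans (F.solve 2 (λ w h → F.:c 2 F.:* ((w F.:+ F.:c 1) F.:* h) F.:- F.:c 1 F.:= (w F.:+ F.:c 1) F.:* (F.:c 2 F.:* h) F.:- F.:c 1) refl w half)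
          (trans (cong (λ z → (w F.+ F.1#) F.* z F.- F.1#) F-2half) (F.solve 1 (λ w → (w F.:+ F.:c 1) F.:* F.:c 1 F.:- F.:c 1 F.:= w) refl w))
        bwd : ∀ x → (F.ν 2 F.* x F.- F.1# F.+ F.1#) F.* half ≡ x
        bwd x = trans (F.solve 2 (λ x h → (F.:c 2 F.:* x F.:- F.:c 1 F.:+ F.:c 1) F.:* h F.:= x F.:* (F.:c 2 F.:* h)) refl x half)
          (trans (cong (x F.*_) F-2half) (F.*-identityʳ x))

      -- Scaling b by s ≠ 0 gives χ(s)² J. At s = 0 the sum is χ(-1) Σφ = 0, which agrees because
      -- φ(0) = 0.
      inner : ∀ s → Σ∀ (λ b → χ b * χ (s F.- b)) ≡ φ s * J
      inner s = by (s F.≟ F.0#)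
        where
        by : Dec (s ≡ F.0#) → Σ∀ (λ b → χ b * χ (s F.- b)) ≡ φ s * J
        by (yes refl) = begin
          Σ∀ (λ b → χ b * χ (F.0# F.- b))
            ≡⟨ Σ∀-cong (λ b → trans (cong (χ b *_) (trans (cong χ (F.solve 1 (λ b → F.:c 0 F.:- b F.:= (F.:- F.:c 1) F.:* b) refl b)) (χ-* (F.- F.1#) b)))
                 (trans (solve 2 (λ b m → b :* (m :* b) := m :* (b :* b)) refl (χ b) (χ (F.- F.1#))) (cong (χ (F.- F.1#) *_) (sym (φ≡χ² b))))) ⟩
          Σ∀ (λ b → χ (F.- F.1#) * φ b)  ≡⟨ Σ∀-*ˡ (χ (F.- F.1#)) φ ⟩
          χ (F.- F.1#) * Σ∀ φ            ≡⟨ trans (cong (χ (F.- F.1#) *_) Σφ) (zeroʳ _) ⟩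
          0#                             ≡⟨ sym (trans (cong (_* J) φ-0) (zeroˡ J)) ⟩
          φ F.0# * J ∎
        by (no ne) = begin
          Σ∀ (λ b → χ b * χ (s F.- b))
            ≡⟨ sym (Σ∀-reindex (s F.*_) (y F.*_)
                 (λ x → trans (sym (F.*-assoc s y x)) (trans (cong (F._* x) e) (F.*-identityˡ x)))
                 (λ x → trans (sym (F.*-assoc y s x)) (trans (cong (F._* x) (trans (F.*-comm y s) e)) (F.*-identityˡ x))) (λ b → χ b * χ (s F.- b))) ⟩
          Σ∀ (λ b → χ (s F.* b) * χ (s F.- s F.* b))
            ≡⟨ Σ∀-cong (λ b → trans (cong₂ _*_ (χ-* s b) (trans (cong χ (F.solve 2 (λ s b → s F.:- s F.:* b F.:= s F.:* (F.:c 1 F.:- b)) refl s b)) (χ-* s _)))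
                 (trans (solve 3 (λ s b c → s :* b :* (s :* c) := s :* s :* (b :* c)) refl (χ s) (χ b) (χ (F.1# F.- b))) (cong (_* (χ b * χ (F.1# F.- b))) (sym (φ≡χ² s))))) ⟩
          Σ∀ (λ b → φ s * (χ b * χ (F.1# F.- b)))
            ≡⟨ Σ∀-*ˡ (φ s) (λ b → χ b * χ (F.1# F.- b)) ⟩
          φ s * J ∎
          where
          y = proj₁ (F-inverse ne)
          e = proj₂ (F-inverse ne)

      term : F.Carrier → F.Carrier → F.Carrier → Carrier
      term a b c = δ (a F.+ b F.+ c) F.1# * (χ a * χ b * χ c)

      -- Summing over c by the constraint and over b by `inner` leaves J times the sum defining K.
      triple : Σ∀ (λ a → Σ∀ (λ b → Σ∀ (λ c → term a b c))) ≡ K * J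
      triple = begin
        Σ∀ (λ a → Σ∀ (λ b → Σ∀ (λ c → term a b c)))
          ≡⟨ Σ∀-cong (λ a → Σ∀-cong (λ b → trans (Σ∀-cong (λ c → cong (_* (χ a * χ b * χ c)) (if-cong (a F.+ b F.+ c F.≟ F.1#) (c F.≟ F.1# F.- a F.- b) (isolate a b c) (restore a b c))))
               (Σδ (F.1# F.- a F.- b) (λ c → χ a * χ b * χ c)))) ⟩
        Σ∀ (λ a → Σ∀ (λ b → χ a * χ b * χ (F.1# F.- a F.- b)))
          ≡⟨ Σ∀-cong (λ a → trans (Σ∀-cong (λ b → *-assoc (χ a) (χ b) (χ (F.1# F.- a F.- b)))) (trans (Σ∀-*ˡ (χ a) (λ b → χ b * χ (F.1# F.- a F.- b))) (trans (cong (χ a *_) (inner (F.1# F.- a)))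
               (solve 3 (λ a f J → a :* (f :* J) := J :* (a :* f)) refl (χ a) (φ (F.1# F.- a)) J)))) ⟩
        Σ∀ (λ a → J * (χ a * φ (F.1# F.- a)))
          ≡⟨ trans (Σ∀-*ˡ J (λ a → χ a * φ (F.1# F.- a))) (*-comm J K) ⟩
        K * J ∎
        where
        isolate : ∀ a b c → a F.+ b F.+ c ≡ F.1# → c ≡ F.1# F.- a F.- b
        isolate a b c e = trans (F.solve 3 (λ a b c → c F.:= (a F.:+ b F.:+ c) F.:- a F.:- b) refl a b c) (cong (λ z → z F.- a F.- b) e)
        restore : ∀ a b c → c ≡ F.1# F.- a F.- b → a F.+ b F.+ c ≡ F.1#
        restore a b c refl = F.solve 2 (λ a b → a F.:+ b F.:+ (F.:c 1 F.:- a F.:- b) F.:= F.:c 1) refl a b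

      diagonal : Σ∀ (λ a → term a a a) ≡ χ third ^ 3
      diagonal = trans (Σ∀-cong (λ a → cong₂ _*_ (if-cong (a F.+ a F.+ a F.≟ F.1#) (a F.≟ third) (divide a) (multiply a))
          (solve 1 (λ x → x :* x :* x := x :^ 3) refl (χ a)))) (Σδ third (λ a → χ a ^ 3))
        where
        divide : ∀ a → a F.+ a F.+ a ≡ F.1# → a ≡ third
        divide a e = trans (trans (sym (F.*-identityʳ a)) (cong (a F.*_) (sym F-3third)))
          (trans (F.solve 2 (λ a t → a F.:* (F.:c 3 F.:* t) F.:= (a F.:+ a F.:+ a) F.:* t) refl a third) (trans (cong (F._* third) e) (F.*-identityˡ third)))
        multiply : ∀ a → a ≡ third → a F.+ a F.+ a ≡ F.1#
        multiply a refl = trans (F.solve 1 (λ t → t F.:+ t F.:+ t F.:= F.:c 3 F.:* t) refl third) F-3third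

      -- By `χ4*J`, K² = χ(4) K J, and K J is the symmetric triple sum, whose only diagonal term
      -- sits at a = b = c = 1/3.
      K²-mod-3 : ∃ λ w → K * K ≡ χ (F.ν 4) * (χ third ^ 3 + ν 3 * w)
      K²-mod-3 = proj₁ frobenius , (begin
        K * K                      ≡⟨ cong (K *_) (sym χ4*J) ⟩
        K * (χ (F.ν 4) * J)        ≡⟨ solve 3 (λ k c j → k :* (c :* j) := c :* (k :* j)) refl K (χ (F.ν 4)) J ⟩
        χ (F.ν 4) * (K * J)        ≡⟨ cong (χ (F.ν 4) *_) (trans (sym triple) (trans (proj₂ frobenius) (cong (_+ ν 3 * proj₁ frobenius) diagonal))) ⟩
        χ (F.ν 4) * (χ third ^ 3 + ν 3 * proj₁ frobenius) ∎)
        where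
        frobenius : ∃ λ w → Σ∀ (λ a → Σ∀ (λ b → Σ∀ (λ c → term a b c))) ≡ Σ∀ (λ a → term a a a) + ν 3 * w
        frobenius = SymmetricTriple.mod-3 S (λ a b c → term (F.ν a) (F.ν b) (F.ν c))
          (λ a b c → cong₂ _*_ (cong (λ z → δ (z F.+ F.ν c) F.1#) (F.+-comm (F.ν a) (F.ν b))) (cong (_* χ (F.ν c)) (*-comm (χ (F.ν a)) (χ (F.ν b)))))
          (λ a b c → cong₂ _*_ (cong (λ z → δ z F.1#) (F.solve 3 (λ a b c → a F.:+ b F.:+ c F.:= a F.:+ c F.:+ b) refl (F.ν a) (F.ν b) (F.ν c)))
             (solve 3 (λ a b c → a :* b :* c := a :* c :* b) refl (χ (F.ν a)) (χ (F.ν b)) (χ (F.ν c)))) p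

-- The quartic residue character and its Jacobi sum

module Character where

  open RingKit
  open ZMod
  open Local
  open Gaussian
  open Teichmuller
  open JacobiSum
  open Factorials
  open TwoSquares using (parity)
  open CubicSum
  open import Data.Nat as ℕ using (ℕ; zero; suc; _<_)
  import Data.Nat.Properties as ℕP
  open import Data.Nat.Divisibility as ℕD using (_∣_)
  open import Data.Nat.Primality using (Prime)
  open import Data.Integer as ℤ using (ℤ; +_; -[1+_])
  import Data.Integer.Properties as ℤP
  open import Data.Fin as Fin using (Fin)
  open import Data.Fin.Patterns
  open import Data.Product using (_,_; ∃; _×_; proj₁; proj₂)
  open import Data.Sum using (_⊎_; inj₁; inj₂; [_,_]′)
  open import Data.Empty using (⊥-elim)
  open import Relation.Nullary using (Dec; yes; no)
  open import Relation.Binary.PropositionalEquality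
  open import Relation.Binary.Definitions using (tri<; tri≈; tri>)

  private
    -- the only positive n ≤ p² with n ≡ p (mod p²)
    congruent-to-p : ∀ p n → 1 < p → n ℕ.≤ p ℕ.^ 2 → p ℕ.^ 2 ∣ ℤ.∣ + n ℤ.- + p ∣ → n ≢ 0 → n ≡ p
    congruent-to-p p n 1<p n≤p² d n≢0 with ℕP.<-cmp n p
    ... | tri≈ _ e _ = e
    ... | tri> _ _ l = ⊥-elim (ℕP.<⇒≱ (ℕP.<-≤-trans (ℕP.∸-monoʳ-< {n} {p} {0} (ℕP.<-trans (ℕ.s≤s ℕ.z≤n) 1<p) (ℕP.<⇒≤ l)) n≤p²)
        (ℕD.∣⇒≤ {{ℕ.>-nonZero (ℕP.m<n⇒0<n∸m l)}} (subst (p ℕ.^ 2 ∣_) (trans (cong ℤ.∣_∣ (ℤP.m-n≡m⊖n n p)) (cong ℤ.∣_∣ (ℤP.⊖-≥ (ℕP.<⇒≤ l)))) d)))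
    ... | tri< l _ _ = ⊥-elim (ℕP.<⇒≱ (ℕP.<-≤-trans (ℕP.∸-monoʳ-< {p} {n} {0} (ℕP.n≢0⇒n>0 n≢0) (ℕP.<⇒≤ l)) p≤p²)
        (ℕD.∣⇒≤ {{ℕ.>-nonZero (ℕP.m<n⇒0<n∸m l)}} (subst (p ℕ.^ 2 ∣_) (trans (cong ℤ.∣_∣ (ℤP.m-n≡m⊖n n p))
          (trans (cong ℤ.∣_∣ (ℤP.⊖-≤ (ℕP.<⇒≤ l))) (ℤP.∣-i∣≡∣i∣ (+ (p ℕ.∸ n))))) d)))
      where
      p≤p² : p ℕ.≤ p ℕ.^ 2
      p≤p² = ℕP.≤-trans (ℕP.m≤m*n p p {{ℕ.>-nonZero (ℕP.<-trans (ℕ.s≤s ℕ.z≤n) 1<p)}}) (ℕP.≤-reflexive (cong (p ℕ.*_) (sym (ℕP.*-identityʳ p))))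

    normℕ : ℤ[i] → ℕ
    normℕ z = ℤ.∣ re z ∣ ℕ.* ℤ.∣ re z ∣ ℕ.+ ℤ.∣ im z ∣ ℕ.* ℤ.∣ im z ∣

    norm-size : ∀ z → norm z ≡ + normℕ z
    norm-size (x +i y) = cong₂ ℤ._+_ (square x) (square y)
      where
      square : ∀ x → x ℤ.* x ≡ + (ℤ.∣ x ∣ ℕ.* ℤ.∣ x ∣)
      square (+ n) = sym (ℤP.pos-* n n)
      square -[1+ n ] = refl

    norm≤size² : ∀ z {n} → size z ℕ.≤ n → normℕ z ℕ.≤ n ℕ.^ 2
    norm≤size² (x +i y) {n} l = ℕP.≤-trans (ℕP.m≤m+n _ (a ℕ.* b ℕ.+ b ℕ.* a)) (ℕP.≤-trans (ℕP.≤-reflexive (expand a b))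
        (ℕP.≤-trans (ℕP.*-mono-≤ l l) (ℕP.≤-reflexive (cong (n ℕ.*_) (sym (ℕP.*-identityʳ n))))))
      where
      import Data.Nat.Solver as ℕS
      a = ℤ.∣ x ∣
      b = ℤ.∣ y ∣
      expand : ∀ a b → a ℕ.* a ℕ.+ b ℕ.* b ℕ.+ (a ℕ.* b ℕ.+ b ℕ.* a) ≡ (a ℕ.+ b) ℕ.* (a ℕ.+ b)
      expand = N.solve 2 (λ a b → a N.:* a N.:+ b N.:* b N.:+ (a N.:* b N.:+ b N.:* a) N.:= (a N.:+ b) N.:* (a N.:+ b)) refl
        where module N = ℕS.+-*-Solver

    module Identities (K : Ring≡) where
      open Kit K
      distribute : ∀ a b t w → a * (b + t * w) ≡ a * b + t * (a * w)
      distribute = solve 4 (λ a b t w → a :* (b :+ t :* w) := a :* b :+ t :* (a :* w)) refl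
      pull : ∀ w t S → w * (t - 1#) * S ≡ w * (t * S - S)
      pull = solve 3 (λ w t S → w :* (t :- :c 1) :* S := w :* (t :* S :- S)) refl
      pad : ∀ K n → K + n ≡ K + ((- 1#) * 0# + ((- 1#) * 0# + n))
      pad = solve 2 (λ K n → K :+ n := K :+ ((:- :c 1) :* :c 0 :+ ((:- :c 1) :* :c 0 :+ n))) refl
      expand : ∀ a b → a * b + ((- 1#) * a + ((- 1#) * b + 1#)) ≡ (a - 1#) * (b - 1#)
      expand = solve 2 (λ a b → a :* b :+ ((:- :c 1) :* a :+ ((:- :c 1) :* b :+ :c 1)) := (a :- :c 1) :* (b :- :c 1)) refl

  module Characters (p : ℕ) (pr : Prime p) (g : ℕ) (p≡ : p ≡ suc (4 ℕ.* suc g))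
    (F : Quotient p) (R : Quotient (p ℕ.^ 2))
    (I : Quotient.Carrier R) (I² : Quotient._*_ R I I ≡ Quotient.-_ R (Quotient.1# R)) where
    module F = Quotient F
    open Quotient R
    open TeichmullerSums p pr (suc g) p≡ (ℕ.s≤s ℕ.z≤n) F R public
    open JacobiSums p pr g p≡ F R using (W; module UnitSum) public
    module ZS = SumOver F ℤ[i]-ring
    open ShiftedFactorials p pr R hiding (P²)

    f : ℕ
    f = suc g

    -- The ring homomorphism sending i to I; it exists because I² = -1 holds modulo p² and not just
    -- modulo p.
    ev : ℤ[i] → Carrier
    ev z = ι (re z) + ι (im z) * I

    ev-+ : ∀ x y → ev (x Z.+ y) ≡ ev x + ev y
    ev-+ (a +i b) (c +i d) = trans (cong₂ (λ u v → u + v * I) (ι-+ a c) (ι-+ b d))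
      (solve 5 (λ a b c d I → a :+ c :+ (b :+ d) :* I := a :+ b :* I :+ (c :+ d :* I)) refl (ι a) (ι b) (ι c) (ι d) I)

    ev-neg : ∀ x → ev (Z.- x) ≡ - ev x
    ev-neg (a +i b) = trans (cong₂ (λ u v → u + v * I) (ι-neg a) (ι-neg b)) (solve 3 (λ a b I → :- a :+ (:- b) :* I := :- (a :+ b :* I)) refl (ι a) (ι b) I)

    ev-* : ∀ x y → ev (x Z.* y) ≡ ev x * ev y
    ev-* (a +i b) (c +i d) = begin
      ι (a ℤ.* c ℤ.- b ℤ.* d) + ι (a ℤ.* d ℤ.+ b ℤ.* c) * I
        ≡⟨ cong₂ (λ u v → u + v * I)
             (trans (ι-+ (a ℤ.* c) (ℤ.- (b ℤ.* d))) (cong₂ _+_ (ι-* a c) (trans (ι-neg (b ℤ.* d)) (cong -_ (ι-* b d)))))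
             (trans (ι-+ (a ℤ.* d) (b ℤ.* c)) (cong₂ _+_ (ι-* a d) (ι-* b c))) ⟩
      A * C - B * D + (A * D + B * C) * I
        ≡⟨ solve 5 (λ a b c d I → a :* c :- b :* d :+ (a :* d :+ b :* c) :* I := a :* c :+ (:- :c 1) :* (b :* d) :+ (a :* d :+ b :* c) :* I) refl A B C D I ⟩
      A * C + (- 1#) * (B * D) + (A * D + B * C) * I
        ≡⟨ cong (λ z → A * C + z * (B * D) + (A * D + B * C) * I) (sym I²) ⟩
      A * C + (I * I) * (B * D) + (A * D + B * C) * I
        ≡⟨ solve 5 (λ a b c d I → a :* c :+ I :* I :* (b :* d) :+ (a :* d :+ b :* c) :* I := (a :+ b :* I) :* (c :+ d :* I)) refl A B C D I ⟩
      (A + B * I) * (C + D * I) ∎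
      where
      open ≡-Reasoning
      A = ι a
      B = ι b
      C = ι c
      D = ι d

    ev-1 : ev Z.1# ≡ 1#
    ev-1 = solve 1 (λ I → :c 1 :+ :c 0 :* I := :c 1) refl I

    ev-0 : ev Z.0# ≡ 0#
    ev-0 = solve 1 (λ I → :c 0 :+ :c 0 :* I := :c 0) refl I

    ev-^ : ∀ x n → ev (x Z.^ n) ≡ ev x ^ n
    ev-^ x zero = ev-1
    ev-^ x (suc n) = trans (ev-* x (x Z.^ n)) (cong (ev x *_) (ev-^ x n))

    ev-Σ : ∀ n h → ev (Z.Σ< n h) ≡ Σ< n (λ i → ev (h i))
    ev-Σ zero h = ev-0
    ev-Σ (suc n) h = trans (ev-+ (Z.Σ< n h) (h n)) (cong (_+ ev (h n)) (ev-Σ n h))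

    ev-norm : ∀ z → ev z * ev (conj z) ≡ ι (norm z)
    ev-norm z = trans (sym (ev-* z (conj z))) (trans (cong ev (*-conj z)) (trans (cong (λ w → ι (norm z) + w) (zeroˡ I)) (+-identityʳ _)))

    4<p : 4 < p
    4<p = subst (4 <_) (sym p≡) (ℕ.s≤s (ℕP.*-monoʳ-≤ 4 {1} {f} (ℕ.s≤s ℕ.z≤n)))

    P-ker : ∀ z → P * ι z ≡ 0# → p ∣ ℤ.∣ z ∣
    P-ker z e = ℕD.*-cancelˡ-∣ p (subst₂ _∣_ (cong (p ℕ.*_) (ℕP.*-identityʳ p)) (ℤP.abs-* (+ p) z)
      (ι-ker (+ p ℤ.* z) (trans (ι-* (+ p) z) e)))

    -- The factor p weakens the hypothesis to a congruence modulo p. The norm of the difference is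
    -- then divisible by p but at most 4.
    ev-inj : ∀ s t → P * ev ⟦ s ⟧ ≡ P * ev ⟦ t ⟧ → ⟦ s ⟧ ≡ ⟦ t ⟧
    ev-inj s t e = ⟦⟧-norm0 s t (norm0 (ℕP.≤-<-trans (⟦⟧-norm≤4 s t) 4<p) (P-ker (norm d) (begin
      P * ι (norm d)            ≡⟨ cong (P *_) (sym (ev-norm d)) ⟩
      P * (ev d * ev (conj d))  ≡⟨ sym (*-assoc _ _ _) ⟩
      P * ev d * ev (conj d)    ≡⟨ cong (λ z → P * z * ev (conj d)) (trans (ev-+ ⟦ s ⟧ (Z.- ⟦ t ⟧)) (cong (λ z → ev ⟦ s ⟧ + z) (ev-neg ⟦ t ⟧))) ⟩
      P * (ev ⟦ s ⟧ - ev ⟦ t ⟧) * ev (conj d) ≡⟨ cong (_* ev (conj d)) (trans (solve 3 (λ P a b → P :* (a :- b) := P :* a :- P :* b) refl P (ev ⟦ s ⟧) (ev ⟦ t ⟧)) (x≡y⇒x-y≡0 e)) ⟩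
      0# * ev (conj d)          ≡⟨ zeroˡ _ ⟩
      0# ∎)))
      where
      open ≡-Reasoning
      d = ⟦ s ⟧ Z.- ⟦ t ⟧
      norm0 : ∀ {n} → n < p → p ∣ n → n ≡ 0
      norm0 {zero} _ _ = refl
      norm0 {suc n} l d = ⊥-elim (ℕP.<⇒≱ l (ℕD.∣⇒≤ d))

    -- If u and v were both multiples of p, so would be the unit v - u. Hence one of them is a unit
    -- and the other is 0.
    zero-divisor : ∀ {u v w} → u * v ≡ 0# → (v - u) * w ≡ 1# → u ≡ 0# ⊎ v ≡ 0#
    zero-divisor {u} {v} {w} uv unit with p ℕD.∣? rep u
    ... | no nd with unit-rep u nd
    ...   | y , uy = inj₂ (cancelʳ u y uy (trans (*-comm v u) (trans uv (sym (zeroˡ u)))))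
    zero-divisor {u} {v} {w} uv unit | yes d with p ℕD.∣? rep v
    ...   | no nd with unit-rep v nd
    ...     | y , vy = inj₁ (cancelʳ v y vy (trans uv (sym (zeroˡ v))))
    zero-divisor {u} {v} {w} uv unit | yes d | yes d′ with p∣rep u d | p∣rep v d′
    ... | a , refl | b , refl = ⊥-elim (nonunit {p} {(b - a) * w} ℕD.∣-refl (trans (solve 4 (λ P b a w → P :* ((b :- a) :* w) := (P :* b :- P :* a) :* w) refl P b a w) unit))

    h : Carrier
    h = proj₁ (unit-ν {2} (λ d → ℕP.<⇒≱ (ℕP.<-trans (ℕ.s≤s (ℕ.s≤s (ℕ.s≤s ℕ.z≤n))) 4<p) (ℕD.∣⇒≤ d)))

    2h : ν 2 * h ≡ 1#
    2h = proj₂ (unit-ν {2} (λ d → ℕP.<⇒≱ (ℕP.<-trans (ℕ.s≤s (ℕ.s≤s (ℕ.s≤s ℕ.z≤n))) 4<p) (ℕD.∣⇒≤ d)))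

    -- y⁴ - 1 = (y² - 1)(y² + 1), and each quadratic splits again. The two factors always differ by
    -- a unit, 2 or 2I, so `zero-divisor` applies although ℤ/p² is no domain.
    fourth-root : ∀ y → y ^ 4 ≡ 1# → ∃ λ s → ev ⟦ s ⟧ ≡ y
    fourth-root y y⁴ = [ real , imaginary ]′ (zero-divisor {y * y - 1#} {y * y - - 1#} {h}
        (trans (solve 1 (λ y → (y :* y :- :c 1) :* (y :* y :- (:- :c 1)) := y :^ 4 :- :c 1) refl y) (x≡y⇒x-y≡0 y⁴))
        (trans (solve 2 (λ y h → (y :* y :- (:- :c 1) :- (y :* y :- :c 1)) :* h := :c 2 :* h) refl y h) 2h))
      where
      is : ∀ s {u} → ev ⟦ s ⟧ ≡ u → y - u ≡ 0# → ∃ λ s → ev ⟦ s ⟧ ≡ y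
      is s e d = s , trans e (sym (x-y≡0⇒x≡y d))
      real : y * y - 1# ≡ 0# → ∃ λ s → ev ⟦ s ⟧ ≡ y
      real e = [ is 1F (solve 1 (λ I → :c 1 :+ :c 0 :* I := :c 1) refl I)
               , is 2F (solve 1 (λ I → (:- :c 1) :+ :c 0 :* I := :- :c 1) refl I) ]′ (zero-divisor {y - 1#} {y - - 1#} {h}
        (trans (solve 1 (λ y → (y :- :c 1) :* (y :- (:- :c 1)) := y :* y :- :c 1) refl y) e)
        (trans (solve 2 (λ y h → (y :- (:- :c 1) :- (y :- :c 1)) :* h := :c 2 :* h) refl y h) 2h))
      imaginary : y * y - - 1# ≡ 0# → ∃ λ s → ev ⟦ s ⟧ ≡ y
      imaginary e = [ is 3F (solve 1 (λ I → :c 0 :+ :c 1 :* I := I) refl I)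
                    , is 4F (solve 1 (λ I → :c 0 :+ (:- :c 1) :* I := :- I) refl I) ]′ (zero-divisor {y - I} {y - - I} {(- I) * h}
        (trans (solve 2 (λ y I → (y :- I) :* (y :- (:- I)) := y :* y :- I :* I) refl y I) (trans (cong (λ z → y * y - z) I²) e))
        (trans (solve 3 (λ y I h → (y :- (:- I) :- (y :- I)) :* ((:- I) :* h) := (:- (I :* I)) :* (:c 2 :* h)) refl y I h)
          (trans (cong₂ (λ a b → (- a) * b) I² 2h) (solve 0 ((:- (:- :c 1)) :* :c 1 := :c 1) refl))))

    abstract
      classify : ∀ x → ∃ λ s → ev ⟦ s ⟧ ≡ T x ^ f
      classify x with x F.≟ F.0#
      ... | yes refl = 0F , trans ev-0 (sym (trans (cong (_* T F.0# ^ g) T-0) (zeroˡ _)))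
      ... | no ne = fourth-root (T x ^ f) (trans (^-assocʳ (T x) f 4) (trans (cong (T x ^_) (ℕP.*-comm f 4)) (T-4f ne)))

    -- the quartic residue character x ↦ T(x)^((p-1)/4)
    χ φ : F.Carrier → ℤ[i]
    χ x = ⟦ proj₁ (classify x) ⟧
    φ x = χ x Z.^ 2

    ev-χ : ∀ x → ev (χ x) ≡ T x ^ f
    ev-χ x = proj₂ (classify x)

    χ-unique : ∀ s x → P * T x ^ f ≡ P * ev ⟦ s ⟧ → χ x ≡ ⟦ s ⟧
    χ-unique s x e = ev-inj (proj₁ (classify x)) s (trans (cong (P *_) (ev-χ x)) e)

    χ-* : ∀ x y → χ (x F.* y) ≡ χ x Z.* χ y
    χ-* x y with ⟦⟧-closed (proj₁ (classify x)) (proj₁ (classify y))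
    ... | r , e = trans (χ-unique r (x F.* y) (cong (P *_) (begin
      T (x F.* y) ^ f      ≡⟨ cong (_^ f) (T-* x y) ⟩
      (T x * T y) ^ f      ≡⟨ ^-distrib-* (T x) (T y) f ⟩
      T x ^ f * T y ^ f    ≡⟨ sym (cong₂ _*_ (ev-χ x) (ev-χ y)) ⟩
      ev (χ x) * ev (χ y)  ≡⟨ sym (ev-* (χ x) (χ y)) ⟩
      ev (χ x Z.* χ y)     ≡⟨ cong ev e ⟩
      ev ⟦ r ⟧ ∎))) (sym e)
      where open ≡-Reasoning

    χ-0 : χ F.0# ≡ Z.0#
    χ-0 = χ-unique 0F F.0# (cong (P *_) (trans (cong (_* T F.0# ^ g) T-0) (trans (zeroˡ _) (sym ev-0))))

    χ-1 : χ F.1# ≡ Z.1#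
    χ-1 = χ-unique 1F F.1# (cong (P *_) (trans (cong (_^ f) T-1) (trans (1^ f) (sym ev-1))))

    φ-* : ∀ x y → φ (x F.* y) ≡ φ x Z.* φ y
    φ-* x y = trans (cong (Z._^ 2) (χ-* x y)) (Z.^-distrib-* (χ x) (χ y) 2)

    φ-class : ∀ x → ∃ λ s → φ x ≡ ⟦ s ⟧
    φ-class x with ⟦⟧-closed (proj₁ (classify x)) (proj₁ (classify x))
    ... | r , e = r , trans (cong (χ x Z.*_) (Z.*-identityʳ (χ x))) e

    φ-0 : φ F.0# ≡ Z.0#
    φ-0 = cong (Z._^ 2) χ-0

    φ-1 : φ F.1# ≡ Z.1#
    φ-1 = cong (Z._^ 2) χ-1

    2z≡0⇒z≡0 : ∀ z → Z.ν 2 Z.* z ≡ Z.0# → z ≡ Z.0#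
    2z≡0⇒z≡0 (a +i b) e = cong₂ _+i_
      (half a (trans (sym (trans (ℤP.+-identityʳ _) refl)) (cong re e)))
      (half b (trans (sym (ℤP.+-identityʳ _)) (cong im e)))
      where
      half : ∀ a → + 2 ℤ.* a ≡ + 0 → a ≡ + 0
      half a e = ℤP.*-cancelˡ-≡ (+ 2) a (+ 0) e

    -- Every such s - 1 divides 2, so an invariant sum S with (s - 1) S = 0 satisfies 2S = 0; this
    -- replaces cancellation in ℤ[i].
    associate : ∀ s → ⟦ s ⟧ ≢ Z.1# → ∃ λ w → w Z.* (⟦ s ⟧ Z.- Z.1#) ≡ Z.ν 2
    associate 0F _ = (-[1+ 1 ] +i + 0) , refl
    associate 1F ne = ⊥-elim (ne refl)
    associate 2F _ = (-[1+ 0 ] +i + 0) , refl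
    associate 3F _ = (-[1+ 0 ] +i -[1+ 0 ]) , refl
    associate 4F _ = (-[1+ 0 ] +i + 1) , refl

    character-sum : ∀ (ψ : F.Carrier → ℤ[i]) → (∀ x y → ψ (x F.* y) ≡ ψ x Z.* ψ y) →
      ∀ x₀ → x₀ ≢ F.0# → ∀ s → ψ x₀ ≡ ⟦ s ⟧ → ⟦ s ⟧ ≢ Z.1# → ZS.Σ∀ ψ ≡ Z.0#
    character-sum ψ ψ-* x₀ ne s ψ≡ s≠1 = 2z≡0⇒z≡0 S (begin
      Z.ν 2 Z.* S                     ≡⟨ cong (Z._* S) (sym (proj₂ (associate s s≠1))) ⟩
      w Z.* (⟦ s ⟧ Z.- Z.1#) Z.* S    ≡⟨ Identities.pull ℤ[i]-ring w ⟦ s ⟧ S ⟩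
      w Z.* (⟦ s ⟧ Z.* S Z.- S)       ≡⟨ cong (w Z.*_) (Z.x≡y⇒x-y≡0 (trans (cong (Z._* S) (sym ψ≡)) invariant)) ⟩
      w Z.* Z.0#                      ≡⟨ Z.zeroʳ w ⟩
      Z.0# ∎)
      where
      open ≡-Reasoning
      S = ZS.Σ∀ ψ
      w = proj₁ (associate s s≠1)
      y = proj₁ (F-inverse ne)
      e = proj₂ (F-inverse ne)
      invariant : ψ x₀ Z.* S ≡ S
      invariant = trans (sym (ZS.Σ∀-*ˡ (ψ x₀) ψ)) (trans (ZS.Σ∀-cong (λ x → sym (ψ-* x₀ x)))
        (ZS.Σ∀-reindex (x₀ F.*_) (y F.*_)
          (λ x → trans (sym (F.*-assoc x₀ y x)) (trans (cong (F._* x) e) (F.*-identityˡ x)))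
          (λ x → trans (sym (F.*-assoc y x₀ x)) (trans (cong (F._* x) (trans (F.*-comm y x₀) e)) (F.*-identityˡ x))) ψ))

    T-root : ∀ x r → T x ^ r ≡ 1# → x F.^ r ≡ F.1#
    T-root x r e = trans (cong (F._^ r) (sym (T-rep x))) (trans (sym (F.ν-^ (rep (T x)) r))
      (from-mod-p {rep (T x) ℕ.^ r} {1} 0# (trans (ν-^ (rep (T x)) r) (trans (cong (_^ r) (ν-rep (T x)))
        (trans e (solve 1 (λ P → :c 1 := :c 1 :+ P :* :c 0) refl P))))))

    Σχ : ZS.Σ∀ χ ≡ Z.0#
    Σχ = go (non-root f (ℕ.s≤s ℕ.z≤n) (ℕP.m<m+n f (ℕ.s≤s ℕ.z≤n)))
      where
      go : (∃ λ x → x ≢ F.0# × x F.^ f ≢ F.1#) → ZS.Σ∀ χ ≡ Z.0#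
      go (x₀ , ne , nr) = character-sum χ χ-* x₀ ne (proj₁ (classify x₀)) refl
        (λ e → nr (T-root x₀ f (trans (sym (ev-χ x₀)) (trans (cong ev e) ev-1))))

    Σφ : ZS.Σ∀ φ ≡ Z.0#
    Σφ = go (non-root (f ℕ.* 2) (ℕ.s≤s ℕ.z≤n) (subst (f ℕ.* 2 <_) (ℕP.*-comm f 4) (ℕP.*-monoʳ-< f (ℕ.s≤s (ℕ.s≤s (ℕ.s≤s ℕ.z≤n))))))
      where
      go : (∃ λ x → x ≢ F.0# × x F.^ (f ℕ.* 2) ≢ F.1#) → ZS.Σ∀ φ ≡ Z.0#
      go (x₀ , ne , nr) = character-sum φ φ-* x₀ ne (proj₁ (φ-class x₀)) (proj₂ (φ-class x₀))
        (λ s≡1 → nr (T-root x₀ (f ℕ.* 2) (trans (sym (^-assocʳ (T x₀) f 2)) (trans (cong (_^ 2) (sym (ev-χ x₀)))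
          (trans (sym (ev-^ (χ x₀) 2)) (trans (cong ev (trans (proj₂ (φ-class x₀)) s≡1)) ev-1))))))

    flip : ∀ (ψ : F.Carrier → ℤ[i]) → ZS.Σ∀ (λ x → ψ (F.1# F.- x)) ≡ ZS.Σ∀ ψ
    flip ψ = ZS.Σ∀-reindex (λ x → F.1# F.- x) (λ x → F.1# F.- x) invol invol ψ
      where
      invol : ∀ x → F.1# F.- (F.1# F.- x) ≡ x
      invol = F.solve 1 (λ x → F.:c 1 F.:- (F.:c 1 F.:- x) F.:= x) refl

    -- the Jacobi sum J(χ,χ²)
    abstract
      K : ℤ[i]
      K = ZS.Σ∀ (λ x → χ x Z.* φ (F.1# F.- x))

      K-def : K ≡ ZS.Σ∀ (λ x → χ x Z.* φ (F.1# F.- x))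
      K-def = refl

    ev-φ : ∀ x → ev (φ x) ≡ T x ^ (2 ℕ.* f)
    ev-φ x = trans (ev-^ (χ x) 2) (trans (cong (_^ 2) (ev-χ x)) (trans (^-assocʳ (T x) f 2) (cong (T x ^_) (ℕP.*-comm f 2))))

    private
      summand : ℕ → ℤ[i]
      summand i = χ (F.ν i) Z.* φ (F.1# F.- F.ν i)

    ev-K : ev K ≡ W f
    ev-K = trans (cong ev K-def) (trans (ev-Σ p summand) (Σ-cong p (λ i _ → trans (ev-* (χ (F.ν i)) (φ (F.1# F.- F.ν i))) (cong₂ _*_ (ev-χ (F.ν i)) (ev-φ (F.1# F.- F.ν i))))))

    conj-Σ : ∀ n u → conj (Z.Σ< n u) ≡ Z.Σ< n (λ i → conj (u i))
    conj-Σ zero u = refl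
    conj-Σ (suc n) u = trans (conj-+ (Z.Σ< n u) (u n)) (cong (Z._+ conj (u n)) (conj-Σ n u))

    -- On character values complex conjugation is cubing, and it fixes squares; so T^f turns into
    -- T^(3f) while the factor from φ stays.
    ev-conjK : ev (conj K) ≡ W (3 ℕ.* f)
    ev-conjK = trans (cong (λ z → ev (conj z)) K-def) (trans (cong ev (conj-Σ p summand)) (trans (ev-Σ p (λ i → conj (summand i))) (Σ-cong p (λ i _ → term (F.ν i)))))
      where
      term : ∀ x → ev (conj (χ x Z.* φ (F.1# F.- x))) ≡ T x ^ (3 ℕ.* f) * T (F.1# F.- x) ^ (2 ℕ.* f)
      term x = trans (cong ev (trans (conj-* (χ x) (φ (F.1# F.- x))) (cong₂ Z._*_ (⟦⟧-conj (proj₁ (classify x))) (⟦⟧²-conj (proj₁ (classify (F.1# F.- x)))))))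
        (trans (ev-* (χ x Z.^ 3) (φ (F.1# F.- x))) (cong₂ _*_ (trans (ev-^ (χ x) 3) (trans (cong (_^ 3) (ev-χ x))
          (trans (^-assocʳ (T x) f 3) (cong (T x ^_) (ℕP.*-comm f 3))))) (ev-φ (F.1# F.- x))))

    size-K : size K ℕ.≤ p
    size-K = subst (λ z → size z ℕ.≤ p) (sym K-def) (bound p summand (λ i → small (F.ν i)))
      where
      small : ∀ x → size (χ x Z.* φ (F.1# F.- x)) ℕ.≤ 1
      small x = subst (λ z → size z ℕ.≤ 1) (sym (trans (cong (χ x Z.*_) (proj₂ (φ-class (F.1# F.- x)))) (proj₂ r))) (⟦⟧-size≤1 (proj₁ r))
        where r = ⟦⟧-closed (proj₁ (classify x)) (proj₁ (φ-class (F.1# F.- x)))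
      bound : ∀ n u → (∀ i → size (u i) ℕ.≤ 1) → size (Z.Σ< n u) ℕ.≤ n
      bound zero u _ = ℕ.z≤n
      bound (suc n) u l = ℕP.≤-trans (size-+ (Z.Σ< n u) (u n)) (ℕP.≤-trans (ℕP.+-mono-≤ (bound n u l) (l n)) (ℕP.≤-reflexive (ℕP.+-comm n 1)))

    -- The classical |J|² = p by arithmetic: the norm is p modulo p², it is nonzero since p² does
    -- not divide p, and it is at most p² because K is a sum of p values of size at most 1.
    norm-K : ∀ κ → ν 2 * κ ≡ h → norm K ≡ + p
    norm-K κ 2κ = trans (norm-size K) (cong +_ (congruent-to-p p _ 1<p (norm≤size² K size-K) close nonzero))
      where
      1<p : 1 < p
      1<p = ℕP.<-trans (ℕ.s≤s (ℕ.s≤s ℕ.z≤n)) 4<p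
      ν-norm : ν (normℕ K) ≡ P
      ν-norm = trans (cong ι (sym (norm-size K))) (trans (sym (ev-norm K)) (trans (cong₂ _*_ ev-K ev-conjK) (UnitSum.norm h κ 2h 2κ)))
      close : p ℕ.^ 2 ∣ ℤ.∣ + normℕ K ℤ.- + p ∣
      close = ι-ker (+ normℕ K ℤ.- + p) (trans (ι-+ (+ normℕ K) (ℤ.- + p)) (trans (cong (λ z → ν (normℕ K) + z) (ι-neg (+ p))) (x≡y⇒x-y≡0 ν-norm)))
      nonzero : normℕ K ≢ 0
      nonzero e = ℕP.<⇒≱ (subst (p <_) (cong (p ℕ.*_) (sym (ℕP.*-identityʳ p))) (ℕP.m<m*n p p 1<p))
        (ℕD.∣⇒≤ (ν-ker p (trans (sym ν-norm) (cong ν e))))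

    nonzero-χ : ∀ {x} → x ≢ F.0# → χ x ≢ ⟦ 0F ⟧
    nonzero-χ {x} ne e = Z0≢1 (trans (sym (trans (cong (Z._* χ y) e) (Z.zeroˡ (χ y)))) (trans (sym (χ-* x y)) (trans (cong χ xy) χ-1)))
      where
      y = proj₁ (F-inverse ne)
      xy = proj₂ (F-inverse ne)
      Z0≢1 : Z.0# ≢ Z.1#
      Z0≢1 ()

    -- Σ (χ(x) - 1)(φ(1-x) - 1) = K + p, and every summand is a multiple of 2(1 - i).
    abstract
      K-mod : ∃ λ w → K Z.+ Z.ν p ≡ (+ 2 +i -[1+ 1 ]) Z.* w
      K-mod = Z.Σ< p (λ i → proj₁ (multiple (F.ν i))) , (begin
        K Z.+ Z.ν p
          ≡⟨ Identities.pad ℤ[i]-ring K (Z.ν p) ⟩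
        K Z.+ ((Z.- Z.1#) Z.* Z.0# Z.+ ((Z.- Z.1#) Z.* Z.0# Z.+ Z.ν p))
          ≡⟨ cong₂ (λ u v → K Z.+ ((Z.- Z.1#) Z.* u Z.+ ((Z.- Z.1#) Z.* v Z.+ Z.ν p))) (sym Σχ) (sym (trans (flip φ) Σφ)) ⟩
        K Z.+ ((Z.- Z.1#) Z.* ZS.Σ∀ χ Z.+ ((Z.- Z.1#) Z.* ZS.Σ∀ (λ x → φ (F.1# F.- x)) Z.+ Z.ν p))
          ≡⟨ cong₂ (λ u v → K Z.+ (u Z.+ v)) (sym (ZS.Σ∀-*ˡ (Z.- Z.1#) χ)) (cong₂ Z._+_ (sym (ZS.Σ∀-*ˡ (Z.- Z.1#) (λ x → φ (F.1# F.- x)))) (sym (Σ1 p))) ⟩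
        K Z.+ (ZS.Σ∀ (λ x → (Z.- Z.1#) Z.* χ x) Z.+ (ZS.Σ∀ (λ x → (Z.- Z.1#) Z.* φ (F.1# F.- x)) Z.+ ZS.Σ∀ (λ _ → Z.1#)))
          ≡⟨ sym (trans (ZS.Σ∀-+ (λ x → χ x Z.* φ (F.1# F.- x)) (λ x → (Z.- Z.1#) Z.* χ x Z.+ ((Z.- Z.1#) Z.* φ (F.1# F.- x) Z.+ Z.1#))) (cong (K Z.+_) (trans (ZS.Σ∀-+ (λ x → (Z.- Z.1#) Z.* χ x) (λ x → (Z.- Z.1#) Z.* φ (F.1# F.- x) Z.+ Z.1#)) (cong (ZS.Σ∀ (λ x → (Z.- Z.1#) Z.* χ x) Z.+_) (ZS.Σ∀-+ (λ x → (Z.- Z.1#) Z.* φ (F.1# F.- x)) (λ _ → Z.1#)))))) ⟩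
        ZS.Σ∀ (λ x → χ x Z.* φ (F.1# F.- x) Z.+ ((Z.- Z.1#) Z.* χ x Z.+ ((Z.- Z.1#) Z.* φ (F.1# F.- x) Z.+ Z.1#)))
          ≡⟨ ZS.Σ∀-cong (λ x → trans (Identities.expand ℤ[i]-ring (χ x) (φ (F.1# F.- x))) (proj₂ (multiple x))) ⟩
        ZS.Σ∀ (λ x → (+ 2 +i -[1+ 1 ]) Z.* proj₁ (multiple x))
          ≡⟨ ZS.Σ∀-*ˡ (+ 2 +i -[1+ 1 ]) (λ x → proj₁ (multiple x)) ⟩
        (+ 2 +i -[1+ 1 ]) Z.* Z.Σ< p (λ i → proj₁ (multiple (F.ν i))) ∎)
        where
        open ≡-Reasoning
        Σ1 : ∀ n → Z.Σ< n (λ _ → Z.1#) ≡ Z.ν n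
        Σ1 zero = refl
        Σ1 (suc n) = trans (cong (Z._+ Z.1#) (Σ1 n)) (trans (Z.+-comm (Z.ν n) Z.1#) (sym (Z.ν-suc n)))
        -- t² - 1 is 0 or -2, and s - 1 is a multiple of 1 - i for every unit s. At x = 0 and x = 1
        -- one of the characters vanishes, but the other is 1 and annihilates the product.
        factor : ∀ s t → ⟦ s ⟧ ≢ ⟦ 0F ⟧ → ⟦ t ⟧ ≢ ⟦ 0F ⟧ → ∃ λ w → (⟦ s ⟧ Z.- Z.1#) Z.* (⟦ t ⟧ Z.^ 2 Z.- Z.1#) ≡ (+ 2 +i -[1+ 1 ]) Z.* w
        factor 0F t ne _ = ⊥-elim (ne refl)
        factor s 0F _ ne = ⊥-elim (ne refl)
        factor 1F 1F _ _ = (+ 0 +i + 0) , refl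
        factor 1F 2F _ _ = (+ 0 +i + 0) , refl
        factor 1F 3F _ _ = (+ 0 +i + 0) , refl
        factor 1F 4F _ _ = (+ 0 +i + 0) , refl
        factor 2F 1F _ _ = (+ 0 +i + 0) , refl
        factor 2F 2F _ _ = (+ 0 +i + 0) , refl
        factor 2F 3F _ _ = (+ 1 +i + 1) , refl
        factor 2F 4F _ _ = (+ 1 +i + 1) , refl
        factor 3F 1F _ _ = (+ 0 +i + 0) , refl
        factor 3F 2F _ _ = (+ 0 +i + 0) , refl
        factor 3F 3F _ _ = (+ 1 +i + 0) , refl
        factor 3F 4F _ _ = (+ 1 +i + 0) , refl
        factor 4F 1F _ _ = (+ 0 +i + 0) , refl
        factor 4F 2F _ _ = (+ 0 +i + 0) , refl
        factor 4F 3F _ _ = (+ 0 +i + 1) , refl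
        factor 4F 4F _ _ = (+ 0 +i + 1) , refl
        at-0 : ∀ x → x ≡ F.0# → (χ x Z.- Z.1#) Z.* (φ (F.1# F.- x) Z.- Z.1#) ≡ (+ 2 +i -[1+ 1 ]) Z.* Z.0#
        at-0 x e = trans (cong (λ z → (χ x Z.- Z.1#) Z.* (z Z.- Z.1#)) (trans (cong φ (trans (cong (λ z → F.1# F.- z) e) (F.solve 0 (F.:c 1 F.:- F.:c 0 F.:= F.:c 1) refl))) φ-1))
          (Z.zeroʳ (χ x Z.- Z.1#))
        at-1 : ∀ x → F.1# F.- x ≡ F.0# → (χ x Z.- Z.1#) Z.* (φ (F.1# F.- x) Z.- Z.1#) ≡ (+ 2 +i -[1+ 1 ]) Z.* Z.0#
        at-1 x e = trans (cong (λ z → (z Z.- Z.1#) Z.* (φ (F.1# F.- x) Z.- Z.1#)) (trans (cong χ (sym (F.x-y≡0⇒x≡y e))) χ-1)) (Z.zeroˡ (φ (F.1# F.- x) Z.- Z.1#))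
        multiple : ∀ x → ∃ λ w → (χ x Z.- Z.1#) Z.* (φ (F.1# F.- x) Z.- Z.1#) ≡ (+ 2 +i -[1+ 1 ]) Z.* w
        multiple x = by (x F.≟ F.0#) ((F.1# F.- x) F.≟ F.0#)
          where
          by : Dec (x ≡ F.0#) → Dec (F.1# F.- x ≡ F.0#) → ∃ λ w → (χ x Z.- Z.1#) Z.* (φ (F.1# F.- x) Z.- Z.1#) ≡ (+ 2 +i -[1+ 1 ]) Z.* w
          by (yes e) _ = Z.0# , at-0 x e
          by (no _) (yes e) = Z.0# , at-1 x e
          by (no ne) (no ne′) = factor (proj₁ (classify x)) (proj₁ (classify (F.1# F.- x))) (nonzero-χ ne) (nonzero-χ ne′)

    F2≢0 : F.ν 2 ≢ F.0#
    F2≢0 e = ℕP.<⇒≱ (ℕP.<-trans (ℕ.s≤s (ℕ.s≤s (ℕ.s≤s ℕ.z≤n))) 4<p) (ℕD.∣⇒≤ (F.ν-ker 2 e))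
    F3≢0 : F.ν 3 ≢ F.0#
    F3≢0 e = ℕP.<⇒≱ (ℕP.<-trans (ℕP.n<1+n 3) 4<p) (ℕD.∣⇒≤ (F.ν-ker 3 e))

    third : F.Carrier
    third = proj₁ (F-inverse F3≢0)

    char0 : ∀ n → Z.ν n ≡ Z.0# → n ≡ 0
    char0 n e = ℤP.+-injective (trans (sym (re-ν n)) (cong re e))

    φ≡χ² : ∀ x → φ x ≡ χ x Z.* χ x
    φ≡χ² x = cong (χ x Z.*_) (Z.*-identityʳ (χ x))

    φ² : ∀ x → x ≢ F.0# → φ x Z.* φ x ≡ Z.1#
    φ² x ne = ⟦⟧²²≡1 (proj₁ (classify x)) (nonzero-χ ne)

    1+φ : ∀ x → ∃ λ k → Z.1# Z.+ φ x ≡ Z.ν k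
    1+φ x = 1+⟦⟧² (proj₁ (classify x))

    module C = CubicSums.Congruence F ℤ[i]-ring F-inverse (proj₁ (F-inverse F2≢0)) (proj₂ (F-inverse F2≢0)) third (proj₂ (F-inverse F3≢0))
      char0 χ φ χ-* φ≡χ² φ-0 φ² 1+φ Σχ Σφ

    cubic : ∃ λ w → K Z.* K ≡ χ (F.ν 4) Z.* (χ third Z.^ 3 Z.+ Z.ν 3 Z.* w)
    cubic = subst (λ z → ∃ λ w → z Z.* z ≡ χ (F.ν 4) Z.* (χ third Z.^ 3 Z.+ Z.ν 3 Z.* w)) (sym K-def) C.K²-mod-3

    -- On units of order dividing 4 the cube is the inverse.
    χ-third : χ third Z.^ 3 ≡ χ (F.ν 3)
    χ-third = ⟦⟧³-inverse (proj₁ (classify third)) (proj₁ (classify (F.ν 3)))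
      (trans (sym (χ-* third (F.ν 3))) (trans (cong χ (trans (F.*-comm third (F.ν 3)) (proj₂ (F-inverse F3≢0)))) χ-1))

    open ≡-Reasoning

    sgn : ℕ → Carrier
    sgn k = (- 1#) ^ k

    3f<p : 3 ℕ.* f < p
    3f<p = ℕP.≤-<-trans (ℕP.*-monoˡ-≤ f {3} {4} (ℕ.s≤s (ℕ.s≤s (ℕ.s≤s ℕ.z≤n)))) 4f<p
    2f<p : 2 ℕ.* f < p
    2f<p = ℕP.≤-<-trans (ℕP.*-monoˡ-≤ f {2} {4} (ℕ.s≤s (ℕ.s≤s ℕ.z≤n))) 4f<p
    f<p : f < p
    f<p = ℕP.≤-<-trans (ℕP.m≤m+n f _) 4f<p

    sgn-even : ∀ n → sgn (2 ℕ.* n) ≡ 1#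
    sgn-even n = trans (sym (^-assocʳ (- 1#) 2 n)) (trans (cong (_^ n) (solve 0 ((:- :c 1) :^ 2 := :c 1) refl)) (1^ n))

    sgn-odd : ∀ n → sgn (suc (2 ℕ.* n)) ≡ - 1#
    sgn-odd n = trans (cong ((- 1#) *_) (sgn-even n)) (*-identityʳ _)

    sgn² : ∀ k → sgn k * sgn k ≡ 1#
    sgn² k = trans (sym (^-distrib-* (- 1#) (- 1#) k)) (trans (cong (_^ k) (solve 0 ((:- :c 1) :* (:- :c 1) := :c 1) refl)) (1^ k))

    P-power : ∀ {a b} → P * a ≡ P * b → ∀ n → P * a ^ n ≡ P * b ^ n
    P-power e zero = refl
    P-power {a} {b} e (suc n) = begin
      P * (a * a ^ n)  ≡⟨ solve 3 (λ P t u → P :* (t :* u) := t :* (P :* u)) refl P a (a ^ n) ⟩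
      a * (P * a ^ n)  ≡⟨ cong (a *_) (P-power e n) ⟩
      a * (P * b ^ n)  ≡⟨ solve 3 (λ P t u → t :* (P :* u) := P :* t :* u) refl P a (b ^ n) ⟩
      P * a * b ^ n    ≡⟨ cong (_* b ^ n) e ⟩
      P * b * b ^ n    ≡⟨ *-assoc _ _ _ ⟩
      P * (b * b ^ n) ∎

    P-T-ν : ∀ n → P * T (F.ν n) ≡ P * ν n
    P-T-ν n = trans (PT (F.ν n)) (go (mod-p {F.rep (F.ν n)} {n} (F.ν-rep (F.ν n))))
      where
      go : (∃ λ z → ν (F.rep (F.ν n)) ≡ ν n + P * z) → P * ν (F.rep (F.ν n)) ≡ P * ν n
      go (z , e) = trans (cong (P *_) e) (drop0 PP z (solve 3 (λ P l z → P :* (l :+ P :* z) := P :* l :+ P :* P :* z) refl P (ν n) z))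

    -- The supplementary law for 2, by duplication with (p - 1)/2 = 2f: modulo p the factorials
    -- cancel and 2^f (-2)^f ≡ 1 remains.
    P-4^f : P * ν 4 ^ f ≡ P * sgn f
    P-4^f = begin
      P * ν 4 ^ f                    ≡⟨ cong (λ z → P * z) (trans (cong (_^ f) (ν-* 2 2)) (^-distrib-* (ν 2) (ν 2) f)) ⟩
      P * (ν 2 ^ f * ν 2 ^ f)        ≡⟨ trans (solve 3 (λ P s t → P :* (t :* t) := :c 1 :* (P :* (t :* t))) refl P (sgn f) (ν 2 ^ f)) (cong (_* (P * (ν 2 ^ f * ν 2 ^ f))) (sym (sgn² f))) ⟩
      sgn f * sgn f * (P * (ν 2 ^ f * ν 2 ^ f)) ≡⟨ solve 3 (λ P s t → s :* s :* (P :* (t :* t)) := s :* (P :* (t :* (s :* t)))) refl P (sgn f) (ν 2 ^ f) ⟩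
      sgn f * (P * (ν 2 ^ f * (sgn f * ν 2 ^ f))) ≡⟨ cong (λ z → sgn f * (P * (ν 2 ^ f * z))) (sym (trans (cong (_^ f) (solve 0 (:- :c 2 := (:- :c 1) :* :c 2) refl)) (^-distrib-* (- 1#) (ν 2) f))) ⟩
      sgn f * (P * (ν 2 ^ f * (- ν 2) ^ f)) ≡⟨ cong (sgn f *_) (sym P≡) ⟩
      sgn f * P                      ≡⟨ *-comm _ _ ⟩
      P * sgn f ∎
      where
      open Halves h 2h
      F2 = fac (2 ℕ.* f) 0#
      F1 = fac f 0#
      t = ν 2 ^ f * (- ν 2) ^ f
      ff : f ℕ.+ f ≡ 2 ℕ.* f
      ff = cong (f ℕ.+_) (sym (ℕP.+-identityʳ f))
      P≡ : P ≡ P * t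
      P≡ = cancel-unit {x = P} (fac-unit f 0# f<p) (cancel-unit {x = P * F1} (fac-unit (2 ℕ.* f) 0# 2f<p) (begin
        P * F1 * F2          ≡⟨ cong (_* F2) (sym (P-fac f (- (h + 0#)))) ⟩
        P * fac f (- (h + 0#)) * F2 ≡⟨ solve 3 (λ P a b → P :* a :* b := P :* (b :* a)) refl P _ F2 ⟩
        P * (F2 * fac f (- (h + 0#))) ≡⟨ cong (λ z → P * (fac (2 ℕ.* f) z * fac f (- (h + 0#)))) (sym (zeroʳ (ν 2))) ⟩
        P * (fac (2 ℕ.* f) (ν 2 * 0#) * fac f (- (h + 0#))) ≡⟨ cong (P *_) (doubling f f 0# (trans p≡ (cong suc (trans (ℕP.*-assoc 2 2 f) (cong (2 ℕ.*_) (sym ff)))))) ⟩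
        P * (t * (F1 * fac (f ℕ.+ f) (- (h + 0#)))) ≡⟨ solve 4 (λ P t a b → P :* (t :* (a :* b)) := t :* a :* (P :* b)) refl P t F1 _ ⟩
        t * F1 * (P * fac (f ℕ.+ f) (- (h + 0#))) ≡⟨ cong (t * F1 *_) (trans (P-fac (f ℕ.+ f) _) (cong (λ k → P * fac k 0#) ff)) ⟩
        t * F1 * (P * F2)    ≡⟨ solve 4 (λ P t a b → t :* a :* (P :* b) := P :* t :* a :* b) refl P t F1 F2 ⟩
        P * t * F1 * F2 ∎))

    abstract
     closure : ∃ λ r → χ (F.ν 4) Z.* χ (F.ν 3) ≡ ⟦ r ⟧
     closure = ⟦⟧-closed (proj₁ (classify (F.ν 4))) (proj₁ (classify (F.ν 3)))

    ev-χ4 : ev (χ (F.ν 4)) ≡ sgn f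
    ev-χ4 = [ (λ { (n , e) → by 1F (trans ev-1 (sym (trans (cong sgn e) (sgn-even n)))) })
            , (λ { (n , e) → by 2F (trans (trans (ev-neg Z.1#) (cong -_ ev-1)) (sym (trans (cong sgn e) (sgn-odd n)))) }) ]′ (parity f)
      where
      by : ∀ s → ev ⟦ s ⟧ ≡ sgn f → ev (χ (F.ν 4)) ≡ sgn f
      by s e = trans (cong ev (χ-unique s (F.ν 4) (trans (P-power (P-T-ν 4) f) (trans P-4^f (cong (P *_) (sym e)))))) e

    -- the fourth root of unity congruent to (-3)^f is congruent to K² modulo 3
    s₃ : Fin 5
    s₃ = proj₁ closure

    ev-s₃ : ev ⟦ s₃ ⟧ ≡ sgn f * T (F.ν 3) ^ f
    ev-s₃ = trans (cong ev (sym (proj₂ closure))) (trans (ev-* (χ (F.ν 4)) (χ (F.ν 3))) (cong₂ _*_ ev-χ4 (ev-χ (F.ν 3))))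

    K²-mod-3 : ∃ λ v → K Z.* K ≡ ⟦ s₃ ⟧ Z.+ Z.ν 3 Z.* v
    K²-mod-3 = go cubic
      where
      go : (∃ λ w → K Z.* K ≡ χ (F.ν 4) Z.* (χ third Z.^ 3 Z.+ Z.ν 3 Z.* w)) → ∃ λ v → K Z.* K ≡ ⟦ s₃ ⟧ Z.+ Z.ν 3 Z.* v
      go (w , e) = χ (F.ν 4) Z.* w ,
        trans e (trans (cong (λ z → χ (F.ν 4) Z.* (z Z.+ Z.ν 3 Z.* w)) χ-third)
          (trans (Identities.distribute ℤ[i]-ring (χ (F.ν 4)) (χ (F.ν 3)) (Z.ν 3) w) (cong (λ z → z Z.+ Z.ν 3 Z.* (χ (F.ν 4) Z.* w)) (proj₂ closure))))

-- The theorem of Chowla, Dwork and Evans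

module Ordinary where

  open RingKit
  open ZMod
  open Local
  open Gaussian
  open Factorials
  open Teichmuller
  open JacobiSum
  open Character
  open CubicSum
  open TwoSquares
  open import Data.Nat as ℕ using (ℕ; suc; _<_)
  open import Data.Nat.Divisibility as ℕD using (_∤_; divides)
  open import Data.Nat.Primality using (Prime; prime⇒nonZero)
  open import Data.Integer as ℤ using (ℤ; +_; -[1+_])
  import Data.Integer.Properties as ℤP
  import Data.Integer.Divisibility as ℤD
  import Data.Integer.Divisibility.Signed as ℤS
  open import Data.Fin as Fin using (Fin)
  open import Data.Fin.Patterns
  open import Data.Product using (_,_; ∃; _×_; proj₁; proj₂)
  open import Data.Sum using (_⊎_; inj₁; inj₂; [_,_]′)
  open import Relation.Nullary using (Dec; yes; no)
  open import Relation.Binary.PropositionalEquality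

  private
    module Identities (K : Ring≡) where
      open Kit K
      factor : ∀ p u v → (u * p) * (u * p) + (v * p) * (v * p) ≡ p * (p * (u * u + v * v))
      factor = solve 3 (λ p u v → (u :* p) :* (u :* p) :+ (v :* p) :* (v :* p) := p :* (p :* (u :* u :+ v :* v))) refl
      split : ∀ x → x ≡ 1# + (x - 1#)
      split = solve 1 (λ x → x := :c 1 :+ (x :- :c 1)) refl
      even-part : ∀ a b → ν 2 * b + (- ν 2) * a ≡ ν 2 * (b - a)
      even-part = solve 2 (λ a b → :c 2 :* b :+ (:- :c 2) :* a := :c 2 :* (b :- a)) refl
      total : ∀ a b → (ν 2 * a - (- ν 2) * b) + ν 2 * (b - a) ≡ ν 4 * b
      total = solve 2 (λ a b → (:c 2 :* a :- (:- :c 2) :* b) :+ :c 2 :* (b :- a) := :c 4 :* b) refl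
      rotate : ∀ c d p → c + d + p ≡ (c + p) + d
      rotate = solve 3 (λ c d p → c :+ d :+ p := (c :+ p) :+ d) refl
      real : ∀ e x y → e * x * (e * x) - e * y * (e * y) ≡ e * e * (x * x - y * y)
      real = solve 3 (λ e x y → e :* x :* (e :* x) :- e :* y :* (e :* y) := e :* e :* (x :* x :- y :* y)) refl
      imaginary : ∀ e x y → e * x * (e * y) + e * y * (e * x) ≡ e * e * (ν 2 * (x * y))
      imaginary = solve 3 (λ e x y → e :* x :* (e :* y) :+ e :* y :* (e :* x) := e :* e :* (:c 2 :* (x :* y))) refl
      drop : ∀ a b → ν 3 * a - ν 0 * b ≡ ν 3 * a
      drop = solve 2 (λ a b → :c 3 :* a :- :c 0 :* b := :c 3 :* a) refl
      drop′ : ∀ a b → ν 3 * b + ν 0 * a ≡ ν 3 * b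
      drop′ = solve 2 (λ a b → :c 3 :* b :+ :c 0 :* a := :c 3 :* b) refl

    re-mod : ∀ K n w → K Z.+ n ≡ (+ 2 +i -[1+ 1 ]) Z.* w → re K ℤ.+ re n ≡ + 2 ℤ.* re w ℤ.- (ℤ.- + 2) ℤ.* im w
    re-mod (_ +i _) (_ +i _) (_ +i _) = cong re

    im-mod : ∀ K n w → K Z.+ n ≡ (+ 2 +i -[1+ 1 ]) Z.* w → im K ℤ.+ im n ≡ + 2 ℤ.* (im w ℤ.- re w)
    im-mod (_ +i _) (_ +i _) (a +i b) e = trans (cong im e) (Identities.even-part ℤ-ring a b)

    re-square : ∀ K s v → K Z.* K ≡ s Z.+ Z.ν 3 Z.* v → ∀ ε x y → ε ℤ.* ε ≡ + 1 → re K ≡ ε ℤ.* x → im K ≡ ε ℤ.* y →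
      x ℤ.* x ℤ.- y ℤ.* y ≡ re s ℤ.+ + 3 ℤ.* re v
    re-square (_ +i _) s@(_ +i _) v@(_ +i _) e ε x y ε² c≡ d≡ = trans (sym (trans (cong₂ (λ c d → c ℤ.* c ℤ.- d ℤ.* d) c≡ d≡)
        (trans (Identities.real ℤ-ring ε x y) (trans (cong (ℤ._* (x ℤ.* x ℤ.- y ℤ.* y)) ε²) (ℤP.*-identityˡ (x ℤ.* x ℤ.- y ℤ.* y))))))
      (trans (cong re e) (cong (λ z → re s ℤ.+ z) (Identities.drop ℤ-ring (re v) (im v))))

    im-square : ∀ K s v → K Z.* K ≡ s Z.+ Z.ν 3 Z.* v → ∀ ε x y → ε ℤ.* ε ≡ + 1 → re K ≡ ε ℤ.* x → im K ≡ ε ℤ.* y →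
      + 2 ℤ.* (x ℤ.* y) ≡ im s ℤ.+ + 3 ℤ.* im v
    im-square (_ +i _) s@(_ +i _) v@(_ +i _) e ε x y ε² c≡ d≡ = trans (sym (trans (cong₂ (λ c d → c ℤ.* d ℤ.+ d ℤ.* c) c≡ d≡)
        (trans (Identities.imaginary ℤ-ring ε x y) (trans (cong (ℤ._* (+ 2 ℤ.* (x ℤ.* y))) ε²) (ℤP.*-identityˡ (+ 2 ℤ.* (x ℤ.* y)))))))
      (trans (cong im e) (cong (λ z → im s ℤ.+ z) (Identities.drop′ ℤ-ring (re v) (im v))))

    pos-suc-4* : ∀ {p} f → p ≡ suc (4 ℕ.* f) → + p ≡ + 1 ℤ.+ + 4 ℤ.* + f
    pos-suc-4* f p≡ = trans (cong +_ p≡) (trans (ℤP.pos-+ 1 (4 ℕ.* f)) (cong (λ z → + 1 ℤ.+ z) (ℤP.pos-* 4 f)))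

  -- z = ε (x + i y) with ε = -(-1)^f
  record Associate (f : ℕ) (z : ℤ[i]) (x y : ℤ) : Set where
    field
      ε : ℤ
      ε² : ε ℤ.* ε ≡ + 1
      ε-sign : (∃ λ n → f ≡ 2 ℕ.* n × ε ≡ ℤ.- + 1) ⊎ (∃ λ n → f ≡ suc (2 ℕ.* n) × ε ≡ + 1)
      c≡ : re z ≡ ε ℤ.* x
      d≡ : im z ≡ ε ℤ.* y

  -- A multiple of 2 - 2i has an even imaginary part, and its real and imaginary parts add up to a
  -- multiple of 4. For z + p these are the conditions that single out the unit.
  associate-of-x+iy : ∀ p f .{{_ : ℕ.NonZero p}} → + p ≡ + 1 ℤ.+ + 4 ℤ.* + f →
    ∀ x y i → + p ≡ x ℤ.* x ℤ.+ y ℤ.* y → + 4 ℤD.∣ x ℤ.- + 1 → + p ℤS.∣ x ℤ.+ y ℤ.* + i →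
    ∀ z w → z Z.+ Z.ν p ≡ (+ 2 +i -[1+ 1 ]) Z.* w → norm z ≡ + p → + p ℤS.∣ re z ℤ.+ im z ℤ.* + i →
    Associate f z x y
  associate-of-x+iy p f p≡ x y i xy 4∣x-1 p∣x+yi z@(c +i d) w e nz p∣z =
    [ (λ { (n , fn) → record { ε = ℤ.- + 1 ; ε² = refl ; ε-sign = inj₁ (n , fn , refl) ; c≡ = proj₁ (sign-even n fn) ; d≡ = proj₂ (sign-even n fn) } })
    , (λ { (n , fn) → record { ε = + 1 ; ε² = refl ; ε-sign = inj₂ (n , fn , refl) ; c≡ = proj₁ (sign-odd n fn) ; d≡ = proj₂ (sign-odd n fn) } }) ]′ (parity f)
    where
    4∣ : + 4 ℤS.∣ x ℤ.- + 1
    4∣ = ℤS.∣ᵤ⇒∣ 4∣x-1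

    x′ : ℤ
    x′ = ℤS._∣_.quotient 4∣

    x≡ : x ≡ + 1 ℤ.+ x′ ℤ.* + 4
    x≡ = trans (Identities.split ℤ-ring x) (cong (λ z → + 1 ℤ.+ z) (ℤS._∣_.equality 4∣))

    d-even : d ≡ + 2 ℤ.* (im w ℤ.- re w)
    d-even = trans (sym (trans (cong (λ z → d ℤ.+ z) (im-ν p)) (ℤP.+-identityʳ d))) (im-mod z (Z.ν p) w e)

    c+p : c ℤ.+ + p ≡ + 2 ℤ.* re w ℤ.- (ℤ.- + 2) ℤ.* im w
    c+p = trans (cong (λ z → c ℤ.+ z) (sym (re-ν p))) (re-mod z (Z.ν p) w e)

    k≡ : c ℤ.+ d ℤ.+ + p ≡ + 4 ℤ.* im w
    k≡ = trans (Identities.rotate ℤ-ring c d (+ p)) (trans (cong₂ ℤ._+_ c+p d-even) (Identities.total ℤ-ring (re w) (im w)))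

    open SumOfTwoSquares p f p≡ x y c d (+ i) x′ (im w ℤ.- re w) (im w) xy (sym nz) p∣x+yi p∣z x≡ d-even k≡

  module FourthRoot (p : ℕ) (pr : Prime p) (f : ℕ) (p≡ : p ≡ suc (4 ℕ.* f)) (0<f : 0 < f)
    (F : Quotient p) (R : Quotient (p ℕ.^ 2))
    (x y : ℤ) (xy : + p ≡ x ℤ.* x ℤ.+ y ℤ.* y) where
    private module F = Quotient F
    open Quotient R
    open TeichmullerSums p pr f p≡ 0<f F R
    open ≡-Reasoning

    private
      a b : F.Carrier
      a = F.ι x
      b = F.ι y

      a²+b² : a F.* a F.+ b F.* b ≡ F.0#
      a²+b² = trans (sym (trans (F.ι-+ (x ℤ.* x) (y ℤ.* y)) (cong₂ F._+_ (F.ι-* x x) (F.ι-* y y)))) (trans (cong F.ι (sym xy)) F.νM)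

      p∤both : a ≡ F.0# → b ≡ F.0# → F.1# ≡ F.0#
      p∤both ea eb = F.∣⇒ν≡0 (subst₂ ℕD._∣_ refl one (ℕD.m∣m*n ℤ.∣ s ∣))
        where
        px : + p ℤS.∣ x
        px = ℤS.∣ᵤ⇒∣ (F.ι-ker x ea)
        py : + p ℤS.∣ y
        py = ℤS.∣ᵤ⇒∣ (F.ι-ker y eb)
        open ℤS._∣_ px using () renaming (quotient to u; equality to eu)
        open ℤS._∣_ py using () renaming (quotient to v; equality to ev′)
        s : ℤ
        s = u ℤ.* u ℤ.+ v ℤ.* v
        one : p ℕ.* ℤ.∣ s ∣ ≡ 1
        one = trans (sym (ℤP.abs-* (+ p) s)) (cong ℤ.∣_∣ (ℤP.*-cancelˡ-≡ (+ p) (+ p ℤ.* s) (+ 1) {{p≢0}} (begin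
          + p ℤ.* (+ p ℤ.* s)   ≡⟨ sym (Identities.factor ℤ-ring (+ p) u v) ⟩
          (u ℤ.* + p) ℤ.* (u ℤ.* + p) ℤ.+ (v ℤ.* + p) ℤ.* (v ℤ.* + p) ≡⟨ cong₂ (λ s t → s ℤ.* s ℤ.+ t ℤ.* t) (sym eu) (sym ev′) ⟩
          x ℤ.* x ℤ.+ y ℤ.* y   ≡⟨ sym xy ⟩
          + p                   ≡⟨ sym (ℤP.*-identityʳ (+ p)) ⟩
          + p ℤ.* + 1 ∎)))

      b≢0 : b ≢ F.0#
      b≢0 eb = F-1≢0 (p∤both (by (a F.≟ F.0#)) eb)
        where
        by : Dec (a ≡ F.0#) → a ≡ F.0#
        by (yes e) = e
        by (no ne) = trans (sym (F.*-identityʳ a)) (trans (cong (a F.*_) (sym (proj₂ (F-inverse ne))))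
          (trans (sym (F.*-assoc a a _)) (trans (cong (F._* proj₁ (F-inverse ne)) a²) (F.zeroˡ _))))
          where
          a² : a F.* a ≡ F.0#
          a² = trans (sym (F.+-identityʳ _)) (trans (cong (λ z → a F.* a F.+ z) (sym (trans (cong (F._* b) eb) (F.zeroˡ b)))) a²+b²)

      b⁻¹ i₀ : F.Carrier
      b⁻¹ = proj₁ (F-inverse b≢0)
      i₀ = F.- (a F.* b⁻¹)

      bb⁻¹ : b F.* b⁻¹ ≡ F.1#
      bb⁻¹ = proj₂ (F-inverse b≢0)

      i₀² : i₀ F.* i₀ ≡ F.- F.1#
      i₀² = begin
        i₀ F.* i₀ ≡⟨ F.solve 3 (λ a b c → (F.:- (a F.:* c)) F.:* (F.:- (a F.:* c)) F.:= (a F.:* a F.:+ b F.:* b) F.:* (c F.:* c) F.:- (b F.:* c) F.:* (b F.:* c)) refl a b b⁻¹ ⟩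
        (a F.* a F.+ b F.* b) F.* (b⁻¹ F.* b⁻¹) F.- (b F.* b⁻¹) F.* (b F.* b⁻¹) ≡⟨ cong₂ (λ u v → u F.* (b⁻¹ F.* b⁻¹) F.- v F.* v) a²+b² bb⁻¹ ⟩
        F.0# F.* (b⁻¹ F.* b⁻¹) F.- F.1# F.* F.1# ≡⟨ F.solve 1 (λ c → F.:c 0 F.:* (c F.:* c) F.:- F.:c 1 F.:* F.:c 1 F.:= F.:- F.:c 1) refl b⁻¹ ⟩
        F.- F.1# ∎

      ν4f : ν (4 ℕ.* f) ≡ - 1# + P * 1#
      ν4f = trans (solve 1 (λ z → z := :c 1 :+ z :- :c 1) refl (ν (4 ℕ.* f))) (trans (cong (_- 1#) (trans (sym (ν-suc (4 ℕ.* f))) (cong ν (sym p≡))))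
        (solve 1 (λ P → P :- :c 1 := :- :c 1 :+ P :* :c 1) refl P))

      F-ν4f : F.- F.1# ≡ F.ν (4 ℕ.* f)
      F-ν4f = sym (trans (F.solve 1 (λ z → z F.:= (F.:c 1 F.:+ z) F.:- F.:c 1) refl (F.ν (4 ℕ.* f)))
          (trans (cong (F._- F.1#) (trans (sym (F.ν-suc (4 ℕ.* f))) (trans (cong F.ν (sym p≡)) F.νM))) (F.+-identityˡ _)))

    p∤y : p ∤ ℤ.∣ y ∣
    p∤y d = b≢0 (F.∣⇒ι≡0 y d)

    -- The Teichmüller lift of -x/y: the square root of -1 under which x + iy, like the Jacobi sum
    -- K, maps to a multiple of p.
    I : Carrier
    I = T i₀

    I² : I * I ≡ - 1#
    I² = begin
      T i₀ * T i₀       ≡⟨ sym (T-* i₀ i₀) ⟩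
      T (i₀ F.* i₀)     ≡⟨ T-ν (4 ℕ.* f) (trans i₀² F-ν4f) ⟩
      ν (4 ℕ.* f) ^ p   ≡⟨ power-mod-p {v = - 1#} (1# , ν4f) ⟩
      (- 1#) ^ p        ≡⟨ trans (cong ((- 1#) ^_) p≡) (trans (cong ((- 1#) *_) (evenPower f)) (*-identityʳ _)) ⟩
      - 1# ∎

    p∣x+yI : + p ℤS.∣ x ℤ.+ y ℤ.* + rep I
    p∣x+yI = ℤS.∣ᵤ⇒∣ (F.ι-ker (x ℤ.+ y ℤ.* + rep I) (begin
      F.ι (x ℤ.+ y ℤ.* + rep I)     ≡⟨ trans (F.ι-+ x (y ℤ.* + rep I)) (cong (λ z → a F.+ z) (F.ι-* y (+ rep I))) ⟩
      a F.+ b F.* F.ν (rep I)       ≡⟨ cong (λ z → a F.+ b F.* z) (T-rep i₀) ⟩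
      a F.+ b F.* (F.- (a F.* b⁻¹)) ≡⟨ F.solve 3 (λ a b c → a F.:+ b F.:* (F.:- (a F.:* c)) F.:= a F.:- a F.:* (b F.:* c)) refl a b b⁻¹ ⟩
      a F.- a F.* (b F.* b⁻¹)       ≡⟨ cong (λ z → a F.- a F.* z) bb⁻¹ ⟩
      a F.- a F.* F.1#              ≡⟨ F.solve 1 (λ a → a F.:- a F.:* F.:c 1 F.:= F.:c 0) refl a ⟩
      F.0# ∎))

  module OrdinaryPrimes (p : ℕ) (pr : Prime p) (3<p : 3 < p) (g : ℕ) (p≡ : p ≡ suc (4 ℕ.* suc g))
    (F : Quotient p) (R : Quotient (p ℕ.^ 2))
    (x y : ℤ) (xy : + p ≡ x ℤ.* x ℤ.+ y ℤ.* y) (4∣x-1 : + 4 ℤD.∣ x ℤ.- + 1) where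
    private
      module F = Quotient F
      f : ℕ
      f = suc g
    open Quotient R
    open FourthRoot p pr f p≡ (ℕ.s≤s ℕ.z≤n) F R x y xy public
    private module Ch = Characters p pr g p≡ F R I I²
    open Ch hiding (f; module F; ev; s₃; ev-s₃; P-power; P-T-ν; P-ker)
    open Ch using (ev; s₃; ev-s₃; P-power; P-T-ν; P-ker) public
    open JacobiSums p pr g p≡ F R using (W-f)
    open ShiftedFactorials p pr R
    open ≡-Reasoning

    private
      h² : ν 2 * (h * h) ≡ h
      h² = trans (sym (*-assoc _ _ _)) (trans (cong (_* h) 2h) (*-identityˡ h))

      -- `W f` has a factor p by `W-f`; thus K lies in the prime of ℤ[i] above p that contains x +
      -- iy.
      P-Wf : P * W f ≡ 0#
      P-Wf = cancel-unit {x = P * W f} (fac-unit (3 ℕ.* f) 0# 3f<p) (begin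
        P * W f * fac (3 ℕ.* f) 0#       ≡⟨ *-assoc P (W f) (fac (3 ℕ.* f) 0#) ⟩
        P * (W f * fac (3 ℕ.* f) 0#)     ≡⟨ cong (P *_) W-f ⟩
        P * (- (P * fac (2 ℕ.* f) 0# * fac f 0#)) ≡⟨ drop0 PP (- (fac (2 ℕ.* f) 0# * fac f 0#)) (solve 3 (λ P a b → P :* (:- (P :* a :* b)) := :c 0 :+ P :* P :* (:- (a :* b))) refl P (fac (2 ℕ.* f) 0#) (fac f 0#)) ⟩
        0#                               ≡⟨ sym (zeroˡ (fac (3 ℕ.* f) 0#)) ⟩
        0# * fac (3 ℕ.* f) 0# ∎)

      P-evK : P * ev K ≡ 0#
      P-evK = trans (cong (P *_) ev-K) P-Wf

      p∣-of-ev : ∀ z → P * ev z ≡ 0# → + p ℤS.∣ re z ℤ.+ im z ℤ.* + rep I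
      p∣-of-ev (c +i d) e = ℤS.∣ᵤ⇒∣ {+ p} {c ℤ.+ d ℤ.* + rep I} (P-ker (c ℤ.+ d ℤ.* + rep I) (trans (cong (P *_)
        (trans (ι-+ c (d ℤ.* + rep I)) (cong (λ z → ι c + z) (trans (ι-* d (+ rep I)) (cong (ι d *_) (ν-rep I)))))) e))

      p∣K : + p ℤS.∣ re K ℤ.+ im K ℤ.* + rep I
      p∣K = p∣-of-ev K P-evK

      abstract
        K-associate : Associate f K x y
        K-associate = go K-mod
          where
          go : (∃ λ w → K Z.+ Z.ν p ≡ (+ 2 +i -[1+ 1 ]) Z.* w) → Associate f K x y
          go (w , e) = associate-of-x+iy p f {{prime⇒nonZero pr}} (pos-suc-4* f p≡) x y (rep I) xy 4∣x-1 p∣x+yI K w e (norm-K (h * h) h²) p∣K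

      open Associate K-associate

      ιε : ι ε ≡ - sgn f
      ιε = [ (λ { (n , fn , e) → trans (cong ι e) (cong -_ (sym (trans (cong sgn fn) (sgn-even n)))) })
           , (λ { (n , fn , e) → trans (cong ι e) (sym (trans (cong -_ (trans (cong sgn fn) (sgn-odd n))) (-‿involutive 1#))) }) ]′ ε-sign

    nonunit-multiple : ∃ λ z → ι x + ι y * I ≡ P * z
    nonunit-multiple = go p∣x+yI
      where
      go : + p ℤS.∣ x ℤ.+ y ℤ.* + rep I → ∃ λ z → ι x + ι y * I ≡ P * z
      go (ℤS.divides q e) = ι q , (begin
        ι x + ι y * I                 ≡⟨ cong (λ z → ι x + ι y * z) (sym (ν-rep I)) ⟩
        ι x + ι y * ν (rep I)         ≡⟨ cong (λ z → ι x + z) (sym (ι-* y (+ rep I))) ⟩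
        ι x + ι (y ℤ.* + rep I)       ≡⟨ sym (ι-+ x (y ℤ.* + rep I)) ⟩
        ι (x ℤ.+ y ℤ.* + rep I)       ≡⟨ cong ι e ⟩
        ι (q ℤ.* + p)                 ≡⟨ trans (ι-* q (+ p)) (*-comm _ _) ⟩
        P * ι q ∎)

    norm-R : ι x * ι x + ι y * ι y ≡ P
    norm-R = trans (sym (trans (ι-+ (x ℤ.* x) (y ℤ.* y)) (cong₂ _+_ (ι-* x x) (ι-* y y)))) (cong ι (sym xy))

    private
      ev-conj-associate : ∀ z ε → re z ≡ ε ℤ.* x → im z ≡ ε ℤ.* y → ev (conj z) ≡ ι ε * (ι x - ι y * I)
      ev-conj-associate (c +i d) ε c≡ d≡ = begin
        ι c + ι (ℤ.- d) * I     ≡⟨ cong₂ (λ u v → u + v * I) (trans (cong ι c≡) (ι-* ε x)) (trans (ι-neg d) (cong -_ (trans (cong ι d≡) (ι-* ε y)))) ⟩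
        ι ε * ι x + (- (ι ε * ι y)) * I ≡⟨ solve 4 (λ e x y I → e :* x :+ (:- (e :* y)) :* I := e :* (x :- y :* I)) refl (ι ε) (ι x) (ι y) I ⟩
        ι ε * (ι x - ι y * I) ∎

      ev-conjK-associate : ∀ w → w ≡ ev (conj K) → w ≡ ι ε * (ι x - ι y * I)
      ev-conjK-associate w e = trans e (ev-conj-associate K ε c≡ d≡)

      W₃≡ev : W (3 ℕ.* f) ≡ ev (conj K)
      W₃≡ev = sym ev-conjK

      evconj : W (3 ℕ.* f) ≡ ι ε * (ι x - ι y * I)
      evconj = ev-conjK-associate (W (3 ℕ.* f)) W₃≡ev

    -- the theorem of Chowla, Dwork and Evans, with x - y I in place of 2x - p/2x
    chowla-dwork-evans : ∀ h κ → ν 2 * h ≡ 1# → ν 2 * κ ≡ h →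
      (ι x - ι y * I) * (fac f (- κ) * fac f (- κ)) ≡ fac (2 ℕ.* f) (- h)
    chowla-dwork-evans h κ 2h 2κ = begin
      w₁ * G                      ≡⟨ trans (sym (*-identityˡ _)) (cong (_* (w₁ * G)) (sym (sgn² f))) ⟩
      sgn f * sgn f * (w₁ * G)    ≡⟨ solve 3 (λ s w G → s :* s :* (w :* G) := (:- s) :* ((:- s) :* w :* G)) refl (sgn f) w₁ G ⟩
      (- sgn f) * ((- sgn f) * w₁ * G) ≡⟨ cong (λ z → (- sgn f) * (z * w₁ * G)) (sym ιε) ⟩
      (- sgn f) * (ι ε * w₁ * G)  ≡⟨ cong (λ z → (- sgn f) * (z * G)) (sym evconj) ⟩
      (- sgn f) * (W (3 ℕ.* f) * G) ≡⟨ cong ((- sgn f) *_) (UnitSum.unitSum h κ 2h 2κ) ⟩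
      (- sgn f) * (- (sgn f * fac (2 ℕ.* f) (- h))) ≡⟨ solve 2 (λ s F → (:- s) :* (:- (s :* F)) := s :* s :* F) refl (sgn f) _ ⟩
      sgn f * sgn f * fac (2 ℕ.* f) (- h) ≡⟨ trans (cong (_* fac (2 ℕ.* f) (- h)) (sgn² f)) (*-identityˡ _) ⟩
      fac (2 ℕ.* f) (- h) ∎
      where
      w₁ = ι x - ι y * I
      G = fac f (- κ) * fac f (- κ)

    -- K² = ε²(x + iy)² with ε² = 1, so the sign relating K to x + iy drops out.
    s₃-mod-3 : ∃ λ v → (x ℤ.* x ℤ.- y ℤ.* y ≡ re ⟦ s₃ ⟧ ℤ.+ + 3 ℤ.* re v) × (+ 2 ℤ.* (x ℤ.* y) ≡ im ⟦ s₃ ⟧ ℤ.+ + 3 ℤ.* im v)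
    s₃-mod-3 = go K²-mod-3
      where
      go : (∃ λ v → K Z.* K ≡ ⟦ s₃ ⟧ Z.+ Z.ν 3 Z.* v) →
        ∃ λ v → (x ℤ.* x ℤ.- y ℤ.* y ≡ re ⟦ s₃ ⟧ ℤ.+ + 3 ℤ.* re v) × (+ 2 ℤ.* (x ℤ.* y) ≡ im ⟦ s₃ ⟧ ℤ.+ + 3 ℤ.* im v)
      go (v , e) = v , re-square K ⟦ s₃ ⟧ v e ε x y ε² c≡ d≡ , im-square K ⟦ s₃ ⟧ v e ε x y ε² c≡ d≡

-- Duplication and triplication of X for p ≡ 1 (mod 4)

module Values where

  open RingKit
  open ZMod
  open Local
  open Factorials
  open import Data.Nat as ℕ using (ℕ; suc; _<_)
  import Data.Nat.Properties as ℕP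
  import Data.Nat.Solver as ℕS
  open import Data.Nat.Primality using (Prime)
  open import Relation.Binary.PropositionalEquality

  module OrdinaryValue (p : ℕ) (pr : Prime p) (R : Quotient (p ℕ.^ 2))
    (A : Quotient.Carrier R) (A12 : Quotient._*_ R A (Quotient.ν R 12) ≡ Quotient.1# R) where
    open Quotient R
    open LocalRing p pr 1 R
    open ShiftedFactorials p pr R
    open ≡-Reasoning

    private
      sgn : ℕ → Carrier
      sgn k = (- 1#) ^ k

      2h : ν 2 * (ν 6 * A) ≡ 1#
      2h = trans (solve 1 (λ A → :c 2 :* (:c 6 :* A) := A :* :c 12) refl A) A12

      3h : ν 3 * (ν 4 * A) ≡ 1#
      3h = trans (solve 1 (λ A → :c 3 :* (:c 4 :* A) := A :* :c 12) refl A) A12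

      shift : ∀ N c c′ {d} → d ≡ c + c′ → N < p → fac N d ≡ fac N c * (1# + P * c′ * H N)
      shift N c c′ e l = trans (cong (fac N) e) (fac-shift N c c′ l)

    -- To first order only the sum of the shifts counts, and -2b + 0 = -b - b.
    square-shift : ∀ N b → N < p → fac N (- (ν 2 * b)) * fac N 0# ≡ fac N (- b) * fac N (- b)
    square-shift N b l = begin
      fac N (- (ν 2 * b)) * fac N 0#
        ≡⟨ cong₂ _*_ (shift N (- b) (- b) (solve 1 (λ b → :- (:c 2 :* b) := :- b :+ :- b) refl b) l) (shift N (- b) b (solve 1 (λ b → :c 0 := :- b :+ b) refl b) l) ⟩
      F * (1# + P * (- b) * H N) * (F * (1# + P * b * H N))
        ≡⟨ drop0 P² (- (F * F * b * b * H N * H N)) (solve 4 (λ F P b h → F :* (:c 1 :+ P :* (:- b) :* h) :* (F :* (:c 1 :+ P :* b :* h))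
             := F :* F :+ P :* P :* (:- (F :* F :* b :* b :* h :* h))) refl F P b (H N)) ⟩
      F * F ∎
      where F = fac N (- b)

    signs : ∀ N → sgn N * (ν 2 ^ N * (- ν 2) ^ N) ≡ ν 2 ^ (N ℕ.+ N)
    signs N = begin
      sgn N * (ν 2 ^ N * (- ν 2) ^ N)
        ≡⟨ cong (λ z → sgn N * (ν 2 ^ N * z)) (trans (cong (_^ N) (solve 0 (:- :c 2 := (:- :c 1) :* :c 2) refl)) (^-distrib-* (- 1#) (ν 2) N)) ⟩
      sgn N * (ν 2 ^ N * (sgn N * ν 2 ^ N))
        ≡⟨ solve 2 (λ s t → s :* (t :* (s :* t)) := s :* s :* (t :* t)) refl (sgn N) (ν 2 ^ N) ⟩
      sgn N * sgn N * (ν 2 ^ N * ν 2 ^ N)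
        ≡⟨ cong₂ _*_ (trans (sym (^-distrib-* (- 1#) (- 1#) N)) (trans (cong (_^ N) (solve 0 ((:- :c 1) :* (:- :c 1) := :c 1) refl)) (1^ N))) (sym (^-homo-* (ν 2) N N)) ⟩
      1# * ν 2 ^ (N ℕ.+ N) ≡⟨ *-identityˡ _ ⟩
      ν 2 ^ (N ℕ.+ N) ∎

    -- X n! n! = α (-1)^n (2n)! becomes X n! b! = α 4^n (n+b)!.
    duplicated : ∀ N b v α X → p ≡ suc (2 ℕ.* (b ℕ.+ N)) →
      X * fac N (- (ν 2 * v)) * fac N 0# ≡ α * sgn N * fac (N ℕ.+ N) (- (ν 2 * v)) →
      X * fac N (- v) * fac b (- (ν 6 * A - v)) ≡ α * ν 2 ^ (N ℕ.+ N) * fac (b ℕ.+ N) (- (ν 6 * A - v))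
    duplicated N b v α X p≡ e = cancel-unit {x = X * F * B} (fac-unit N (- v) N<p) (begin
      X * F * B * F
        ≡⟨ solve 3 (λ X F B → X :* F :* B :* F := X :* (F :* F) :* B) refl X F B ⟩
      X * (F * F) * B
        ≡⟨ cong (λ z → X * z * B) (sym (square-shift N v N<p)) ⟩
      X * (fac N (- (ν 2 * v)) * fac N 0#) * B
        ≡⟨ cong (_* B) (trans (sym (*-assoc _ _ _)) e) ⟩
      α * sgn N * fac (N ℕ.+ N) (- (ν 2 * v)) * B
        ≡⟨ cong₂ (λ k z → α * sgn N * fac k z * B) (cong (N ℕ.+_) (sym (ℕP.+-identityʳ N))) (solve 1 (λ v → :- (:c 2 :* v) := :c 2 :* (:- v)) refl v) ⟩
      α * sgn N * fac (2 ℕ.* N) (ν 2 * - v) * B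
        ≡⟨ *-assoc _ _ _ ⟩
      α * sgn N * (fac (2 ℕ.* N) (ν 2 * - v) * B)
        ≡⟨ cong (α * sgn N *_) (Halves.doubling (ν 6 * A) 2h N b (- v) p≡) ⟩
      α * sgn N * (ν 2 ^ N * (- ν 2) ^ N * (F * G))
        ≡⟨ solve 5 (λ a s t F G → a :* s :* (t :* (F :* G)) := a :* (s :* t) :* G :* F) refl α (sgn N) (ν 2 ^ N * (- ν 2) ^ N) F G ⟩
      α * (sgn N * (ν 2 ^ N * (- ν 2) ^ N)) * G * F
        ≡⟨ cong (λ z → α * z * G * F) (signs N) ⟩
      α * ν 2 ^ (N ℕ.+ N) * G * F ∎)
      where
      F = fac N (- v)
      B = fac b (- (ν 6 * A - v))
      G = fac (b ℕ.+ N) (- (ν 6 * A - v))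
      N<p : N < p
      N<p = subst (N <_) (sym p≡) (ℕ.s≤s (ℕP.≤-trans (ℕP.m≤n+m N b) (ℕP.m≤m+n (b ℕ.+ N) _)))

    -- Triplication trades m! M! for f!², leaving t! once with shift -5/12 and once with shift
    -- -3/12. Their quotient 1 + p H_t/6 is the factor containing 2A.
    triplicated : ∀ f t m M e κ X E → t < p →
      fac f (- (ν 3 * A)) * (fac f (- (ν 3 * A)) * fac t (- (ν 5 * A))) ≡ e * (fac m (- A) * fac t (- (ν 3 * A)) * fac M (- (ν 5 * A))) →
      X * (fac m (- A) * fac M (- (ν 5 * A))) ≡ κ * E →
      X * (fac f (- (ν 3 * A)) * fac f (- (ν 3 * A))) ≡ κ * (e * (1# + P * (ν 2 * A) * H t)) * E
    triplicated f t m M e κ X E t<p trip dup = cancel-unit {x = X * (G * G)} (fac-unit t (- (ν 5 * A)) t<p) (begin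
      X * (G * G) * T₅           ≡⟨ solve 3 (λ X G T → X :* (G :* G) :* T := X :* (G :* (G :* T))) refl X G T₅ ⟩
      X * (G * (G * T₅))         ≡⟨ cong (X *_) trip ⟩
      X * (e * (a * fac t (- (ν 3 * A)) * b)) ≡⟨ cong (λ z → X * (e * (a * z * b))) (shift t (- (ν 5 * A)) (ν 2 * A) (solve 1 (λ A → :- (:c 3 :* A) := :- (:c 5 :* A) :+ :c 2 :* A) refl A) t<p) ⟩
      X * (e * (a * (T₅ * q) * b)) ≡⟨ solve 6 (λ X e a T q b → X :* (e :* (a :* (T :* q) :* b)) := X :* (a :* b) :* (e :* q) :* T) refl X e a T₅ q b ⟩
      X * (a * b) * (e * q) * T₅ ≡⟨ cong (λ z → z * (e * q) * T₅) dup ⟩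
      κ * E * (e * q) * T₅       ≡⟨ solve 4 (λ k E e T → k :* E :* e :* T := k :* e :* E :* T) refl κ E (e * q) T₅ ⟩
      κ * (e * q) * E * T₅ ∎)
      where
      G = fac f (- (ν 3 * A))
      T₅ = fac t (- (ν 5 * A))
      a = fac m (- A)
      b = fac M (- (ν 5 * A))
      q = 1# + P * (ν 2 * A) * H t

    PH₂ : ∀ N → p ≡ suc (2 ℕ.* N) → 1# + P * (- (ν 6 * A)) * H N ≡ ν 2 ^ (2 ℕ.* N)
    PH₂ N p≡ = cancel-unit {x = 1# + P * (- (ν 6 * A)) * H N} (fac-unit N 0# N<p) (trans (*-comm _ _)
      (trans (sym (shift N 0# (- (ν 6 * A)) (sym (+-identityˡ _)) N<p)) (fermat2 (ν 6 * A) 2h N p≡)))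
      where
      N<p : N < p
      N<p = subst (N <_) (sym p≡) (ℕ.s≤s (ℕP.m≤m+n N _))

    -- The shift -(1 - 1/3) = -2/3 is -8A, and t! cancels.
    PH₃ : ∀ t L → t < p → fac t (- (1# - ν 4 * A)) ≡ ν 3 ^ L * fac t 0# → 1# + P * (- (ν 8 * A)) * H t ≡ ν 3 ^ L
    PH₃ t L t<p e = cancel-unit {x = 1# + P * (- (ν 8 * A)) * H t} (fac-unit t 0# t<p) (trans (*-comm _ _)
      (trans (sym (shift t 0# (- (ν 8 * A)) eq t<p)) e))
      where
      eq : - (1# - ν 4 * A) ≡ 0# + - (ν 8 * A)
      eq = trans (cong (λ z → - (z - ν 4 * A)) (sym A12)) (solve 1 (λ A → :- (A :* :c 12 :- :c 4 :* A) := :c 0 :+ :- (:c 8 :* A)) refl A)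

    -- The fourth power of 3^f is 3^(4f) = 1 - 8A p H, and (1 + 2A p H)⁴ = 1 + 8A p H modulo p²; the
    -- two corrections cancel.
    ρ-fourth : ∀ m f H → 1# + P * (- (ν 8 * A)) * H ≡ ν 3 ^ (4 ℕ.* f) → (sgn m * ν 3 ^ f * (1# + P * (ν 2 * A) * H)) ^ 4 ≡ 1#
    ρ-fourth m f H e = begin
      (sgn m * ν 3 ^ f * (1# + P * (ν 2 * A) * H)) ^ 4
        ≡⟨ trans (^-distrib-* (sgn m * ν 3 ^ f) _ 4) (cong (_* (1# + P * (ν 2 * A) * H) ^ 4) (^-distrib-* (sgn m) (ν 3 ^ f) 4)) ⟩
      sgn m ^ 4 * (ν 3 ^ f) ^ 4 * (1# + P * (ν 2 * A) * H) ^ 4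
        ≡⟨ cong₂ (λ u v → u * v * (1# + P * (ν 2 * A) * H) ^ 4) sign⁴ (trans (^-assocʳ (ν 3) f 4) (trans (cong (ν 3 ^_) (ℕP.*-comm f 4)) (sym e))) ⟩
      1# * (1# + P * (- (ν 8 * A)) * H) * (1# + P * (ν 2 * A) * H) ^ 4
        ≡⟨ drop0 P² (ν 24 * x - ν 192 * x - P * (ν 192 * x * A * H) + P * (ν 32 * x * A * H) - P * P * (ν 256 * x * x) + P * P * (ν 16 * x * x) - P * P * P * (ν 128 * x * x * A * H) + (ν 128 * x))
             (solve 3 (λ P A H → :c 1 :* (:c 1 :+ P :* (:- (:c 8 :* A)) :* H) :* (:c 1 :+ P :* (:c 2 :* A) :* H) :^ 4
               := :c 1 :+ P :* P :* (let x = A :* A :* H :* H in :c 24 :* x :- :c 192 :* x :- P :* (:c 192 :* x :* A :* H) :+ P :* (:c 32 :* x :* A :* H) :- P :* P :* (:c 256 :* x :* x) :+ P :* P :* (:c 16 :* x :* x) :- P :* P :* P :* (:c 128 :* x :* x :* A :* H) :+ :c 128 :* x)) refl P A H) ⟩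
      1# ∎
      where
      x = A * A * H * H
      sign⁴ : sgn m ^ 4 ≡ 1#
      sign⁴ = trans (^-assocʳ (- 1#) m 4) (trans (cong ((- 1#) ^_) (ℕP.*-comm m 4)) (trans (sym (^-assocʳ (- 1#) 4 m)) (trans (cong (_^ m) (solve 0 ((:- :c 1) :^ 4 := :c 1) refl)) (1^ m))))

    -- Here n = m. Duplication yields 4^m (6m)!/(m! (5m)!), and triplication with shift -1/12
    -- converts m! (5m)! into (3m)!², where f = 3m and t = 4m.
    value₁ : ∀ m X → p ≡ suc (12 ℕ.* m) → X * fac m (- (ν 2 * ν 1 * A)) * fac m 0# ≡ ν 1 * sgn m * fac (m ℕ.+ m) (- (ν 2 * ν 1 * A)) →
      X * (fac (3 ℕ.* m) (- (ν 3 * A)) * fac (3 ℕ.* m) (- (ν 3 * A)))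
      ≡ ν 1 * ν 2 ^ (m ℕ.+ m) * (sgn m * ν 3 ^ (3 ℕ.* m) * (1# + P * (ν 2 * A) * H (4 ℕ.* m))) * fac (6 ℕ.* m) (- (ν 5 * A))
    value₁ m X p≡ e = triplicated (3 ℕ.* m) (4 ℕ.* m) m (5 ℕ.* m) _ _ X _ t<p trip dup
      where
      open ℕS.+-*-Solver renaming (solve to solveℕ; _:+_ to _:+ℕ_; _:*_ to _:*ℕ_; con to conℕ; _:=_ to _:=ℕ_) using ()
      t<p : 4 ℕ.* m < p
      t<p = subst (4 ℕ.* m <_) (sym p≡) (ℕ.s≤s (ℕP.*-monoˡ-≤ m {4} {12} (ℕ.s≤s (ℕ.s≤s (ℕ.s≤s (ℕ.s≤s ℕ.z≤n))))))
      arg₅ : - (ν 6 * A - A) ≡ - (ν 5 * A)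
      arg₅ = solve 1 (λ A → :- (:c 6 :* A :- A) := :- (:c 5 :* A)) refl A
      arg₁ : - (ν 2 * ν 1 * A) ≡ - (ν 2 * A)
      arg₁ = solve 1 (λ A → :- (:c 2 :* :c 1 :* A) := :- (:c 2 :* A)) refl A
      dup : X * (fac m (- A) * fac (5 ℕ.* m) (- (ν 5 * A))) ≡ ν 1 * ν 2 ^ (m ℕ.+ m) * fac (6 ℕ.* m) (- (ν 5 * A))
      dup = trans (sym (*-assoc _ _ _)) (trans (cong (λ z → X * fac m (- A) * fac (5 ℕ.* m) z) (sym arg₅))
        (trans (duplicated m (5 ℕ.* m) A (ν 1) X (trans p≡ (cong suc (solveℕ 1 (λ m → conℕ 12 :*ℕ m :=ℕ conℕ 2 :*ℕ (conℕ 5 :*ℕ m :+ℕ m)) refl m)))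
            (subst (λ z → X * fac m z * fac m 0# ≡ ν 1 * sgn m * fac (m ℕ.+ m) z) arg₁ e))
          (cong₂ (λ k z → ν 1 * ν 2 ^ (m ℕ.+ m) * fac k z) (solveℕ 1 (λ m → conℕ 5 :*ℕ m :+ℕ m :=ℕ conℕ 6 :*ℕ m) refl m) arg₅)))
      trip : fac (3 ℕ.* m) (- (ν 3 * A)) * (fac (3 ℕ.* m) (- (ν 3 * A)) * fac (4 ℕ.* m) (- (ν 5 * A)))
        ≡ sgn m * ν 3 ^ (3 ℕ.* m) * (fac m (- A) * fac (4 ℕ.* m) (- (ν 3 * A)) * fac (5 ℕ.* m) (- (ν 5 * A)))
      trip = begin
        fac (3 ℕ.* m) (- (ν 3 * A)) * (fac (3 ℕ.* m) (- (ν 3 * A)) * fac (4 ℕ.* m) (- (ν 5 * A)))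
          ≡⟨ cong₂ (λ u v → fac (3 ℕ.* m) u * (fac (3 ℕ.* m) v * fac (4 ℕ.* m) (- (ν 5 * A)))) (solve 1 (λ A → :- (:c 3 :* A) := :c 3 :* (:- A)) refl A) (sym arg₃) ⟩
        fac (3 ℕ.* m) (ν 3 * - A) * (fac (3 ℕ.* m) (- (ν 4 * A + - A)) * fac (4 ℕ.* m) (- (ν 5 * A)))
          ≡⟨ cong (λ z → fac (3 ℕ.* m) (ν 3 * - A) * (fac (3 ℕ.* m) (- (ν 4 * A + - A)) * fac (4 ℕ.* m) z)) (sym arg₄) ⟩
        fac (3 ℕ.* m) (ν 3 * - A) * (fac (3 ℕ.* m) (- (ν 4 * A + - A)) * fac (4 ℕ.* m) (- A - ν 4 * A))
          ≡⟨ Thirds.tripling₁ (ν 4 * A) 3h m (3 ℕ.* m) (4 ℕ.* m) (- A) (trans p≡ (cong suc (solveℕ 1 (λ m → conℕ 12 :*ℕ m :=ℕ conℕ 3 :*ℕ (conℕ 4 :*ℕ m)) refl m)))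
               (solveℕ 1 (λ m → conℕ 4 :*ℕ m :=ℕ conℕ 3 :*ℕ m :+ℕ m) refl m) ⟩
        ν 3 ^ m * (- ν 3) ^ m * ν 3 ^ m * (fac m (- A) * fac (4 ℕ.* m) (- (ν 4 * A + - A)) * fac (4 ℕ.* m ℕ.+ m) (- A - ν 4 * A))
          ≡⟨ cong₂ (λ u v → u * (fac m (- A) * fac (4 ℕ.* m) v * fac (4 ℕ.* m ℕ.+ m) (- A - ν 4 * A)))
               (trans (power3 m m m) (cong (λ k → sgn m * ν 3 ^ k) (solveℕ 1 (λ m → m :+ℕ m :+ℕ m :=ℕ conℕ 3 :*ℕ m) refl m))) arg₃ ⟩
        sgn m * ν 3 ^ (3 ℕ.* m) * (fac m (- A) * fac (4 ℕ.* m) (- (ν 3 * A)) * fac (4 ℕ.* m ℕ.+ m) (- A - ν 4 * A))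
          ≡⟨ cong₂ (λ k z → sgn m * ν 3 ^ (3 ℕ.* m) * (fac m (- A) * fac (4 ℕ.* m) (- (ν 3 * A)) * fac k z)) (solveℕ 1 (λ m → conℕ 4 :*ℕ m :+ℕ m :=ℕ conℕ 5 :*ℕ m) refl m) arg₄ ⟩
        sgn m * ν 3 ^ (3 ℕ.* m) * (fac m (- A) * fac (4 ℕ.* m) (- (ν 3 * A)) * fac (5 ℕ.* m) (- (ν 5 * A))) ∎
        where
        arg₃ : - (ν 4 * A + - A) ≡ - (ν 3 * A)
        arg₃ = solve 1 (λ A → :- (:c 4 :* A :+ :- A) := :- (:c 3 :* A)) refl A
        arg₄ : - A - ν 4 * A ≡ - (ν 5 * A)
        arg₄ = solve 1 (λ A → :- A :- :c 4 :* A := :- (:c 5 :* A)) refl A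

    -- Here n = M = 5m + 2, so m and M exchange roles in the duplication, and the numerator (2f)!
    -- gets the shift -1/12 instead of -5/12.
    value₅ : ∀ m X → p ≡ suc (4 ℕ.+ 12 ℕ.* m) → let M = 2 ℕ.+ 5 ℕ.* m ; f = suc (3 ℕ.* m) in
      X * fac M (- (ν 2 * ν 5 * A)) * fac M 0# ≡ ν 5 * sgn M * fac (M ℕ.+ M) (- (ν 2 * ν 5 * A)) →
      X * (fac f (- (ν 3 * A)) * fac f (- (ν 3 * A)))
      ≡ ν 5 * ν 2 ^ (M ℕ.+ M) * (sgn m * ν 3 ^ f * (1# + P * (ν 2 * A) * H (suc (4 ℕ.* m)))) * fac (2 ℕ.* f) (- A)
    value₅ m X p≡ e = triplicated f t m M _ _ X _ t<p trip dup
      where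
      open ℕS.+-*-Solver renaming (solve to solveℕ; _:+_ to _:+ℕ_; _:*_ to _:*ℕ_; con to conℕ; _:=_ to _:=ℕ_) using ()
      M f t : ℕ
      M = 2 ℕ.+ 5 ℕ.* m
      f = suc (3 ℕ.* m)
      t = suc (4 ℕ.* m)
      t<p : t < p
      t<p = subst (t <_) (sym p≡) (ℕ.s≤s (ℕP.+-mono-≤ {1} {4} (ℕ.s≤s ℕ.z≤n) (ℕP.*-monoˡ-≤ m {4} {12} (ℕ.s≤s (ℕ.s≤s (ℕ.s≤s (ℕ.s≤s ℕ.z≤n)))))))
      arg₁ : - (ν 6 * A - ν 5 * A) ≡ - A
      arg₁ = solve 1 (λ A → :- (:c 6 :* A :- :c 5 :* A) := :- A) refl A
      arg₁₀ : - (ν 2 * ν 5 * A) ≡ - (ν 2 * (ν 5 * A))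
      arg₁₀ = solve 1 (λ A → :- (:c 2 :* :c 5 :* A) := :- (:c 2 :* (:c 5 :* A))) refl A
      dup : X * (fac m (- A) * fac M (- (ν 5 * A))) ≡ ν 5 * ν 2 ^ (M ℕ.+ M) * fac (2 ℕ.* f) (- A)
      dup = trans (solve 3 (λ X a b → X :* (a :* b) := X :* b :* a) refl X _ _) (trans (cong (λ z → X * fac M (- (ν 5 * A)) * fac m z) (sym arg₁))
        (trans (duplicated M m (ν 5 * A) (ν 5) X (trans p≡ (cong suc (solveℕ 1 (λ m → conℕ 4 :+ℕ conℕ 12 :*ℕ m :=ℕ conℕ 2 :*ℕ (m :+ℕ (conℕ 2 :+ℕ conℕ 5 :*ℕ m))) refl m)))
            (subst (λ z → X * fac M z * fac M 0# ≡ ν 5 * sgn M * fac (M ℕ.+ M) z) arg₁₀ e))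
          (cong₂ (λ k z → ν 5 * ν 2 ^ (M ℕ.+ M) * fac k z) (solveℕ 1 (λ m → m :+ℕ (conℕ 2 :+ℕ conℕ 5 :*ℕ m) :=ℕ conℕ 2 :*ℕ (conℕ 1 :+ℕ conℕ 3 :*ℕ m)) refl m) arg₁)))
      trip : fac f (- (ν 3 * A)) * (fac f (- (ν 3 * A)) * fac t (- (ν 5 * A)))
        ≡ sgn m * ν 3 ^ f * (fac m (- A) * fac t (- (ν 3 * A)) * fac M (- (ν 5 * A)))
      trip = begin
        fac f (- (ν 3 * A)) * (fac f (- (ν 3 * A)) * fac t (- (ν 5 * A)))
          ≡⟨ cong₂ (λ u v → fac f u * (fac f v * fac t (- (ν 5 * A)))) (solve 1 (λ A → :- (:c 3 :* A) := :c 3 :* (:- A)) refl A) (sym arg₃) ⟩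
        fac f (ν 3 * - A) * (fac f (- (ν 4 * A + - A)) * fac t (- (ν 5 * A)))
          ≡⟨ cong (λ z → fac f (ν 3 * - A) * (fac f (- (ν 4 * A + - A)) * fac t z)) (sym arg₄) ⟩
        fac f (ν 3 * - A) * (fac f (- (ν 4 * A + - A)) * fac t (- A - ν 4 * A))
          ≡⟨ Thirds.tripling₂ (ν 4 * A) 3h m f t (- A) (trans p≡ (solveℕ 1 (λ m → conℕ 5 :+ℕ conℕ 12 :*ℕ m :=ℕ conℕ 2 :+ℕ conℕ 3 :*ℕ (conℕ 1 :+ℕ conℕ 4 :*ℕ m)) refl m))
               (solveℕ 1 (λ m → conℕ 1 :+ℕ conℕ 4 :*ℕ m :=ℕ conℕ 1 :+ℕ conℕ 3 :*ℕ m :+ℕ m) refl m) ⟩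
        ν 3 ^ m * (- ν 3) ^ m * ν 3 ^ suc m * (fac m (- A) * fac t (- (ν 4 * A + - A)) * fac (t ℕ.+ suc m) (- A - ν 4 * A))
          ≡⟨ cong₂ (λ u v → u * (fac m (- A) * fac t v * fac (t ℕ.+ suc m) (- A - ν 4 * A)))
               (trans (power3 m m (suc m)) (cong (λ k → sgn m * ν 3 ^ k) (solveℕ 1 (λ m → m :+ℕ m :+ℕ (conℕ 1 :+ℕ m) :=ℕ conℕ 1 :+ℕ conℕ 3 :*ℕ m) refl m))) arg₃ ⟩
        sgn m * ν 3 ^ f * (fac m (- A) * fac t (- (ν 3 * A)) * fac (t ℕ.+ suc m) (- A - ν 4 * A))
          ≡⟨ cong₂ (λ k z → sgn m * ν 3 ^ f * (fac m (- A) * fac t (- (ν 3 * A)) * fac k z)) (solveℕ 1 (λ m → conℕ 1 :+ℕ conℕ 4 :*ℕ m :+ℕ (conℕ 1 :+ℕ m) :=ℕ conℕ 2 :+ℕ conℕ 5 :*ℕ m) refl m) arg₄ ⟩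
        sgn m * ν 3 ^ f * (fac m (- A) * fac t (- (ν 3 * A)) * fac M (- (ν 5 * A))) ∎
        where
        arg₃ : - (ν 4 * A + - A) ≡ - (ν 3 * A)
        arg₃ = solve 1 (λ A → :- (:c 4 :* A :+ :- A) := :- (:c 3 :* A)) refl A
        arg₄ : - A - ν 4 * A ≡ - (ν 5 * A)
        arg₄ = solve 1 (λ A → :- A :- :c 4 :* A := :- (:c 5 :* A)) refl A

-- Fixing the fourth root of unity and evaluating X

module Evaluation where

  open RingKit
  open ZMod
  open Local
  open Gaussian using (⟦_⟧; re; im)
  open Factorials
  open Teichmuller
  open TwoSquares using (ℤ-ring)
  open Ordinary
  open Values
  open import Data.Nat as ℕ using (ℕ; zero; suc; _<_)
  import Data.Nat.Properties as ℕP
  import Data.Nat.Solver as ℕS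
  open import Data.Nat.Divisibility as ℕD using (_∣_; divides)
  open import Data.Nat.Primality using (Prime)
  open import Data.Integer as ℤ using (ℤ; +_; -[1+_])
  import Data.Integer.Properties as ℤP
  import Data.Integer.Divisibility as ℤD
  import Data.Integer.Divisibility.Signed as ℤS
  open import Data.Integer.DivMod as ℤDM using ()
  open import Data.Fin as Fin using (Fin)
  open import Data.Fin.Patterns
  open import Data.Product using (_,_; ∃; _×_)
  open import Data.Empty using (⊥-elim)
  open import Relation.Nullary using (¬_)
  open import Relation.Binary.PropositionalEquality

  private
    module Identities (K : Ring≡) where
      open Kit K
      sq₁ : ∀ x q → x ≡ 1# + q * ν 3 → ∃ λ u → x * x ≡ 1# + u * ν 3
      sq₁ x q refl = ν 3 * q * q + ν 2 * q ,
        solve 1 (λ q → (:c 1 :+ q :* :c 3) :* (:c 1 :+ q :* :c 3) := :c 1 :+ (:c 3 :* q :* q :+ :c 2 :* q) :* :c 3) refl q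
      sq₂ : ∀ x q → x ≡ ν 2 + q * ν 3 → ∃ λ u → x * x ≡ 1# + u * ν 3
      sq₂ x q refl = ν 3 * q * q + ν 4 * q + 1# ,
        solve 1 (λ q → (:c 2 :+ q :* :c 3) :* (:c 2 :+ q :* :c 3) := :c 1 :+ (:c 3 :* q :* q :+ :c 4 :* q :+ :c 1) :* :c 3) refl q
      -- s = x² - y² - 3 v and p = x² + y² = 1 + 3 k with x = 3 q
      case₀ : ∀ q y s v k → (q * ν 3) * (q * ν 3) - y * y ≡ s + ν 3 * v → 1# + ν 3 * k ≡ (q * ν 3) * (q * ν 3) + y * y →
        ∃ λ t → s + 1# ≡ t * ν 3
      case₀ q y s v k e₁ e₂ = ν 6 * q * q - k - v , trans (solve 2 (λ s v → s :+ :c 1 := (s :+ :c 3 :* v) :- :c 3 :* v :+ :c 1) refl s v)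
        (trans (cong (λ z → z - ν 3 * v + 1#) (sym e₁)) (trans
          (solve 4 (λ q y v k → (q :* :c 3) :* (q :* :c 3) :- y :* y :- :c 3 :* v :+ :c 1
            := (:c 6 :* q :* q :- k :- v) :* :c 3 :+ ((:c 1 :+ :c 3 :* k) :- ((q :* :c 3) :* (q :* :c 3) :+ y :* y))) refl q y v k)
          (trans (cong (λ z → (ν 6 * q * q - k - v) * ν 3 + z) (x≡y⇒x-y≡0 e₂)) (+-identityʳ _))))
      -- 1 ≡ x² + y² and x² ≡ 1 modulo 3 give y² ≡ 0, hence s ≡ x² - y² ≡ 1.
      case₁ : ∀ x y s v k u → x * x ≡ 1# + u * ν 3 → x * x - y * y ≡ s + ν 3 * v → 1# + ν 3 * k ≡ x * x + y * y →
        ∃ λ t → s - 1# ≡ t * ν 3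
      case₁ x y s v k u e₀ e₁ e₂ = ν 2 * u - k - v , trans (solve 2 (λ s v → s :- :c 1 := (s :+ :c 3 :* v) :- :c 3 :* v :- :c 1) refl s v)
        (trans (cong (λ z → z - ν 3 * v - 1#) (sym e₁)) (trans
          (solve 4 (λ X Y v k → X :- Y :- :c 3 :* v :- :c 1 := :c 2 :* (X :- :c 1) :- :c 3 :* k :- :c 3 :* v :+ ((:c 1 :+ :c 3 :* k) :- (X :+ Y))) refl (x * x) (y * y) v k)
          (trans (cong₂ (λ X z → ν 2 * (X - 1#) - ν 3 * k - ν 3 * v + z) e₀ (x≡y⇒x-y≡0 e₂))
            (solve 3 (λ u k v → :c 2 :* (:c 1 :+ u :* :c 3 :- :c 1) :- :c 3 :* k :- :c 3 :* v :+ :c 0 := (:c 2 :* u :- k :- v) :* :c 3) refl u k v))))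
      -- 2xy = (x² + y²) - (x - y)², which is 2 modulo 3 when 3 divides x - y.
      case₂ : ∀ x y s v k q → x - y ≡ q * ν 3 → ν 2 * (x * y) ≡ s + ν 3 * v → ν 2 + ν 3 * k ≡ x * x + y * y →
        ∃ λ t → s + 1# ≡ t * ν 3
      case₂ x y s v k q e₀ e₁ e₂ = 1# + k - v - ν 3 * q * q , trans (solve 2 (λ s v → s :+ :c 1 := (s :+ :c 3 :* v) :- :c 3 :* v :+ :c 1) refl s v)
        (trans (cong (λ z → z - ν 3 * v + 1#) (sym e₁)) (trans
          (solve 4 (λ x y v k → :c 2 :* (x :* y) :- :c 3 :* v :+ :c 1 := :c 3 :* (:c 1 :+ k) :- :c 3 :* v :- (x :- y) :* (x :- y) :+ ((x :* x :+ y :* y) :- (:c 2 :+ :c 3 :* k))) refl x y v k)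
          (trans (cong₂ (λ d z → ν 3 * (1# + k) - ν 3 * v - d * d + z) e₀ (x≡y⇒x-y≡0 (sym e₂)))
            (solve 3 (λ q k v → :c 3 :* (:c 1 :+ k) :- :c 3 :* v :- (q :* :c 3) :* (q :* :c 3) :+ :c 0 := (:c 1 :+ k :- v :- :c 3 :* q :* q) :* :c 3) refl q k v))))

    module Id = Identities ℤ-ring

    square-mod-3 : ∀ x → ¬ (+ 3 ℤD.∣ x) → ∃ λ u → x ℤ.* x ≡ + 1 ℤ.+ u ℤ.* + 3
    square-mod-3 x ∤x = go (x ℤDM.% + 3) (ℤDM.n%d<d x (+ 3)) (ℤDM.a≡a%n+[a/n]*n x (+ 3))
      where
      q : ℤ
      q = x ℤDM./ + 3
      go : ∀ r → r < 3 → x ≡ + r ℤ.+ q ℤ.* + 3 → ∃ λ u → x ℤ.* x ≡ + 1 ℤ.+ u ℤ.* + 3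
      go 0 _ e = ⊥-elim (∤x (ℤS.∣⇒∣ᵤ (ℤS.divides q (trans e (ℤP.+-identityˡ _)))))
      go 1 _ e = Id.sq₁ x q e
      go 2 _ e = Id.sq₂ x q e
      go (suc (suc (suc _))) (ℕ.s≤s (ℕ.s≤s (ℕ.s≤s ()))) _

    pos-affine : ∀ r k → + (r ℕ.+ 3 ℕ.* k) ≡ + r ℤ.+ + 3 ℤ.* + k
    pos-affine r k = trans (ℤP.pos-+ r (3 ℕ.* k)) (cong (λ z → + r ℤ.+ z) (ℤP.pos-* 3 k))

    not-dividing : ∀ {z q} {A : Set} → z ≡ q ℤ.* + 3 → ¬ (3 ∣ ℤ.∣ z ∣) → A
    not-dividing {z} {q} e n = ⊥-elim (n (ℤS.∣⇒∣ᵤ {+ 3} {z} (ℤS.divides q e)))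

    3∤1 : ¬ (3 ∣ 1)
    3∤1 (divides zero ())
    3∤1 (divides (suc _) ())

    3∤2 : ¬ (3 ∣ 2)
    3∤2 (divides zero ())
    3∤2 (divides (suc _) ())

    -- The real and imaginary parts of 0, ±1, ±i are 0, 1 or -1, distinct modulo 3; a nonzero
    -- residue of one of them identifies the value.
    re≡-1 : ∀ s → (∃ λ q → re ⟦ s ⟧ ℤ.+ + 1 ≡ q ℤ.* + 3) → s ≡ 2F
    re≡-1 0F (q , e) = not-dividing {q = q} e 3∤1
    re≡-1 1F (q , e) = not-dividing {q = q} e 3∤2
    re≡-1 2F e = refl
    re≡-1 3F (q , e) = not-dividing {q = q} e 3∤1
    re≡-1 4F (q , e) = not-dividing {q = q} e 3∤1

    re≡1 : ∀ s → (∃ λ q → re ⟦ s ⟧ ℤ.- + 1 ≡ q ℤ.* + 3) → s ≡ 1F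
    re≡1 0F (q , e) = not-dividing {q = q} e 3∤1
    re≡1 1F e = refl
    re≡1 2F (q , e) = not-dividing {q = q} e 3∤2
    re≡1 3F (q , e) = not-dividing {q = q} e 3∤1
    re≡1 4F (q , e) = not-dividing {q = q} e 3∤1

    im≡-1 : ∀ s → (∃ λ q → im ⟦ s ⟧ ℤ.+ + 1 ≡ q ℤ.* + 3) → s ≡ 4F
    im≡-1 0F (q , e) = not-dividing {q = q} e 3∤1
    im≡-1 1F (q , e) = not-dividing {q = q} e 3∤1
    im≡-1 2F (q , e) = not-dividing {q = q} e 3∤1
    im≡-1 3F (q , e) = not-dividing {q = q} e 3∤2
    im≡-1 4F e = refl

  module OrdinaryEvaluation (p : ℕ) (pr : Prime p) (R : Quotient (p ℕ.^ 2)) (A : Quotient.Carrier R) (A12 : Quotient._*_ R A (Quotient.ν R 12) ≡ Quotient.1# R)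
    (f : ℕ) (p≡ : p ≡ suc (4 ℕ.* f)) where
    open Quotient R
    open LocalRing p pr 1 R
    open ShiftedFactorials p pr R

    module WithFourthRoot
      (a b I : Carrier) (I² : I * I ≡ - 1#) (norm-R : a * a + b * b ≡ P) (nonunit-multiple : ∃ λ z → a + b * I ≡ P * z)
      (P-ker : ∀ z → P * ι z ≡ 0# → p ∣ ℤ.∣ z ∣)
      (U S : Carrier) (P-U : P * U ≡ P * ν 3 ^ f) (S≡ : S ≡ (- 1#) ^ f * U)
      (chowla-dwork-evans : (a - b * I) * (fac f (- (ν 3 * A)) * fac f (- (ν 3 * A))) ≡ fac (2 ℕ.* f) (- (ν 6 * A))) where
      open OrdinaryValue p pr R A A12
      open ≡-Reasoning

      private
        sgn : ℕ → Carrier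
        sgn k = (- 1#) ^ k

        sgn² : ∀ k → sgn k * sgn k ≡ 1#
        sgn² k = trans (sym (^-distrib-* (- 1#) (- 1#) k)) (trans (cong (_^ k) (solve 0 ((:- :c 1) :* (:- :c 1) := :c 1) refl)) (1^ k))

        2f<p : 2 ℕ.* f < p
        2f<p = subst (2 ℕ.* f <_) (sym p≡) (ℕ.s≤s (ℕP.*-monoˡ-≤ f {2} {4} (ℕ.s≤s (ℕ.s≤s ℕ.z≤n))))

        f<p : f < p
        f<p = ℕP.≤-<-trans (ℕP.m≤m+n f _) 2f<p

        w w′ : Carrier
        w = a - b * I
        w′ = a + b * I

        w′² : w′ * w′ ≡ 0#
        w′² = go nonunit-multiple
          where
          go : (∃ λ z → w′ ≡ P * z) → w′ * w′ ≡ 0#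
          go (z , e) = trans (cong₂ _*_ e e) (trans (solve 2 (λ P z → P :* z :* (P :* z) := P :* P :* (z :* z)) refl P z) (trans (cong (_* (z * z)) P²) (zeroˡ _)))

        -- As u′² = 0, one has u′(u + u′) = u u′ = p; hence p/2c = u′ and 2c - p/2c = u. This is the
        -- origin of 2x - p/2x and 2y - p/2y.
        conjugate-sum : ∀ c u u′ c′ → u + u′ ≡ ν 2 * c → u * u′ ≡ P → u′ * u′ ≡ 0# → ν 2 * c * c′ ≡ 1# → ν 2 * c - P * c′ ≡ u
        conjugate-sum c u u′ c′ s n z i = begin
          ν 2 * c - P * c′                ≡⟨ cong₂ (λ a b → a - b * c′) (sym s) (sym n) ⟩
          u + u′ - u * u′ * c′            ≡⟨ solve 3 (λ u v c → u :+ v :- u :* v :* c := u :+ v :- v :* ((u :+ v) :* c) :+ v :* v :* c) refl u u′ c′ ⟩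
          u + u′ - u′ * ((u + u′) * c′) + u′ * u′ * c′ ≡⟨ cong₂ (λ a b → u + u′ - u′ * a + b * c′) (trans (cong (_* c′) s) i) z ⟩
          u + u′ - u′ * 1# + 0# * c′      ≡⟨ solve 3 (λ u v c → u :+ v :- v :* :c 1 :+ :c 0 :* c := u) refl u u′ c′ ⟩
          u ∎

        2x-p/2x : ∀ x′ → ν 2 * a * x′ ≡ 1# → ν 2 * a - P * x′ ≡ w
        2x-p/2x x′ = conjugate-sum (a) w w′ x′
          (solve 3 (λ a b I → (a :- b :* I) :+ (a :+ b :* I) := :c 2 :* a) refl (a) (b) I)
          (trans (solve 3 (λ a b I → (a :- b :* I) :* (a :+ b :* I) := a :* a :- b :* b :* (I :* I)) refl (a) (b) I)
            (trans (cong (λ z → a * a - b * b * z) I²) (trans (solve 2 (λ a b → a :* a :- b :* b :* (:- :c 1) := a :* a :+ b :* b) refl (a) (b)) norm-R)))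
          w′²

        -- Multiplying the conjugate pair by I and -I turns its half sum x into y.
        2y-p/2y : ∀ y′ → ν 2 * b * y′ ≡ 1# → ν 2 * b - P * y′ ≡ I * w
        2y-p/2y y′ = conjugate-sum (b) (I * w) (- (I * w′)) y′
          (trans (solve 3 (λ a b I → I :* (a :- b :* I) :+ (:- (I :* (a :+ b :* I))) := :c 2 :* b :* (:- (I :* I))) refl (a) (b) I)
            (trans (cong (λ z → ν 2 * b * (- z)) I²) (solve 1 (λ b → :c 2 :* b :* (:- (:- :c 1)) := :c 2 :* b) refl (b))))
          (trans (solve 3 (λ a b I → I :* (a :- b :* I) :* (:- (I :* (a :+ b :* I))) := (I :* I) :* (I :* I :* b :* b :- a :* a)) refl (a) (b) I)
            (trans (cong (λ z → z * (z * b * b - a * a)) I²) (trans (solve 2 (λ a b → (:- :c 1) :* ((:- :c 1) :* b :* b :- a :* a) := a :* a :+ b :* b) refl (a) (b)) norm-R)))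
          (trans (solve 2 (λ I w → (:- (I :* w)) :* (:- (I :* w)) := I :* I :* (w :* w)) refl I w′) (trans (cong (I * I *_) w′²) (zeroʳ _)))

        P-kernel : ∀ u → P * u ≡ 0# → ∃ λ z → u ≡ P * z
        P-kernel u e = go (P-ker (+ rep u) (trans (cong (P *_) (ν-rep u)) e))
          where
          go : p ∣ rep u → ∃ λ z → u ≡ P * z
          go (divides q eq) = ν q , trans (sym (ν-rep u)) (trans (cong ν eq) (trans (ν-* q p) (*-comm _ _)))

        -- r = s + P z and r⁴ = s⁴ give 4 s³ P z = 0
        fourth-roots-lift : ∀ r s → r ^ 4 ≡ 1# → s ^ 4 ≡ 1# → P * r ≡ P * s → r ≡ s
        fourth-roots-lift r s r⁴ s⁴ e = go (P-kernel (r - s) (trans (solve 3 (λ P r s → P :* (r :- s) := P :* r :- P :* s) refl P r s) (x≡y⇒x-y≡0 e)))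
          where
          go : (∃ λ z → r - s ≡ P * z) → r ≡ s
          go (z , d) = x-y≡0⇒x≡y (trans d (begin
            P * z                             ≡⟨ solve 1 (λ a → a := a :* :c 1 :* :c 1) refl (P * z) ⟩
            P * z * 1# * 1#                   ≡⟨ cong₂ (λ a b → P * z * a * b) (sym s⁴) (sym A12) ⟩
            P * z * s ^ 4 * (A * ν 12)        ≡⟨ solve 3 (λ d s A → d :* s :^ 4 :* (A :* :c 12) := :c 3 :* A :* s :* (:c 4 :* s :* s :* s :* d)) refl (P * z) s A ⟩
            ν 3 * A * s * (ν 4 * s * s * s * (P * z)) ≡⟨ cong (ν 3 * A * s *_) vanish ⟩
            ν 3 * A * s * 0#                  ≡⟨ zeroʳ _ ⟩
            0# ∎))
            where
            vanish : ν 4 * s * s * s * (P * z) ≡ 0#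
            vanish = sym (begin
              0#                              ≡⟨ sym (-‿inverseʳ 1#) ⟩
              1# - 1#                         ≡⟨ cong₂ _-_ (sym r⁴) (sym s⁴) ⟩
              r ^ 4 - s ^ 4                   ≡⟨ cong (λ t → t ^ 4 - s ^ 4) (trans (solve 2 (λ r s → r := s :+ (r :- s)) refl r s) (cong (λ t → s + t) d)) ⟩
              (s + P * z) ^ 4 - s ^ 4         ≡⟨ drop0 P² (ν 6 * s * s * z * z + ν 4 * s * P * z * z * z + P * P * z * z * z * z)
                  (solve 3 (λ s P z → (s :+ P :* z) :^ 4 :- s :^ 4 := :c 4 :* s :* s :* s :* (P :* z) :+ P :* P :* (:c 6 :* s :* s :* z :* z :+ :c 4 :* s :* P :* z :* z :* z :+ P :* P :* z :* z :* z :* z)) refl s P z) ⟩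
              ν 4 * s * s * s * (P * z) ∎)

        -- By `ρ-fourth` and `fourth-roots-lift` the unit ρ equals r as soon as both agree modulo p.
        -- The shift -b exceeds the -1/2 of `chowla-dwork-evans` by b′, whence the last factor.
        evaluate : ∀ m t b b′ e X → b ≡ ν 6 * A - b′ → 1# + P * (- (ν 8 * A)) * H t ≡ ν 3 ^ (4 ℕ.* f) →
          X * (fac f (- (ν 3 * A)) * fac f (- (ν 3 * A))) ≡ e * (sgn m * ν 3 ^ f * (1# + P * (ν 2 * A) * H t)) * fac (2 ℕ.* f) (- b) →
          ∀ r → r ^ 4 ≡ 1# → sgn m * sgn f * S ≡ r → X ≡ e * r * (w * (1# + P * b′ * H (2 ℕ.* f)))
        evaluate m t b b′ e X b≡ PH₃t eq r r⁴ r≡ = cancel-unit {x = X} (fac-unit f (- (ν 3 * A)) f<p) (cancel-unit {x = X * G} (fac-unit f (- (ν 3 * A)) f<p) (begin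
          X * G * G                                  ≡⟨ *-assoc _ _ _ ⟩
          X * (G * G)                                ≡⟨ eq ⟩
          e * ρ * fac (2 ℕ.* f) (- b)                ≡⟨ cong₂ (λ a c → e * a * c) ρ≡r (trans (cong (fac (2 ℕ.* f)) shifted) (fac-shift (2 ℕ.* f) (- (ν 6 * A)) b′ 2f<p)) ⟩
          e * r * (fac (2 ℕ.* f) (- (ν 6 * A)) * q)  ≡⟨ cong (λ z → e * r * (z * q)) (sym chowla-dwork-evans) ⟩
          e * r * (w * (G * G) * q)                  ≡⟨ solve 5 (λ e r w G q → e :* r :* (w :* (G :* G) :* q) := e :* r :* (w :* q) :* G :* G) refl e r w G q ⟩
          e * r * (w * q) * G * G ∎))
          where
          G = fac f (- (ν 3 * A))
          q = 1# + P * b′ * H (2 ℕ.* f)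
          ρ = sgn m * ν 3 ^ f * (1# + P * (ν 2 * A) * H t)
          shifted : - b ≡ - (ν 6 * A) + b′
          shifted = trans (cong -_ b≡) (solve 2 (λ h b → :- (h :- b) := (:- h) :+ b) refl (ν 6 * A) b′)
          ρ≡r : ρ ≡ r
          ρ≡r = fourth-roots-lift ρ r (ρ-fourth m f (H t) PH₃t) r⁴ (begin
            P * ρ                                    ≡⟨ drop0 P² (sgn m * ν 3 ^ f * (ν 2 * A * H t)) (solve 5 (λ P s t A h → P :* (s :* t :* (:c 1 :+ P :* A :* h)) := s :* (P :* t) :+ P :* P :* (s :* t :* (A :* h))) refl P (sgn m) (ν 3 ^ f) (ν 2 * A) (H t)) ⟩
            sgn m * (P * ν 3 ^ f)                    ≡⟨ cong (sgn m *_) (sym P-U) ⟩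
            sgn m * (P * U)              ≡⟨ solve 3 (λ s P t → s :* (P :* t) := P :* (s :* (:c 1 :* t))) refl (sgn m) P (U) ⟩
            P * (sgn m * (1# * U))       ≡⟨ cong (λ z → P * (sgn m * (z * U))) (sym (sgn² f)) ⟩
            P * (sgn m * (sgn f * sgn f * U)) ≡⟨ cong (P *_) (solve 3 (λ s t u → s :* (t :* t :* u) := s :* t :* (t :* u)) refl (sgn m) (sgn f) (U)) ⟩
            P * (sgn m * sgn f * (sgn f * U)) ≡⟨ cong (λ z → P * (sgn m * sgn f * z)) (sym S≡) ⟩
            P * (sgn m * sgn f * S)          ≡⟨ cong (P *_) r≡ ⟩
            P * r ∎)

        p≡2f : p ≡ suc (2 ℕ.* (2 ℕ.* f))
        p≡2f = trans p≡ (cong suc (ℕP.*-assoc 2 2 f))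

        -- By `PH₂`, 2^(p-1) = 1 - p H/2, so p H/12 is -(2^(p-1) - 1)/6. Here the Fermat quotient of
        -- the final formulas appears.
        PAH : P * A * H (2 ℕ.* f) ≡ - ((ν 2 ^ (4 ℕ.* f) - 1#) * (ν 2 * A))
        PAH = sym (begin
          - ((ν 2 ^ (4 ℕ.* f) - 1#) * (ν 2 * A))   ≡⟨ cong (λ k → - ((ν 2 ^ k - 1#) * (ν 2 * A))) (ℕP.*-assoc 2 2 f) ⟩
          - ((ν 2 ^ (2 ℕ.* (2 ℕ.* f)) - 1#) * (ν 2 * A)) ≡⟨ cong (λ z → - ((z - 1#) * (ν 2 * A))) (sym (PH₂ (2 ℕ.* f) p≡2f)) ⟩
          - ((1# + P * (- (ν 6 * A)) * H (2 ℕ.* f) - 1#) * (ν 2 * A)) ≡⟨ solve 3 (λ P A h → :- ((:c 1 :+ P :* (:- (:c 6 :* A)) :* h :- :c 1) :* (:c 2 :* A)) := P :* A :* h :* (A :* :c 12)) refl P A (H (2 ℕ.* f)) ⟩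
          P * A * H (2 ℕ.* f) * (A * ν 12)         ≡⟨ trans (cong (P * A * H (2 ℕ.* f) *_) A12) (*-identityʳ _) ⟩
          P * A * H (2 ℕ.* f) ∎)

        even⌊/2⌋ : ∀ N → 2 ℕ.* ℕ.⌊ 2 ℕ.* N /2⌋ ≡ 2 ℕ.* N
        even⌊/2⌋ N = cong (2 ℕ.*_) (trans (cong ℕ.⌊_/2⌋ (cong (N ℕ.+_) (ℕP.+-identityʳ N))) (sym (ℕP.n≡⌊n+n/2⌋ N)))

        3h : ν 3 * (ν 4 * A) ≡ 1#
        3h = trans (solve 1 (λ A → :c 3 :* (:c 4 :* A) := A :* :c 12) refl A) A12

        pred : ∀ {k} → p ≡ suc k → 4 ℕ.* f ≡ k
        pred e = ℕP.suc-injective (trans (sym p≡) e)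

        4f-even : ∀ {k} → p ≡ suc k → 2 ℕ.* ℕ.⌊ k /2⌋ ≡ k
        4f-even e = subst (λ k → 2 ℕ.* ℕ.⌊ k /2⌋ ≡ k) (trans (sym (ℕP.*-assoc 2 2 f)) (pred e)) (even⌊/2⌋ (2 ℕ.* f))

        <p : ∀ {t k} → p ≡ suc k → t ℕ.≤ k → t < p
        <p {t} e l = subst (t <_) (sym e) (ℕ.s≤s l)

      open ℕS.+-*-Solver renaming (solve to solveℕ; _:+_ to _:+ℕ_; _:*_ to _:*ℕ_; con to conℕ; _:=_ to _:=ℕ_) using ()

      module One (m : ℕ) (f≡ : f ≡ 3 ℕ.* m) (X : Carrier)
        (T-fac : X * fac m (- (ν 2 * ν 1 * A)) * fac m 0# ≡ ν 1 * (- 1#) ^ m * fac (m ℕ.+ m) (- (ν 2 * ν 1 * A)))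
        (x′ : Carrier) (xx′ : ν 2 * a * x′ ≡ 1#) where

        private
          p₁₂ : p ≡ suc (12 ℕ.* m)
          p₁₂ = trans p≡ (cong suc (trans (cong (4 ℕ.*_) f≡) (sym (ℕP.*-assoc 4 3 m))))
          p₃ : p ≡ suc (3 ℕ.* (4 ℕ.* m))
          p₃ = trans p₁₂ (cong suc (ℕP.*-assoc 3 4 m))

        by-root : ∀ r → r ^ 4 ≡ 1# → S ≡ r →
            X ≡ r * (ν 2 ^ (m ℕ.+ m) * (1# - (ν 2 ^ (4 ℕ.* f) - 1#) * (ν 2 * A)) * (ν 2 * a - P * x′))
        by-root r r⁴ r≡ = begin
            X ≡⟨ evaluate m (4 ℕ.* m) (ν 5 * A) A (ν 1 * ν 2 ^ (m ℕ.+ m)) X (solve 1 (λ A → :c 5 :* A := :c 6 :* A :- A) refl A)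
                  (trans (PH₃ (4 ℕ.* m) (3 ℕ.* (4 ℕ.* m)) (<p p₃ (ℕP.m≤m+n (4 ℕ.* m) _)) (Fermat3.fermat3₁ (ν 4 * A) 3h (4 ℕ.* m) p₃ (4f-even p₃))) (cong (ν 3 ^_) (sym (pred p₃))))
                  value r r⁴ (trans (cong (_* S) signs≡1) (trans (*-identityˡ _) r≡)) ⟩
            ν 1 * ν 2 ^ (m ℕ.+ m) * r * (w * (1# + P * A * H (2 ℕ.* f)))
              ≡⟨ cong₂ (λ u v → ν 1 * ν 2 ^ (m ℕ.+ m) * r * (u * (1# + v))) (sym (2x-p/2x x′ xx′)) PAH ⟩
            ν 1 * ν 2 ^ (m ℕ.+ m) * r * ((ν 2 * a - P * x′) * (1# - (ν 2 ^ (4 ℕ.* f) - 1#) * (ν 2 * A)))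
              ≡⟨ solve 4 (λ t r u v → :c 1 :* t :* r :* (u :* v) := r :* (t :* v :* u)) refl (ν 2 ^ (m ℕ.+ m)) r (ν 2 * a - P * x′) (1# - (ν 2 ^ (4 ℕ.* f) - 1#) * (ν 2 * A)) ⟩
            r * (ν 2 ^ (m ℕ.+ m) * (1# - (ν 2 ^ (4 ℕ.* f) - 1#) * (ν 2 * A)) * (ν 2 * a - P * x′)) ∎
            where
            value : X * (fac f (- (ν 3 * A)) * fac f (- (ν 3 * A)))
              ≡ ν 1 * ν 2 ^ (m ℕ.+ m) * (sgn m * ν 3 ^ f * (1# + P * (ν 2 * A) * H (4 ℕ.* m))) * fac (2 ℕ.* f) (- (ν 5 * A))
            value = trans (cong (λ k → X * (fac k (- (ν 3 * A)) * fac k (- (ν 3 * A)))) f≡) (trans (value₁ m X p₁₂ T-fac)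
              (cong₂ (λ k j → ν 1 * ν 2 ^ (m ℕ.+ m) * (sgn m * ν 3 ^ k * (1# + P * (ν 2 * A) * H (4 ℕ.* m))) * fac j (- (ν 5 * A))) (sym f≡)
                (trans (ℕP.*-assoc 2 3 m) (cong (2 ℕ.*_) (sym f≡)))))
            signs≡1 : sgn m * sgn f ≡ 1#
            signs≡1 = trans (cong (sgn m *_) (trans (cong sgn (trans f≡ (solveℕ 1 (λ m → conℕ 3 :*ℕ m :=ℕ m :+ℕ (m :+ℕ m)) refl m)))
                (trans (^-homo-* (- 1#) m (m ℕ.+ m)) (cong (sgn m *_) (trans (^-homo-* (- 1#) m m) (sgn² m)))))) (trans (cong (sgn m *_) (*-identityʳ _)) (sgn² m))

      module Five (m : ℕ) (f≡ : f ≡ suc (3 ℕ.* m)) (X : Carrier)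
        (T-fac : X * fac (2 ℕ.+ 5 ℕ.* m) (- (ν 2 * ν 5 * A)) * fac (2 ℕ.+ 5 ℕ.* m) 0# ≡ ν 5 * (- 1#) ^ (2 ℕ.+ 5 ℕ.* m) * fac ((2 ℕ.+ 5 ℕ.* m) ℕ.+ (2 ℕ.+ 5 ℕ.* m)) (- (ν 2 * ν 5 * A)))
        (y′ : Carrier) (yy′ : ν 2 * b * y′ ≡ 1#) where

        private
          M : ℕ
          M = 2 ℕ.+ 5 ℕ.* m
          half : Carrier
          half = ν 6 * A
          p₁₂ : p ≡ suc (4 ℕ.+ 12 ℕ.* m)
          p₁₂ = trans p≡ (cong suc (trans (cong (4 ℕ.*_) f≡) (solveℕ 1 (λ m → conℕ 4 :*ℕ (conℕ 1 :+ℕ conℕ 3 :*ℕ m) :=ℕ conℕ 4 :+ℕ conℕ 12 :*ℕ m) refl m)))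
          p₃ : p ≡ suc (suc (3 ℕ.* suc (4 ℕ.* m)))
          p₃ = trans p₁₂ (cong suc (solveℕ 1 (λ m → conℕ 4 :+ℕ conℕ 12 :*ℕ m :=ℕ conℕ 1 :+ℕ conℕ 3 :*ℕ (conℕ 1 :+ℕ conℕ 4 :*ℕ m)) refl m))

          signs≡-1 : sgn m * sgn f ≡ - 1#
          signs≡-1 = trans (cong (sgn m *_) (trans (cong sgn (trans f≡ (cong suc (solveℕ 1 (λ m → conℕ 3 :*ℕ m :=ℕ m :+ℕ (m :+ℕ m)) refl m))))
                (cong (- 1# *_) (trans (^-homo-* (- 1#) m (m ℕ.+ m)) (cong (sgn m *_) (trans (^-homo-* (- 1#) m m) (sgn² m)))))))
              (trans (solve 1 (λ s → s :* ((:- :c 1) :* (s :* :c 1)) := (:- :c 1) :* (s :* s)) refl (sgn m)) (trans (cong (- 1# *_) (sgn² m)) (*-identityʳ _)))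

          -- 2m + 2M = p - 1 = 4f, and `half` is 1/2. The factor 2^(p-1) cannot be dropped modulo
          -- p²: it changes the coefficient of the Fermat quotient.
          powers : ν 2 ^ (M ℕ.+ M) ≡ half ^ (m ℕ.+ m) * ν 2 ^ (4 ℕ.* f)
          powers = sym (begin
            half ^ (m ℕ.+ m) * ν 2 ^ (4 ℕ.* f)  ≡⟨ cong (λ k → half ^ (m ℕ.+ m) * ν 2 ^ k) (trans (cong (4 ℕ.*_) f≡)
                 (solveℕ 1 (λ m → conℕ 4 :*ℕ (conℕ 1 :+ℕ conℕ 3 :*ℕ m) :=ℕ (m :+ℕ m) :+ℕ ((conℕ 2 :+ℕ conℕ 5 :*ℕ m) :+ℕ (conℕ 2 :+ℕ conℕ 5 :*ℕ m))) refl m)) ⟩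
            half ^ (m ℕ.+ m) * ν 2 ^ ((m ℕ.+ m) ℕ.+ (M ℕ.+ M)) ≡⟨ cong (half ^ (m ℕ.+ m) *_) (^-homo-* (ν 2) (m ℕ.+ m) (M ℕ.+ M)) ⟩
            half ^ (m ℕ.+ m) * (ν 2 ^ (m ℕ.+ m) * ν 2 ^ (M ℕ.+ M)) ≡⟨ sym (*-assoc _ _ _) ⟩
            half ^ (m ℕ.+ m) * ν 2 ^ (m ℕ.+ m) * ν 2 ^ (M ℕ.+ M) ≡⟨ cong (_* ν 2 ^ (M ℕ.+ M)) (trans (sym (^-distrib-* half (ν 2) (m ℕ.+ m)))
                 (trans (cong (_^ (m ℕ.+ m)) (trans (solve 1 (λ A → :c 6 :* A :* :c 2 := A :* :c 12) refl A) A12)) (1^ (m ℕ.+ m)))) ⟩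
            1# * ν 2 ^ (M ℕ.+ M) ≡⟨ *-identityˡ _ ⟩
            ν 2 ^ (M ℕ.+ M) ∎)

        by-root : S ≡ - I → X ≡ ν 5 * half ^ (m ℕ.+ m) * (1# + (ν 2 ^ (4 ℕ.* f) - 1#) * (ν 2 * A)) * (ν 2 * b - P * y′)
        by-root S≡-I = begin
          X ≡⟨ evaluate m (suc (4 ℕ.* m)) A (ν 5 * A) (ν 5 * ν 2 ^ (M ℕ.+ M)) X (solve 1 (λ A → A := :c 6 :* A :- :c 5 :* A) refl A)
                (trans (PH₃ (suc (4 ℕ.* m)) (suc (3 ℕ.* suc (4 ℕ.* m))) (<p p₃ (ℕP.≤-trans (ℕP.m≤m+n (suc (4 ℕ.* m)) _) (ℕP.n≤1+n _))) (Fermat3.fermat3₂ (ν 4 * A) 3h (suc (4 ℕ.* m)) p₃ (4f-even p₃))) (cong (ν 3 ^_) (sym (pred p₃))))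
                value I I⁴ (trans (cong₂ _*_ signs≡-1 S≡-I) (solve 1 (λ I → (:- :c 1) :* (:- I) := I) refl I)) ⟩
          ν 5 * ν 2 ^ (M ℕ.+ M) * I * (w * (1# + P * (ν 5 * A) * H (2 ℕ.* f)))
            ≡⟨ cong (λ z → ν 5 * z * I * (w * (1# + P * (ν 5 * A) * H (2 ℕ.* f)))) powers ⟩
          ν 5 * (half ^ (m ℕ.+ m) * ν 2 ^ (4 ℕ.* f)) * I * (w * (1# + P * (ν 5 * A) * H (2 ℕ.* f)))
            ≡⟨ solve 7 (λ h t I w P A H → :c 5 :* (h :* t) :* I :* (w :* (:c 1 :+ P :* (:c 5 :* A) :* H)) := :c 5 :* h :* (t :* (:c 1 :+ :c 5 :* (P :* A :* H))) :* (I :* w)) refl (half ^ (m ℕ.+ m)) (ν 2 ^ (4 ℕ.* f)) I w P A (H (2 ℕ.* f)) ⟩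
          ν 5 * half ^ (m ℕ.+ m) * (ν 2 ^ (4 ℕ.* f) * (1# + ν 5 * (P * A * H (2 ℕ.* f)))) * (I * w)
            ≡⟨ cong₂ (λ u v → ν 5 * half ^ (m ℕ.+ m) * u * v) fermat (sym (2y-p/2y y′ yy′)) ⟩
          ν 5 * half ^ (m ℕ.+ m) * (1# + (ν 2 ^ (4 ℕ.* f) - 1#) * (ν 2 * A)) * (ν 2 * b - P * y′) ∎
          where
          -- (1 - 6 a)(1 + 5 a) = 1 - a for a = P H / 12
          fermat : ν 2 ^ (4 ℕ.* f) * (1# + ν 5 * (P * A * H (2 ℕ.* f))) ≡ 1# + (ν 2 ^ (4 ℕ.* f) - 1#) * (ν 2 * A)
          fermat = begin
            ν 2 ^ (4 ℕ.* f) * (1# + ν 5 * (P * A * H (2 ℕ.* f)))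
              ≡⟨ cong (_* (1# + ν 5 * (P * A * H (2 ℕ.* f)))) (trans (cong (ν 2 ^_) (ℕP.*-assoc 2 2 f)) (sym (PH₂ (2 ℕ.* f) p≡2f))) ⟩
            (1# + P * (- (ν 6 * A)) * H (2 ℕ.* f)) * (1# + ν 5 * (P * A * H (2 ℕ.* f)))
              ≡⟨ drop0 P² (- (ν 30 * A * A * H (2 ℕ.* f) * H (2 ℕ.* f))) (solve 3 (λ P A h → (:c 1 :+ P :* (:- (:c 6 :* A)) :* h) :* (:c 1 :+ :c 5 :* (P :* A :* h)) := :c 1 :- P :* A :* h :+ P :* P :* (:- (:c 30 :* A :* A :* h :* h))) refl P A (H (2 ℕ.* f))) ⟩
            1# - P * A * H (2 ℕ.* f)
              ≡⟨ cong (λ z → 1# - z) PAH ⟩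
            1# - (- ((ν 2 ^ (4 ℕ.* f) - 1#) * (ν 2 * A)))
              ≡⟨ cong (λ z → 1# + z) (-‿involutive _) ⟩
            1# + (ν 2 ^ (4 ℕ.* f) - 1#) * (ν 2 * A) ∎
          I⁴ : I ^ 4 ≡ 1#
          I⁴ = trans (solve 1 (λ I → I :^ 4 := (I :* I) :* (I :* I)) refl I) (trans (cong₂ _*_ I² I²) (solve 0 ((:- :c 1) :* (:- :c 1) := :c 1) refl))
          value : X * (fac f (- (ν 3 * A)) * fac f (- (ν 3 * A)))
            ≡ ν 5 * ν 2 ^ (M ℕ.+ M) * (sgn m * ν 3 ^ f * (1# + P * (ν 2 * A) * H (suc (4 ℕ.* m)))) * fac (2 ℕ.* f) (- A)
          value = trans (cong (λ k → X * (fac k (- (ν 3 * A)) * fac k (- (ν 3 * A)))) f≡) (trans (value₅ m X p₁₂ T-fac)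
            (cong (λ k → ν 5 * ν 2 ^ (M ℕ.+ M) * (sgn m * ν 3 ^ k * (1# + P * (ν 2 * A) * H (suc (4 ℕ.* m)))) * fac (2 ℕ.* k) (- A)) (sym f≡)))

  module OrdinaryCases (p : ℕ) (pr : Prime p) (3<p : 3 < p) (g : ℕ) (p≡ : p ≡ suc (4 ℕ.* suc g))
    (F : Quotient p) (R : Quotient (p ℕ.^ 2)) (A : Quotient.Carrier R) (A12 : Quotient._*_ R A (Quotient.ν R 12) ≡ Quotient.1# R)
    (x y : ℤ) (xy : + p ≡ x ℤ.* x ℤ.+ y ℤ.* y) (4∣x-1 : + 4 ℤD.∣ x ℤ.- + 1) where
    open Quotient R
    private module F = Quotient F
    open LocalRing p pr 1 R
    open ShiftedFactorials p pr R
    open OrdinaryPrimes p pr 3<p g p≡ F R x y xy 4∣x-1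
    open TeichmullerSums p pr (suc g) p≡ (ℕ.s≤s ℕ.z≤n) F R using (T)

    private
      f : ℕ
      f = suc g

      S≡unit : ∀ s r → ev ⟦ s ⟧ ≡ r → s₃ ≡ s → ev ⟦ s₃ ⟧ ≡ r
      S≡unit s r e refl = e

      cde : (ι x - ι y * I) * (fac f (- (ν 3 * A)) * fac f (- (ν 3 * A))) ≡ fac (2 ℕ.* f) (- (ν 6 * A))
      cde = chowla-dwork-evans (ν 6 * A) (ν 3 * A)
        (trans (solve 1 (λ A → :c 2 :* (:c 6 :* A) := A :* :c 12) refl A) A12) (solve 1 (λ A → :c 2 :* (:c 3 :* A) := :c 6 :* A) refl A)

      module E = OrdinaryEvaluation.WithFourthRoot p pr R A A12 f p≡ (ι x) (ι y) I I² norm-R nonunit-multiple P-ker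
        (T (F.ν 3) ^ f) (ev ⟦ s₃ ⟧) (P-power (P-T-ν 3) f) ev-s₃ cde

    -- p = 12m+1
    module One (m : ℕ) (f≡ : f ≡ 3 ℕ.* m) (X : Carrier)
      (T-fac : X * fac m (- (ν 2 * ν 1 * A)) * fac m 0# ≡ ν 1 * (- 1#) ^ m * fac (m ℕ.+ m) (- (ν 2 * ν 1 * A)))
      (x′ : Carrier) (xx′ : ν 2 * ι x * x′ ≡ 1#) where

      private
        p≡1+3k : + 1 ℤ.+ + 3 ℤ.* + (4 ℕ.* m) ≡ x ℤ.* x ℤ.+ y ℤ.* y
        p≡1+3k = trans (sym (pos-affine 1 (4 ℕ.* m))) (trans (cong +_ (sym
          (trans p≡ (cong suc (trans (cong (4 ℕ.*_) f≡) (trans (sym (ℕP.*-assoc 4 3 m)) (ℕP.*-assoc 3 4 m))))))) xy)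

        V : Carrier
        V = ν 2 ^ (m ℕ.+ m) * (1# - (ν 2 ^ (4 ℕ.* f) - 1#) * (ν 2 * A)) * (ν 2 * ι x - P * x′)

      3∣x⇒ : + 3 ℤD.∣ x → X ≡ - V
      3∣x⇒ 3∣x = trans (E.One.by-root m f≡ X T-fac x′ xx′ (- 1#) (solve 0 ((:- :c 1) :^ 4 := :c 1) refl)
          (S≡unit 2F (- 1#) (solve 1 (λ I → (:- :c 1) :+ :c 0 :* I := :- :c 1) refl I) (go (ℤS.∣ᵤ⇒∣ 3∣x) s₃-mod-3)))
        (solve 1 (λ z → (:- :c 1) :* z := :- z) refl V)
        where
        go : + 3 ℤS.∣ x → (∃ λ v → (x ℤ.* x ℤ.- y ℤ.* y ≡ re ⟦ s₃ ⟧ ℤ.+ + 3 ℤ.* re v) × (+ 2 ℤ.* (x ℤ.* y) ≡ im ⟦ s₃ ⟧ ℤ.+ + 3 ℤ.* im v)) → s₃ ≡ 2F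
        go (ℤS.divides q e) (v , er , _) = re≡-1 s₃ (Id.case₀ q y (re ⟦ s₃ ⟧) (re v) (+ (4 ℕ.* m))
          (subst (λ z → z ℤ.* z ℤ.- y ℤ.* y ≡ re ⟦ s₃ ⟧ ℤ.+ + 3 ℤ.* re v) e er)
          (subst (λ z → + 1 ℤ.+ + 3 ℤ.* + (4 ℕ.* m) ≡ z ℤ.* z ℤ.+ y ℤ.* y) e p≡1+3k))

      3∤x⇒ : ¬ (+ 3 ℤD.∣ x) → X ≡ V
      3∤x⇒ 3∤x = trans (E.One.by-root m f≡ X T-fac x′ xx′ 1# (1^ 4)
          (S≡unit 1F 1# (solve 1 (λ I → :c 1 :+ :c 0 :* I := :c 1) refl I) (go (square-mod-3 x 3∤x) s₃-mod-3))) (*-identityˡ V)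
        where
        go : (∃ λ u → x ℤ.* x ≡ + 1 ℤ.+ u ℤ.* + 3) → (∃ λ v → (x ℤ.* x ℤ.- y ℤ.* y ≡ re ⟦ s₃ ⟧ ℤ.+ + 3 ℤ.* re v) × (+ 2 ℤ.* (x ℤ.* y) ≡ im ⟦ s₃ ⟧ ℤ.+ + 3 ℤ.* im v)) → s₃ ≡ 1F
        go (u , e) (v , er , _) = re≡1 s₃ (Id.case₁ x y (re ⟦ s₃ ⟧) (re v) (+ (4 ℕ.* m)) u e er p≡1+3k)

    -- p = 12m+5
    module Five (m : ℕ) (f≡ : f ≡ suc (3 ℕ.* m)) (X : Carrier)
      (T-fac : X * fac (2 ℕ.+ 5 ℕ.* m) (- (ν 2 * ν 5 * A)) * fac (2 ℕ.+ 5 ℕ.* m) 0# ≡ ν 5 * (- 1#) ^ (2 ℕ.+ 5 ℕ.* m) * fac ((2 ℕ.+ 5 ℕ.* m) ℕ.+ (2 ℕ.+ 5 ℕ.* m)) (- (ν 2 * ν 5 * A)))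
      (y′ : Carrier) (yy′ : ν 2 * ι y * y′ ≡ 1#) where

      private
        p≡2+3k : + 2 ℤ.+ + 3 ℤ.* + suc (4 ℕ.* m) ≡ x ℤ.* x ℤ.+ y ℤ.* y
        p≡2+3k = trans (sym (pos-affine 2 (suc (4 ℕ.* m)))) (trans (cong +_ (sym
          (trans p≡ (cong suc (trans (cong (4 ℕ.*_) f≡) (solveℕ 1 (λ m → conℕ 4 :*ℕ (conℕ 1 :+ℕ conℕ 3 :*ℕ m) :=ℕ conℕ 1 :+ℕ conℕ 3 :*ℕ (conℕ 1 :+ℕ conℕ 4 :*ℕ m)) refl m)))))) xy)
          where open ℕS.+-*-Solver renaming (solve to solveℕ; _:+_ to _:+ℕ_; _:*_ to _:*ℕ_; con to conℕ; _:=_ to _:=ℕ_) using ()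

      3∣x-y⇒ : + 3 ℤD.∣ x ℤ.- y → X ≡ ν 5 * (ν 6 * A) ^ (m ℕ.+ m) * (1# + (ν 2 ^ (4 ℕ.* f) - 1#) * (ν 2 * A)) * (ν 2 * ι y - P * y′)
      3∣x-y⇒ 3∣x-y = E.Five.by-root m f≡ X T-fac y′ yy′
        (S≡unit 4F (- I) (solve 1 (λ I → :c 0 :+ (:- :c 1) :* I := :- I) refl I) (go (ℤS.∣ᵤ⇒∣ 3∣x-y) s₃-mod-3))
        where
        go : + 3 ℤS.∣ x ℤ.- y → (∃ λ v → (x ℤ.* x ℤ.- y ℤ.* y ≡ re ⟦ s₃ ⟧ ℤ.+ + 3 ℤ.* re v) × (+ 2 ℤ.* (x ℤ.* y) ≡ im ⟦ s₃ ⟧ ℤ.+ + 3 ℤ.* im v)) → s₃ ≡ 4F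
        go (ℤS.divides q e) (v , _ , ei) = im≡-1 s₃ (Id.case₂ x y (im ⟦ s₃ ⟧) (im v) (+ suc (4 ℕ.* m)) q e ei p≡2+3k)

-- The value of X for p ≡ 3 (mod 4)

module Supersingular where

  open RingKit
  open ZMod
  open Local
  open Factorials
  open JacobiSum using (C-factorials)
  open Values
  open import Data.Nat as ℕ using (ℕ; zero; suc; _<_; _!)
  import Data.Nat.Properties as ℕP
  import Data.Nat.Solver as ℕS
  open import Data.Nat.Combinatorics using (_C_)
  open import Data.Nat.Primality using (Prime)
  open import Data.Product using (_,_; ∃; _×_)
  open import Relation.Binary.PropositionalEquality

  module SupersingularValue (p : ℕ) (pr : Prime p) (R : Quotient (p ℕ.^ 2))
    (A : Quotient.Carrier R) (A12 : Quotient._*_ R A (Quotient.ν R 12) ≡ Quotient.1# R) where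
    open Quotient R
    open LocalRing p pr 1 R
    open ShiftedFactorials p pr R
    open OrdinaryValue p pr R A A12 using (signs; PH₂)
    open ≡-Reasoning
    open ℕS.+-*-Solver renaming (solve to solveℕ; _:+_ to _:+ℕ_; _:*_ to _:*ℕ_; con to conℕ; _:=_ to _:=ℕ_) using ()

    private
      sgn : ℕ → Carrier
      sgn k = (- 1#) ^ k

      G : ℕ → Carrier
      G N = fac N 0#

      sgn² : ∀ k → sgn k * sgn k ≡ 1#
      sgn² k = trans (sym (^-distrib-* (- 1#) (- 1#) k)) (trans (cong (_^ k) (solve 0 ((:- :c 1) :* (:- :c 1) := :c 1) refl)) (1^ k))

      sgn-2* : ∀ k → sgn (2 ℕ.* k) ≡ 1#
      sgn-2* k = trans (^-homo-* (- 1#) k (k ℕ.+ 0)) (trans (cong (λ j → sgn k * sgn j) (ℕP.+-identityʳ k)) (sgn² k))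

      G-! : ∀ N → G N ≡ ν (N !)
      G-! zero = refl
      G-! (suc N) = trans (cong (_* (ν (suc N) + P * 0#)) (G-! N)) (trans (solve 3 (λ a b P → a :* (b :+ P :* :c 0) := b :* a) refl (ν (N !)) (ν (suc N)) P) (sym (ν-* (suc N) (N !))))

      binomial-G : ∀ j → ν ((j ℕ.+ j) C j) * (G j * G j) ≡ G (j ℕ.+ j)
      binomial-G j = begin
        ν ((j ℕ.+ j) C j) * (G j * G j)          ≡⟨ cong (ν ((j ℕ.+ j) C j) *_) (trans (cong₂ _*_ (G-! j) (G-! j)) (sym (ν-* (j !) (j !)))) ⟩
        ν ((j ℕ.+ j) C j) * ν ((j !) ℕ.* (j !))  ≡⟨ sym (ν-* ((j ℕ.+ j) C j) _) ⟩
        ν (((j ℕ.+ j) C j) ℕ.* ((j !) ℕ.* (j !))) ≡⟨ cong ν (C-factorials j j) ⟩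
        ν ((j ℕ.+ j) !)                          ≡⟨ sym (G-! (j ℕ.+ j)) ⟩
        G (j ℕ.+ j) ∎

      2h : ν 2 * (ν 6 * A) ≡ 1#
      2h = trans (solve 1 (λ A → :c 2 :* (:c 6 :* A) := A :* :c 12) refl A) A12

      D : ℕ → Carrier
      D j = ν 2 ^ j * (- ν 2) ^ j

      D² : ∀ j → D j * D j ≡ ν 2 ^ (j ℕ.+ j ℕ.+ (j ℕ.+ j))
      D² j = begin
        D j * D j                        ≡⟨ trans (sym (*-identityˡ _)) (cong (_* (D j * D j)) (sym (sgn² j))) ⟩
        sgn j * sgn j * (D j * D j)      ≡⟨ solve 2 (λ s d → s :* s :* (d :* d) := s :* d :* (s :* d)) refl (sgn j) (D j) ⟩
        sgn j * D j * (sgn j * D j)      ≡⟨ cong₂ _*_ (signs j) (signs j) ⟩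
        ν 2 ^ (j ℕ.+ j) * ν 2 ^ (j ℕ.+ j) ≡⟨ sym (^-homo-* (ν 2) (j ℕ.+ j) (j ℕ.+ j)) ⟩
        ν 2 ^ (j ℕ.+ j ℕ.+ (j ℕ.+ j)) ∎

      P-doubling : ∀ N j → p ≡ suc (2 ℕ.* (N ℕ.+ j)) → P * (G (j ℕ.+ j) * G N) ≡ P * (D j * (G j * G (N ℕ.+ j)))
      P-doubling N j p≡ = begin
        P * (G (j ℕ.+ j) * G N)     ≡⟨ solve 3 (λ P a b → P :* (a :* b) := a :* (P :* b)) refl P (G (j ℕ.+ j)) (G N) ⟩
        G (j ℕ.+ j) * (P * G N)     ≡⟨ cong₂ (λ a b → a * b) (cong₂ fac (cong (j ℕ.+_) (sym (ℕP.+-identityʳ j))) (sym (zeroʳ (ν 2)))) (sym (P-fac N c)) ⟩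
        fac (2 ℕ.* j) (ν 2 * 0#) * (P * fac N c) ≡⟨ solve 3 (λ P a b → a :* (P :* b) := P :* (a :* b)) refl P (fac (2 ℕ.* j) (ν 2 * 0#)) (fac N c) ⟩
        P * (fac (2 ℕ.* j) (ν 2 * 0#) * fac N c) ≡⟨ cong (P *_) (Halves.doubling (ν 6 * A) 2h j N 0# p≡) ⟩
        P * (D j * (G j * fac (N ℕ.+ j) c)) ≡⟨ solve 4 (λ P d a b → P :* (d :* (a :* b)) := d :* a :* (P :* b)) refl P (D j) (G j) (fac (N ℕ.+ j) c) ⟩
        D j * G j * (P * fac (N ℕ.+ j) c) ≡⟨ cong (D j * G j *_) (P-fac (N ℕ.+ j) c) ⟩
        D j * G j * (P * G (N ℕ.+ j)) ≡⟨ solve 4 (λ P d a b → d :* a :* (P :* b) := P :* (d :* (a :* b))) refl P (D j) (G j) (G (N ℕ.+ j)) ⟩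
        P * (D j * (G j * G (N ℕ.+ j))) ∎
        where c = - (ν 6 * A + 0#)

      P-reflection : ∀ b N → p ≡ suc (b ℕ.+ N) → P * G (b ℕ.+ N) ≡ P * (G b * (sgn N * G N))
      P-reflection b N p≡ = begin
        P * G (b ℕ.+ N)               ≡⟨ cong (P *_) (reflection b N 0# p≡) ⟩
        P * (G b * (sgn N * fac N (- (1# + 0#)))) ≡⟨ solve 4 (λ P a s b → P :* (a :* (s :* b)) := a :* s :* (P :* b)) refl P (G b) (sgn N) _ ⟩
        G b * sgn N * (P * fac N (- (1# + 0#)))   ≡⟨ cong (G b * sgn N *_) (P-fac N _) ⟩
        G b * sgn N * (P * G N)       ≡⟨ solve 4 (λ P a s b → a :* s :* (P :* b) := P :* (a :* (s :* b))) refl P (G b) (sgn N) _ ⟩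
        P * (G b * (sgn N * G N)) ∎

      -- Common to both classes, with k + 1 = 2j. The hypothesis on κ gives κ(1 + c) k! ≡ -(2j)!.
      -- Two duplications replace (2j)! N! by j! ((p-1)/2)! and powers of 2. Finally ((p-1)/2)!² ≡
      -- -(p-1)!, because (p-1)/2 = N + j is odd, and (p-1)! ≡ (-1)^N n! N!.
      value : ∀ n N i q κ μ c X → let j = suc i ; k = i ℕ.+ suc i in
        p ≡ suc (n ℕ.+ N) → n ℕ.+ n ≡ p ℕ.+ k → N ℕ.+ j ≡ suc (2 ℕ.* q) → p ≡ suc (2 ℕ.* (N ℕ.+ j)) →
        P * ν (suc k) ≡ - (P * κ * (1# + c)) →
        X * fac n c * fac n 0# ≡ μ * sgn n * fac (n ℕ.+ n) c →
        X * κ * ν ((j ℕ.+ j) C j) ≡ sgn N * μ * ν 2 ^ (j ℕ.+ j ℕ.+ (j ℕ.+ j)) * P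
      value n N i q κ μ c X p≡ 2n Nj p≡2 r eq =
        cancel-unit {x = X * κ * B} (fac-unit j 0# j<p) (cancel-unit {x = X * κ * B * G j} (fac-unit j 0# j<p)
          (cancel-unit {x = X * κ * B * G j * G j} (fac-unit n 0# n<p) (cancel-unit {x = X * κ * B * G j * G j * G n} (fac-unit N 0# N<p) (begin
        X * κ * B * G j * G j * G n * G N
          ≡⟨ solve 6 (λ X k B a n N → X :* k :* B :* a :* a :* n :* N := X :* k :* n :* (B :* (a :* a)) :* N) refl X κ B (G j) (G n) (G N) ⟩
        X * κ * G n * (B * (G j * G j)) * G N
          ≡⟨ cong₂ (λ u v → u * v * G N) (reduced (supersingular n N k c p≡ 2n eq)) (binomial-G j) ⟩
        - (P * (μ * G N * G (j ℕ.+ j))) * G (j ℕ.+ j) * G N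
          ≡⟨ solve 4 (λ P m a b → (:- (P :* (m :* a :* b))) :* b :* a := :- (m :* b :* a :* (P :* (b :* a)))) refl P μ (G N) (G (j ℕ.+ j)) ⟩
        - (μ * G (j ℕ.+ j) * G N * (P * (G (j ℕ.+ j) * G N)))
          ≡⟨ cong (λ z → - (μ * G (j ℕ.+ j) * G N * z)) (P-doubling N j p≡2) ⟩
        - (μ * G (j ℕ.+ j) * G N * (P * Z))
          ≡⟨ solve 5 (λ P m a b z → :- (m :* b :* a :* (P :* z)) := :- (m :* z :* (P :* (b :* a)))) refl P μ (G N) (G (j ℕ.+ j)) Z ⟩
        - (μ * Z * (P * (G (j ℕ.+ j) * G N)))
          ≡⟨ cong (λ z → - (μ * Z * z)) (P-doubling N j p≡2) ⟩
        - (μ * (D j * (G j * E)) * (P * (D j * (G j * E))))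
          ≡⟨ solve 5 (λ P m d a e → :- (m :* (d :* (a :* e)) :* (P :* (d :* (a :* e)))) := m :* (d :* d) :* (a :* a) :* (P :* (e :* (:- :c 1 :* e)))) refl P μ (D j) (G j) E ⟩
        μ * (D j * D j) * (G j * G j) * (P * (E * (- 1# * E)))
          ≡⟨ cong₂ (λ u v → μ * u * (G j * G j) * v) (D² j) E² ⟩
        μ * V * (G j * G j) * (P * (G n * (sgn N * G N)))
          ≡⟨ solve 7 (λ P m d a n N s → m :* d :* (a :* a) :* (P :* (n :* (s :* N))) := s :* m :* d :* P :* a :* a :* n :* N) refl P μ V (G j) (G n) (G N) (sgn N) ⟩
        sgn N * μ * V * P * G j * G j * G n * G N ∎))))
        where
        j = suc i
        k = i ℕ.+ suc i
        B = ν ((j ℕ.+ j) C j)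
        E = G (N ℕ.+ j)
        Z = D j * (G j * E)
        V = ν 2 ^ (j ℕ.+ j ℕ.+ (j ℕ.+ j))
        n<p : n < p
        n<p = subst (n <_) (sym p≡) (ℕ.s≤s (ℕP.m≤m+n n N))
        N<p : N < p
        N<p = subst (N <_) (sym p≡) (ℕ.s≤s (ℕP.m≤n+m N n))
        j<p : j < p
        j<p = subst (j <_) (sym p≡2) (ℕ.s≤s (ℕP.≤-trans (ℕP.m≤n+m j N) (ℕP.m≤m+n (N ℕ.+ j) _)))
        doubled : 2 ℕ.* (N ℕ.+ j) ≡ n ℕ.+ N
        doubled = ℕP.suc-injective (trans (sym p≡2) p≡)
        sgn-Nj : sgn (N ℕ.+ j) ≡ - 1#
        sgn-Nj = trans (cong sgn Nj) (trans (cong (- 1# *_) (sgn-2* q)) (*-identityʳ _))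
        E² : P * (E * (- 1# * E)) ≡ P * (G n * (sgn N * G N))
        E² = begin
          P * (E * (- 1# * E))            ≡⟨ cong (λ z → P * (E * (z * E))) (sym sgn-Nj) ⟩
          P * (E * (sgn (N ℕ.+ j) * E))   ≡⟨ sym (P-reflection (N ℕ.+ j) (N ℕ.+ j) (trans p≡2 (cong (λ z → suc (N ℕ.+ j ℕ.+ z)) (ℕP.+-identityʳ (N ℕ.+ j))))) ⟩
          P * G (N ℕ.+ j ℕ.+ (N ℕ.+ j))   ≡⟨ cong (λ z → P * G z) (trans (cong (N ℕ.+ j ℕ.+_) (sym (ℕP.+-identityʳ (N ℕ.+ j)))) doubled) ⟩
          P * G (n ℕ.+ N)                 ≡⟨ P-reflection n N p≡ ⟩
          P * (G n * (sgn N * G N)) ∎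
        sgn-nN : sgn n * sgn N ≡ 1#
        sgn-nN = trans (sym (^-homo-* (- 1#) n N)) (trans (cong sgn (sym doubled)) (sgn-2* (N ℕ.+ j)))
        reduced : (∃ λ Y → X ≡ P * Y × P * (Y * G n) ≡ P * (μ * sgn n * (1# + c) * sgn N * G N * G k)) →
          X * κ * G n ≡ - (P * (μ * G N * G (suc k)))
        reduced (Y , X≡ , e) = begin
          X * κ * G n                      ≡⟨ cong (λ z → z * κ * G n) X≡ ⟩
          P * Y * κ * G n                  ≡⟨ solve 4 (λ P Y k n → P :* Y :* k :* n := k :* (P :* (Y :* n))) refl P Y κ (G n) ⟩
          κ * (P * (Y * G n))              ≡⟨ cong (κ *_) e ⟩
          κ * (P * (μ * sgn n * (1# + c) * sgn N * G N * G k))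
            ≡⟨ solve 8 (λ k P m s c t N K → k :* (P :* (m :* s :* (:c 1 :+ c) :* t :* N :* K)) := m :* (s :* t) :* N :* K :* (P :* k :* (:c 1 :+ c))) refl κ P μ (sgn n) c (sgn N) (G N) (G k) ⟩
          μ * (sgn n * sgn N) * G N * G k * (P * κ * (1# + c))
            ≡⟨ cong₂ (λ u v → μ * u * G N * G k * v) sgn-nN (trans (sym (-‿involutive _)) (cong -_ (sym r))) ⟩
          μ * 1# * G N * G k * (- (P * ν (suc k)))
            ≡⟨ solve 5 (λ m N K P v → m :* :c 1 :* N :* K :* (:- (P :* v)) := :- (P :* (m :* N :* (K :* (v :+ P :* :c 0))))) refl μ (G N) (G k) P (ν (suc k)) ⟩
          - (P * (μ * G N * G (suc k))) ∎

      -- 12(m + 1) = p + d, hence m + 1 ≡ d/12 modulo p.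
      P-multiple : ∀ m d {r} → p ℕ.+ d ≡ 12 ℕ.* suc m → r ≡ suc m → P * ν r ≡ P * (ν d * A)
      P-multiple m d e refl = begin
        P * ν (suc m)                ≡⟨ trans (sym (*-identityʳ _)) (cong (P * ν (suc m) *_) (sym A12)) ⟩
        P * ν (suc m) * (A * ν 12)   ≡⟨ solve 3 (λ P v A → P :* v :* (A :* :c 12) := P :* A :* (:c 12 :* v)) refl P (ν (suc m)) A ⟩
        P * A * (ν 12 * ν (suc m))   ≡⟨ cong (P * A *_) (sym (trans (sym (ν-+ p d)) (trans (cong ν e) (ν-* 12 (suc m))))) ⟩
        P * A * (P + ν d)            ≡⟨ drop0 P² A (solve 3 (λ P A d → P :* A :* (P :+ d) := P :* (d :* A) :+ P :* P :* A) refl P A (ν d)) ⟩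
        P * (ν d * A) ∎

    -- j = (p + 5)/12, so 2j ≡ 5/6, while 1 + c = 1 - 7/6 = -1/6; hence κ = 5. The constant 28 is 7
    -- times a factor 4 split off from 2^(4j).
    value₇ : ∀ m X → p ≡ suc (6 ℕ.+ 12 ℕ.* m) → let n = 4 ℕ.+ 7 ℕ.* m ; j = suc m in
      X * fac n (- (ν 2 * ν 7 * A)) * fac n 0# ≡ ν 7 * (- 1#) ^ n * fac (n ℕ.+ n) (- (ν 2 * ν 7 * A)) →
      X * (ν 5 * ν ((j ℕ.+ j) C j)) ≡ (- 1#) ^ m * (ν 28 * ν 2 ^ (2 ℕ.+ 4 ℕ.* m) * P)
    value₇ m X p≡ eq = begin
      X * (ν 5 * ν ((j ℕ.+ j) C j)) ≡⟨ sym (*-assoc _ _ _) ⟩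
      X * ν 5 * ν ((j ℕ.+ j) C j)
        ≡⟨ value (4 ℕ.+ 7 ℕ.* m) (2 ℕ.+ 5 ℕ.* m) m (1 ℕ.+ 3 ℕ.* m) (ν 5) (ν 7) (- (ν 2 * ν 7 * A)) X
            (trans p≡ (solveℕ 1 (λ m → conℕ 7 :+ℕ conℕ 12 :*ℕ m :=ℕ conℕ 1 :+ℕ ((conℕ 4 :+ℕ conℕ 7 :*ℕ m) :+ℕ (conℕ 2 :+ℕ conℕ 5 :*ℕ m))) refl m))
            (sym (trans (cong (ℕ._+ (m ℕ.+ suc m)) p≡) (solveℕ 1 (λ m → conℕ 7 :+ℕ conℕ 12 :*ℕ m :+ℕ (m :+ℕ (conℕ 1 :+ℕ m)) :=ℕ (conℕ 4 :+ℕ conℕ 7 :*ℕ m) :+ℕ (conℕ 4 :+ℕ conℕ 7 :*ℕ m)) refl m)))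
            (solveℕ 1 (λ m → conℕ 2 :+ℕ conℕ 5 :*ℕ m :+ℕ (conℕ 1 :+ℕ m) :=ℕ conℕ 1 :+ℕ conℕ 2 :*ℕ (conℕ 1 :+ℕ conℕ 3 :*ℕ m)) refl m)
            (trans p≡ (solveℕ 1 (λ m → conℕ 7 :+ℕ conℕ 12 :*ℕ m :=ℕ conℕ 1 :+ℕ conℕ 2 :*ℕ (conℕ 2 :+ℕ conℕ 5 :*ℕ m :+ℕ (conℕ 1 :+ℕ m))) refl m))
            ratio eq ⟩
      sgn (2 ℕ.+ 5 ℕ.* m) * ν 7 * ν 2 ^ (j ℕ.+ j ℕ.+ (j ℕ.+ j)) * P
        ≡⟨ cong₂ (λ s t → s * ν 7 * t * P) sign (cong (ν 2 ^_) (solveℕ 1 (λ m → let j = conℕ 1 :+ℕ m in j :+ℕ j :+ℕ (j :+ℕ j) :=ℕ conℕ 2 :+ℕ (conℕ 2 :+ℕ conℕ 4 :*ℕ m)) refl m)) ⟩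
      sgn m * ν 7 * (ν 2 * (ν 2 * ν 2 ^ (2 ℕ.+ 4 ℕ.* m))) * P
        ≡⟨ solve 3 (λ s t P → s :* :c 7 :* (:c 2 :* (:c 2 :* t)) :* P := s :* (:c 28 :* t :* P)) refl (sgn m) (ν 2 ^ (2 ℕ.+ 4 ℕ.* m)) P ⟩
      sgn m * (ν 28 * ν 2 ^ (2 ℕ.+ 4 ℕ.* m) * P) ∎
      where
      j = suc m
      sign : sgn (2 ℕ.+ 5 ℕ.* m) ≡ sgn m
      sign = trans (cong sgn (solveℕ 1 (λ m → conℕ 2 :+ℕ conℕ 5 :*ℕ m :=ℕ conℕ 2 :*ℕ (conℕ 1 :+ℕ conℕ 2 :*ℕ m) :+ℕ m) refl m))
        (trans (^-homo-* (- 1#) (2 ℕ.* (1 ℕ.+ 2 ℕ.* m)) m) (trans (cong (_* sgn m) (sgn-2* (1 ℕ.+ 2 ℕ.* m))) (*-identityˡ _)))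
      ratio : P * ν (suc (m ℕ.+ suc m)) ≡ - (P * ν 5 * (1# + - (ν 2 * ν 7 * A)))
      ratio = begin
        P * ν (suc m ℕ.+ suc m)          ≡⟨ cong (P *_) (ν-+ (suc m) (suc m)) ⟩
        P * (ν (suc m) + ν (suc m))      ≡⟨ solve 2 (λ P v → P :* (v :+ v) := P :* v :+ P :* v) refl P (ν (suc m)) ⟩
        P * ν (suc m) + P * ν (suc m)    ≡⟨ cong (λ z → z + z) (P-multiple m 5 (trans (cong (ℕ._+ 5) p≡) (solveℕ 1 (λ m → conℕ 7 :+ℕ conℕ 12 :*ℕ m :+ℕ conℕ 5 :=ℕ conℕ 12 :*ℕ (conℕ 1 :+ℕ m)) refl m)) refl) ⟩
        P * (ν 5 * A) + P * (ν 5 * A)    ≡⟨ solve 2 (λ P A → P :* (:c 5 :* A) :+ P :* (:c 5 :* A) := :- (P :* :c 5 :* (A :* :c 12 :+ (:- (:c 2 :* :c 7 :* A))))) refl P A ⟩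
        - (P * ν 5 * (A * ν 12 + - (ν 2 * ν 7 * A))) ≡⟨ cong (λ z → - (P * ν 5 * (z + - (ν 2 * ν 7 * A)))) A12 ⟩
        - (P * ν 5 * (1# + - (ν 2 * ν 7 * A))) ∎

    -- j = 5(p + 1)/12, so 2j ≡ 5/6, while 1 + c = 1 - 11/6 = -5/6; hence κ = 1. As 4m + 4j = 2(p -
    -- 1), the power 2^(4j) is the inverse of 2^(4m) modulo p.
    value₁₁ : ∀ m X → p ≡ suc (10 ℕ.+ 12 ℕ.* m) → let n = 10 ℕ.+ 11 ℕ.* m ; j = 5 ℕ.+ 5 ℕ.* m in
      X * fac n (- (ν 2 * ν 11 * A)) * fac n 0# ≡ ν 11 * (- 1#) ^ n * fac (n ℕ.+ n) (- (ν 2 * ν 11 * A)) →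
      X * (ν 2 ^ (4 ℕ.* m) * ν ((j ℕ.+ j) C j)) ≡ (- 1#) ^ m * (ν 11 * P)
    value₁₁ m X p≡ eq = begin
      X * (ν 2 ^ (4 ℕ.* m) * ν ((j ℕ.+ j) C j)) ≡⟨ solve 3 (λ X t B → X :* (t :* B) := t :* (X :* :c 1 :* B)) refl X (ν 2 ^ (4 ℕ.* m)) (ν ((j ℕ.+ j) C j)) ⟩
      ν 2 ^ (4 ℕ.* m) * (X * ν 1 * ν ((j ℕ.+ j) C j))
        ≡⟨ cong (ν 2 ^ (4 ℕ.* m) *_) (value (10 ℕ.+ 11 ℕ.* m) m i (2 ℕ.+ 3 ℕ.* m) (ν 1) (ν 11) (- (ν 2 * ν 11 * A)) X
            (trans p≡ (solveℕ 1 (λ m → conℕ 11 :+ℕ conℕ 12 :*ℕ m :=ℕ conℕ 1 :+ℕ ((conℕ 10 :+ℕ conℕ 11 :*ℕ m) :+ℕ m)) refl m))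
            (sym (trans (cong (ℕ._+ (i ℕ.+ suc i)) p≡) (solveℕ 1 (λ m → let i = conℕ 4 :+ℕ conℕ 5 :*ℕ m in conℕ 11 :+ℕ conℕ 12 :*ℕ m :+ℕ (i :+ℕ (conℕ 1 :+ℕ i)) :=ℕ (conℕ 10 :+ℕ conℕ 11 :*ℕ m) :+ℕ (conℕ 10 :+ℕ conℕ 11 :*ℕ m)) refl m)))
            (solveℕ 1 (λ m → m :+ℕ (conℕ 5 :+ℕ conℕ 5 :*ℕ m) :=ℕ conℕ 1 :+ℕ conℕ 2 :*ℕ (conℕ 2 :+ℕ conℕ 3 :*ℕ m)) refl m)
            p≡2 ratio eq) ⟩
      ν 2 ^ (4 ℕ.* m) * (sgn m * ν 11 * ν 2 ^ (j ℕ.+ j ℕ.+ (j ℕ.+ j)) * P)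
        ≡⟨ solve 4 (λ a s b P → a :* (s :* :c 11 :* b :* P) := s :* (:c 11 :* (a :* b :* P))) refl (ν 2 ^ (4 ℕ.* m)) (sgn m) (ν 2 ^ (j ℕ.+ j ℕ.+ (j ℕ.+ j))) P ⟩
      sgn m * (ν 11 * (ν 2 ^ (4 ℕ.* m) * ν 2 ^ (j ℕ.+ j ℕ.+ (j ℕ.+ j)) * P))
        ≡⟨ cong (λ z → sgn m * (ν 11 * z)) power ⟩
      sgn m * (ν 11 * P) ∎
      where
      i = 4 ℕ.+ 5 ℕ.* m
      j = suc i
      L = 2 ℕ.* (m ℕ.+ j)
      p≡2 : p ≡ suc (2 ℕ.* (m ℕ.+ j))
      p≡2 = trans p≡ (solveℕ 1 (λ m → conℕ 11 :+ℕ conℕ 12 :*ℕ m :=ℕ conℕ 1 :+ℕ conℕ 2 :*ℕ (m :+ℕ (conℕ 5 :+ℕ conℕ 5 :*ℕ m))) refl m)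
      fermat : ν 2 ^ L * P ≡ P
      fermat = trans (cong (_* P) (sym (PH₂ (m ℕ.+ j) p≡2))) (drop0 P² (- (ν 6 * A) * H (m ℕ.+ j)) (solve 3 (λ P a h → (:c 1 :+ P :* a :* h) :* P := P :+ P :* P :* (a :* h)) refl P (- (ν 6 * A)) (H (m ℕ.+ j))))
      power : ν 2 ^ (4 ℕ.* m) * ν 2 ^ (j ℕ.+ j ℕ.+ (j ℕ.+ j)) * P ≡ P
      power = begin
        ν 2 ^ (4 ℕ.* m) * ν 2 ^ (j ℕ.+ j ℕ.+ (j ℕ.+ j)) * P ≡⟨ cong (_* P) (sym (^-homo-* (ν 2) (4 ℕ.* m) _)) ⟩
        ν 2 ^ (4 ℕ.* m ℕ.+ (j ℕ.+ j ℕ.+ (j ℕ.+ j))) * P ≡⟨ cong (λ k → ν 2 ^ k * P) (solveℕ 1 (λ m → let j = conℕ 5 :+ℕ conℕ 5 :*ℕ m in conℕ 4 :*ℕ m :+ℕ (j :+ℕ j :+ℕ (j :+ℕ j)) :=ℕ conℕ 2 :*ℕ (m :+ℕ j) :+ℕ conℕ 2 :*ℕ (m :+ℕ j)) refl m) ⟩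
        ν 2 ^ (L ℕ.+ L) * P            ≡⟨ cong (_* P) (^-homo-* (ν 2) L L) ⟩
        ν 2 ^ L * ν 2 ^ L * P          ≡⟨ trans (*-assoc _ _ _) (cong (ν 2 ^ L *_) fermat) ⟩
        ν 2 ^ L * P                    ≡⟨ fermat ⟩
        P ∎
      ratio : P * ν (suc (i ℕ.+ suc i)) ≡ - (P * ν 1 * (1# + - (ν 2 * ν 11 * A)))
      ratio = begin
        P * ν (suc i ℕ.+ suc i)          ≡⟨ cong (λ k → P * ν k) (solveℕ 1 (λ m → let j = conℕ 5 :+ℕ conℕ 5 :*ℕ m in j :+ℕ j :=ℕ conℕ 10 :*ℕ (conℕ 1 :+ℕ m)) refl m) ⟩
        P * ν (10 ℕ.* suc m)             ≡⟨ cong (P *_) (ν-* 10 (suc m)) ⟩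
        P * (ν 10 * ν (suc m))           ≡⟨ solve 2 (λ P v → P :* (:c 10 :* v) := :c 10 :* (P :* v)) refl P (ν (suc m)) ⟩
        ν 10 * (P * ν (suc m))           ≡⟨ cong (ν 10 *_) (P-multiple m 1 (trans (cong (ℕ._+ 1) p≡) (solveℕ 1 (λ m → conℕ 11 :+ℕ conℕ 12 :*ℕ m :+ℕ conℕ 1 :=ℕ conℕ 12 :*ℕ (conℕ 1 :+ℕ m)) refl m)) refl) ⟩
        ν 10 * (P * (ν 1 * A))           ≡⟨ solve 2 (λ P A → :c 10 :* (P :* (:c 1 :* A)) := :- (P :* :c 1 :* (A :* :c 12 :+ (:- (:c 2 :* :c 11 :* A))))) refl P A ⟩
        - (P * ν 1 * (A * ν 12 + - (ν 2 * ν 11 * A))) ≡⟨ cong (λ z → - (P * ν 1 * (z + - (ν 2 * ν 11 * A)))) A12 ⟩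
        - (P * ν 1 * (1# + - (ν 2 * ν 11 * A))) ∎

-- From X modulo p² to the sum modulo p³

module Lift where

  open RingKit
  open ZMod
  open Local
  open Reduction
  open Truncated
  open Factorials
  open import Data.Nat as ℕ using (ℕ; suc; NonZero; _<_)
  open import Data.Nat.Divisibility as ℕD using (_∣_)
  open import Data.Nat.Primality using (Prime)
  open import Data.Integer as ℤ using (ℤ; +_; -[1+_])
  import Data.Integer.Properties as ℤP
  open import Relation.Binary.PropositionalEquality

  module TimesP (p : ℕ) (pr : Prime p) (e : ℕ) (K : Ring≡)
    (R : Quotient (p ℕ.^ e)) (Q : Quotient (p ℕ.^ suc e)) where
    private
      module K = Kit K
      module R = Quotient R
      module Q = Quotient Q
    open Reduce p pr K R.ring using () renaming (_↦_ to _↦ᴿ_; red to redᴿ)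
    open Reduce p pr K Q.ring

    -- Multiplication by p raises divisibility of the numerator from p^e to p^(e+1); this links the
    -- two residue rings.
    p*0↦0 : ∀ {a} → a ↦ᴿ R.0# → K.ν p K.* a ↦ Q.0#
    p*0↦0 {a} (redᴿ m z u e₁ e₂) = red m (+ p ℤ.* z) u
      (begin
        K.ν m K.* (K.ν p K.* a)  ≡⟨ K.solve 3 (λ m p a → m K.:* (p K.:* a) K.:= p K.:* (m K.:* a)) refl (K.ν m) (K.ν p) a ⟩
        K.ν p K.* (K.ν m K.* a)  ≡⟨ cong (K.ν p K.*_) e₁ ⟩
        K.ν p K.* K.ι z          ≡⟨ sym (K.ι-* (+ p) z) ⟩
        K.ι (+ p ℤ.* z) ∎)
      (trans (Q.zeroʳ _) (sym (Q.∣⇒ι≡0 (+ p ℤ.* z)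
        (subst (p ℕ.^ suc e ∣_) (sym (ℤP.abs-* (+ p) z)) (ℕD.*-monoʳ-∣ p (R.ι-ker z (trans (sym e₂) (R.zeroʳ _))))))))
      where open ≡-Reasoning

  module Lifting (p : ℕ) (pr : Prime p) (3<p : 3 < p) (K : Ring≡)
    (recip : ∀ k .{{_ : NonZero k}} → Ring≡.Carrier K)
    (recip-inv : ∀ k .{{_ : NonZero k}} → Ring≡._*_ K (recip k) (Kit.ν K k) ≡ Ring≡.1# K)
    (a n : ℕ) {{a≢0 : NonZero a}} (an : a ℕ.* p ≡ suc (12 ℕ.* n)) (n<p : n < p) (0<n : 0 < n)
    (R : Quotient (p ℕ.^ 2)) (Q : Quotient (p ℕ.^ 3)) where
    open Kit K
    open ShiftedFactorials p pr R using (fac)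
    private
      module R = Quotient R
      module Q = Quotient Q
      module I₂ = Image p pr 3<p K recip recip-inv a n an 1 R
      module I₃ = Image p pr 3<p K recip recip-inv a n an 2 Q
      module LR = LocalRing p pr 1 R
      module LQ = LocalRing p pr 2 Q
      module CF = ClosedForm p pr 3<p K recip recip-inv a n an
      module ↦Q = Reduce p pr K Q.ring
      open ≡-Reasoning

      u²₂ : I₂.u₂ R.* I₂.u₂ ≡ R.0#
      u²₂ = R.drop0 LR.P^ (R.ν a R.* R.ν a R.* I₂.A₂ R.* I₂.A₂)
        (R.solve 3 (λ a P A → (R.:- (a R.:* P R.:* A)) R.:* (R.:- (a R.:* P R.:* A)) R.:= R.:c 0 R.:+ (P R.:^ 2) R.:* (a R.:* a R.:* A R.:* A)) refl (R.ν a) LR.P I₂.A₂)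

      u³₃ : I₃.u₂ Q.* I₃.u₂ Q.* I₃.u₂ ≡ Q.0#
      u³₃ = Q.drop0 LQ.P^ (Q.- (Q.ν a Q.* Q.ν a Q.* Q.ν a Q.* I₃.A₂ Q.* I₃.A₂ Q.* I₃.A₂))
        (Q.solve 3 (λ a P A → (Q.:- (a Q.:* P Q.:* A)) Q.:* (Q.:- (a Q.:* P Q.:* A)) Q.:* (Q.:- (a Q.:* P Q.:* A))
          Q.:= Q.:c 0 Q.:+ (P Q.:^ 3) Q.:* (Q.:- (a Q.:* a Q.:* a Q.:* A Q.:* A Q.:* A))) refl (Q.ν a) LQ.P I₃.A₂)

      module S₂ = I₂.Square u²₂ n<p 0<n
      module N₃ = I₃.Nilpotent u³₃

    open CF public using (binomTerm)
    open Reduce p pr K R.ring using () renaming (_↦_ to _↦ᴿ_; red-- to redᴿ--)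

    A₂ X : R.Carrier
    A₂ = I₂.A₂
    X = S₂.T₂

    A₂12 : A₂ R.* R.ν 12 ≡ R.1#
    A₂12 = I₂.A₂12

    X-fac : X R.* fac n (R.- (R.ν 2 R.* R.ν a R.* A₂)) R.* fac n R.0#
      ≡ R.ν a R.* (R.- R.1#) R.^ n R.* fac (n ℕ.+ n) (R.- (R.ν 2 R.* R.ν a R.* A₂))
    X-fac = S₂.T₂-fac

    -- With T₀ the exact quotient, the sum minus p T is (sum - p T₀) + p (T₀ - T); the first bracket
    -- vanishes modulo p³, the second already modulo p².
    difference : ∀ T → T ↦ᴿ X → ↦Q._↦_ (Σ< p binomTerm - ν p * T) Q.0#
    difference T r = subst₂ ↦Q._↦_ regroup (trans (cong₂ Q._+_ (Q.-‿inverseʳ N₃.S₂) refl) (Q.+-identityˡ _))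
      (↦Q.red-+ (↦Q.red-- N₃.binomSum↦ (N₃.closed↦ n<p)) (TimesP.p*0↦0 p pr 2 K R Q
        (subst ((CF.T - T) ↦ᴿ_) (R.-‿inverseʳ X) (redᴿ-- S₂.T↦ r))))
      where
      regroup : (Σ< p binomTerm - ν 12 * CF.WP.closed n) + ν p * (CF.T - T) ≡ Σ< p binomTerm - ν p * T
      regroup = trans (cong (λ z → (Σ< p binomTerm - z) + ν p * (CF.T - T)) (CF.12closed≡pT 0<n))
        (solve 4 (λ s p t u → (s :- p :* t) :+ p :* (t :- u) := s :- p :* u) refl (Σ< p binomTerm) (ν p) CF.T T)

  -- The pull identities bring p, an inner factor of the right-hand sides, to the front, where
  -- `congruent` expects it.
  module Pull (K : Ring≡) where
    open Kit K
    pull₃ : ∀ a p b c → a * p * b * c ≡ p * (a * b * c)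
    pull₃ = solve 4 (λ a p b c → a :* p :* b :* c := p :* (a :* b :* c)) refl
    pull₃- : ∀ a p b c → - (a * p * b * c) ≡ p * (- (a * b * c))
    pull₃- = solve 4 (λ a p b c → :- (a :* p :* b :* c) := p :* (:- (a :* b :* c))) refl
    pull₄ : ∀ e a p b c → e * a * p * b * c ≡ p * (e * a * b * c)
    pull₄ = solve 5 (λ e a p b c → e :* a :* p :* b :* c := p :* (e :* a :* b :* c)) refl
    pull² : ∀ s b p r → s * (b * (p * p) * r) ≡ p * (s * (b * p * r))
    pull² = solve 4 (λ s b p r → s :* (b :* (p :* p) :* r) := p :* (s :* (b :* p :* r))) refl
    move-neg : ∀ v r → (- v) * (- 1# * r) ≡ r * v
    move-neg = solve 2 (λ v r → (:- v) :* (:- :c 1 :* r) := r :* v) refl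

open import Defs
open RingKit
open ZMod
open Local
open Reduction
open Truncated
open Lift
open JacobiSum using (C-factorials)
open Ordinary using (module FourthRoot)
open Evaluation
open Supersingular
open import Data.Nat as ℕ using (ℕ; zero; suc; NonZero; _<_; _∸_; _%_; _!)
import Data.Nat.Properties as ℕP
import Data.Nat.DivMod as ℕM
import Data.Nat.Solver as ℕS
open import Data.Nat.Divisibility as ℕD using (_∣_; _∤_; divides)
open import Data.Nat.Combinatorics using (_C_)
open import Data.Nat.Primality using (Prime; prime⇒nonZero)
open import Data.Integer as ℤ using (ℤ; +_; -[1+_])
import Data.Integer.Properties as ℤP
open import Data.Integer.Divisibility as ℤD using ()
open import Data.Rational as ℚ using (ℚ; _+_; _*_; _-_; -_)
open import Data.List using (foldr; map; applyUpTo)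
open import Data.Product using (_,_; ∃; _×_)
open import Data.Empty using (⊥-elim)
open import Function using (_∘_; id)
open import Relation.Nullary using (¬_)
open import Relation.Binary.PropositionalEquality

-- Rewriting the rational expressions of the statement

module RationalSums where

  ^ℚ≡^ : ∀ q n → q ^ℚ n ≡ q ℚK.^ n
  ^ℚ≡^ q zero = refl
  ^ℚ≡^ q (suc n) = cong (q *_) (^ℚ≡^ q n)

  falling≡Π : ∀ a k → falling a k ≡ ℚK.Π< k (λ j → a - ℚK.ν j)
  falling≡Π a zero = refl
  falling≡Π a (suc k) = cong₂ (λ u v → u * (a - v)) (falling≡Π a k) (ℕ→ℚ≡ν k)

  sum≡Σ : ∀ n (g : ℕ → ℚ) (h : ℕ → ℕ) → foldr _+_ ℚ.0ℚ (map g (applyUpTo h n)) ≡ ℚK.Σ< n (g ∘ h)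
  sum≡Σ zero g h = refl
  sum≡Σ (suc n) g h = trans (cong (λ z → g (h 0) + z) (sum≡Σ n g (h ∘ suc))) (sym (ℚK.Σ-first n (g ∘ h)))

  module Pulls = Pull ℚring

  ℕ→ℚ-p² : ∀ p → ℕ→ℚ (p ℕ.^ 2) ≡ ℕ→ℚ p * ℕ→ℚ p
  ℕ→ℚ-p² p = trans (ℕ→ℚ≡ν (p ℕ.^ 2)) (trans (cong ℚK.ν (cong (p ℕ.*_) (ℕP.*-identityʳ p)))
    (trans (ℚK.ν-* p p) (sym (cong₂ _*_ (ℕ→ℚ≡ν p) (ℕ→ℚ≡ν p)))))

  reciprocal : ∀ z → ℤ.∣ z ∣ ≢ 0 → ∃ λ r → (∀ q → q ÷ℤ z ≡ q * r) × ℚK.ι z * r ≡ ℚ.1ℚ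
  reciprocal (+ zero) ne = ⊥-elim (ne refl)
  reciprocal (+ suc n) _ = ((+ 1) ℚ./ suc n) , (λ _ → refl) , trans (ℚK.*-comm (ℚK.ν (suc n)) _) (unitFraction (suc n))
  reciprocal -[1+ n ] _ = (-[1+ 0 ] ℚ./ suc n) , (λ _ → refl) ,
    trans (cong ((ℚ.- ℚK.ν (suc n)) *_) (fraction -[1+ 0 ] (suc n)))
      (trans (Pulls.move-neg (ℚK.ν (suc n)) ((+ 1) ℚ./ suc n)) (unitFraction (suc n)))

open RationalSums

-- The congruences for each residue class modulo 12

module Congruence (p : ℕ) (pr : Prime p) (3<p : 3 < p) where

  instance
    p≢0 : NonZero p
    p≢0 = prime⇒nonZero pr

    p²≢0 : NonZero (p ℕ.^ 2)
    p²≢0 = ℕP.m^n≢0 p 2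

    p³≢0 : NonZero (p ℕ.^ 3)
    p³≢0 = ℕP.m^n≢0 p 3

  -- From here on the residue rings are used through the interface `Quotient` only; being opaque,
  -- their elements are never unfolded to `Fin`.
  abstract
    F : Quotient p
    F = quotient p
    R : Quotient (p ℕ.^ 2)
    R = quotient (p ℕ.^ 2)
    Q : Quotient (p ℕ.^ 3)
    Q = quotient (p ℕ.^ 3)

  private
    module B = Quotient R
  open ∤Facts pr 3<p
  open LocalRing p pr 1 R
  open Reduce p pr ℚring B.ring
  open Inverse nonunit unit-ν

  red-ℕ→ℚ : ∀ n → ℕ→ℚ n ↦ B.ν n
  red-ℕ→ℚ n = subst (_↦ B.ν n) (sym (ℕ→ℚ≡ν n)) (red-ν n)

  red-ℕ→ℚ-^ : ∀ b n → ℕ→ℚ (b ℕ.^ n) ↦ B.ν b B.^ n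
  red-ℕ→ℚ-^ b n = subst (ℕ→ℚ (b ℕ.^ n) ↦_) (B.ν-^ b n) (red-ℕ→ℚ (b ℕ.^ n))

  red-ℤ→ℚ : ∀ z → ℤ→ℚ z ↦ B.ι z
  red-ℤ→ℚ z = subst (_↦ B.ι z) (sym (ℤ→ℚ≡ι z)) (red-ι z)

  red-^ℚ : ∀ {q r} n → q ↦ r → (q ^ℚ n) ↦ r B.^ n
  red-^ℚ {q} {r} n e = subst (_↦ r B.^ n) (sym (^ℚ≡^ q n)) (red-^ n e)

  ι-unit : ∀ z → p ∤ ℤ.∣ z ∣ → ∃ λ y → B.ι z B.* y ≡ B.1#
  ι-unit (+ n) u = unit-ν u
  ι-unit -[1+ n ] u = go (unit-ν u)
    where
    go : (∃ λ y → B.ν (suc n) B.* y ≡ B.1#) → ∃ λ y → (B.- B.ν (suc n)) B.* y ≡ B.1#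
    go (y , e) = B.- y , trans (B.solve 2 (λ v y → (B.:- v) B.:* (B.:- y) B.:= v B.:* y) refl (B.ν (suc n)) y) e

  -- The rational 1/z together with its residue. It is constructed for p not dividing z, which
  -- excludes the junk value of `÷ℤ` at 0.
  record Division (z : ℤ) : Set where
    field
      r : ℚ
      ÷≡ : ∀ q → q ÷ℤ z ≡ q * r
      r₂ : B.Carrier
      inverse : B.ι z B.* r₂ ≡ B.1#
      r↦ : r ↦ r₂

  division : ∀ z → p ∤ ℤ.∣ z ∣ → Division z
  division z u = go (reciprocal z (λ e → u (subst (p ∣_) (sym e) (divides 0 refl)))) (ι-unit z u)
    where
    go : (∃ λ r → (∀ q → q ÷ℤ z ≡ q * r) × ℚK.ι z * r ≡ ℚ.1ℚ) → (∃ λ y → B.ι z B.* y ≡ B.1#) → Division z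
    go (r , ÷≡ , e) (y , e₂) = record { r = r ; ÷≡ = ÷≡ ; r₂ = y ; inverse = e₂ ; r↦ = red-inverse (red-ι z) e e₂ }

  recip : ∀ k .{{_ : NonZero k}} → ℚ
  recip k = (+ 1) ℚ./ k

  -- In the applications a is the residue of p modulo 12: units modulo 12 are their own inverses, so
  -- ap ≡ 1 and n = (ap - 1)/12 is an integer.
  module At (a n : ℕ) {{a≢0 : NonZero a}} (an : a ℕ.* p ≡ suc (12 ℕ.* n)) (n<p : n < p) (0<n : 0 < n) where
    open Lifting p pr 3<p ℚring recip unitFraction a n an n<p 0<n R Q public

    private
      term≡ : ∀ k → ℕ→ℚ (24 ℕ.* k ℕ.+ 1) * (binomℚ (-[1+ 0 ] ℚ./ 12) k ^ℚ 4) ≡ binomTerm k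
      term≡ k = cong₂ _*_ (ℕ→ℚ≡ν (24 ℕ.* k ℕ.+ 1)) (trans (^ℚ≡^ (binomℚ (-[1+ 0 ] ℚ./ 12) k) 4)
        (cong (λ z → (z * recip (k !) {{k ℕP.!≢0}}) ℚK.^ 4) (falling≡Π (-[1+ 0 ] ℚ./ 12) k)))

      S≡Σ : S p ≡ ℚK.Σ< p binomTerm
      S≡Σ = trans (sum≡Σ p _ id) (ℚK.Σ-cong p (λ k _ → term≡ k))

    congruent : ∀ {b} T → b ≡ ℕ→ℚ p * T → T ↦ X → CongMod p 3 (S p) b
    congruent {b} T b≡ r = ToCongMod.congMod-0 p pr 3 Q {S p} {b}
      (subst₂ (λ s t → Reduce._↦_ p pr ℚring (Quotient.ring Q) (s - t) (Quotient.0# Q)) (sym S≡Σ)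
        (sym (trans b≡ (cong (_* T) (ℕ→ℚ≡ν p)))) (difference T r))

  private
    A : B.Carrier
    A = inv 12

    A12 : A B.* B.ν 12 ≡ B.1#
    A12 = trans (B.*-comm _ _) (ν-inv p∤12)

    6-inverse : (B.ν 2 B.* A) B.* B.ν 6 ≡ B.1#
    6-inverse = trans (B.solve 1 (λ A → (B.:c 2 B.:* A) B.:* B.:c 6 B.:= A B.:* B.:c 12) refl A) A12

    2-inverse : (B.ν 6 B.* A) B.* B.ν 2 ≡ B.1#
    2-inverse = trans (B.solve 1 (λ A → (B.:c 6 B.:* A) B.:* B.:c 2 B.:= A B.:* B.:c 12) refl A) A12

    red-½ : ℚ.½ ↦ B.ν 6 B.* A
    red-½ = red-unit 2 p∤2 (unitFraction 2) 2-inverse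

    red-fermat : ∀ {k} → p ∸ 1 ≡ k → ((ℕ→ℚ (2 ℕ.^ (p ∸ 1)) - ℚ.1ℚ) ÷ℕ 6) ↦ (B.ν 2 B.^ k B.- B.1#) B.* (B.ν 2 B.* A)
    red-fermat refl = red-* (red-- (red-ℕ→ℚ-^ 2 (p ∸ 1)) (red-ν 1)) (red-unit 6 p∤6 (unitFraction 6) 6-inverse)

    p∤2* : ∀ z → p ∤ ℤ.∣ z ∣ → p ∤ ℤ.∣ + 2 ℤ.* z ∣
    p∤2* z u d = ∤* p∤2 u (subst (p ∣_) (ℤP.abs-* (+ 2) z) d)

    red-2z-p/2z : ∀ z (D : Division (+ 2 ℤ.* z)) → (ℤ→ℚ (+ 2 ℤ.* z) - (ℕ→ℚ p ÷ℤ (+ 2 ℤ.* z))) ↦ B.ν 2 B.* B.ι z B.- P B.* Division.r₂ D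
    red-2z-p/2z z D = red-- (subst (ℤ→ℚ (+ 2 ℤ.* z) ↦_) (B.ι-* (+ 2) z) (red-ℤ→ℚ (+ 2 ℤ.* z)))
      (subst (_↦ P B.* Division.r₂ D) (sym (Division.÷≡ D (ℕ→ℚ p))) (red-* (red-ℕ→ℚ p) (Division.r↦ D)))

    2z-inverse : ∀ z (D : Division (+ 2 ℤ.* z)) → B.ν 2 B.* B.ι z B.* Division.r₂ D ≡ B.1#
    2z-inverse z D = trans (cong (B._* Division.r₂ D) (sym (B.ι-* (+ 2) z))) (Division.inverse D)

    /≡ : ∀ a b q .{{_ : NonZero b}} → a ≡ q ℕ.* b → a ℕ./ b ≡ q
    /≡ _ b q refl = ℕM.m*n/n≡m q b

  open ℕS.+-*-Solver renaming (solve to solveℕ; _:+_ to _:+ℕ_; _:*_ to _:*ℕ_; con to conℕ; _:=_ to _:=ℕ_) using ()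

  -- C(2j, j) divides (2j)!, a product of numbers below p.
  p∤C : ∀ j → j ℕ.+ j < p → p ∤ ((j ℕ.+ j) C j)
  p∤C j l d = p∤! l (subst (p ∣_) (C-factorials j j) (ℕD.∣-trans d (ℕD.m∣m*n _)))

  module Case₁ (m′ : ℕ) (p≡ : p ≡ suc (12 ℕ.* suc m′)) (x y : ℤ) (xy : + p ≡ x ℤ.* x ℤ.+ y ℤ.* y) (4∣x-1 : + 4 ℤD.∣ x ℤ.- + 1) where
    private
      m g : ℕ
      m = suc m′
      g = m′ ℕ.+ 2 ℕ.* suc m′

      p≡4 : p ≡ suc (4 ℕ.* suc g)
      p≡4 = trans p≡ (cong suc (ℕP.*-assoc 4 3 m))

      m<p : m < p
      m<p = subst (m <_) (sym p≡) (ℕ.s≤s (ℕP.m≤n*m m 12))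

      module S₁ = At 1 m (trans (ℕP.*-identityˡ p) p≡) m<p (ℕ.s≤s ℕ.z≤n)

      -- The representation p = x² + y² is symmetric, so the nondivisibility of the second
      -- coordinate serves with x and y exchanged.
      p∤x : p ∤ ℤ.∣ x ∣
      p∤x = FourthRoot.p∤y p pr (suc g) p≡4 (ℕ.s≤s ℕ.z≤n) F R y x (trans xy (ℤP.+-comm (x ℤ.* x) (y ℤ.* y)))

      D : Division (+ 2 ℤ.* x)
      D = division (+ 2 ℤ.* x) (p∤2* x p∤x)

      module O = OrdinaryCases.One p pr 3<p g p≡4 F R A A12 x y xy 4∣x-1 m refl S₁.X S₁.X-fac (Division.r₂ D) (2z-inverse x D)

      T : ℚ
      T = ℕ→ℚ (2 ℕ.^ ((p ∸ 1) ℕ./ 6)) * (ℚ.1ℚ - ((ℕ→ℚ (2 ℕ.^ (p ∸ 1)) - ℚ.1ℚ) ÷ℕ 6)) * (ℤ→ℚ (+ 2 ℤ.* x) - (ℕ→ℚ p ÷ℤ (+ 2 ℤ.* x)))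

      exponent : (p ∸ 1) ℕ./ 6 ≡ m ℕ.+ m
      exponent = trans (cong (λ k → (k ∸ 1) ℕ./ 6) p≡) (/≡ (12 ℕ.* m) 6 (m ℕ.+ m) (solveℕ 1 (λ m → conℕ 12 :*ℕ m :=ℕ (m :+ℕ m) :*ℕ conℕ 6) refl m))

      T↦ : T ↦ B.ν 2 B.^ (m ℕ.+ m) B.* (B.1# B.- (B.ν 2 B.^ (4 ℕ.* suc g) B.- B.1#) B.* (B.ν 2 B.* A)) B.* (B.ν 2 B.* B.ι x B.- P B.* Division.r₂ D)
      T↦ = red-* (red-* (subst (λ k → ℕ→ℚ (2 ℕ.^ ((p ∸ 1) ℕ./ 6)) ↦ B.ν 2 B.^ k) exponent (red-ℕ→ℚ-^ 2 ((p ∸ 1) ℕ./ 6)))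
        (red-- (red-ν 1) (red-fermat (cong (_∸ 1) p≡4)))) (red-2z-p/2z x D)

    3∣x⇒ : + 3 ℤD.∣ x → CongMod p 3 (S p)
      (- (ℕ→ℚ (2 ℕ.^ ((p ∸ 1) ℕ./ 6)) * ℕ→ℚ p * (ℚ.1ℚ - ((ℕ→ℚ (2 ℕ.^ (p ∸ 1)) - ℚ.1ℚ) ÷ℕ 6)) * (ℤ→ℚ (+ 2 ℤ.* x) - (ℕ→ℚ p ÷ℤ (+ 2 ℤ.* x)))))
    3∣x⇒ d = S₁.congruent (- T) (Pulls.pull₃- (ℕ→ℚ (2 ℕ.^ ((p ∸ 1) ℕ./ 6))) (ℕ→ℚ p) _ _) (subst ((- T) ↦_) (sym (O.3∣x⇒ d)) (red-neg T↦))

    3∤x⇒ : ¬ (+ 3 ℤD.∣ x) → CongMod p 3 (S p)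
      (ℕ→ℚ (2 ℕ.^ ((p ∸ 1) ℕ./ 6)) * ℕ→ℚ p * (ℚ.1ℚ - ((ℕ→ℚ (2 ℕ.^ (p ∸ 1)) - ℚ.1ℚ) ÷ℕ 6)) * (ℤ→ℚ (+ 2 ℤ.* x) - (ℕ→ℚ p ÷ℤ (+ 2 ℤ.* x))))
    3∤x⇒ d = S₁.congruent T (Pulls.pull₃ (ℕ→ℚ (2 ℕ.^ ((p ∸ 1) ℕ./ 6))) (ℕ→ℚ p) _ _) (subst (T ↦_) (sym (O.3∤x⇒ d)) T↦)

  module Case₅ (m : ℕ) (p≡ : p ≡ suc (4 ℕ.+ 12 ℕ.* m)) (x y : ℤ) (xy : + p ≡ x ℤ.* x ℤ.+ y ℤ.* y) (4∣x-1 : + 4 ℤD.∣ x ℤ.- + 1) where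
    private
      g n : ℕ
      g = 3 ℕ.* m
      n = 2 ℕ.+ 5 ℕ.* m

      p≡4 : p ≡ suc (4 ℕ.* suc g)
      p≡4 = trans p≡ (solveℕ 1 (λ m → conℕ 5 :+ℕ conℕ 12 :*ℕ m :=ℕ conℕ 1 :+ℕ conℕ 4 :*ℕ (conℕ 1 :+ℕ conℕ 3 :*ℕ m)) refl m)

      n<p : n < p
      n<p = subst (n <_) (sym p≡) (ℕ.s≤s (ℕP.+-mono-≤ {2} {4} (ℕ.s≤s (ℕ.s≤s ℕ.z≤n)) (ℕP.*-monoˡ-≤ m {5} {12} (ℕ.s≤s (ℕ.s≤s (ℕ.s≤s (ℕ.s≤s (ℕ.s≤s ℕ.z≤n))))))))

      module S₅ = At 5 n (trans (cong (5 ℕ.*_) p≡) (solveℕ 1 (λ m → conℕ 5 :*ℕ (conℕ 5 :+ℕ conℕ 12 :*ℕ m) :=ℕ conℕ 1 :+ℕ conℕ 12 :*ℕ (conℕ 2 :+ℕ conℕ 5 :*ℕ m)) refl m)) n<p (ℕ.s≤s ℕ.z≤n)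

      D : Division (+ 2 ℤ.* y)
      D = division (+ 2 ℤ.* y) (p∤2* y (FourthRoot.p∤y p pr (suc g) p≡4 (ℕ.s≤s ℕ.z≤n) F R x y xy))

      module O = OrdinaryCases.Five p pr 3<p g p≡4 F R A A12 x y xy 4∣x-1 m refl S₅.X S₅.X-fac (Division.r₂ D) (2z-inverse y D)

      T : ℚ
      T = ℕ→ℚ 5 * (ℚ.½ ^ℚ ((p ∸ 5) ℕ./ 6)) * (ℚ.1ℚ + ((ℕ→ℚ (2 ℕ.^ (p ∸ 1)) - ℚ.1ℚ) ÷ℕ 6)) * (ℤ→ℚ (+ 2 ℤ.* y) - (ℕ→ℚ p ÷ℤ (+ 2 ℤ.* y)))

      exponent : (p ∸ 5) ℕ./ 6 ≡ m ℕ.+ m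
      exponent = trans (cong (λ k → (k ∸ 5) ℕ./ 6) p≡) (/≡ (12 ℕ.* m) 6 (m ℕ.+ m) (solveℕ 1 (λ m → conℕ 12 :*ℕ m :=ℕ (m :+ℕ m) :*ℕ conℕ 6) refl m))

      T↦ : T ↦ B.ν 5 B.* (B.ν 6 B.* A) B.^ (m ℕ.+ m) B.* (B.1# B.+ (B.ν 2 B.^ (4 ℕ.* suc g) B.- B.1#) B.* (B.ν 2 B.* A)) B.* (B.ν 2 B.* B.ι y B.- P B.* Division.r₂ D)
      T↦ = red-* (red-* (red-* (red-ℕ→ℚ 5) (subst (λ k → (ℚ.½ ^ℚ ((p ∸ 5) ℕ./ 6)) ↦ (B.ν 6 B.* A) B.^ k) exponent (red-^ℚ ((p ∸ 5) ℕ./ 6) red-½)))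
        (red-+ (red-ν 1) (red-fermat (cong (_∸ 1) p≡4)))) (red-2z-p/2z y D)

    3∣x-y⇒ : + 3 ℤD.∣ x ℤ.- y → CongMod p 3 (S p)
      (ℕ→ℚ 5 * (ℚ.½ ^ℚ ((p ∸ 5) ℕ./ 6)) * ℕ→ℚ p * (ℚ.1ℚ + ((ℕ→ℚ (2 ℕ.^ (p ∸ 1)) - ℚ.1ℚ) ÷ℕ 6)) * (ℤ→ℚ (+ 2 ℤ.* y) - (ℕ→ℚ p ÷ℤ (+ 2 ℤ.* y))))
    3∣x-y⇒ d = S₅.congruent T (Pulls.pull₄ (ℕ→ℚ 5) (ℚ.½ ^ℚ ((p ∸ 5) ℕ./ 6)) (ℕ→ℚ p) _ _) (subst (T ↦_) (sym (O.3∣x-y⇒ d)) T↦)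

  private
    divided : ∀ {X u v} D → X B.* u ≡ v → B.ι D ≡ u → (∀ r → B.ι D B.* r ≡ B.1# → X ≡ v B.* r)
    divided {X} {u} {v} D e D≡ r i = trans (sym (B.*-identityʳ X)) (trans (cong (X B.*_) (sym i))
      (trans (sym (B.*-assoc X (B.ι D) r)) (cong (B._* r) (trans (cong (X B.*_) D≡) e))))

    move-* : ∀ s b P r → s B.* (b B.* P) B.* r ≡ s B.* (b B.* P B.* r)
    move-* s b P r = B.*-assoc s (b B.* P) r

    -- One p of the p² moves in front; the other stays in T, matching the factor p found in X.
    squared : ∀ s b r {q} D → q ≡ b * ℕ→ℚ (p ℕ.^ 2) → (∀ q → q ÷ℤ D ≡ q * r) → s * (q ÷ℤ D) ≡ ℕ→ℚ p * (s * (b * ℕ→ℚ p * r))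
    squared s b r D q≡ ÷≡ = trans (cong (s *_) (trans (÷≡ _) (cong (_* r) (trans q≡ (cong (b *_) (ℕ→ℚ-p² p)))))) (Pulls.pull² s b (ℕ→ℚ p) r)

  module Case₇ (m : ℕ) (p≡ : p ≡ suc (6 ℕ.+ 12 ℕ.* m)) where
    private
      n j N : ℕ
      n = 4 ℕ.+ 7 ℕ.* m
      j = suc m
      N = 5 ℕ.* (((p ℕ.+ 5) ℕ./ 6) C ((p ℕ.+ 5) ℕ./ 12))

      n<p : n < p
      n<p = subst (n <_) (sym p≡) (ℕ.s≤s (ℕP.+-mono-≤ {4} {6} (ℕ.s≤s (ℕ.s≤s (ℕ.s≤s (ℕ.s≤s ℕ.z≤n)))) (ℕP.*-monoˡ-≤ m {7} {12} (ℕP.m≤m+n 7 5))))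

      j+j<p : j ℕ.+ j < p
      j+j<p = subst (j ℕ.+ j <_) (sym p≡) (subst (ℕ._< suc (6 ℕ.+ 12 ℕ.* m)) (sym (solveℕ 1 (λ m → conℕ 1 :+ℕ m :+ℕ (conℕ 1 :+ℕ m) :=ℕ conℕ 2 :+ℕ conℕ 2 :*ℕ m) refl m))
        (ℕ.s≤s (ℕP.+-mono-≤ {2} {6} (ℕP.m≤m+n 2 4) (ℕP.*-monoˡ-≤ m {2} {12} (ℕP.m≤m+n 2 10)))))

      5<p : 5 < p
      5<p = subst (5 <_) (sym p≡) (ℕP.≤-trans (ℕP.m≤m+n 6 1) (ℕ.s≤s (ℕP.m≤m+n 6 _)))

      module S₇ = At 7 n (trans (cong (7 ℕ.*_) p≡) (solveℕ 1 (λ m → conℕ 7 :*ℕ (conℕ 7 :+ℕ conℕ 12 :*ℕ m) :=ℕ conℕ 1 :+ℕ conℕ 12 :*ℕ (conℕ 4 :+ℕ conℕ 7 :*ℕ m)) refl m)) n<p (ℕ.s≤s ℕ.z≤n)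

      N≡ : N ≡ 5 ℕ.* ((j ℕ.+ j) C j)
      N≡ = cong (5 ℕ.*_) (cong₂ _C_
        (trans (cong (λ k → (k ℕ.+ 5) ℕ./ 6) p≡) (/≡ (suc (6 ℕ.+ 12 ℕ.* m) ℕ.+ 5) 6 (j ℕ.+ j) (solveℕ 1 (λ m → conℕ 7 :+ℕ conℕ 12 :*ℕ m :+ℕ conℕ 5 :=ℕ (conℕ 1 :+ℕ m :+ℕ (conℕ 1 :+ℕ m)) :*ℕ conℕ 6) refl m)))
        (trans (cong (λ k → (k ℕ.+ 5) ℕ./ 12) p≡) (/≡ (suc (6 ℕ.+ 12 ℕ.* m) ℕ.+ 5) 12 j (solveℕ 1 (λ m → conℕ 7 :+ℕ conℕ 12 :*ℕ m :+ℕ conℕ 5 :=ℕ (conℕ 1 :+ℕ m) :*ℕ conℕ 12) refl m))))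

      D : Division (+ N)
      D = division (+ N) (subst (p ∤_) (sym N≡) (∤* (suc<⇒∤ 5<p) (p∤C j j+j<p)))

      T : ℚ
      T = ((- ℚ.1ℚ) ^ℚ ((p ∸ 7) ℕ./ 12)) * (ℕ→ℚ 28 * ℕ→ℚ (2 ℕ.^ ((p ∸ 1) ℕ./ 3)) * ℕ→ℚ p * Division.r D)

      sign-exponent : (p ∸ 7) ℕ./ 12 ≡ m
      sign-exponent = trans (cong (λ k → (k ∸ 7) ℕ./ 12) p≡) (/≡ (12 ℕ.* m) 12 m (ℕP.*-comm 12 m))

      exponent : (p ∸ 1) ℕ./ 3 ≡ 2 ℕ.+ 4 ℕ.* m
      exponent = trans (cong (λ k → (k ∸ 1) ℕ./ 3) p≡) (/≡ (6 ℕ.+ 12 ℕ.* m) 3 (2 ℕ.+ 4 ℕ.* m) (solveℕ 1 (λ m → conℕ 6 :+ℕ conℕ 12 :*ℕ m :=ℕ (conℕ 2 :+ℕ conℕ 4 :*ℕ m) :*ℕ conℕ 3) refl m))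

      T↦ : T ↦ (B.- B.1#) B.^ m B.* (B.ν 28 B.* B.ν 2 B.^ (2 ℕ.+ 4 ℕ.* m) B.* P B.* Division.r₂ D)
      T↦ = red-* (subst (λ k → ((- ℚ.1ℚ) ^ℚ ((p ∸ 7) ℕ./ 12)) ↦ (B.- B.1#) B.^ k) sign-exponent (red-^ℚ ((p ∸ 7) ℕ./ 12) (red-neg (red-ν 1))))
        (red-* (red-* (red-* (red-ℕ→ℚ 28) (subst (λ k → ℕ→ℚ (2 ℕ.^ ((p ∸ 1) ℕ./ 3)) ↦ B.ν 2 B.^ k) exponent (red-ℕ→ℚ-^ 2 ((p ∸ 1) ℕ./ 3)))) (red-ℕ→ℚ p)) (Division.r↦ D))

      X≡ : S₇.X ≡ (B.- B.1#) B.^ m B.* (B.ν 28 B.* B.ν 2 B.^ (2 ℕ.+ 4 ℕ.* m) B.* P B.* Division.r₂ D)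
      X≡ = trans (divided (+ N) (SupersingularValue.value₇ p pr R A A12 m S₇.X p≡ S₇.X-fac)
          (trans (cong B.ν N≡) (B.ν-* 5 ((j ℕ.+ j) C j))) (Division.r₂ D) (Division.inverse D))
        (move-* ((B.- B.1#) B.^ m) (B.ν 28 B.* B.ν 2 B.^ (2 ℕ.+ 4 ℕ.* m)) P (Division.r₂ D))

    conclusion : CongMod p 3 (S p) (((- ℚ.1ℚ) ^ℚ ((p ∸ 7) ℕ./ 12)) * ((ℕ→ℚ 28 * ℕ→ℚ (2 ℕ.^ ((p ∸ 1) ℕ./ 3)) * ℕ→ℚ (p ℕ.^ 2)) ÷ℕ N))
    conclusion = S₇.congruent T (squared ((- ℚ.1ℚ) ^ℚ ((p ∸ 7) ℕ./ 12)) (ℕ→ℚ 28 * ℕ→ℚ (2 ℕ.^ ((p ∸ 1) ℕ./ 3))) (Division.r D) (+ N) refl (Division.÷≡ D)) (subst (T ↦_) (sym X≡) T↦)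

  module Case₁₁ (m : ℕ) (p≡ : p ≡ suc (10 ℕ.+ 12 ℕ.* m)) where
    private
      n j N : ℕ
      n = 10 ℕ.+ 11 ℕ.* m
      j = 5 ℕ.+ 5 ℕ.* m
      N = 2 ℕ.^ ((p ∸ 11) ℕ./ 3) ℕ.* (((5 ℕ.* (p ℕ.+ 1)) ℕ./ 6) C ((5 ℕ.* (p ℕ.+ 1)) ℕ./ 12))

      n<p : n < p
      n<p = subst (n <_) (sym p≡) (ℕ.s≤s (ℕP.+-monoʳ-≤ 10 (ℕP.*-monoˡ-≤ m {11} {12} (ℕP.m≤m+n 11 1))))

      j+j<p : j ℕ.+ j < p
      j+j<p = subst (j ℕ.+ j <_) (sym p≡) (subst (ℕ._< suc (10 ℕ.+ 12 ℕ.* m)) (sym (solveℕ 1 (λ m → conℕ 5 :+ℕ conℕ 5 :*ℕ m :+ℕ (conℕ 5 :+ℕ conℕ 5 :*ℕ m) :=ℕ conℕ 10 :+ℕ conℕ 10 :*ℕ m) refl m))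
        (ℕ.s≤s (ℕP.+-monoʳ-≤ 10 (ℕP.*-monoˡ-≤ m {10} {12} (ℕP.m≤m+n 10 2)))))

      module S₁₁ = At 11 n (trans (cong (11 ℕ.*_) p≡) (solveℕ 1 (λ m → conℕ 11 :*ℕ (conℕ 11 :+ℕ conℕ 12 :*ℕ m) :=ℕ conℕ 1 :+ℕ conℕ 12 :*ℕ (conℕ 10 :+ℕ conℕ 11 :*ℕ m)) refl m)) n<p (ℕ.s≤s ℕ.z≤n)

      exponent : (p ∸ 11) ℕ./ 3 ≡ 4 ℕ.* m
      exponent = trans (cong (λ k → (k ∸ 11) ℕ./ 3) p≡) (/≡ (12 ℕ.* m) 3 (4 ℕ.* m) (solveℕ 1 (λ m → conℕ 12 :*ℕ m :=ℕ (conℕ 4 :*ℕ m) :*ℕ conℕ 3) refl m))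

      N≡ : N ≡ 2 ℕ.^ (4 ℕ.* m) ℕ.* ((j ℕ.+ j) C j)
      N≡ = cong₂ ℕ._*_ (cong (2 ℕ.^_) exponent) (cong₂ _C_
        (trans (cong (λ k → (5 ℕ.* (k ℕ.+ 1)) ℕ./ 6) p≡) (/≡ (5 ℕ.* (suc (10 ℕ.+ 12 ℕ.* m) ℕ.+ 1)) 6 (j ℕ.+ j) (solveℕ 1 (λ m → conℕ 5 :*ℕ (conℕ 11 :+ℕ conℕ 12 :*ℕ m :+ℕ conℕ 1) :=ℕ (conℕ 5 :+ℕ conℕ 5 :*ℕ m :+ℕ (conℕ 5 :+ℕ conℕ 5 :*ℕ m)) :*ℕ conℕ 6) refl m)))
        (trans (cong (λ k → (5 ℕ.* (k ℕ.+ 1)) ℕ./ 12) p≡) (/≡ (5 ℕ.* (suc (10 ℕ.+ 12 ℕ.* m) ℕ.+ 1)) 12 j (solveℕ 1 (λ m → conℕ 5 :*ℕ (conℕ 11 :+ℕ conℕ 12 :*ℕ m :+ℕ conℕ 1) :=ℕ (conℕ 5 :+ℕ conℕ 5 :*ℕ m) :*ℕ conℕ 12) refl m))))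

      p∤2^ : ∀ k → p ∤ (2 ℕ.^ k)
      p∤2^ zero = p∤1
      p∤2^ (suc k) = ∤* p∤2 (p∤2^ k)

      D : Division (+ N)
      D = division (+ N) (subst (p ∤_) (sym N≡) (∤* (p∤2^ (4 ℕ.* m)) (p∤C j j+j<p)))

      T : ℚ
      T = ((- ℚ.1ℚ) ^ℚ ((p ∸ 11) ℕ./ 12)) * (ℕ→ℚ 11 * ℕ→ℚ p * Division.r D)

      sign-exponent : (p ∸ 11) ℕ./ 12 ≡ m
      sign-exponent = trans (cong (λ k → (k ∸ 11) ℕ./ 12) p≡) (/≡ (12 ℕ.* m) 12 m (ℕP.*-comm 12 m))

      T↦ : T ↦ (B.- B.1#) B.^ m B.* (B.ν 11 B.* P B.* Division.r₂ D)
      T↦ = red-* (subst (λ k → ((- ℚ.1ℚ) ^ℚ ((p ∸ 11) ℕ./ 12)) ↦ (B.- B.1#) B.^ k) sign-exponent (red-^ℚ ((p ∸ 11) ℕ./ 12) (red-neg (red-ν 1))))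
        (red-* (red-* (red-ℕ→ℚ 11) (red-ℕ→ℚ p)) (Division.r↦ D))

      X≡ : S₁₁.X ≡ (B.- B.1#) B.^ m B.* (B.ν 11 B.* P B.* Division.r₂ D)
      X≡ = trans (divided (+ N) (SupersingularValue.value₁₁ p pr R A A12 m S₁₁.X p≡ S₁₁.X-fac)
          (trans (cong B.ν N≡) (trans (B.ν-* (2 ℕ.^ (4 ℕ.* m)) ((j ℕ.+ j) C j)) (cong (B._* B.ν ((j ℕ.+ j) C j)) (B.ν-^ 2 (4 ℕ.* m))))) (Division.r₂ D) (Division.inverse D))
        (move-* ((B.- B.1#) B.^ m) (B.ν 11) P (Division.r₂ D))

    conclusion : CongMod p 3 (S p) (((- ℚ.1ℚ) ^ℚ ((p ∸ 11) ℕ./ 12)) * ((ℕ→ℚ 11 * ℕ→ℚ (p ℕ.^ 2)) ÷ℕ N))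
    conclusion = S₁₁.congruent T (squared ((- ℚ.1ℚ) ^ℚ ((p ∸ 11) ℕ./ 12)) (ℕ→ℚ 11) (Division.r D) (+ N) refl (Division.÷≡ D)) (subst (T ↦_) (sym X≡) T↦)

  residue : ∀ {r} → p % 12 ≡ r → p ≡ r ℕ.+ 12 ℕ.* (p ℕ./ 12)
  residue {r} e = trans (ℕM.m≡m%n+[m/n]*n p 12) (cong₂ ℕ._+_ e (ℕP.*-comm (p ℕ./ 12) 12))

  -- p > 3 excludes m = 0. That m ≥ 1 ensures n = m > 0 and lets f = 3m be written as a successor.
  positive : ∀ {A : Set} m → p ≡ suc (12 ℕ.* m) → (∀ m′ → p ≡ suc (12 ℕ.* suc m′) → A) → A
  positive zero p≡ _ = ⊥-elim (ℕP.<⇒≱ 3<p (subst (ℕ._≤ 3) (sym p≡) (ℕ.s≤s ℕ.z≤n)))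
  positive (suc m′) p≡ k = k m′ p≡

theorem5p9 : (p : ℕ) → Prime p → 3 < p →
    ((x y : ℤ) → + p ≡ x ℤ.* x ℤ.+ y ℤ.* y → + 4 ℤD.∣ x ℤ.- + 1 →
      p % 12 ≡ 1 → + 3 ℤD.∣ x →
      CongMod p 3 (S p)
        (- (ℕ→ℚ (2 ℕ.^ ((p ∸ 1) ℕ./ 6)) * ℕ→ℚ p
            * (ℚ.1ℚ - ((ℕ→ℚ (2 ℕ.^ (p ∸ 1)) - ℚ.1ℚ) ÷ℕ 6))
            * (ℤ→ℚ (+ 2 ℤ.* x) - (ℕ→ℚ p ÷ℤ (+ 2 ℤ.* x))))))
    × ((x y : ℤ) → + p ≡ x ℤ.* x ℤ.+ y ℤ.* y → + 4 ℤD.∣ x ℤ.- + 1 →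
      p % 12 ≡ 1 → ¬ (+ 3 ℤD.∣ x) →
      CongMod p 3 (S p)
        (ℕ→ℚ (2 ℕ.^ ((p ∸ 1) ℕ./ 6)) * ℕ→ℚ p
            * (ℚ.1ℚ - ((ℕ→ℚ (2 ℕ.^ (p ∸ 1)) - ℚ.1ℚ) ÷ℕ 6))
            * (ℤ→ℚ (+ 2 ℤ.* x) - (ℕ→ℚ p ÷ℤ (+ 2 ℤ.* x)))))
    × ((x y : ℤ) → + p ≡ x ℤ.* x ℤ.+ y ℤ.* y → + 4 ℤD.∣ x ℤ.- + 1 →
      p % 12 ≡ 5 → + 3 ℤD.∣ x ℤ.- y →
      CongMod p 3 (S p)
        (ℕ→ℚ 5 * (ℚ.½ ^ℚ ((p ∸ 5) ℕ./ 6)) * ℕ→ℚ p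
            * (ℚ.1ℚ + ((ℕ→ℚ (2 ℕ.^ (p ∸ 1)) - ℚ.1ℚ) ÷ℕ 6))
            * (ℤ→ℚ (+ 2 ℤ.* y) - (ℕ→ℚ p ÷ℤ (+ 2 ℤ.* y)))))
    × (p % 12 ≡ 7 →
      CongMod p 3 (S p)
        (((- ℚ.1ℚ) ^ℚ ((p ∸ 7) ℕ./ 12))
          * ((ℕ→ℚ 28 * ℕ→ℚ (2 ℕ.^ ((p ∸ 1) ℕ./ 3)) * ℕ→ℚ (p ℕ.^ 2))
              ÷ℕ (5 ℕ.* (((p ℕ.+ 5) ℕ./ 6) C ((p ℕ.+ 5) ℕ./ 12))))))
    × (p % 12 ≡ 11 →
      CongMod p 3 (S p)
        (((- ℚ.1ℚ) ^ℚ ((p ∸ 11) ℕ./ 12))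
          * ((ℕ→ℚ 11 * ℕ→ℚ (p ℕ.^ 2))
              ÷ℕ (2 ℕ.^ ((p ∸ 11) ℕ./ 3)
                  ℕ.* (((5 ℕ.* (p ℕ.+ 1)) ℕ./ 6) C ((5 ℕ.* (p ℕ.+ 1)) ℕ./ 12))))))
theorem5p9 p pr 3<p =
    (λ x y xy 4∣x-1 r 3∣x → positive (p ℕ./ 12) (residue r) (λ m′ p≡ → Case₁.3∣x⇒ m′ p≡ x y xy 4∣x-1 3∣x))
  , (λ x y xy 4∣x-1 r 3∤x → positive (p ℕ./ 12) (residue r) (λ m′ p≡ → Case₁.3∤x⇒ m′ p≡ x y xy 4∣x-1 3∤x))
  , (λ x y xy 4∣x-1 r 3∣x-y → Case₅.3∣x-y⇒ (p ℕ./ 12) (residue r) x y xy 4∣x-1 3∣x-y)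
  , (λ r → Case₇.conclusion (p ℕ./ 12) (residue r))
  , (λ r → Case₁₁.conclusion (p ℕ./ 12) (residue r))
  where open Congruence p pr 3<p
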